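{- There is an absolute constant $C>0$ such that the following holds. Let $N$ be a positive integer, let $0<\delta\le 1$, let $A \subset \{1,\dots,N\}\times \{1,\dots,N\}$ with $|A| \geq \delta N^2$, and let $0<\varepsilon \leq 1/2$. Then either $N \leq \exp\big(C\varepsilon^{ -C}\big)$, or there exists an integer $d \neq 0$ such that $$\#\{(x,y) \in A : (x+d, y)\in A \text{ and } (x,y+d^2) \in A\} \geq (\delta^3-\varepsilon) N^2.$$ -}

module Defs where

open import Data.Bool using (Bool; true; _∧_)
open import Data.Nat as ℕ using (ℕ; suc; _^_)
open import Data.Integer as ℤ using (ℤ; +_)
open import Data.Rational as ℚ using (ℚ; _/_; ↥_; ↧ₙ_)
open import Data.List using (List; applyUpTo; concatMap; map; filter; length)
open import Data.Product using (_×_; _,_)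
open import Relation.Binary.PropositionalEquality using (_≡_)
open import Relation.Nullary.Decidable using (Dec)
open import Data.Bool.Properties using () renaming (_≟_ to _≟ᵇ_)

InGrid : ℕ → (ℤ → ℤ → Bool) → Set
InGrid N A = ∀ x y → A x y ≡ true →
  (+ 1 ℤ.≤ x) × (x ℤ.≤ + N) × (+ 1 ℤ.≤ y) × (y ℤ.≤ + N)

range : ℕ → List ℤ
range N = applyUpTo (λ i → + suc i) N

grid : ℕ → List (ℤ × ℤ)
grid N = concatMap (λ x → map (λ y → (x , y)) (range N)) (range N)

countGrid : ℕ → (ℤ → ℤ → Bool) → ℕ
countGrid N P = length (filter (λ { (x , y) → P x y ≟ᵇ true }) (grid N))

card : ℕ → (ℤ → ℤ → Bool) → ℕ
card N A = countGrid N A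

cornerCount : ℕ → (ℤ → ℤ → Bool) → ℤ → ℕ
cornerCount N A d =
  countGrid N (λ x y → A x y ∧ A (x ℤ.+ d) y ∧ A x (y ℤ.+ d ℤ.* d))

ℕtoℚ : ℕ → ℚ
ℕtoℚ n = + n / 1

-- N ≤ 2 ^ (C · ε^(-C)), stated exactly without real numbers:
-- writing ε = p/q (p = numerator, q = denominator), this is
-- N ^ (p ^ C) ≤ 2 ^ (C · q ^ C).
BelowExpBound : ℕ → ℚ → ℕ → Set
BelowExpBound C ε N =
  N ^ (ℤ.∣ ↥ ε ∣ ^ C) ℕ.≤ 2 ^ (C ℕ.* (↧ₙ ε) ^ C)

-- Everything is done by Cauchy–Schwarz on the torus (ℤ/n)², with n slightly larger than N so that nothing wraps
-- around. Van der Corput differencing (PET) bounds 𝔼 f₀(x,y) f₁(x+d,y) f₂(x,y+d²) by box norms of f₂ in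
-- directions that are linear in the differencing parameters. If these parameters are written in base B with
-- random digits, pairs of directions almost always generate a whole progression of bounded step, so the
-- directions concatenate, and a degree-lowering argument removes the box norms one by one. Hence the count is
-- controlled by averages of f₂ along one vertical progression, with power losses only. An energy increment over
-- nested partitions into progressions finds a scale at which f₂ and f₁ may be replaced by their conditional
-- expectations v and u, and 𝔼 f u v ≥ (𝔼 f)³. The scales grow exponentially in powers of 1/ε.

module Submission where

open import Data.Bool using (Bool; true; false; _∧_)
open import Data.Empty using (⊥)
open import Data.Unit using (⊤; tt)
open import Data.Nat as ℕ using (ℕ; suc; zero)
import Data.Nat.Properties as ℕP
open import Data.Integer as ℤ using (ℤ)
import Data.Integer.Properties as ℤP
open import Data.Fin using (Fin; zero; suc; toℕ)
import Data.Fin.Properties as FP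
open import Data.List using (List; []; _∷_; length)
open import Data.Rational as ℚ using (ℚ; 0ℚ; 1ℚ; ½; _*_; _-_; _+_; -_; _≤_)
import Data.Rational.Properties as ℚP
open import Data.Product using (Σ; _×_; _,_; proj₁; proj₂; ∃)
open import Data.Sum using (_⊎_; inj₁; inj₂)
open import Function using (_∘_; id; case_of_)
open import Relation.Nullary using (¬_; yes; no; Dec; contradiction)
open import Relation.Nullary.Decidable using (dec⇒maybe)
open import Relation.Binary.PropositionalEquality
  using (_≡_; _≢_; refl; sym; trans; cong; cong₂; subst; subst₂)
open import Tactic.RingSolver.Core.AlmostCommutativeRing using (fromCommutativeRing)
open import Tactic.RingSolver using (solve-∀)
import Data.Integer.Tactic.RingSolver as ℤS
import Data.Nat.Tactic.RingSolver as ℕS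
import Data.Nat.DivMod as ℕDM
open import Data.Nat.Divisibility using (_∣_; divides; ∣-trans; m∣m*n; m≤n⇒m!∣n!)
open import Data.Nat using (_!)
import Data.Fin as DF
import Data.Integer.DivMod as ℤDM
import Data.Nat.Divisibility as ℕD
open import Defs
import Data.Rational.Unnormalised as ℚᵘ
import Data.Rational.Unnormalised.Properties as ℚᵘP
open import Data.List using (filter; concatMap; map; applyUpTo; _++_)
open import Relation.Unary using (Decidable)

-- Size is the obstacle. When d runs up to M, (d + x)² - d² reaches the order of M², and making it
-- harmless takes progressions of bounded step and length about M². Differencing only yields
-- directions of size about M, followed for about M steps. Two of them, written B·a + b with bounded
-- digits and B comparable to M, close the gap: integer combinations give det and B·det, so a number
-- below B², itself written in base B, is reached with coefficients of order B. The step would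
-- depend on the determinant; `Qr`, the factorial of a bound for all determinants, serves every pair
-- at once and brings in the exponential of a power of 1/ε. Degree lowering needs a function that is
-- itself an average of dual functions. It is therefore applied to a quarter of a second difference
-- X of the dual function F, because the inner product of X and F is a quarter of ‖F - PF‖²: the
-- result is that F is almost invariant along a progression. No roots are taken: estimates have the
-- form `pw n Λ ≤ ι K * (z + κ)`, where `pw n` is the power 2^n and κ = 1/(r + 1) is the common
-- error.

-- Rational inequalities, finite averages and powers 2^n.

module RationalMeans where
  ℚR = fromCommutativeRing ℚP.+-*-commutativeRing (λ x → dec⇒maybe (0ℚ ℚP.≟ x))

  2ℚ : ℚ
  2ℚ = 1ℚ + 1ℚ

  _≤⟨⟩_ : ∀ {x y z : ℚ} → x ≤ y → y ≤ z → x ≤ z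
  p ≤⟨⟩ q = ℚP.≤-trans p q
  infixr 3 _≤⟨⟩_

  ≡≤ : ∀ {x y : ℚ} → x ≡ y → x ≤ y
  ≡≤ = ℚP.≤-reflexive

  infixl 6 _+≤_
  _+≤_ : ∀ {a b c d} → a ≤ b → c ≤ d → a + c ≤ b + d
  _+≤_ = ℚP.+-mono-≤

  +l : ∀ {a b} x → a ≤ b → x + a ≤ x + b
  +l x = ℚP.+-monoʳ-≤ x

  +r : ∀ {a b} x → a ≤ b → a + x ≤ b + x
  +r x = ℚP.+-monoˡ-≤ x

  nn+ : ∀ {x y} → 0ℚ ≤ x → 0ℚ ≤ y → 0ℚ ≤ x + y
  nn+ p q = p +≤ q

  0≤½ : 0ℚ ≤ ½
  0≤½ = ℚP.≤ᵇ⇒≤ _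

  0≤1 : 0ℚ ≤ 1ℚ
  0≤1 = ℚP.≤ᵇ⇒≤ _

  0≤2 : 0ℚ ≤ 2ℚ
  0≤2 = ℚP.≤ᵇ⇒≤ _

  *mono : ∀ {x y} c → 0ℚ ≤ c → x ≤ y → c * x ≤ c * y
  *mono c 0≤c = ℚP.*-monoˡ-≤-nonNeg c {{ℚ.nonNegative 0≤c}}

  *mono' : ∀ {x y} c → 0ℚ ≤ c → x ≤ y → x * c ≤ y * c
  *mono' c 0≤c = ℚP.*-monoʳ-≤-nonNeg c {{ℚ.nonNegative 0≤c}}

  nn* : ∀ {x y} → 0ℚ ≤ x → 0ℚ ≤ y → 0ℚ ≤ x * y
  nn* {x} {y} p q = ≡≤ (sym (ℚP.*-zeroʳ x)) ≤⟨⟩ *mono x p q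

  diff : ∀ {x y} → x ≤ y → 0ℚ ≤ y - x
  diff {x} {y} p = ≡≤ (sym (ℚP.+-inverseʳ x)) ≤⟨⟩ (p +≤ ℚP.≤-refl {x = - x})

  by : ∀ {x y r} → 0ℚ ≤ r → y ≡ x + r → x ≤ y
  by {x} p e = ≡≤ (sym (ℚP.+-identityʳ x)) ≤⟨⟩ +l x p ≤⟨⟩ ≡≤ (sym e)

  neg≤ : ∀ {x y} → x ≤ y → - y ≤ - x
  neg≤ = ℚP.neg-antimono-≤

  nn-sq : ∀ x → 0ℚ ≤ x * x
  nn-sq x with ℚP.≤-total 0ℚ x
  ... | inj₁ p = nn* p p
  ... | inj₂ p = nn* (neg≤ p) (neg≤ p) ≤⟨⟩ ≡≤ (lem x)
    where lem : ∀ x → - x * - x ≡ x * x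
          lem = solve-∀ ℚR

  sq : ℚ → ℚ
  sq x = x * x

  Bd : ℚ → Set
  Bd x = (- 1ℚ ≤ x) × (x ≤ 1ℚ)

  -- From (x + 1)(y + 1) + (1 - x)(1 - y) = 2 + 2xy and its mirror image. Absolute values are
  -- avoided in this way throughout: an inequality is an identity with a nonnegative remainder,
  -- passed to `by`.
  bd* : ∀ {x y} → Bd x → Bd y → Bd (x * y)
  bd* {x} {y} (a , b) (c , d) =
    by (nn* 0≤½ (nn+ (nn* (diff a) (diff c)) (nn* (diff b) (diff d)))) (l1 x y) ,
    by (nn* 0≤½ (nn+ (nn* (diff b) (diff c)) (nn* (diff a) (diff d)))) (l2 x y)
    where
    l1 : ∀ x y → x * y ≡ - 1ℚ + ½ * ((x - - 1ℚ) * (y - - 1ℚ) + (1ℚ - x) * (1ℚ - y))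
    l1 = solve-∀ ℚR
    l2 : ∀ x y → 1ℚ ≡ x * y + ½ * ((1ℚ - x) * (y - - 1ℚ) + (x - - 1ℚ) * (1ℚ - y))
    l2 = solve-∀ ℚR

  bd1 : Bd 1ℚ
  bd1 = ℚP.≤ᵇ⇒≤ _ , ℚP.≤-refl

  bd0 : Bd 0ℚ
  bd0 = ℚP.≤ᵇ⇒≤ _ , ℚP.≤ᵇ⇒≤ _

  sq≤1 : ∀ {x} → Bd x → x * x ≤ 1ℚ
  sq≤1 b = proj₂ (bd* b b)

  bd-nn : ∀ {x} → 0ℚ ≤ x → x ≤ 1ℚ → Bd x
  bd-nn p q = (ℚP.≤ᵇ⇒≤ _ ≤⟨⟩ p) , q

  Near : ℚ → ℚ → ℚ → Set
  Near x y η = (x ≤ y + η) × (y ≤ x + η)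

  near-refl : ∀ {x η} → 0ℚ ≤ η → Near x x η
  near-refl {x} p = by p refl , by p refl

  near-sym : ∀ {x y η} → Near x y η → Near y x η
  near-sym (a , b) = b , a

  near-trans : ∀ {x y z η θ} → Near x y η → Near y z θ → Near x z (η + θ)
  near-trans {x} {y} {z} {η} {θ} (a , b) (c , d) =
    (a ≤⟨⟩ +r η c ≤⟨⟩ ≡≤ (l z η θ)) , (d ≤⟨⟩ +r θ b ≤⟨⟩ ≡≤ (l' x η θ))
    where
    l : ∀ z η θ → z + θ + η ≡ z + (η + θ)
    l = solve-∀ ℚR
    l' : ∀ z η θ → z + η + θ ≡ z + (η + θ)
    l' = solve-∀ ℚR

  near-weaken : ∀ {x y η θ} → η ≤ θ → Near x y η → Near x y θ
  near-weaken {x} {y} p (a , b) = (a ≤⟨⟩ +l y p) , (b ≤⟨⟩ +l x p)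

  near-≡ : ∀ {x x' y y' η} → x ≡ x' → y ≡ y' → Near x y η → Near x' y' η
  near-≡ refl refl n = n

  -- z is the convex combination of 1 and -1 with weights (1 + z)/2 and (1 - z)/2, and for these two
  -- values the claim is the hypothesis.
  near-* : ∀ {x y z η} → Bd z → Near x y η → Near (z * x) (z * y) η
  near-* {x} {y} {z} {η} (a , b) (c , d) =
    by (nn* 0≤½ (nn+ (nn* (diff c) (diff a)) (nn* (diff d) (diff b)))) (l x y z η) ,
    by (nn* 0≤½ (nn+ (nn* (diff c) (diff b)) (nn* (diff d) (diff a)))) (l' x y z η)
    where
    l : ∀ x y z η → z * y + η ≡ z * x + ½ * ((y + η - x) * (z - - 1ℚ) + (x + η - y) * (1ℚ - z))
    l = solve-∀ ℚR
    l' : ∀ x y z η → z * x + η ≡ z * y + ½ * ((y + η - x) * (1ℚ - z) + (x + η - y) * (z - - 1ℚ))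
    l' = solve-∀ ℚR

  -- x² - y² = (x - y)(x + y), where x + y lies between -2 and 2.
  near-sq : ∀ {x y η} → Bd x → Bd y → Near x y η → x * x ≤ y * y + 2ℚ * η
  near-sq {x} {y} {η} (a , b) (a' , b') (c , d) =
    by (nn* 0≤½ (nn+ (nn* (diff c) (nn+ (diff a) (diff a'))) (nn* (diff d) (nn+ (diff b) (diff b'))))) (l x y η)
    where
    l : ∀ x y η → y * y + 2ℚ * η ≡ x * x + ½ * ((y + η - x) * ((x - - 1ℚ) + (y - - 1ℚ)) + (x + η - y) * ((1ℚ - x) + (1ℚ - y)))
    l = solve-∀ ℚR

  near-bd : ∀ {x y} → Bd x → Bd y → Near x y 2ℚ
  near-bd {x} {y} (a , b) (c , d) = (b ≤⟨⟩ by (diff c) (l y)) , (d ≤⟨⟩ by (diff a) (l x))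
    where
    l : ∀ y → y + 2ℚ ≡ 1ℚ + (y - - 1ℚ)
    l = solve-∀ ℚR

  -- Recursive, so that sums and products are handled by induction; `ℕtoℚ≡ι` translates to the form
  -- `+ n / 1` of the statement.
  ι : ℕ → ℚ
  ι zero = 0ℚ
  ι (suc n) = 1ℚ + ι n

  0≤ι : ∀ n → 0ℚ ≤ ι n
  0≤ι zero = ℚP.≤-refl
  0≤ι (suc n) = nn+ 0≤1 (0≤ι n)

  ι-+ : ∀ m n → ι (m ℕ.+ n) ≡ ι m + ι n
  ι-+ zero n = sym (ℚP.+-identityˡ _)
  ι-+ (suc m) n = trans (cong (λ z → 1ℚ + z) (ι-+ m n)) (sym (ℚP.+-assoc 1ℚ (ι m) (ι n)))

  ι-* : ∀ m n → ι (m ℕ.* n) ≡ ι m * ι n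
  ι-* zero n = sym (ℚP.*-zeroˡ (ι n))
  ι-* (suc m) n = trans (ι-+ n (m ℕ.* n)) (trans (cong (ι n +_) (ι-* m n)) (l (ι m) (ι n)))
    where l : ∀ m n → n + m * n ≡ (1ℚ + m) * n
          l = solve-∀ ℚR

  ι-mono : ∀ {m n} → m ℕ.≤ n → ι m ≤ ι n
  ι-mono {m} {n} p with ℕP.m≤n⇒∃[o]m+o≡n p
  ... | k , refl = by (0≤ι k) (ι-+ m k)

  ιpos : ∀ n → ℚ.Positive (ι (suc n))
  ιpos n = ℚ.positive (ℚP.<-≤-trans {0ℚ} {1ℚ} (ℚP.positive⁻¹ 1ℚ) (by (0≤ι n) refl))

  abstract
    rec : ℕ → ℚ
    rec n = (ℚ.1/ ι (suc n)) {{ℚP.pos⇒nonZero (ι (suc n)) {{ιpos n}}}}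

    rec-inv : ∀ n → rec n * ι (suc n) ≡ 1ℚ
    rec-inv n = ℚP.*-inverseˡ (ι (suc n)) {{ℚP.pos⇒nonZero (ι (suc n)) {{ιpos n}}}}

    0≤rec : ∀ n → 0ℚ ≤ rec n
    0≤rec n = ℚP.<⇒≤ (ℚP.positive⁻¹ (rec n) {{ℚP.1/pos⇒pos (ι (suc n)) {{ιpos n}}}})

  rec≤1 : ∀ n → rec n ≤ 1ℚ
  rec≤1 n = ≡≤ (sym (ℚP.*-identityʳ (rec n))) ≤⟨⟩ *mono (rec n) (0≤rec n) (by (0≤ι n) refl) ≤⟨⟩ ≡≤ (rec-inv n) 

  ≤rec : ∀ {x y} n → x * ι (suc n) ≤ y → x ≤ rec n * y
  ≤rec {x} {y} n p = ≡≤ (sym (trans (l (rec n) x (ι (suc n))) (trans (cong (_* x) (rec-inv n)) (ℚP.*-identityˡ x)))) ≤⟨⟩ *mono (rec n) (0≤rec n) p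
    where l : ∀ r x s → r * (x * s) ≡ r * s * x
          l = solve-∀ ℚR

  rec≤ : ∀ {x y} n → y ≤ x * ι (suc n) → rec n * y ≤ x
  rec≤ {x} {y} n p = *mono (rec n) (0≤rec n) p ≤⟨⟩ ≡≤ (trans (l (rec n) x (ι (suc n))) (trans (cong (_* x) (rec-inv n)) (ℚP.*-identityˡ x)))
    where l : ∀ r x s → r * (x * s) ≡ r * s * x
          l = solve-∀ ℚR

  Σs : ∀ n → (Fin n → ℚ) → ℚ
  Σs zero f = 0ℚ
  Σs (suc n) f = f zero + Σs n (f ∘ suc)

  Σs-cong : ∀ n {f g : Fin n → ℚ} → (∀ i → f i ≡ g i) → Σs n f ≡ Σs n g
  Σs-cong zero e = refl
  Σs-cong (suc n) e = cong₂ _+_ (e zero) (Σs-cong n (e ∘ suc))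

  Σs-mono : ∀ n {f g : Fin n → ℚ} → (∀ i → f i ≤ g i) → Σs n f ≤ Σs n g
  Σs-mono zero e = ℚP.≤-refl
  Σs-mono (suc n) e = e zero +≤ Σs-mono n (e ∘ suc)

  Σs-+ : ∀ n (f g : Fin n → ℚ) → Σs n (λ i → f i + g i) ≡ Σs n f + Σs n g
  Σs-+ zero f g = refl
  Σs-+ (suc n) f g = trans (cong (f zero + g zero +_) (Σs-+ n (f ∘ suc) (g ∘ suc))) (l (f zero) (g zero) (Σs n (f ∘ suc)) (Σs n (g ∘ suc)))
    where l : ∀ a b c d → a + b + (c + d) ≡ a + c + (b + d)
          l = solve-∀ ℚR

  Σs-* : ∀ n c (f : Fin n → ℚ) → Σs n (λ i → c * f i) ≡ c * Σs n f
  Σs-* zero c f = sym (ℚP.*-zeroʳ c)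
  Σs-* (suc n) c f = trans (cong (c * f zero +_) (Σs-* n c (f ∘ suc))) (sym (ℚP.*-distribˡ-+ c _ _))

  Σs-const : ∀ n c → Σs n (λ _ → c) ≡ ι n * c
  Σs-const zero c = sym (ℚP.*-zeroˡ c)
  Σs-const (suc n) c = trans (cong (c +_) (Σs-const n c)) (l c (ι n))
    where l : ∀ c n → c + n * c ≡ (1ℚ + n) * c
          l = solve-∀ ℚR

  -- Averages are kept as syntax recording the order in which parameters are drawn, so that `E` of a
  -- nested average unfolds to iterated means by computation, and a condition on all drawn values is
  -- the nested condition `Supp`.
  data Mean (A : Set) : Set₁ where
    uni  : (n : ℕ) → (Fin (suc n) → A) → Mean A
    pure : A → Mean A
    bind : {B : Set} → Mean B → (B → Mean A) → Mean A

  E : {A : Set} → Mean A → (A → ℚ) → ℚ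
  E (uni n f) g = rec n * Σs (suc n) (g ∘ f)
  E (pure a) g = g a
  E (bind μ k) g = E μ (λ b → E (k b) g)

  Supp : {A : Set} → Mean A → (A → Set) → Set
  Supp (uni n f) P = ∀ i → P (f i)
  Supp (pure a) P = P a
  Supp (bind μ k) P = Supp μ (λ b → Supp (k b) P)

  supp-all : {A : Set} (μ : Mean A) {P : A → Set} → (∀ a → P a) → Supp μ P
  supp-all (uni n f) h i = h (f i)
  supp-all (pure a) h = h a
  supp-all (bind μ k) h = supp-all μ (λ b → supp-all (k b) h)

  supp-map : {A : Set} (μ : Mean A) {P Q : A → Set} → (∀ a → P a → Q a) → Supp μ P → Supp μ Q
  supp-map (uni n f) h s i = h (f i) (s i)
  supp-map (pure a) h s = h a s
  supp-map (bind μ k) h s = supp-map μ (λ b → supp-map (k b) h) s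

  supp-× : {A : Set} (μ : Mean A) {P Q : A → Set} → Supp μ P → Supp μ Q → Supp μ (λ a → P a × Q a)
  supp-× (uni n f) s t i = s i , t i
  supp-× (pure a) s t = s , t
  supp-× (bind μ k) s t = supp-map μ (λ b (u , v) → supp-× (k b) u v) (supp-× μ s t)

  E-congS : {A : Set} (μ : Mean A) {f g : A → ℚ} → Supp μ (λ a → f a ≡ g a) → E μ f ≡ E μ g
  E-congS (uni n h) e = cong (rec n *_) (Σs-cong (suc n) e)
  E-congS (pure a) e = e
  E-congS (bind μ k) e = E-congS μ (supp-map μ (λ b → E-congS (k b)) e)

  E-cong : {A : Set} (μ : Mean A) {f g : A → ℚ} → (∀ a → f a ≡ g a) → E μ f ≡ E μ g
  E-cong μ e = E-congS μ (supp-all μ e)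

  E-monoS : {A : Set} (μ : Mean A) {f g : A → ℚ} → Supp μ (λ a → f a ≤ g a) → E μ f ≤ E μ g
  E-monoS (uni n h) e = *mono (rec n) (0≤rec n) (Σs-mono (suc n) e)
  E-monoS (pure a) e = e
  E-monoS (bind μ k) e = E-monoS μ (supp-map μ (λ b → E-monoS (k b)) e)

  E-mono : {A : Set} (μ : Mean A) {f g : A → ℚ} → (∀ a → f a ≤ g a) → E μ f ≤ E μ g
  E-mono μ e = E-monoS μ (supp-all μ e)

  E-+ : {A : Set} (μ : Mean A) (f g : A → ℚ) → E μ (λ a → f a + g a) ≡ E μ f + E μ g
  E-+ (uni n h) f g = trans (cong (rec n *_) (Σs-+ (suc n) (f ∘ h) (g ∘ h))) (ℚP.*-distribˡ-+ (rec n) _ _)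
  E-+ (pure a) f g = refl
  E-+ (bind μ k) f g = trans (E-cong μ (λ b → E-+ (k b) f g)) (E-+ μ _ _)

  E-* : {A : Set} (μ : Mean A) (c : ℚ) (f : A → ℚ) → E μ (λ a → c * f a) ≡ c * E μ f
  E-* (uni n h) c f = trans (cong (rec n *_) (Σs-* (suc n) c (f ∘ h))) (l (rec n) c _)
    where l : ∀ r c s → r * (c * s) ≡ c * (r * s)
          l = solve-∀ ℚR
  E-* (pure a) c f = refl
  E-* (bind μ k) c f = trans (E-cong μ (λ b → E-* (k b) c f)) (E-* μ c _)

  E-*ʳ : {A : Set} (μ : Mean A) (c : ℚ) (f : A → ℚ) → E μ (λ a → f a * c) ≡ E μ f * c
  E-*ʳ μ c f = trans (E-cong μ (λ a → ℚP.*-comm (f a) c)) (trans (E-* μ c f) (ℚP.*-comm c _))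

  E-const : {A : Set} (μ : Mean A) (c : ℚ) → E μ (λ _ → c) ≡ c
  E-const (uni n h) c = trans (cong (rec n *_) (Σs-const (suc n) c))
    (trans (sym (ℚP.*-assoc (rec n) _ c)) (trans (cong (_* c) (rec-inv n)) (ℚP.*-identityˡ c)))
  E-const (pure a) c = refl
  E-const (bind μ k) c = trans (E-cong μ (λ b → E-const (k b) c)) (E-const μ c)

  E-Σs : {A : Set} (μ : Mean A) (n : ℕ) (f : A → Fin n → ℚ) →
    E μ (λ a → Σs n (f a)) ≡ Σs n (λ i → E μ (λ a → f a i))
  E-Σs μ zero f = E-const μ 0ℚ
  E-Σs μ (suc n) f = trans (E-+ μ _ _) (cong (E μ (λ a → f a zero) +_) (E-Σs μ n (λ a → f a ∘ suc)))

  E-swap : {A B : Set} (μ : Mean A) (ν : Mean B) (f : A → B → ℚ) →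
    E μ (λ a → E ν (f a)) ≡ E ν (λ b → E μ (λ a → f a b))
  E-swap (uni n h) ν f = trans (cong (rec n *_) (sym (E-Σs ν (suc n) (λ b i → f (h i) b)))) (sym (E-* ν (rec n) _))
  E-swap (pure a) ν f = refl
  E-swap (bind μ k) ν f = trans (E-cong μ (λ b → E-swap (k b) ν f)) (E-swap μ ν _)

  E-aff : {A : Set} (μ : Mean A) (c κ : ℚ) (f : A → ℚ) → E μ (λ a → c * (f a + κ)) ≡ c * (E μ f + κ)
  E-aff μ c κ f = trans (E-* μ c _) (cong (c *_) (trans (E-+ μ f _) (cong (E μ f +_) (E-const μ κ))))

  E-+c : {A : Set} (μ : Mean A) (c : ℚ) (f : A → ℚ) → E μ (λ a → f a + c) ≡ E μ f + c
  E-+c μ c f = trans (E-+ μ f _) (cong (E μ f +_) (E-const μ c))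

  E-neg : {A : Set} (μ : Mean A) (f : A → ℚ) → E μ (λ a → - f a) ≡ - E μ f
  E-neg μ f = trans (E-cong μ (λ a → l (f a))) (trans (E-* μ (- 1ℚ) f) (sym (l _)))
    where l : ∀ x → - x ≡ - 1ℚ * x
          l = solve-∀ ℚR

  E-- : {A : Set} (μ : Mean A) (f g : A → ℚ) → E μ (λ a → f a - g a) ≡ E μ f - E μ g
  E-- μ f g = trans (E-+ μ f _) (cong (E μ f +_) (E-neg μ g))

  E-≤c : {A : Set} (μ : Mean A) {f : A → ℚ} {c : ℚ} → (∀ a → f a ≤ c) → E μ f ≤ c
  E-≤c μ {f} {c} h = E-mono μ h ≤⟨⟩ ≡≤ (E-const μ c)

  E-≥c : {A : Set} (μ : Mean A) {f : A → ℚ} {c : ℚ} → (∀ a → c ≤ f a) → c ≤ E μ f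
  E-≥c μ {f} {c} h = ≡≤ (sym (E-const μ c)) ≤⟨⟩ E-mono μ h

  E-bd : {A : Set} (μ : Mean A) {f : A → ℚ} → (∀ a → Bd (f a)) → Bd (E μ f)
  E-bd μ h = E-≥c μ (proj₁ ∘ h) , E-≤c μ (proj₂ ∘ h)

  E-nearS : {A : Set} (μ : Mean A) {f g : A → ℚ} {η : ℚ} → Supp μ (λ a → Near (f a) (g a) η) → Near (E μ f) (E μ g) η
  E-nearS μ {f} {g} {η} s =
    (E-monoS μ (supp-map μ (λ _ → proj₁) s) ≤⟨⟩ ≡≤ (trans (E-+ μ g _) (cong (E μ g +_) (E-const μ η)))) ,
    (E-monoS μ (supp-map μ (λ _ → proj₂) s) ≤⟨⟩ ≡≤ (trans (E-+ μ f _) (cong (E μ f +_) (E-const μ η))))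

  E-near : {A : Set} (μ : Mean A) {f g : A → ℚ} {η : ℚ} → (∀ a → Near (f a) (g a) η) → Near (E μ f) (E μ g) η
  E-near μ h = E-nearS μ (supp-all μ h)

  E-sq : {A B : Set} (μ : Mean A) (ν : Mean B) (f : A → ℚ) (g : B → ℚ) →
    E μ f * E ν g ≡ E μ (λ a → E ν (λ b → f a * g b))
  E-sq μ ν f g = trans (sym (E-*ʳ μ (E ν g) f)) (E-cong μ (λ a → sym (E-* ν (f a) g)))

  -- The variance, the mean of (f - m)², is nonnegative.
  jensen : {A : Set} (μ : Mean A) (f : A → ℚ) → sq (E μ f) ≤ E μ (λ a → sq (f a))
  jensen μ f = by (E-≥c μ (λ a → nn-sq (f a - m))) (trans (l (E μ (λ a → sq (f a))) m) (cong (m * m +_) (sym e)))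
    where
    m = E μ f
    l : ∀ s m → s ≡ m * m + (s - 2ℚ * m * m + m * m)
    l = solve-∀ ℚR
    l2 : ∀ x m → (x - m) * (x - m) ≡ x * x - 2ℚ * m * x + m * m
    l2 = solve-∀ ℚR
    e : E μ (λ a → (f a - m) * (f a - m)) ≡ E μ (λ a → sq (f a)) - 2ℚ * m * m + m * m
    e = trans (E-cong μ (λ a → l2 (f a) m)) (trans (E-+ μ _ _)
        (cong₂ _+_ (trans (E-- μ _ _) (cong (λ z → E μ (λ a → sq (f a)) - z) (E-* μ (2ℚ * m) f))) (E-const μ (m * m))))

  sq-bd : ∀ {b} x → Bd b → sq (b * x) ≤ sq x
  sq-bd {b} x h = ≡≤ (l b x) ≤⟨⟩ *mono' (sq x) (nn-sq x) (sq≤1 h) ≤⟨⟩ ≡≤ (ℚP.*-identityˡ _)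
    where l : ∀ b x → b * x * (b * x) ≡ b * b * (x * x)
          l = solve-∀ ℚR

  -- Cauchy-Schwarz in the form used everywhere: a bounded weight is discarded at the price of one
  -- squaring.
  kill : {A : Set} (μ : Mean A) (b X : A → ℚ) → (∀ a → Bd (b a)) → sq (E μ (λ a → b a * X a)) ≤ E μ (λ a → sq (X a))
  kill μ b X h = jensen μ _ ≤⟨⟩ E-mono μ (λ a → sq-bd (X a) (h a))

  abstract
    -- The power x^(2^n) as repeated squaring, so that its convexity is `jensen` applied n times.
    pw : ℕ → ℚ → ℚ
    pw zero x = x
    pw (suc n) x = pw n (sq x)

    pwℕ : ℕ → ℕ → ℕ
    pwℕ zero k = k
    pwℕ (suc n) k = pwℕ n (k ℕ.* k)

    pwℕ-0 : ∀ k → pwℕ 0 k ≡ k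
    pwℕ-0 k = refl

    pwℕ-suc : ∀ n k → pwℕ (suc n) k ≡ pwℕ n (k ℕ.* k)
    pwℕ-suc n k = refl

    pw-0 : ∀ x → pw 0 x ≡ x
    pw-0 x = refl

    pw-suc : ∀ n x → pw (suc n) x ≡ pw n (sq x)
    pw-suc n x = refl

    pw-nn : ∀ n {x} → 0ℚ ≤ x → 0ℚ ≤ pw n x
    pw-nn zero p = p
    pw-nn (suc n) {x} p = pw-nn n (nn-sq x)

    pw-mono : ∀ n {x y} → 0ℚ ≤ x → x ≤ y → pw n x ≤ pw n y
    pw-mono zero p q = q
    pw-mono (suc n) {x} {y} p q = pw-mono n (nn-sq x) (*mono x p q ≤⟨⟩ *mono' y (p ≤⟨⟩ q) q)

    pw-sq : ∀ n x → pw n (sq x) ≡ sq (pw n x)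
    pw-sq zero x = refl
    pw-sq (suc n) x = pw-sq n (sq x)

    pw-+ : ∀ m n x → pw (m ℕ.+ n) x ≡ pw n (pw m x)
    pw-+ zero n x = refl
    pw-+ (suc m) n x = pw-+ m n (sq x)

    pw-* : ∀ n x y → pw n (x * y) ≡ pw n x * pw n y
    pw-* zero x y = refl
    pw-* (suc n) x y = trans (cong (pw n) (l x y)) (pw-* n (sq x) (sq y))
      where l : ∀ x y → x * y * (x * y) ≡ x * x * (y * y)
            l = solve-∀ ℚR

    pw-ι : ∀ n k → pw n (ι k) ≡ ι (pwℕ n k)
    pw-ι zero k = refl
    pw-ι (suc n) k = trans (cong (pw n) (sym (ι-* k k))) (pw-ι n (k ℕ.* k))

    pw-jensen : ∀ n {A : Set} (μ : Mean A) (f : A → ℚ) → pw n (E μ f) ≤ E μ (λ a → pw n (f a))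
    pw-jensen zero μ f = ℚP.≤-refl
    pw-jensen (suc n) μ f = pw-mono n (nn-sq (E μ f)) (jensen μ f) ≤⟨⟩ pw-jensen n μ _

    pw≤1 : ∀ n {x} → 0ℚ ≤ x → x ≤ 1ℚ → pw n x ≤ x
    pw≤1 zero p q = ℚP.≤-refl
    pw≤1 (suc n) {x} p q = pw≤1 n (nn-sq x) (*mono x p q ≤⟨⟩ ≡≤ (ℚP.*-identityʳ x) ≤⟨⟩ q) ≤⟨⟩ *mono x p q ≤⟨⟩ ≡≤ (ℚP.*-identityʳ x)

    pw-bd : ∀ n {x} → Bd x → Bd (pw n x)
    pw-bd zero b = b
    pw-bd (suc n) b = pw-bd n (bd* b b)

    cN : ℕ → ℕ
    cN zero = 1
    cN (suc m) = cN m ℕ.* pwℕ m 2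

    -- Iterates (a + b)² ≤ 2a² + 2b². The factor 2 is carried through the remaining squarings, which
    -- is the recursion of `cN`.
    pw-split : ∀ m a b → pw m (a + b) ≤ ι (cN m) * (pw m a + pw m b)
    pw-split zero a b = ≡≤ (l (a + b))
      where l : ∀ x → x ≡ (1ℚ + 0ℚ) * x
            l = solve-∀ ℚR
    pw-split (suc m) a b =
      pw-mono m (nn-sq (a + b)) (by (nn-sq (a - b)) (l a b)) ≤⟨⟩
      pw-split m (2ℚ * sq a) (2ℚ * sq b) ≤⟨⟩
      ≡≤ (trans (cong₂ (λ u v → ι (cN m) * (u + v)) (e a) (e b)) (trans (l2 (ι (cN m)) (ι (pwℕ m 2)) _ _) (cong (λ z → z * (pw m (sq a) + pw m (sq b))) (sym (ι-* (cN m) (pwℕ m 2))))))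
      where
      l : ∀ a b → 2ℚ * (a * a) + 2ℚ * (b * b) ≡ (a + b) * (a + b) + (a - b) * (a - b)
      l = solve-∀ ℚR
      l2 : ∀ c p u v → c * (p * u + p * v) ≡ c * p * (u + v)
      l2 = solve-∀ ℚR
      e : ∀ a → pw m (2ℚ * sq a) ≡ ι (pwℕ m 2) * pw m (sq a)
      e a = trans (pw-* m 2ℚ (sq a)) (cong (_* pw m (sq a)) (pw-ι m 2))

    trK : ℕ → ℕ → ℕ → ℕ
    trK b K L = pwℕ b K ℕ.* cN b ℕ.* suc L

    -- Chains two estimates of the standard shape. Since κ ≤ 1, every power of κ is at most κ, so
    -- the shape survives and only the constant grows.
    le-trans : ∀ {κ} → 0ℚ ≤ κ → κ ≤ 1ℚ → ∀ b {K L P y z} → 0ℚ ≤ P → 0ℚ ≤ z →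
      P ≤ ι K * (y + κ) → pw b y ≤ ι L * (z + κ) → pw b P ≤ ι (trK b K L) * (z + κ)
    le-trans {κ} k0 k1 b {K} {L} {P} {y} {z} P0 z0 p q =
      pw-mono b P0 p ≤⟨⟩
      ≡≤ (trans (pw-* b (ι K) (y + κ)) (cong (_* pw b (y + κ)) (pw-ι b K))) ≤⟨⟩
      *mono (ι (pwℕ b K)) (0≤ι (pwℕ b K)) (pw-split b y κ ≤⟨⟩
        *mono (ι (cN b)) (0≤ι (cN b)) (q +≤ (pw≤1 b k0 k1 ≤⟨⟩ by z0 (l3 z κ)))) ≤⟨⟩
      ≡≤ (trans (l (ι (pwℕ b K)) (ι (cN b)) (ι L) (z + κ))
         (cong (_* (z + κ)) (trans (cong (_* (1ℚ + ι L)) (sym (ι-* (pwℕ b K) (cN b)))) (sym (ι-* (pwℕ b K ℕ.* cN b) (suc L))))))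
      where
      l : ∀ a c L w → a * (c * (L * w + w)) ≡ a * c * (1ℚ + L) * w
      l = solve-∀ ℚR
      l3 : ∀ z κ → z + κ ≡ κ + z
      l3 = solve-∀ ℚR

    kE : ℕ → ℕ
    kE c = 2 ℕ.+ (c ℕ.* c ℕ.+ c ℕ.* c)

    -- Two Cauchy-Schwarz steps in a row; `kE c` = 2 + 2c² comes from (y + cκ)² ≤ 2y² + 2c²κ².
    two-step : ∀ c {x y u κ} → 0ℚ ≤ κ → κ ≤ 1ℚ → 0ℚ ≤ u → sq x ≤ y + ι c * κ → sq y ≤ u → pw 2 x ≤ ι (kE c) * (u + κ)
    two-step c {x} {y} {u} {κ} k0 k1 u0 p q =
      *mono (sq x) (nn-sq x) p ≤⟨⟩ *mono' (y + ι c * κ) (nn-sq x ≤⟨⟩ p) p ≤⟨⟩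
      by (nn-sq (y - ι c * κ)) (l y (ι c) κ) ≤⟨⟩
      (*mono 2ℚ 0≤2 q +≤ *mono (ι c * ι c + ι c * ι c) (nn+ cc cc) (*mono κ k0 k1 ≤⟨⟩ ≡≤ (ℚP.*-identityʳ κ))) ≤⟨⟩
      by (nn+ (nn* (nn+ cc cc) u0) (nn* 0≤2 k0)) (trans (cong (λ w → (1ℚ + (1ℚ + w)) * (u + κ)) (trans (ι-+ (c ℕ.* c) (c ℕ.* c)) (cong₂ _+_ (ι-* c c) (ι-* c c)))) (l2 u κ (ι c)))
      where
      cc : 0ℚ ≤ ι c * ι c
      cc = nn* (0≤ι c) (0≤ι c)
      l : ∀ y c κ → 2ℚ * (y * y) + (c * c + c * c) * (κ * κ) ≡ (y + c * κ) * (y + c * κ) + (y - c * κ) * (y - c * κ)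
      l = solve-∀ ℚR
      l2 : ∀ u κ c → (1ℚ + (1ℚ + (c * c + c * c))) * (u + κ) ≡ 2ℚ * u + (c * c + c * c) * κ + ((c * c + c * c) * u + 2ℚ * κ)
      l2 = solve-∀ ℚR
open RationalMeans

-- Near-invariant means, measure-preserving actions and box norms.

module Absorption where
  -- μ is nearly invariant under translation by a.
  record Abs (μ : Mean ℤ) (a : ℤ) (η : ℚ) : Set where
    constructor mkAbs
    field ab : (f : ℤ → ℚ) → (∀ x → Bd (f x)) → Near (E μ (λ x → f (x ℤ.+ a))) (E μ f) η
  open Abs public

  abs-weaken : ∀ {μ a η θ} → η ≤ θ → Abs μ a η → Abs μ a θ
  ab (abs-weaken p h) f b = near-weaken p (ab h f b)

  abs-+ : ∀ μ {a b η θ} → Abs μ a η → Abs μ b θ → Abs μ (a ℤ.+ b) (η + θ)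
  ab (abs-+ μ {a} {b} h k) f bf =
    near-≡ (E-cong μ (λ x → cong f (ℤP.+-assoc x a b))) refl
      (near-trans (ab h (λ y → f (y ℤ.+ b)) (λ y → bf (y ℤ.+ b))) (ab k f bf))

  abs-0 : ∀ μ → Abs μ ℤ.0ℤ 0ℚ
  ab (abs-0 μ) f bf = near-≡ (E-cong μ (λ x → cong f (sym (ℤP.+-identityʳ x)))) refl (near-refl ℚP.≤-refl)

  abs-neg : ∀ μ {a η} → Abs μ a η → Abs μ (ℤ.- a) η
  ab (abs-neg μ {a} h) f bf = near-sym (near-≡ (E-cong μ (λ x → cong f (l x a))) refl
      (ab h (λ y → f (y ℤ.+ ℤ.- a)) (λ y → bf (y ℤ.+ ℤ.- a))))
    where
    l : ∀ x a → x ℤ.+ a ℤ.+ ℤ.- a ≡ x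
    l = ℤS.solve-∀

  abs-ℕ* : ∀ μ {a η} n → Abs μ a η → Abs μ (ℤ.+ n ℤ.* a) (ι n * η)
  abs-ℕ* μ {a} {η} zero h = subst (Abs μ _) (sym (ℚP.*-zeroˡ η)) (abs-0 μ)
  abs-ℕ* μ {a} {η} (suc n) h = subst₂ (Abs μ) (l (ℤ.+ n) a) (l' (ι n) η) (abs-+ μ h (abs-ℕ* μ n h))
    where
    l : ∀ n a → a ℤ.+ n ℤ.* a ≡ (ℤ.+ 1 ℤ.+ n) ℤ.* a
    l = ℤS.solve-∀
    l' : ∀ n η → η + n * η ≡ (1ℚ + n) * η
    l' = solve-∀ ℚR

  abs-ℤ* : ∀ μ {a η} t → Abs μ a η → Abs μ (t ℤ.* a) (ι ℤ.∣ t ∣ * η)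
  abs-ℤ* μ (ℤ.+ n) h = abs-ℕ* μ n h
  abs-ℤ* μ {a} {η} (ℤ.-[1+ n ]) h = subst (λ z → Abs μ z (ι (suc n) * η)) (l (ℤ.+ suc n) a) (abs-neg μ (abs-ℕ* μ (suc n) h))
    where
    l : ∀ n a → ℤ.- (n ℤ.* a) ≡ (ℤ.- n) ℤ.* a
    l = ℤS.solve-∀

  abs-bind : {B : Set} (μ : Mean B) (k : B → Mean ℤ) {a : ℤ} {η : ℚ} → (∀ b → Abs (k b) a η) → Abs (bind μ k) a η
  ab (abs-bind μ k h) f bf = E-near μ (λ b → ab (h b) f bf)

  abs-≡ : ∀ μ ν {a η} → (∀ f → E μ f ≡ E ν f) → Abs μ a η → Abs ν a η
  ab (abs-≡ μ ν e h) f bf = near-≡ (e _) (e _) (ab h f bf)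

  abs-map : ∀ μ c {a η} → Abs μ a η → Abs (bind μ (λ x → pure (c ℤ.* x))) (c ℤ.* a) η
  ab (abs-map μ c {a} h) f bf = near-≡ (E-cong μ (λ x → cong f (ℤP.*-distribˡ-+ c x a))) refl (ab h (λ x → f (c ℤ.* x)) (λ x → bf _))

  -- The opening of every differencing step: each shift costs at most η, so an additional random
  -- shift can be inserted into an average.
  avgAbs : {B : Set} (μ : Mean ℤ) (ν : Mean B) (s : B → ℤ) {η : ℚ} (h : ℤ → ℚ) → (∀ x → Bd (h x)) →
    Supp ν (λ b → Abs μ (s b) η) → Near (E μ h) (E ν (λ b → E μ (λ y → h (y ℤ.+ s b)))) η
  avgAbs μ ν s h bh sp = near-≡ (E-const ν _) refl (E-nearS ν (supp-map ν (λ b w → near-sym (ab w h bh)) sp))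

  module Tele where
    tele : ∀ n (g : ℕ → ℚ) → Σs n (λ i → g (suc (toℕ i))) + g 0 ≡ Σs n (λ i → g (toℕ i)) + g n
    tele zero g = refl
    tele (suc n) g = trans (l (g 1) (Σs n (λ i → g (suc (suc (toℕ i))))) (g 0)) (trans (cong (_+ g 0) (tele n (g ∘ suc))) (l2 (Σs n (λ i → g (suc (toℕ i)))) (g (suc n)) (g 0)))
      where
      l : ∀ a s b → a + s + b ≡ s + a + b
      l = solve-∀ ℚR
      l2 : ∀ s c b → s + c + b ≡ b + s + c
      l2 = solve-∀ ℚR

  -- The hypothesis `y + a ≡ x + c` is the telescoping identity: moving an interval by one changes
  -- its sum only by the two end terms.
  rdiff : ∀ {s a c n} x y → 0ℚ ≤ s → y + a ≡ x + c → Near c a n → Near (s * y) (s * x) (s * n)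
  rdiff {s} {a} {c} {n} x y s0 e (p , q) =
    (≡≤ (cong (s *_) (trans (l y a) (trans (cong (_- a) e) (l2 x c a)))) ≤⟨⟩ *mono s s0 (+l x (+r (- a) p)) ≤⟨⟩ ≡≤ (l3 s x a n)) ,
    (≡≤ (cong (s *_) (trans (l x c) (trans (cong (_- c) (sym e)) (l2 y a c)))) ≤⟨⟩ *mono s s0 (+l y (+r (- c) q)) ≤⟨⟩ ≡≤ (l3 s y c n))
    where
    l : ∀ y a → y ≡ y + a - a
    l = solve-∀ ℚR
    l2 : ∀ x c a → x + c - a ≡ x + (c - a)
    l2 = solve-∀ ℚR
    l3 : ∀ s x a n → s * (x + (a + n - a)) ≡ s * x + s * n
    l3 = solve-∀ ℚR

  abstract
    -- The interval starts at 1 and not at 0, so that the difference eventually picked from it is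
    -- nonzero.
    Iv : ℕ → Mean ℤ
    Iv n = uni n (λ i → ℤ.+ suc (toℕ i))

    abs-Iv : ∀ n → Abs (Iv n) (ℤ.+ 1) (rec n * 2ℚ)
    ab (abs-Iv n) f bf = near-≡ (cong (rec n *_) (Σs-cong (suc n) (λ i → cong (λ k → f (ℤ.+ k)) (ℕP.+-comm 1 (suc (toℕ i))))))
      refl (rdiff (Σs (suc n) (λ i → g (toℕ i))) (Σs (suc n) (λ i → g (suc (toℕ i)))) (0≤rec n) (Tele.tele (suc n) g) (near-bd (bf _) (bf _)))
      where
      g : ℕ → ℚ
      g k = f (ℤ.+ suc k)

    E-Iv : ∀ n f → E (Iv n) f ≡ rec n * Σs (suc n) (λ i → f (ℤ.+ suc (toℕ i)))
    E-Iv n f = refl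

    Iv-supp : ∀ n → Supp (Iv n) (λ d → Σ ℕ λ k → (d ≡ ℤ.+ suc k) × (k ℕ.≤ n))
    Iv-supp n i = toℕ i , refl , ℕP.≤-pred (FP.toℕ<n i)

  abs-Iv* : ∀ n t → Abs (Iv n) t (ι ℤ.∣ t ∣ * (rec n * 2ℚ))
  abs-Iv* n t = subst (λ z → Abs (Iv n) z (ι ℤ.∣ t ∣ * (rec n * 2ℚ))) (ℤP.*-identityʳ t) (abs-ℤ* (Iv n) t (abs-Iv n))

  dir1 : ℤ → ℕ → Mean ℤ
  dir1 u n = bind (Iv n) (λ i → pure (u ℤ.* i))

  dirV : ℤ → ℤ → ℕ → Mean ℤ
  dirV u v n = bind (Iv n) (λ i → bind (Iv n) (λ j → pure (u ℤ.* i ℤ.+ v ℤ.* j)))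

  abs-shift : ∀ μ c {a η} → Abs μ a η → Abs (bind μ (λ x → pure (c ℤ.+ x))) a η
  ab (abs-shift μ c {a} h) f bf = near-≡ (E-cong μ (λ x → cong f (sym (ℤP.+-assoc c x a)))) refl (ab h (λ x → f (c ℤ.+ x)) (λ x → bf _))

  abs-dir1 : ∀ u n → Abs (dir1 u n) u (rec n * 2ℚ)
  abs-dir1 u n = subst (λ z → Abs (dir1 u n) z (rec n * 2ℚ)) (ℤP.*-identityʳ u) (abs-map (Iv n) u (abs-Iv n))

  abs-dirV₂ : ∀ u v n → Abs (dirV u v n) v (rec n * 2ℚ)
  abs-dirV₂ u v n = abs-bind (Iv n) (λ i → bind (Iv n) (λ j → pure (u ℤ.* i ℤ.+ v ℤ.* j))) (λ i → abs-≡ (bind (dir1 v n) (λ x → pure (u ℤ.* i ℤ.+ x))) (bind (Iv n) (λ j → pure (u ℤ.* i ℤ.+ v ℤ.* j))) (λ f → refl) (abs-shift (dir1 v n) (u ℤ.* i) (abs-dir1 v n)))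

  abs-dirV₁ : ∀ u v n → Abs (dirV u v n) u (rec n * 2ℚ)
  abs-dirV₁ u v n = abs-≡ (dirV v u n) (dirV u v n)
    (λ f → trans (E-swap (Iv n) (Iv n) (λ i j → f (v ℤ.* i ℤ.+ u ℤ.* j)))
      (E-cong (Iv n) (λ i → E-cong (Iv n) (λ j → cong f (ℤP.+-comm (v ℤ.* j) (u ℤ.* i))))))
    (abs-dirV₂ v u n)

  -- A measure-preserving action of ℤ. It is kept abstract so that the estimates can be applied
  -- again to the action of the multiples of q, as needed at each scale of the energy increment.
  record Sys : Set₁ where
    infixl 6 _⊕_
    field
      Ω : Set
      mΩ : Mean Ω
      _⊕_ : Ω → ℤ → Ω
      ⊕-⊕ : ∀ ω a b → (ω ⊕ a) ⊕ b ≡ ω ⊕ (a ℤ.+ b)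
      ⊕-0 : ∀ ω → ω ⊕ ℤ.0ℤ ≡ ω
      inv : ∀ a f → E mΩ (λ ω → f (ω ⊕ a)) ≡ E mΩ f

  module Dyn (S : Sys) where
    open Sys S

    Fn : Set
    Fn = Ω → ℚ

    BdF : Fn → Set
    BdF f = ∀ ω → Bd (f ω)

    _↑_ : Fn → ℤ → Fn
    (f ↑ a) ω = f (ω ⊕ a)

    bd↑ : ∀ {f} a → BdF f → BdF (f ↑ a)
    bd↑ a b ω = b (ω ⊕ a)

    sh : ∀ (f : Fn) ω a b {c} → a ℤ.+ b ≡ c → f ((ω ⊕ a) ⊕ b) ≡ f (ω ⊕ c)
    sh f ω a b refl = cong f (⊕-⊕ ω a b)

    Δ : ℤ → ℤ → Fn → Fn
    Δ c c' X ω = X (ω ⊕ c) * X (ω ⊕ c')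

    bdΔ : ∀ {X} c c' → BdF X → BdF (Δ c c' X)
    bdΔ c c' b ω = bd* (b _) (b _)

    P : Mean ℤ → Fn → Fn
    P μ H ω = E μ (λ x → H (ω ⊕ x))

    bdP : ∀ μ {H} → BdF H → BdF (P μ H)
    bdP μ b ω = E-bd μ (λ x → b _)

    N : Mean ℤ → Fn → ℚ
    N μ H = E mΩ (λ ω → sq (P μ H ω))

    N-nn : ∀ μ H → 0ℚ ≤ N μ H
    N-nn μ H = E-≥c mΩ (λ ω → nn-sq (P μ H ω))

    -- The box norm of X to the power 2^k, where k is the number of directions; each direction
    -- contributes a pair of independent points.
    U : List (Mean ℤ) → Fn → ℚ
    U [] X = E mΩ X
    U (μ ∷ μs) X = E μ (λ c → E μ (λ c' → U μs (Δ c c' X)))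

    -- The Gowers inner product with F at one vertex of the cube and X at all the others.
    V : List (Mean ℤ) → Fn → Fn → ℚ
    V [] F X = E mΩ F
    V (μ ∷ μs) F X = E μ (λ c → E μ (λ c' → V μs (λ ω → F (ω ⊕ c) * X (ω ⊕ c')) (Δ c c' X)))

    cube : List (ℤ × ℤ) → Fn → Fn
    cube [] X = X
    cube ((c , c') ∷ γ) X = cube γ (Δ c c' X)

    cubeM : List (Mean ℤ) → Mean (List (ℤ × ℤ))
    cubeM [] = pure []
    cubeM (μ ∷ μs) = bind μ (λ c → bind μ (λ c' → bind (cubeM μs) (λ γ → pure ((c , c') ∷ γ))))

    cube-cong : ∀ γ {X Y : Fn} → (∀ ω → X ω ≡ Y ω) → ∀ ω → cube γ X ω ≡ cube γ Y ω
    cube-cong [] e = e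
    cube-cong ((c , c') ∷ γ) e = cube-cong γ (λ ω → cong₂ _*_ (e _) (e _))

    cube-bd : ∀ γ {X} → BdF X → BdF (cube γ X)
    cube-bd [] b = b
    cube-bd ((c , c') ∷ γ) b = cube-bd γ (bdΔ c c' b)

    cube-* : ∀ γ (X Y : Fn) ω → cube γ (λ ω → X ω * Y ω) ω ≡ cube γ X ω * cube γ Y ω
    cube-* [] X Y ω = refl
    cube-* ((c , c') ∷ γ) X Y ω = trans (cube-cong γ (λ ω → l (X (ω ⊕ c)) (Y (ω ⊕ c)) (X (ω ⊕ c')) (Y (ω ⊕ c'))) ω) (cube-* γ (Δ c c' X) (Δ c c' Y) ω)
      where l : ∀ a b c d → a * b * (c * d) ≡ a * c * (b * d)
            l = solve-∀ ℚR

    cube-↑ : ∀ γ (X : Fn) a ω → cube γ (X ↑ a) ω ≡ cube γ X (ω ⊕ a)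
    cube-↑ [] X a ω = refl
    cube-↑ ((c , c') ∷ γ) X a ω = trans (cube-cong γ (λ ω → cong₂ _*_ (e ω c) (e ω c')) ω) (cube-↑ γ (Δ c c' X) a ω)
      where
      e : ∀ ω c → X ((ω ⊕ c) ⊕ a) ≡ X ((ω ⊕ a) ⊕ c)
      e ω c = trans (sh X ω c a refl) (sym (sh X ω a c (ℤP.+-comm a c)))

    U-cube : ∀ μs X → U μs X ≡ E (cubeM μs) (λ γ → E mΩ (cube γ X))
    U-cube [] X = refl
    U-cube (μ ∷ μs) X = E-cong μ (λ c → E-cong μ (λ c' → U-cube μs (Δ c c' X)))

    pairE : ∀ μ (F X : Fn) → E μ (λ c → E μ (λ c' → E mΩ (λ ω → F (ω ⊕ c) * X (ω ⊕ c')))) ≡ E mΩ (λ ω → P μ F ω * P μ X ω)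
    pairE μ F X = trans (E-cong μ (λ c → E-swap μ mΩ _)) (trans (E-swap μ mΩ _) (E-cong mΩ (λ ω → sym (E-sq μ μ _ _))))

    swap3 : {A B C : Set} (μ : Mean A) (ν : Mean B) (ρ : Mean C) (f : A → B → C → ℚ) →
      E μ (λ a → E ν (λ b → E ρ (λ c → f a b c))) ≡ E ρ (λ c → E μ (λ a → E ν (λ b → f a b c)))
    swap3 μ ν ρ f = trans (E-cong μ (λ a → E-swap ν ρ _)) (E-swap μ ρ _)

    -- Expanding all directions but the first exhibits the box norm as an average of squared norms
    -- of averages along `μ`. This gives positivity, and lets one direction be replaced while the
    -- others are frozen in γ.
    U-N : ∀ μ μs X → U (μ ∷ μs) X ≡ E (cubeM μs) (λ γ → N μ (cube γ X))
    U-N μ μs X = trans (E-cong μ (λ c → E-cong μ (λ c' → trans (U-cube μs (Δ c c' X))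
        (E-cong (cubeM μs) (λ γ → E-cong mΩ (λ ω → trans (cube-* γ (X ↑ c) (X ↑ c') ω) (cong₂ _*_ (cube-↑ γ X c ω) (cube-↑ γ X c' ω))))))))
      (trans (swap3 μ μ (cubeM μs) _) (E-cong (cubeM μs) (λ γ → pairE μ (cube γ X) (cube γ X))))

    U-nn : ∀ μ μs X → 0ℚ ≤ U (μ ∷ μs) X
    U-nn μ μs X = E-≥c (cubeM μs) (λ γ → N-nn μ (cube γ X)) ≤⟨⟩ ≡≤ (sym (U-N μ μs X))

    U-bd : ∀ μs {X} → BdF X → Bd (U μs X)
    U-bd [] b = E-bd mΩ b
    U-bd (μ ∷ μs) b = E-bd μ (λ c → E-bd μ (λ c' → U-bd μs (bdΔ c c' b)))

    U-cong : ∀ μs {X Y : Fn} → (∀ ω → X ω ≡ Y ω) → U μs X ≡ U μs Y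
    U-cong [] e = E-cong mΩ e
    U-cong (μ ∷ μs) e = E-cong μ (λ c → E-cong μ (λ c' → U-cong μs (λ ω → cong₂ _*_ (e _) (e _))))

    U-↑ : ∀ μs X a → U μs (X ↑ a) ≡ U μs X
    U-↑ μs X a = trans (U-cube μs (X ↑ a)) (trans (E-cong (cubeM μs) (λ γ → trans (E-cong mΩ (cube-↑ γ X a)) (inv a (cube γ X)))) (sym (U-cube μs X)))

    -- `P μ H` is close to `P μ (P ν H)`, and averaging over `μ` does not increase the norm.
    coarsen : ∀ μ ν {η H} → BdF H → Supp ν (λ y → Abs μ y η) → N μ H ≤ N ν H + 2ℚ * η
    coarsen μ ν {η} {H} b s =
      E-mono mΩ (λ ω → near-sq (bdP μ b ω) (E-bd μ (λ x → bdP ν b _)) (nr ω)) ≤⟨⟩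
      ≡≤ (trans (E-+ mΩ _ _) (cong (E mΩ (λ ω → sq (P μ (P ν H) ω)) +_) (E-const mΩ _))) ≤⟨⟩
      +r (2ℚ * η) (E-mono mΩ (λ ω → jensen μ (λ x → P ν H (ω ⊕ x))) ≤⟨⟩ ≡≤ (trans (E-swap mΩ μ _) (trans (E-cong μ (λ x → inv x (λ ω → sq (P ν H ω)))) (E-const μ _))))
      where
      nr : ∀ ω → Near (P μ H ω) (P μ (P ν H) ω) η
      nr ω = near-≡ refl (trans (E-cong ν (λ y → E-cong μ (λ x → sym (sh H ω x y refl)))) (E-swap ν μ _))
        (avgAbs μ ν id (λ x → H (ω ⊕ x)) (λ x → b _) s)

    W : Mean ℤ → List (Mean ℤ) → Fn → Fn → ℚ
    W μ μs F X = E μ (λ c → E μ (λ c' → U μs (λ ω → F (ω ⊕ c) * X (ω ⊕ c'))))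

    W² : ∀ μ μs F {X} → BdF X → sq (W μ μs F X) ≤ U (μ ∷ μs) F
    W² μ μs F {X} b = ≡≤ (cong sq e) ≤⟨⟩ jensen (cubeM μs) (λ γ → E mΩ (λ ω → P μ (cube γ F) ω * P μ (cube γ X) ω)) ≤⟨⟩
       E-mono (cubeM μs) (λ γ → ≡≤ (cong sq (E-cong mΩ (λ ω → ℚP.*-comm (P μ (cube γ F) ω) (P μ (cube γ X) ω)))) ≤⟨⟩
          kill mΩ (P μ (cube γ X)) (P μ (cube γ F)) (bdP μ (cube-bd γ b))) ≤⟨⟩ ≡≤ (sym (U-N μ μs F))
      where
      e : W μ μs F X ≡ E (cubeM μs) (λ γ → E mΩ (λ ω → P μ (cube γ F) ω * P μ (cube γ X) ω))
      e = trans (E-cong μ (λ c → E-cong μ (λ c' → trans (U-cube μs _)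
        (E-cong (cubeM μs) (λ γ → E-cong mΩ (λ ω → trans (cube-* γ (F ↑ c) (X ↑ c') ω) (cong₂ _*_ (cube-↑ γ F c ω) (cube-↑ γ X c' ω))))))))
        (trans (swap3 μ μ (cubeM μs) _) (E-cong (cubeM μs) (λ γ → pairE μ (cube γ F) (cube γ X))))

    GCS : List (Mean ℤ) → Set
    GCS μs = ∀ (F X : Fn) → BdF X → pw (length μs) (V μs F X) ≤ U μs F

    -- With the pair from `μ` frozen, the induction hypothesis leaves a product of one copy of F and
    -- one of X along `μ`; `W²` discards the copy of X.
    gcs-step : ∀ μ μs → GCS μs → GCS (μ ∷ μs)
    -- `pw 0` is the identity and may be negative, so an inequality could not be squared here; with
    -- one direction it is an equality.
    gcs-step μ [] ih F X b = ≡≤ (trans (pw-suc 0 _) (pw-0 _)) ≤⟨⟩ W² μ [] F b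
    gcs-step μ μs@(_ ∷ μs') ih F X b =
      ≡≤ (trans (pw-suc n v) (pw-sq n v)) ≤⟨⟩ sq-mono pwnn le ≤⟨⟩ W² μ μs F b
      where
      n = length μs
      v = V (μ ∷ μs) F X
      pwnn : 0ℚ ≤ pw n v
      pwnn = pw-nn (length μs') (nn-sq v) ≤⟨⟩ ≡≤ (sym (pw-suc (length μs') v))
      sq-mono : ∀ {x y} → 0ℚ ≤ x → x ≤ y → sq x ≤ sq y
      sq-mono {x} {y} p q = *mono x p q ≤⟨⟩ *mono' y (p ≤⟨⟩ q) q
      le : pw n v ≤ W μ μs F X
      le = pw-jensen n μ _ ≤⟨⟩ E-mono μ (λ c → pw-jensen n μ _ ≤⟨⟩ E-mono μ (λ c' → ih (λ ω → F (ω ⊕ c) * X (ω ⊕ c')) (Δ c c' X) (bdΔ c c' b)))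

    gcs : ∀ μs → GCS μs
    gcs [] F X b = ≡≤ (pw-0 _)
    gcs (μ ∷ μs) = gcs-step μ μs (gcs μs)
open Absorption

-- Two-digit numbers, determinants and the progressions they generate.

module Digits where
  ℤ² : Set
  ℤ² = ℤ × ℤ

  infixl 6 _⊝_
  _⊝_ : ℤ² → ℤ² → ℤ²
  (a , b) ⊝ (c , d) = (a ℤ.- c , b ℤ.- d)

  det : ℤ² → ℤ² → ℤ
  det (a , b) (c , d) = a ℤ.* d ℤ.- b ℤ.* c

  val : ℕ → ℤ² → ℤ
  val B (a , b) = ℤ.+ B ℤ.* a ℤ.+ b

  abstract
    DS : ℕ → Mean ℤ²
    DS r = bind (Iv r) (λ a → bind (Iv r) (λ b → pure (a , b)))

    DD : ℕ → Mean ℤ²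
    DD r = bind (DS r) (λ s → bind (DS r) (λ s' → pure (s' ⊝ s)))

  abstract
    E-DD : ∀ r f → E (DD r) f ≡ E (DS r) (λ s → E (DS r) (λ s' → f (s' ⊝ s)))
    E-DD r f = refl

  χ : ℤ → ℚ
  χ z with z ℤP.≟ ℤ.0ℤ
  ... | yes _ = 1ℚ
  ... | no _ = 0ℚ

  χ-0 : ∀ {z} → z ≡ ℤ.0ℤ → χ z ≡ 1ℚ
  χ-0 {z} e with z ℤP.≟ ℤ.0ℤ
  ... | yes _ = refl
  ... | no n = contradiction e n

  χ-n : ∀ {z} → z ≢ ℤ.0ℤ → χ z ≡ 0ℚ
  χ-n {z} e with z ℤP.≟ ℤ.0ℤ
  ... | yes p = contradiction p e
  ... | no n = refl

  0≤χ : ∀ z → 0ℚ ≤ χ z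
  0≤χ z with z ℤP.≟ ℤ.0ℤ
  ... | yes _ = 0≤1
  ... | no n = ℚP.≤-refl

  χ≤1 : ∀ z → χ z ≤ 1ℚ
  χ≤1 z with z ℤP.≟ ℤ.0ℤ
  ... | yes _ = ℚP.≤-refl
  ... | no n = 0≤1

  Σχ : ∀ n (f : Fin n → ℤ) → (∀ i j → f i ≡ ℤ.0ℤ → f j ≡ ℤ.0ℤ → i ≡ j) → Σs n (χ ∘ f) ≤ 1ℚ
  Σχ zero f h = 0≤1
  Σχ (suc n) f h with f zero ℤP.≟ ℤ.0ℤ
  ... | yes p = ≡≤ (trans (cong (1ℚ +_) (trans (Σs-cong n (λ i → χ-n (λ q → case h zero (suc i) p q of λ ()))) (trans (Σs-const n 0ℚ) (ℚP.*-zeroʳ (ι n))))) (ℚP.+-identityʳ 1ℚ))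
  ... | no _ = ≡≤ (ℚP.+-identityˡ _) ≤⟨⟩ Σχ n (f ∘ suc) (λ i j p q → FP.suc-injective (h (suc i) (suc j) p q))

  module DetProb where
    private
      canc : ∀ {x y} b → x ℤ.+ b ≡ y ℤ.+ b → x ≡ y
      canc {x} {y} b e = trans (l x b) (trans (cong (ℤ._- b) e) (sym (l y b)))
        where l : ∀ x b → x ≡ x ℤ.+ b ℤ.- b
              l = ℤS.solve-∀

      inj : ∀ {r} (a b : ℤ) → a ≢ ℤ.0ℤ → ∀ (i j : Fin r) → a ℤ.* (ℤ.+ suc (toℕ i)) ℤ.+ b ≡ ℤ.0ℤ → a ℤ.* (ℤ.+ suc (toℕ j)) ℤ.+ b ≡ ℤ.0ℤ → i ≡ j
      inj a b a0 i j p q = FP.toℕ-injective (ℕP.suc-injective (ℤP.+-injective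
        (ℤP.*-cancelˡ-≡ a _ _ {{ℤ.≢-nonZero a0}} (canc b (trans p (sym q))))))

    linχ : ∀ r a b → a ≢ ℤ.0ℤ → E (Iv r) (λ x → χ (a ℤ.* x ℤ.+ b)) ≤ rec r
    linχ r a b a0 = ≡≤ (E-Iv r _) ≤⟨⟩ *mono (rec r) (0≤rec r) (Σχ (suc r) _ (inj a b a0)) ≤⟨⟩ ≡≤ (ℚP.*-identityʳ _)

    abstract
      fstχ : ∀ r c → E (DS r) (λ s → χ (proj₁ s ℤ.- c)) ≤ rec r
      fstχ r c = ≡≤ (E-cong (Iv r) (λ a → trans (E-const (Iv r) (χ (a ℤ.- c))) (cong χ (l a c)))) ≤⟨⟩ linχ r (ℤ.+ 1) (ℤ.- c) (λ ())
        where l : ∀ a c → a ℤ.- c ≡ ℤ.+ 1 ℤ.* a ℤ.+ ℤ.- c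
              l = ℤS.solve-∀

      -- Once the first digit of s is fixed, the determinant is affine in the second digit with
      -- slope u₁ ≠ 0, so it vanishes for at most one of r + 1 values.
      detχ : ∀ r u c → proj₁ u ≢ ℤ.0ℤ → E (DS r) (λ s → χ (det u (s ⊝ c))) ≤ rec r
      detχ r (u₁ , u₂) (c₁ , c₂) n = E-≤c (Iv r) (λ a → ≡≤ (E-cong (Iv r) (λ b → cong χ (l u₁ u₂ c₁ c₂ a b))) ≤⟨⟩ linχ r u₁ (ℤ.- (u₁ ℤ.* c₂) ℤ.- u₂ ℤ.* (a ℤ.- c₁)) n)
        where l : ∀ u₁ u₂ c₁ c₂ a b → u₁ ℤ.* (b ℤ.- c₂) ℤ.- u₂ ℤ.* (a ℤ.- c₁) ≡ u₁ ℤ.* b ℤ.+ (ℤ.- (u₁ ℤ.* c₂) ℤ.- u₂ ℤ.* (a ℤ.- c₁))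
              l = ℤS.solve-∀



    -- Here u is random as well: its first digit vanishes with probability at most `rec r`, and
    -- otherwise `detχ` applies.
    detP : ∀ r {A : Set} (μ : Mean A) (u c : A → ℤ²) → E μ (λ a → χ (proj₁ (u a))) ≤ rec r →
      E μ (λ a → E (DS r) (λ s → χ (det (u a) (s ⊝ c a)))) ≤ 2ℚ * rec r
    detP r μ u c h = E-mono μ (λ a → pt (u a) (c a)) ≤⟨⟩ ≡≤ (E-+ μ _ _) ≤⟨⟩ (h +≤ ≡≤ (E-const μ (rec r))) ≤⟨⟩ ≡≤ (l (rec r))
      where
      l : ∀ x → x + x ≡ 2ℚ * x
      l = solve-∀ ℚR
      pt : ∀ u c → E (DS r) (λ s → χ (det u (s ⊝ c))) ≤ χ (proj₁ u) + rec r
      pt u c with proj₁ u ℤP.≟ ℤ.0ℤ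
      ... | yes p = E-≤c (DS r) (λ s → χ≤1 (det u (s ⊝ c))) ≤⟨⟩ by (0≤rec r) refl
      ... | no n = detχ r u c n ≤⟨⟩ ≡≤ (sym (ℚP.+-identityˡ _))

    abstract
      DDfst : ∀ r → E (DD r) (λ e → χ (proj₁ e)) ≤ rec r
      DDfst r = E-≤c (DS r) (λ s → fstχ r (proj₁ s))

      DDdet : ∀ r → E (DD r) (λ e → E (DD r) (λ e' → χ (det e e'))) ≤ 2ℚ * rec r
      DDdet r = ≡≤ (E-swap (DD r) (DS r) (λ e s → E (DS r) (λ s' → χ (det e (s' ⊝ s))))) ≤⟨⟩ E-≤c (DS r) (λ s → detP r (DD r) id (λ _ → s) (DDfst r))

  open DetProb public

  record Small (C : ℕ) (u : ℤ²) : Set where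
    constructor _,,_
    field
      sm₁ : ℤ.∣ proj₁ u ∣ ℕ.≤ C
      sm₂ : ℤ.∣ proj₂ u ∣ ℕ.≤ C

  abstract
    DS-supp : ∀ r → Supp (DS r) (Small (suc r))
    DS-supp r = supp-map (Iv r) (λ a p → supp-map (Iv r) (λ b q → f p ,, f q) (Iv-supp r)) (Iv-supp r)
      where
      f : ∀ {d} → (Σ ℕ λ k → (d ≡ ℤ.+ suc k) × (k ℕ.≤ r)) → ℤ.∣ d ∣ ℕ.≤ suc r
      f (k , refl , p) = ℕ.s≤s p

  small-⊝ : ∀ {C u v} → Small C u → Small C v → Small (C ℕ.+ C) (u ⊝ v)
  small-⊝ {u = a , b} {c , d} (p ,, q) (p' ,, q') =
    ℕP.≤-trans (ℤP.∣i-j∣≤∣i∣+∣j∣ a c) (ℕP.+-mono-≤ p p') ,, ℕP.≤-trans (ℤP.∣i-j∣≤∣i∣+∣j∣ b d) (ℕP.+-mono-≤ q q')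

  small-mono : ∀ {C D u} → C ℕ.≤ D → Small C u → Small D u
  small-mono p (a ,, b) = ℕP.≤-trans a p ,, ℕP.≤-trans b p

  -- Room for four digits of size r + 1, since the vectors met later go up to a sum of two
  -- differences.
  C4 : ℕ → ℕ
  C4 r = (suc r ℕ.+ suc r) ℕ.+ (suc r ℕ.+ suc r)

  abstract
    DD-supp : ∀ r → Supp (DD r) (Small (C4 r))
    DD-supp r = supp-map (DS r) (λ s p → supp-map (DS r) (λ s' q → small-mono (ℕP.m≤m+n _ _) (small-⊝ q p)) (DS-supp r)) (DS-supp r)

  det-small : ∀ {C} u v → Small C u → Small C v → ℤ.∣ det u v ∣ ℕ.≤ C ℕ.* C ℕ.+ C ℕ.* C
  det-small {C} (a , b) (c , d) (p ,, q) (p' ,, q') = ℕP.≤-trans (ℤP.∣i-j∣≤∣i∣+∣j∣ (a ℤ.* d) (b ℤ.* c))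
    (ℕP.+-mono-≤ (subst (ℕ._≤ C ℕ.* C) (sym (ℤP.abs-* a d)) (ℕP.*-mono-≤ p q')) (subst (ℕ._≤ C ℕ.* C) (sym (ℤP.abs-* b c)) (ℕP.*-mono-≤ q p')))

  abstract
    Dr : ℕ → ℕ
    Dr r = C4 r ℕ.* C4 r ℕ.+ C4 r ℕ.* C4 r

    Qr : ℕ → ℕ
    Qr r = (Dr r) !

    Dr-def : ∀ r → Dr r ≡ C4 r ℕ.* C4 r ℕ.+ C4 r ℕ.* C4 r
    Dr-def r = refl

    Qr-def : ∀ r → Qr r ≡ (Dr r) !
    Qr-def r = refl

    Dr-det : ∀ r u v → Small (C4 r) u → Small (C4 r) v → ℤ.∣ det u v ∣ ℕ.≤ Dr r
    Dr-det r u v = det-small u v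

    Dr-C4 : ∀ r → C4 r ℕ.+ C4 r ℕ.≤ Dr r
    Dr-C4 r = ℕP.+-mono-≤ (ℕP.m≤m*n (C4 r) (C4 r)) (ℕP.m≤m*n (C4 r) (C4 r))

    Qr-div : ∀ r m → 1 ℕ.≤ m → m ℕ.≤ Dr r → m ∣ Qr r
    Qr-div r (suc m) _ p = ∣-trans (m∣m*n (m !)) (m≤n⇒m!∣n! p)

    1≤Qr : ∀ r → 1 ℕ.≤ Qr r
    1≤Qr r = ℕP.1≤n! (Dr r)

  recle : ∀ X n r → X ℕ.* 2 ℕ.* suc r ℕ.≤ suc n → ι X * (rec n * 2ℚ) ≤ rec r
  recle X n r p = ≤rec {ι X * (rec n * 2ℚ)} {1ℚ} r (≡≤ (l (ι X) (rec n) (ι (suc r))) ≤⟨⟩ rec≤ n (≡≤ (sym e) ≤⟨⟩ ι-mono p ≤⟨⟩ ≡≤ (sym (ℚP.*-identityˡ _)))) ≤⟨⟩ ≡≤ (ℚP.*-identityʳ (rec r))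
    where
    l : ∀ x n r → x * (n * 2ℚ) * r ≡ n * (x * 2ℚ * r)
    l = solve-∀ ℚR
    e : ι (X ℕ.* 2 ℕ.* suc r) ≡ ι X * 2ℚ * ι (suc r)
    e = trans (ι-* (X ℕ.* 2) (suc r)) (cong (_* ι (suc r)) (trans (ι-* X 2) (cong (ι X *_) refl)))

  private
    cofactor : ∀ Q (d : ℤ) → d ≢ ℤ.0ℤ → ℤ.∣ d ∣ ∣ Q → Σ ℤ λ c → (ℤ.+ Q ≡ d ℤ.* c) × (ℤ.∣ c ∣ ℕ.≤ Q)
    cofactor Q (ℤ.+ zero) n h = contradiction refl n
    cofactor Q (ℤ.+ suc m) n (divides q refl) = ℤ.+ q , trans (ℤP.pos-* q (suc m)) (ℤP.*-comm (ℤ.+ q) (ℤ.+ suc m)) , ℕP.m≤m*n q (suc m)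
    cofactor Q (ℤ.-[1+ m ]) n (divides q refl) = ℤ.- (ℤ.+ q) , trans (ℤP.pos-* q (suc m)) (l (ℤ.+ q) (ℤ.+ suc m)) ,
        subst (ℕ._≤ q ℕ.* suc m) (sym (ℤP.∣-i∣≡∣i∣ (ℤ.+ q))) (ℕP.m≤m*n q (suc m))
      where l : ∀ q m → q ℤ.* m ≡ ℤ.- m ℤ.* ℤ.- q
            l = ℤS.solve-∀

  -- Cramer's rule: v₂·val u - u₂·val v = B·det and u₁·val v - v₁·val u = det, with bounded digits
  -- as coefficients.
  det-abs : ∀ ν k B C u v {θ} → 0ℚ ≤ θ → Small C u → Small C v → Abs ν (k ℤ.* val B u) θ → Abs ν (k ℤ.* val B v) θ →
    Abs ν (k ℤ.* (ℤ.+ B ℤ.* det u v)) (ι (C ℕ.+ C) * θ) × Abs ν (k ℤ.* det u v) (ι (C ℕ.+ C) * θ)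
  det-abs ν k B C u@(u₁ , u₂) v@(v₁ , v₂) {θ} θ0 (p₁ ,, p₂) (q₁ ,, q₂) hu hv =
    subst (λ z → Abs ν z _) (l1 k (ℤ.+ B) u₁ u₂ v₁ v₂) (abs-weaken (wk q₂ (subst (ℕ._≤ C) (sym (ℤP.∣-i∣≡∣i∣ u₂)) p₂)) (abs-+ ν (abs-ℤ* ν v₂ hu) (abs-ℤ* ν (ℤ.- u₂) hv))) ,
    subst (λ z → Abs ν z _) (l2 k (ℤ.+ B) u₁ u₂ v₁ v₂) (abs-weaken (wk p₁ (subst (ℕ._≤ C) (sym (ℤP.∣-i∣≡∣i∣ v₁)) q₁)) (abs-+ ν (abs-ℤ* ν u₁ hv) (abs-ℤ* ν (ℤ.- v₁) hu)))
    where
    l1 : ∀ k B u₁ u₂ v₁ v₂ → v₂ ℤ.* (k ℤ.* (B ℤ.* u₁ ℤ.+ u₂)) ℤ.+ ℤ.- u₂ ℤ.* (k ℤ.* (B ℤ.* v₁ ℤ.+ v₂)) ≡ k ℤ.* (B ℤ.* (u₁ ℤ.* v₂ ℤ.- u₂ ℤ.* v₁))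
    l1 = ℤS.solve-∀
    l2 : ∀ k B u₁ u₂ v₁ v₂ → u₁ ℤ.* (k ℤ.* (B ℤ.* v₁ ℤ.+ v₂)) ℤ.+ ℤ.- v₁ ℤ.* (k ℤ.* (B ℤ.* u₁ ℤ.+ u₂)) ≡ k ℤ.* (u₁ ℤ.* v₂ ℤ.- u₂ ℤ.* v₁)
    l2 = ℤS.solve-∀
    wk : ∀ {a b} → a ℕ.≤ C → b ℕ.≤ C → ι a * θ + ι b * θ ≤ ι (C ℕ.+ C) * θ
    wk {a} {b} p q = ≡≤ (sym (ℚP.*-distribʳ-+ θ (ι a) (ι b))) ≤⟨⟩ *mono' θ θ0 ((ι-mono p +≤ ι-mono q) ≤⟨⟩ ≡≤ (sym (ι-+ C C)))

  module _ (r b n : ℕ) where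
    private B = suc b

    Cond : Set
    Cond = Qr r ℕ.* B ℕ.* Dr r ℕ.* (4 ℕ.* suc r) ℕ.≤ suc n

    -- Write t = t₁B + t₀ and `Qr` = det·c. Then k·Qr·t consists of c·t₁ copies of k·B·det and c·t₀
    -- copies of k·det, and both t₀ and t₁ are at most B although t runs up to B².
    zabs : ∀ ν k ℓ u v → Cond → suc ℓ ℕ.≤ B ℕ.* B → Small (C4 r) u → Small (C4 r) v → det u v ≢ ℤ.0ℤ →
      Abs ν (k ℤ.* val B u) (rec n * 2ℚ) → Abs ν (k ℤ.* val B v) (rec n * 2ℚ) →
      Supp (dir1 (k ℤ.* ℤ.+ Qr r) ℓ) (λ z → Abs ν z (rec r))
    zabs ν k ℓ u v cond ℓB su sv dn hu hv with cofactor (Qr r) (det u v) dn (Qr-div r _ (abs≥1 _ dn) (Dr-det r u v su sv))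
      where
      abs≥1 : ∀ z → z ≢ ℤ.0ℤ → 1 ℕ.≤ ℤ.∣ z ∣
      abs≥1 (ℤ.+ zero) h = contradiction refl h
      abs≥1 (ℤ.+ suc m) h = ℕ.s≤s ℕ.z≤n
      abs≥1 (ℤ.-[1+ m ]) h = ℕ.s≤s ℕ.z≤n
    ... | c , eq , cQ = supp-map (Iv ℓ) go (Iv-supp ℓ)
      where
      θ = rec n * 2ℚ
      θ0 : 0ℚ ≤ θ
      θ0 = nn* (0≤rec n) 0≤2
      C = C4 r
      da = det-abs ν k B C u v θ0 su sv hu hv
      go : ∀ t → (Σ ℕ λ i → (t ≡ ℤ.+ suc i) × (i ℕ.≤ ℓ)) → Abs ν (k ℤ.* ℤ.+ Qr r ℤ.* t) (rec r)
      go t (i , refl , iℓ) = abs-weaken bound (subst (λ z → Abs ν z bnd) zeq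
          (abs-+ ν (abs-ℤ* ν (c ℤ.* ℤ.+ t₁) (proj₁ da)) (abs-ℤ* ν (c ℤ.* ℤ.+ t₀) (proj₂ da))))
        where
        t₁ = suc i ℕDM./ B
        bnd : ℚ
        bnd = ι ℤ.∣ c ℤ.* ℤ.+ (suc i ℕDM./ B) ∣ * (ι (C ℕ.+ C) * θ) + ι ℤ.∣ c ℤ.* ℤ.+ (suc i ℕDM.% B) ∣ * (ι (C ℕ.+ C) * θ)
        t₀ = suc i ℕDM.% B
        zeq : c ℤ.* ℤ.+ t₁ ℤ.* (k ℤ.* (ℤ.+ B ℤ.* det u v)) ℤ.+ c ℤ.* ℤ.+ t₀ ℤ.* (k ℤ.* det u v) ≡ k ℤ.* ℤ.+ Qr r ℤ.* ℤ.+ suc i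
        zeq = trans (l c k (ℤ.+ B) (det u v) (ℤ.+ t₁) (ℤ.+ t₀)) (trans (cong (λ w → k ℤ.* w ℤ.* (ℤ.+ t₀ ℤ.+ ℤ.+ t₁ ℤ.* ℤ.+ B)) (sym eq))
          (cong (λ w → k ℤ.* ℤ.+ Qr r ℤ.* w) (trans (cong (λ w → ℤ.+ t₀ ℤ.+ w) (sym (ℤP.pos-* t₁ B))) (cong ℤ.+_ (sym (ℕDM.m≡m%n+[m/n]*n (suc i) B))))))
          where l : ∀ c k B d t₁ t₀ → c ℤ.* t₁ ℤ.* (k ℤ.* (B ℤ.* d)) ℤ.+ c ℤ.* t₀ ℤ.* (k ℤ.* d) ≡ k ℤ.* (d ℤ.* c) ℤ.* (t₀ ℤ.+ t₁ ℤ.* B)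
                l = ℤS.solve-∀
        t₁≤ : t₁ ℕ.≤ B
        t₁≤ = ℕP.≤-trans (ℕDM./-monoˡ-≤ B (ℕP.≤-trans (ℕ.s≤s iℓ) ℓB)) (ℕP.≤-reflexive (ℕDM.m*n/n≡m B B))
        t₀≤ : t₀ ℕ.≤ B
        t₀≤ = ℕP.<⇒≤ (ℕDM.m%n<n (suc i) B)
        ct : ∀ t → t ℕ.≤ B → ℤ.∣ c ℤ.* ℤ.+ t ∣ ℕ.≤ Qr r ℕ.* B
        ct t p = subst (ℕ._≤ Qr r ℕ.* B) (sym (ℤP.abs-* c (ℤ.+ t))) (ℕP.*-mono-≤ cQ p)
        QB = Qr r ℕ.* B
        bound : ι ℤ.∣ c ℤ.* ℤ.+ t₁ ∣ * (ι (C ℕ.+ C) * θ) + ι ℤ.∣ c ℤ.* ℤ.+ t₀ ∣ * (ι (C ℕ.+ C) * θ) ≤ rec r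
        bound = (*mono' _ (nn* (0≤ι (C ℕ.+ C)) θ0) (ι-mono (ct t₁ t₁≤)) +≤ *mono' _ (nn* (0≤ι (C ℕ.+ C)) θ0) (ι-mono (ct t₀ t₀≤))) ≤⟨⟩
          ≡≤ (trans (l (ι QB) (ι (C ℕ.+ C)) θ) (cong (_* θ) (trans (cong (_* ι (C ℕ.+ C)) (sym (ι-+ QB QB))) (sym (ι-* (QB ℕ.+ QB) (C ℕ.+ C)))))) ≤⟨⟩
          recle ((QB ℕ.+ QB) ℕ.* (C ℕ.+ C)) n r (ℕP.≤-trans (ℕP.≤-trans (ℕP.*-monoˡ-≤ (suc r) (ℕP.*-monoˡ-≤ 2 (ℕP.*-monoʳ-≤ (QB ℕ.+ QB) (Dr-C4 r)))) (ℕP.≤-reflexive (l' QB (Dr r) (suc r)))) cond)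
          where
          l : ∀ q c θ → q * (c * θ) + q * (c * θ) ≡ (q + q) * c * θ
          l = solve-∀ ℚR
          l' : ∀ q d r → (q ℕ.+ q) ℕ.* d ℕ.* 2 ℕ.* r ≡ q ℕ.* d ℕ.* (4 ℕ.* r)
          l' = ℕS.solve-∀

  abstract
    kC : ℕ
    kC = 50

    kC-le : ∀ {x y' u κ} → 0ℚ ≤ κ → κ ≤ 1ℚ → 0ℚ ≤ u → sq x ≤ y' + ι 5 * κ → sq y' ≤ u → pw 2 x ≤ ι kC * (u + κ)
    kC-le {x} {y'} {u} {κ} k0 k1 u0 p q =
      ≡≤ (trans (pw-suc 1 x) (trans (pw-suc 0 (sq x)) (pw-0 _))) ≤⟨⟩
      *mono (sq x) (nn-sq x) p ≤⟨⟩ *mono' (y' + ι 5 * κ) (nn-sq x ≤⟨⟩ p) p ≤⟨⟩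
      by (nn-sq (y' - ι 5 * κ)) (l y' κ) ≤⟨⟩
      (*mono 2ℚ 0≤2 q +≤ *mono (ι 50) (0≤ι 50) (*mono κ k0 k1 ≤⟨⟩ ≡≤ (ℚP.*-identityʳ κ))) ≤⟨⟩
      by (nn* (0≤ι 48) u0) (l2 u κ)
      where
      l : ∀ y κ → 2ℚ * (y * y) + ι 50 * (κ * κ) ≡ (y + ι 5 * κ) * (y + ι 5 * κ) + (y - ι 5 * κ) * (y - ι 5 * κ)
      l = solve-∀ ℚR
      l2 : ∀ u κ → ι 50 * (u + κ) ≡ 2ℚ * u + ι 50 * κ + ι 48 * u
      l2 = solve-∀ ℚR
open Digits

-- Merging random directions, and van der Corput with random digits.

module Concatenation where
  -- Averages along random directions val σ' − val σ are controlled by the average along the single direction Qr: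
  -- two digit vectors with nonzero determinant generate both det·t and B·det·t.
  module Concat (S : Sys) where
    open Sys S
    open Dyn S

    corr-P : ∀ (Z D : Mean ℤ) (H : Fn) → E Z (λ z → E D (λ s → E mΩ (λ ω → H ω * H (ω ⊕ (s ℤ.+ z))))) ≡ E D (λ s → E mΩ (λ ω → H ω * P Z H (ω ⊕ s)))
    corr-P Z D H = trans (E-swap Z D _) (E-cong D (λ s → trans (E-swap Z mΩ _)
       (E-cong mΩ (λ ω → trans (E-* Z (H ω) _) (cong (H ω *_) (E-cong Z (λ z → sym (sh H ω s z refl))))))))

    module _ (r b n : ℕ) (k : ℤ) (ℓ : ℕ) {H : Fn} (bH : BdF H) (cond : Cond r b n) (ℓB : suc ℓ ℕ.≤ suc b ℕ.* suc b) where
      private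
        B = suc b
        κ = rec r
        I = Iv n
        Z : Mean ℤ
        Z = dir1 (k ℤ.* ℤ.+ Qr r) ℓ
        kv : ℤ² → ℤ
        kv e = k ℤ.* val B e
        A : ℤ² → Fn
        A e ω = E I (λ i → E I (λ i' → H (ω ⊕ (kv e ℤ.* i' ℤ.- kv e ℤ.* i))))
        x : ℚ
        x = E (DD r) (λ e → N (dir1 (kv e) n) H)
        G : ℤ → ℚ
        G s = E mΩ (λ ω → H ω * H (ω ⊕ s))
        D : ℤ² → ℤ² → Mean ℤ
        D e e' = bind I (λ i' → bind I (λ j' → bind (dirV (kv e) (ℤ.- kv e') n) (λ s → pure ((kv e' ℤ.* j' ℤ.- kv e ℤ.* i') ℤ.+ s))))

        -- Invariance moves one factor to ω, so the squared norm becomes the pairing of H with an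
        -- average of its translates; in this form Cauchy-Schwarz can discard H.
        N-auto : ∀ u → N (dir1 u n) H ≡ E mΩ (λ ω → H ω * E I (λ i → E I (λ i' → H (ω ⊕ (u ℤ.* i' ℤ.- u ℤ.* i)))))
        N-auto u = trans (E-cong mΩ (λ ω → E-sq I I (λ i → H (ω ⊕ (u ℤ.* i))) (λ i → H (ω ⊕ (u ℤ.* i)))))
          (trans (sym (swap3 I I mΩ (λ i i' ω → H (ω ⊕ (u ℤ.* i)) * H (ω ⊕ (u ℤ.* i')))))
          (trans (E-cong I (λ i → E-cong I (λ i' → sym (trans (sym (inv (u ℤ.* i) (λ ω → H ω * H (ω ⊕ (u ℤ.* i' ℤ.- u ℤ.* i)))))
               (E-cong mΩ (λ ω → cong (H (ω ⊕ (u ℤ.* i)) *_) (sh H ω _ _ (l (u ℤ.* i) (u ℤ.* i')))))))))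
          (trans (swap3 I I mΩ (λ i i' ω → H ω * H (ω ⊕ (u ℤ.* i' ℤ.- u ℤ.* i))))
             (E-cong mΩ (λ ω → trans (E-cong I (λ i → E-* I (H ω) _)) (E-* I (H ω) _))))))
          where
          l : ∀ a b → a ℤ.+ (b ℤ.- a) ≡ b
          l = ℤS.solve-∀

        x-eq : x ≡ E mΩ (λ ω → H ω * E (DD r) (λ e → A e ω))
        x-eq = trans (E-cong (DD r) (λ e → N-auto (kv e))) (trans (E-swap (DD r) mΩ _) (E-cong mΩ (λ ω → E-* (DD r) (H ω) _)))

        -- Two independent directions now meet. Of the four interval variables i and j form `dirV`,
        -- which supplies the absorption, while i' and j' only contribute a shift.
        AA : ∀ e e' → E mΩ (λ ω → A e ω * A e' ω) ≡ E (D e e') G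
        AA e e' = trans (E-cong mΩ (λ ω → trans (E-sq I I _ _) (E-cong I (λ i → E-cong I (λ j → E-sq I I _ _)))))
          (trans (sym (trans (E-cong I (λ i → E-cong I (λ j → swap3 I I mΩ _))) (swap3 I I mΩ _)))
          (trans (E-cong I (λ i → E-cong I (λ j → E-cong I (λ i' → E-cong I (λ j' → pt i j i' j')))))
          (trans (swap3 I I I _) (E-cong I (λ i' → swap3 I I I _)))))
          where
          pt : ∀ i j i' j' → E mΩ (λ ω → H (ω ⊕ (kv e ℤ.* i' ℤ.- kv e ℤ.* i)) * H (ω ⊕ (kv e' ℤ.* j' ℤ.- kv e' ℤ.* j)))
             ≡ G ((kv e' ℤ.* j' ℤ.- kv e ℤ.* i') ℤ.+ (kv e ℤ.* i ℤ.+ ℤ.- kv e' ℤ.* j))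
          pt i j i' j' = sym (trans (sym (inv (kv e ℤ.* i' ℤ.- kv e ℤ.* i) _)) (E-cong mΩ (λ ω → cong (H (ω ⊕ (kv e ℤ.* i' ℤ.- kv e ℤ.* i)) *_)
              (sh H ω _ _ (l (kv e ℤ.* i) (kv e ℤ.* i') (kv e') j (kv e' ℤ.* j'))))))
            where
            l : ∀ u u' v j w' → (u' ℤ.- u) ℤ.+ ((w' ℤ.- u') ℤ.+ (u ℤ.+ ℤ.- v ℤ.* j)) ≡ w' ℤ.- v ℤ.* j
            l = ℤS.solve-∀

        bG : ∀ s → Bd (G s)
        bG s = E-bd mΩ (λ ω → bd* (bH _) (bH _))

        GZ : ℤ → ℚ
        GZ s = E mΩ (λ ω → H ω * P Z H (ω ⊕ s))

        bGZ : ∀ s → Bd (GZ s)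
        bGZ s = E-bd mΩ (λ ω → bd* (bH _) (bdP Z bH _))

        absD : ∀ e e' z {η} → Abs (dirV (kv e) (ℤ.- kv e') n) z η → Abs (D e e') z η
        absD e e' z h = abs-bind I (λ i' → bind I (λ j' → bind (dirV (kv e) (ℤ.- kv e') n) (λ s → pure ((kv e' ℤ.* j' ℤ.- kv e ℤ.* i') ℤ.+ s))))
          (λ i' → abs-bind I (λ j' → bind (dirV (kv e) (ℤ.- kv e') n) (λ s → pure ((kv e' ℤ.* j' ℤ.- kv e ℤ.* i') ℤ.+ s)))
            (λ j' → abs-shift (dirV (kv e) (ℤ.- kv e') n) (kv e' ℤ.* j' ℤ.- kv e ℤ.* i') h))

        -- If the determinant is nonzero, `zabs` inserts an average over `Z`; if it vanishes, the
        -- trivial error 2 is charged to `χ`.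
        near1 : ∀ e e' → Small (C4 r) e → Small (C4 r) e' → Near (E (D e e') G) (E (D e e') GZ) (κ + 2ℚ * χ (det e e'))
        near1 e e' se se' with det e e' ℤP.≟ ℤ.0ℤ
        ... | yes p = near-weaken (by (0≤rec r) (l κ)) (near-bd (E-bd (D e e') bG) (E-bd (D e e') bGZ))
          where l : ∀ κ → κ + 2ℚ * 1ℚ ≡ 2ℚ + κ
                l = solve-∀ ℚR
        ... | no dn = near-weaken (by ℚP.≤-refl (l κ)) (near-≡ refl eq
                (avgAbs (D e e') Z id G bG (supp-map Z (λ z h → absD e e' z h) (zabs r b n (dirV (kv e) (ℤ.- kv e') n) k ℓ e e' cond ℓB se se' dn
                   (abs-dirV₁ (kv e) (ℤ.- kv e') n) (subst (λ z → Abs (dirV (kv e) (ℤ.- kv e') n) z (rec n * 2ℚ)) (ℤP.neg-involutive (kv e')) (abs-neg (dirV (kv e) (ℤ.- kv e') n) (abs-dirV₂ (kv e) (ℤ.- kv e') n)))))))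
          where
          l : ∀ κ → κ + 2ℚ * 0ℚ ≡ κ + 0ℚ
          l = solve-∀ ℚR
          eq : E Z (λ z → E (D e e') (λ s → G (s ℤ.+ z))) ≡ E (D e e') GZ
          eq = corr-P Z (D e e') H

        y' : ℚ
        y' = E (DD r) (λ e → E (DD r) (λ e' → E (D e e') GZ))

        -- 5κ is κ from absorption plus 2·2κ from the probability that the determinant vanishes.
        x²≤ : sq x ≤ y' + ι 5 * κ
        x²≤ = ≡≤ (cong sq x-eq) ≤⟨⟩ kill mΩ H _ bH ≤⟨⟩
          ≡≤ (trans (E-cong mΩ (λ ω → E-sq (DD r) (DD r) (λ e → A e ω) (λ e → A e ω))) (trans (sym (swap3 (DD r) (DD r) mΩ (λ e e' ω → A e ω * A e' ω))) (E-cong (DD r) (λ e → E-cong (DD r) (λ e' → AA e e'))))) ≤⟨⟩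
          E-monoS (DD r) (supp-map (DD r) (λ e se → E-monoS (DD r) (supp-map (DD r) (λ e' se' → proj₁ (near1 e e' se se')) (DD-supp r))) (DD-supp r)) ≤⟨⟩
          ≡≤ (trans (E-cong (DD r) (λ e → E-+ (DD r) _ _)) (E-+ (DD r) _ _)) ≤⟨⟩
          +l y' (≡≤ (trans (E-cong (DD r) (λ e → trans (E-+ (DD r) _ _) (cong₂ _+_ (E-const (DD r) κ) (E-* (DD r) 2ℚ _)))) (trans (E-+ (DD r) _ _) (cong₂ _+_ (E-const (DD r) κ) (E-* (DD r) 2ℚ _)))) ≤⟨⟩
            +l κ (*mono 2ℚ 0≤2 (DDdet r)) ≤⟨⟩ ≡≤ (l κ))
          where l : ∀ κ → κ + 2ℚ * (2ℚ * κ) ≡ ι 5 * κ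
                l = solve-∀ ℚR

        y'² : sq y' ≤ N Z H
        y'² = jensen (DD r) (λ e → E (DD r) (λ e' → E (D e e') GZ)) ≤⟨⟩ E-≤c (DD r) (λ e → jensen (DD r) (λ e' → E (D e e') GZ) ≤⟨⟩ E-≤c (DD r) (λ e' → jensen (D e e') GZ ≤⟨⟩ E-≤c (D e e') (λ s →
           kill mΩ H (λ ω → P Z H (ω ⊕ s)) bH ≤⟨⟩ ≡≤ (inv s (λ ω → sq (P Z H ω))))))

      concat : pw 2 (E (DD r) (λ e → N (dir1 (k ℤ.* val B e) n) H)) ≤ ι kC * (N (dir1 (k ℤ.* ℤ.+ Qr r) ℓ) H + rec r)
      concat = kC-le {x} {y'} (0≤rec r) (rec≤1 r) (N-nn Z H) x²≤ y'²

  module VdC (S : Sys) (r m b : ℕ) (absS : Supp (DS r) (λ σ → Abs (Iv m) (val (suc b) σ) (rec r))) where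
    open Sys S
    open Dyn S

    private
      κ = rec r
      I = Iv m
      D = DS r
      v : ℤ² → ℤ
      v = val (suc b)

    avgD : ∀ (h : ℤ → ℚ) → (∀ x → Bd (h x)) → Near (E I h) (E D (λ σ → E I (λ d → h (d ℤ.+ v σ)))) κ
    avgD h bh = avgAbs I D v h bh absS

    -- The shifts have two random digits instead of filling an interval, so that differences of
    -- shifts are values of digit vectors, to which `concat` applies.
    vdc : ∀ (g : Fn) (y : ℤ → Fn) → BdF g → (∀ d → BdF (y d)) →
      sq (E I (λ d → E mΩ (λ ω → g ω * y d ω))) ≤ E D (λ σ → E D (λ σ' → E I (λ d → E mΩ (λ ω → y (d ℤ.+ v σ) ω * y (d ℤ.+ v σ') ω)))) + 2ℚ * κ
    vdc g y bg by' = near-sq (E-bd I bh) (E-bd D (λ σ → E-bd I (λ d → bh _))) (avgD h bh) ≤⟨⟩ +r (2ℚ * κ) s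
      where
      h : ℤ → ℚ
      h d = E mΩ (λ ω → g ω * y d ω)
      bh : ∀ d → Bd (h d)
      bh d = E-bd mΩ (λ ω → bd* (bg ω) (by' d ω))
      s : sq (E D (λ σ → E I (λ d → h (d ℤ.+ v σ)))) ≤ E D (λ σ → E D (λ σ' → E I (λ d → E mΩ (λ ω → y (d ℤ.+ v σ) ω * y (d ℤ.+ v σ') ω))))
      s = ≡≤ (cong sq (trans (E-swap D I (λ σ d → h (d ℤ.+ v σ))) (E-cong I (λ d → trans (E-swap D mΩ (λ σ ω → g ω * y (d ℤ.+ v σ) ω)) (E-cong mΩ (λ ω → E-* D (g ω) (λ σ → y (d ℤ.+ v σ) ω))))))) ≤⟨⟩
        jensen I _ ≤⟨⟩ E-mono I (λ d → kill mΩ g (λ ω → E D (λ σ → y (d ℤ.+ v σ) ω)) bg) ≤⟨⟩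
        ≡≤ (trans (E-cong I (λ d → trans (E-cong mΩ (λ ω → E-sq D D (λ σ → y (d ℤ.+ v σ) ω) (λ σ → y (d ℤ.+ v σ) ω))) (sym (swap3 D D mΩ (λ σ σ' ω → y (d ℤ.+ v σ) ω * y (d ℤ.+ v σ') ω)))))
            (sym (swap3 D D I (λ σ σ' d → E mΩ (λ ω → y (d ℤ.+ v σ) ω * y (d ℤ.+ v σ') ω)))))
open Concatenation

-- One step of degree lowering for dual functions of squares.

module LoweringStep where
  module Lower (S : Sys) where
    open Sys S
    open Dyn S
    open Concat S

    dual : ℕ → ℤ → Fn → Fn → Fn
    dual m k g₁ g₂ ω = E (Iv m) (λ d → g₁ (ω ⊕ d ℤ.* d) * g₂ (ω ⊕ (d ℤ.+ k) ℤ.* (d ℤ.+ k)))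

    bd-dual : ∀ m k {g₁ g₂} → BdF g₁ → BdF g₂ → BdF (dual m k g₁ g₂)
    bd-dual m k b c ω = E-bd (Iv m) (λ d → bd* (b _) (c _))

    -- The variable d is moved to D = d + q(j + val σ). Cauchy-Schwarz will duplicate σ but not j:
    -- then j cancels in D' - D and survives in D'² - D², where it is the parameter of a new
    -- direction.
    record Absorbing (r m : ℕ) (k q : ℤ) (B J : ℕ) (μ₁ μ₂ : Mean ℤ) : Set where
      field
        absM : Supp (Iv J) (λ j → Supp (DS r) (λ σ → Abs (Iv m) (q ℤ.* (j ℤ.+ val B σ)) (rec r)))
        absδ₁ : Supp (Iv J) (λ j → Supp (DS r) (λ σ → Supp (Iv m) (λ d → let D = d ℤ.+ q ℤ.* (j ℤ.+ val B σ) in Abs μ₁ (D ℤ.* D ℤ.- d ℤ.* d) (rec r))))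
        absδ₂ : Supp (Iv J) (λ j → Supp (DS r) (λ σ → Supp (Iv m) (λ d → let D = d ℤ.+ q ℤ.* (j ℤ.+ val B σ) in Abs μ₂ (D ℤ.* D ℤ.- d ℤ.* d) (rec r))))
        absk : Supp (Iv J) (λ j → Supp (DS r) (λ σ → Abs μ₂ (ℤ.+ 2 ℤ.* k ℤ.* (q ℤ.* (j ℤ.+ val B σ))) (rec r)))

    -- Two box directions are traded for one. Direction `μ₁` makes the factors containing a' forget
    -- D, so that Cauchy-Schwarz discards them; direction `μ₂` then makes the `g₂` factors
    -- independent of j. What remains is X against its translate by -(D'² - D²), which is affine in
    -- j.
    module K0 (r m : ℕ) (k q : ℤ) (B J : ℕ) (μ₁ μ₂ : Mean ℤ) (g₁ g₂ X : Fn) (b₁ : BdF g₁) (b₂ : BdF g₂) (bX : BdF X)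
              (hyp : Absorbing r m k q B J μ₁ μ₂) where
      open Absorbing hyp
      κ = rec r
      I = Iv m

      top : ℤ → ℤ → ℤ → ℤ → ℤ → Fn
      top d a a' b b' ω = (g₁ (ω ⊕ (b ℤ.+ a ℤ.+ d ℤ.* d)) * g₂ (ω ⊕ (b ℤ.+ a ℤ.+ (d ℤ.+ k) ℤ.* (d ℤ.+ k)))) * X (ω ⊕ (b ℤ.+ a')) * (X (ω ⊕ (b' ℤ.+ a)) * X (ω ⊕ (b' ℤ.+ a')))

      h : ℤ → ℚ
      h d = E μ₁ (λ a → E μ₁ (λ a' → E μ₂ (λ b → E μ₂ (λ b' → E mΩ (top d a a' b b')))))

      S0 : ℚ
      S0 = E I h

      bdE4 : ∀ (f : ℤ → ℤ → ℤ → ℤ → Fn) → (∀ a a' b b' → BdF (f a a' b b')) → Bd (E μ₁ (λ a → E μ₁ (λ a' → E μ₂ (λ b → E μ₂ (λ b' → E mΩ (f a a' b b'))))))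
      bdE4 f bf = E-bd μ₁ (λ a → E-bd μ₁ (λ a' → E-bd μ₂ (λ b → E-bd μ₂ (λ b' → E-bd mΩ (bf a a' b b')))))

      bdh : ∀ d → Bd (h d)
      bdh d = bdE4 (top d) (λ a a' b b' ω → bd* (bd* (bd* (b₁ _) (b₂ _)) (bX _)) (bd* (bX _) (bX _)))

      bb : ℤ → ℤ → ℤ → ℤ → ℤ → Fn
      bb d a a' b b' ω = g₁ (ω ⊕ (b ℤ.+ a)) * (X (ω ⊕ (b ℤ.+ a' ℤ.- d ℤ.* d)) * X (ω ⊕ (b' ℤ.+ a' ℤ.- d ℤ.* d)))

      YY : ℤ → ℤ → ℤ → ℤ → Fn
      YY D a b b' ω = g₂ (ω ⊕ (b ℤ.+ a ℤ.+ (ℤ.+ 2 ℤ.* k ℤ.* D ℤ.+ k ℤ.* k))) * X (ω ⊕ (b' ℤ.+ a ℤ.- D ℤ.* D))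

      h1 : ℤ → ℤ → ℚ
      h1 d D = E μ₁ (λ a → E μ₁ (λ a' → E μ₂ (λ b → E μ₂ (λ b' → E mΩ (λ ω → bb d a a' b b' ω * YY D a b b' ω)))))

      ff : ℤ → ℤ → ℤ → ℚ
      ff D a x = E μ₂ (λ b → E μ₂ (λ b' → E mΩ (λ ω → g₁ (ω ⊕ (b ℤ.+ a)) * (X (ω ⊕ (b ℤ.+ x ℤ.- D ℤ.* D)) * X (ω ⊕ (b' ℤ.+ x ℤ.- D ℤ.* D))) * YY D a b b' ω)))

      bdYY : ∀ D a b b' → BdF (YY D a b b')
      bdYY D a b b' ω = bd* (b₂ _) (bX _)

      bdff : ∀ D a x → Bd (ff D a x)
      bdff D a x = E-bd μ₂ (λ b → E-bd μ₂ (λ b' → E-bd mΩ (λ ω → bd* (bd* (b₁ _) (bd* (bX _) (bX _))) (bdYY D a b b' ω))))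

      -- Translating by -D² frees `g₁` from D and leaves `g₂` with the shift 2kD + k², linear in D.
      h≡ : ∀ D → h D ≡ E μ₁ (λ a → E μ₁ (ff D a))
      h≡ D = E-cong μ₁ (λ a → E-cong μ₁ (λ a' → E-cong μ₂ (λ b → E-cong μ₂ (λ b' → trans (sym (inv (ℤ.- (D ℤ.* D)) (top D a a' b b'))) (E-cong mΩ (λ ω →
          trans (cong₂ _*_ (cong₂ _*_ (cong₂ _*_ (sh g₁ ω _ _ (l1 a b D)) (sh g₂ ω _ _ (l2 a b D k))) (sh X ω _ _ (l3 b a' D))) (cong₂ _*_ (sh X ω _ _ (l3 b' a D)) (sh X ω _ _ (l3 b' a' D))))
            (l (g₁ (ω ⊕ (b ℤ.+ a))) (g₂ (ω ⊕ (b ℤ.+ a ℤ.+ (ℤ.+ 2 ℤ.* k ℤ.* D ℤ.+ k ℤ.* k)))) (X (ω ⊕ (b ℤ.+ a' ℤ.- D ℤ.* D))) (X (ω ⊕ (b' ℤ.+ a ℤ.- D ℤ.* D))) (X (ω ⊕ (b' ℤ.+ a' ℤ.- D ℤ.* D))))))))))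
        where
        l : ∀ g g' x y z → g * g' * x * (y * z) ≡ g * (x * z) * (g' * y)
        l = solve-∀ ℚR
        l1 : ∀ a b D → ℤ.- (D ℤ.* D) ℤ.+ (b ℤ.+ a ℤ.+ D ℤ.* D) ≡ b ℤ.+ a
        l1 = ℤS.solve-∀
        l2 : ∀ a b D k → ℤ.- (D ℤ.* D) ℤ.+ (b ℤ.+ a ℤ.+ (D ℤ.+ k) ℤ.* (D ℤ.+ k)) ≡ b ℤ.+ a ℤ.+ (ℤ.+ 2 ℤ.* k ℤ.* D ℤ.+ k ℤ.* k)
        l2 = ℤS.solve-∀
        l3 : ∀ b x D → ℤ.- (D ℤ.* D) ℤ.+ (b ℤ.+ x) ≡ b ℤ.+ x ℤ.- D ℤ.* D
        l3 = ℤS.solve-∀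

      near-h : ∀ d D → Abs μ₁ (D ℤ.* D ℤ.- d ℤ.* d) κ → Near (h D) (h1 d D) κ
      near-h d D ab' = near-≡ (sym (h≡ D)) refl (E-near μ₁ (λ a → near-sym (near-≡ (E-cong μ₁ (λ a' → E-cong μ₂ (λ b → E-cong μ₂ (λ b' → E-cong mΩ (λ ω →
         cong (λ z → g₁ (ω ⊕ (b ℤ.+ a)) * z * YY D a b b' ω) (cong₂ _*_ (cong (λ z → X (ω ⊕ z)) (l b a' D d)) (cong (λ z → X (ω ⊕ z)) (l b' a' D d)))))))) refl
         (ab ab' (ff D a) (bdff D a)))))
        where
        l : ∀ b x D d → b ℤ.+ (x ℤ.+ (D ℤ.* D ℤ.- d ℤ.* d)) ℤ.- D ℤ.* D ≡ b ℤ.+ x ℤ.- d ℤ.* d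
        l = ℤS.solve-∀

      tt' : ℤ → ℤ² → ℤ
      tt' j σ = q ℤ.* (j ℤ.+ val B σ)

      JM : Mean ℤ
      JM = Iv J

      Sh : ℚ
      Sh = E JM (λ j → E (DS r) (λ σ → E I (λ d → h1 d (d ℤ.+ tt' j σ))))

      near1 : Near S0 Sh (κ + κ)
      near1 = near-trans
        (near-≡ refl refl (avgAbs I (bind JM (λ j → bind (DS r) (λ σ → pure (tt' j σ)))) id h bdh absM))
        (E-nearS JM (supp-map JM (λ j → λ p → E-nearS (DS r) (supp-map (DS r) (λ σ p → E-nearS I (supp-map I (λ d p → near-h d (d ℤ.+ tt' j σ) p) p)) p)) absδ₁))

      Q4 : Mean (ℤ × ℤ × ℤ × ℤ × Ω)
      Q4 = bind μ₁ (λ a → bind μ₁ (λ a' → bind μ₂ (λ b → bind μ₂ (λ b' → bind mΩ (λ ω → pure (a , a' , b , b' , ω))))))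

      Sh≡ : Sh ≡ E JM (λ j → E I (λ d → E Q4 (λ { (a , a' , b , b' , ω) → bb d a a' b b' ω * E (DS r) (λ σ → YY (d ℤ.+ tt' j σ) a b b' ω) })))
      Sh≡ = E-cong JM (λ j → trans (E-swap (DS r) I _) (E-cong I (λ d → trans (E-swap (DS r) Q4 (λ { σ (a , a' , b , b' , ω) → bb d a a' b b' ω * YY (d ℤ.+ tt' j σ) a b b' ω }))
          (E-cong Q4 (λ { (a , a' , b , b' , ω) → E-* (DS r) (bb d a a' b b' ω) _ })))))

      R0 : ℤ → ℤ → ℤ → ℚ
      R0 d D D' = E μ₂ (λ b → E μ₂ (λ b' → E mΩ (λ ω → YY D ℤ.0ℤ b b' ω * YY D' ℤ.0ℤ b b' ω)))

      Sh² : sq Sh ≤ E JM (λ j → E I (λ d → E (DS r) (λ σ → E (DS r) (λ σ' → R0 d (d ℤ.+ tt' j σ) (d ℤ.+ tt' j σ')))))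
      Sh² = ≡≤ (cong sq Sh≡) ≤⟨⟩ jensen JM _ ≤⟨⟩ E-mono JM (λ j → jensen I _ ≤⟨⟩ E-mono I (λ d →
          kill Q4 (λ { (a , a' , b , b' , ω) → bb d a a' b b' ω }) (λ { (a , a' , b , b' , ω) → E (DS r) (λ σ → YY (d ℤ.+ tt' j σ) a b b' ω) })
            (λ { (a , a' , b , b' , ω) → bd* (b₁ _) (bd* (bX _) (bX _)) }) ≤⟨⟩
          ≡≤ (trans (E-cong Q4 (λ { (a , a' , b , b' , ω) → E-sq (DS r) (DS r) _ _ }))
             (trans (sym (swap3 (DS r) (DS r) Q4 (λ { σ σ' (a , a' , b , b' , ω) → YY (d ℤ.+ tt' j σ) a b b' ω * YY (d ℤ.+ tt' j σ') a b b' ω })))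
               (E-cong (DS r) (λ σ → E-cong (DS r) (λ σ' → red d (d ℤ.+ tt' j σ) (d ℤ.+ tt' j σ'))))))))
        where
        l1 : ∀ a b D k → ℤ.- a ℤ.+ (b ℤ.+ a ℤ.+ (ℤ.+ 2 ℤ.* k ℤ.* D ℤ.+ k ℤ.* k)) ≡ b ℤ.+ ℤ.0ℤ ℤ.+ (ℤ.+ 2 ℤ.* k ℤ.* D ℤ.+ k ℤ.* k)
        l1 = ℤS.solve-∀
        l2 : ∀ a b D → ℤ.- a ℤ.+ (b ℤ.+ a ℤ.- D ℤ.* D) ≡ b ℤ.+ ℤ.0ℤ ℤ.- D ℤ.* D
        l2 = ℤS.solve-∀
        shY : ∀ D a b b' ω → YY D a b b' (ω ⊕ ℤ.- a) ≡ YY D ℤ.0ℤ b b' ω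
        shY D a b b' ω = cong₂ _*_ (sh g₂ ω _ _ (l1 a b D k)) (sh X ω _ _ (l2 a b' D))
        -- After Cauchy-Schwarz a' has disappeared, and a common translation by -a removes a as
        -- well.
        red : ∀ d D D' → E μ₁ (λ a → E μ₁ (λ a' → E μ₂ (λ b → E μ₂ (λ b' → E mΩ (λ ω → YY D a b b' ω * YY D' a b b' ω))))) ≡ R0 d D D'
        red d D D' = trans (E-cong μ₁ (λ a → trans (E-const μ₁ _) (E-cong μ₂ (λ b → E-cong μ₂ (λ b' →
            trans (sym (inv (ℤ.- a) _)) (E-cong mΩ (λ ω → cong₂ _*_ (shY D a b b' ω) (shY D' a b b' ω)))))))) (E-const μ₁ _)

      ζ : ℤ → ℤ → ℤ → ℤ → ℤ → ℤ → Fn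
      ζ d D D' b b' w ω = g₂ (ω ⊕ (b ℤ.+ k ℤ.* k ℤ.- w)) * g₂ (ω ⊕ (b ℤ.+ k ℤ.* k ℤ.- w ℤ.+ ℤ.+ 2 ℤ.* k ℤ.* (D' ℤ.- D))) * X ω

      R3 : ℤ → ℤ → ℤ → ℚ
      R3 d D D' = E μ₂ (λ b → E μ₂ (λ b' → E mΩ (λ ω → ζ d D D' b b' (b' ℤ.- d ℤ.* d ℤ.- ℤ.+ 2 ℤ.* k ℤ.* d) ω * X (ω ⊕ ℤ.- (D' ℤ.* D' ℤ.- D ℤ.* D)))))

      -- b absorbs 2k(D - d) and b' absorbs D² - d². Afterwards D and D' enter only through D' - D
      -- and D'² - D².
      near-R : ∀ d D D' → Abs μ₂ (ℤ.+ 2 ℤ.* k ℤ.* (D ℤ.- d)) κ → Abs μ₂ (D ℤ.* D ℤ.- d ℤ.* d) κ → Near (R0 d D D') (R3 d D D') (κ + κ)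
      near-R d D D' abk abδ = near-trans s1 s2
        where
        u : ℤ → ℤ → ℚ
        u x y = E mΩ (λ ω → g₂ (ω ⊕ x) * g₂ (ω ⊕ (x ℤ.+ ℤ.+ 2 ℤ.* k ℤ.* (D' ℤ.- D))) * (X (ω ⊕ y) * X (ω ⊕ (y ℤ.- (D' ℤ.* D' ℤ.- D ℤ.* D)))))
        bdu : ∀ x y → Bd (u x y)
        bdu x y = E-bd mΩ (λ ω → bd* (bd* (b₂ _) (b₂ _)) (bd* (bX _) (bX _)))
        R1 : ℚ
        R1 = E μ₂ (λ b → E μ₂ (λ b' → u (b ℤ.+ k ℤ.* k) (b' ℤ.- D ℤ.* D ℤ.- ℤ.+ 2 ℤ.* k ℤ.* d)))
        sA : ∀ b b' → E mΩ (λ ω → YY D ℤ.0ℤ b b' ω * YY D' ℤ.0ℤ b b' ω) ≡ u (b ℤ.+ ℤ.+ 2 ℤ.* k ℤ.* (D ℤ.- d) ℤ.+ k ℤ.* k) (b' ℤ.- D ℤ.* D ℤ.- ℤ.+ 2 ℤ.* k ℤ.* d)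
        sA b b' = trans (sym (inv (ℤ.- (ℤ.+ 2 ℤ.* k ℤ.* d)) _)) (E-cong mΩ (λ ω → trans
            (cong₂ _*_ (cong₂ _*_ (sh g₂ ω _ _ (l1 b k d D)) (sh X ω _ _ (l2 b' k d D))) (cong₂ _*_ (sh g₂ ω _ _ (l3 b k d D D')) (sh X ω _ _ (l4 b' k d D D'))))
            (l (g₂ _) (X _) (g₂ _) (X _))))
          where
          l : ∀ a b c d → a * b * (c * d) ≡ a * c * (b * d)
          l = solve-∀ ℚR
          l1 : ∀ b k d D → ℤ.- (ℤ.+ 2 ℤ.* k ℤ.* d) ℤ.+ (b ℤ.+ ℤ.0ℤ ℤ.+ (ℤ.+ 2 ℤ.* k ℤ.* D ℤ.+ k ℤ.* k)) ≡ b ℤ.+ ℤ.+ 2 ℤ.* k ℤ.* (D ℤ.- d) ℤ.+ k ℤ.* k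
          l1 = ℤS.solve-∀
          l2 : ∀ b k d D → ℤ.- (ℤ.+ 2 ℤ.* k ℤ.* d) ℤ.+ (b ℤ.+ ℤ.0ℤ ℤ.- D ℤ.* D) ≡ b ℤ.- D ℤ.* D ℤ.- ℤ.+ 2 ℤ.* k ℤ.* d
          l2 = ℤS.solve-∀
          l3 : ∀ b k d D D' → ℤ.- (ℤ.+ 2 ℤ.* k ℤ.* d) ℤ.+ (b ℤ.+ ℤ.0ℤ ℤ.+ (ℤ.+ 2 ℤ.* k ℤ.* D' ℤ.+ k ℤ.* k)) ≡ b ℤ.+ ℤ.+ 2 ℤ.* k ℤ.* (D ℤ.- d) ℤ.+ k ℤ.* k ℤ.+ ℤ.+ 2 ℤ.* k ℤ.* (D' ℤ.- D)
          l3 = ℤS.solve-∀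
          l4 : ∀ b k d D D' → ℤ.- (ℤ.+ 2 ℤ.* k ℤ.* d) ℤ.+ (b ℤ.+ ℤ.0ℤ ℤ.- D' ℤ.* D') ≡ b ℤ.- D ℤ.* D ℤ.- ℤ.+ 2 ℤ.* k ℤ.* d ℤ.- (D' ℤ.* D' ℤ.- D ℤ.* D)
          l4 = ℤS.solve-∀
        s1 : Near (R0 d D D') R1 κ
        s1 = near-≡ (E-cong μ₂ (λ b → E-cong μ₂ (λ b' → sym (sA b b')))) refl
               (ab abk (λ x → E μ₂ (λ b' → u (x ℤ.+ k ℤ.* k) (b' ℤ.- D ℤ.* D ℤ.- ℤ.+ 2 ℤ.* k ℤ.* d))) (λ x → E-bd μ₂ (λ b' → bdu _ _)))
        sB : ∀ b b' → E mΩ (λ ω → ζ d D D' b b' (b' ℤ.- d ℤ.* d ℤ.- ℤ.+ 2 ℤ.* k ℤ.* d) ω * X (ω ⊕ ℤ.- (D' ℤ.* D' ℤ.- D ℤ.* D))) ≡ u (b ℤ.+ k ℤ.* k) (b' ℤ.- d ℤ.* d ℤ.- ℤ.+ 2 ℤ.* k ℤ.* d)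
        sB b b' = trans (sym (inv w _)) (E-cong mΩ (λ ω → trans
            (cong₂ _*_ (cong (_* X (ω ⊕ w)) (cong₂ _*_ (sh g₂ ω _ _ (l1 b k w)) (sh g₂ ω _ _ (l2 b k w (ℤ.+ 2 ℤ.* k ℤ.* (D' ℤ.- D)))))) (sh X ω w _ refl)) (l (g₂ _) (g₂ _) (X _) (X _))))
          where
          w = b' ℤ.- d ℤ.* d ℤ.- ℤ.+ 2 ℤ.* k ℤ.* d
          l : ∀ a b c d → a * b * c * d ≡ a * b * (c * d)
          l = solve-∀ ℚR
          l1 : ∀ b k w → w ℤ.+ (b ℤ.+ k ℤ.* k ℤ.- w) ≡ b ℤ.+ k ℤ.* k
          l1 = ℤS.solve-∀
          l2 : ∀ b k w z → w ℤ.+ (b ℤ.+ k ℤ.* k ℤ.- w ℤ.+ z) ≡ b ℤ.+ k ℤ.* k ℤ.+ z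
          l2 = ℤS.solve-∀
        s2 : Near R1 (R3 d D D') κ
        s2 = near-sym (near-≡ (E-cong μ₂ (λ b → trans (E-cong μ₂ (λ b' → cong (u (b ℤ.+ k ℤ.* k)) (l b' (D ℤ.* D) (d ℤ.* d) (ℤ.+ 2 ℤ.* k ℤ.* d)))) (sym (E-cong μ₂ (λ b' → sB b b'))))) refl
               (E-near μ₂ (λ b → ab abδ (λ x → u (b ℤ.+ k ℤ.* k) (x ℤ.- D ℤ.* D ℤ.- ℤ.+ 2 ℤ.* k ℤ.* d)) (λ x → bdu _ _))))
          where
          l : ∀ x D d w → x ℤ.+ (D ℤ.- d) ℤ.- D ℤ.- w ≡ x ℤ.- d ℤ.- w
          l = ℤS.solve-∀

      RR : ℚ
      RR = E JM (λ j → E (DS r) (λ σ → E I (λ d → E (DS r) (λ σ' → R3 d (d ℤ.+ tt' j σ) (d ℤ.+ tt' j σ')))))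

      Sh²' : sq Sh ≤ RR + (κ + κ)
      Sh²' = Sh² ≤⟨⟩ ≡≤ (E-cong JM (λ j → E-swap I (DS r) _)) ≤⟨⟩
        proj₁ (E-nearS JM (supp-map JM (λ j (p , p') → E-nearS (DS r) (supp-map (DS r) (λ σ (p , p') → E-nearS I (supp-map I (λ d p' → E-near (DS r) (λ σ' →
           near-R d (d ℤ.+ tt' j σ) (d ℤ.+ tt' j σ') (subst (λ z → Abs μ₂ (ℤ.+ 2 ℤ.* k ℤ.* z) κ) (sym (l d (tt' j σ))) p) p')) p')) (supp-× (DS r) p p'))) (supp-× JM absk absδ₂)))
        where
        l : ∀ d t → d ℤ.+ t ℤ.- d ≡ t
        l = ℤS.solve-∀

      τ : ℤ² → ℤ
      τ e = ℤ.+ 2 ℤ.* q ℤ.* q ℤ.* val B e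

      -- As a function of j, the shift of X is affine with slope 2q² times the value of a digit
      -- difference. Averaging over j is therefore averaging X along `τ`, and all other factors are
      -- bounded and free of j.
      RR² : sq RR ≤ E (DD r) (λ e → N (dir1 (τ e) J) X)
      RR² = ≡≤ (cong sq (trans (E-swap JM (DS r) _) (E-cong (DS r) (λ σ → trans (E-swap JM I _) (E-cong I (λ d → E-swap JM (DS r) _)))))) ≤⟨⟩
        jensen (DS r) _ ≤⟨⟩ E-mono (DS r) (λ σ → jensen I _ ≤⟨⟩ E-≤c I (λ d → jensen (DS r) _ ≤⟨⟩ E-mono (DS r) (λ σ' → pt d σ σ'))) ≤⟨⟩
        ≡≤ (trans (E-swap (DS r) (DS r) _) (sym (E-DD r _)))
        where
        pt : ∀ d σ σ' → sq (E JM (λ j → R3 d (d ℤ.+ tt' j σ) (d ℤ.+ tt' j σ'))) ≤ N (dir1 (τ (σ ⊝ σ')) J) X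
        pt d σ σ' = ≡≤ (cong sq (trans (sym (swap3 μ₂ μ₂ JM _)) (E-cong μ₂ (λ b → E-cong μ₂ (λ b' → trans (E-swap JM mΩ _) (E-cong mΩ (λ ω →
              trans (E-cong JM (λ j → cong₂ _*_ (cong (λ z → g₂ (ω ⊕ (b ℤ.+ k ℤ.* k ℤ.- (b' ℤ.- d ℤ.* d ℤ.- ℤ.+ 2 ℤ.* k ℤ.* d))) * g₂ (ω ⊕ (b ℤ.+ k ℤ.* k ℤ.- (b' ℤ.- d ℤ.* d ℤ.- ℤ.+ 2 ℤ.* k ℤ.* d) ℤ.+ ℤ.+ 2 ℤ.* k ℤ.* z)) * X ω) (l1 d q j (val B σ) (val B σ'))) (cong (λ z → X (ω ⊕ z)) (l2 d q j (ℤ.+ B) (proj₁ σ) (proj₂ σ) (proj₁ σ') (proj₂ σ')))))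
                (E-* JM (ζ0 b b' ω) _)))))))) ≤⟨⟩
          jensen μ₂ _ ≤⟨⟩ E-≤c μ₂ (λ b → jensen μ₂ _ ≤⟨⟩ E-≤c μ₂ (λ b' → kill mΩ (ζ0 b b') (λ ω → E JM (λ j → X (ω ⊕ (c0 ℤ.+ τ (σ ⊝ σ') ℤ.* j)))) (λ ω → bd* (bd* (b₂ _) (b₂ _)) (bX _)) ≤⟨⟩
            ≡≤ (trans (E-cong mΩ (λ ω → cong sq (E-cong JM (λ j → sym (sh X ω c0 (τ (σ ⊝ σ') ℤ.* j) refl))))) (inv c0 (λ ω → sq (P (dir1 (τ (σ ⊝ σ')) J) X ω)))))) 
          where
          c0 : ℤ
          c0 = q ℤ.* (val B σ ℤ.- val B σ') ℤ.* (ℤ.+ 2 ℤ.* d ℤ.+ q ℤ.* (val B σ ℤ.+ val B σ'))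
          ζ0 : ℤ → ℤ → Fn
          ζ0 b b' ω = let w = b' ℤ.- d ℤ.* d ℤ.- ℤ.+ 2 ℤ.* k ℤ.* d in
            g₂ (ω ⊕ (b ℤ.+ k ℤ.* k ℤ.- w)) * g₂ (ω ⊕ (b ℤ.+ k ℤ.* k ℤ.- w ℤ.+ ℤ.+ 2 ℤ.* k ℤ.* (q ℤ.* (val B σ' ℤ.- val B σ)))) * X ω
          l1 : ∀ d q j s s' → d ℤ.+ q ℤ.* (j ℤ.+ s') ℤ.- (d ℤ.+ q ℤ.* (j ℤ.+ s)) ≡ q ℤ.* (s' ℤ.- s)
          l1 = ℤS.solve-∀
          l2 : ∀ d q j B s₁ s₂ t₁ t₂ →
            ℤ.- ((d ℤ.+ q ℤ.* (j ℤ.+ (B ℤ.* t₁ ℤ.+ t₂))) ℤ.* (d ℤ.+ q ℤ.* (j ℤ.+ (B ℤ.* t₁ ℤ.+ t₂))) ℤ.- (d ℤ.+ q ℤ.* (j ℤ.+ (B ℤ.* s₁ ℤ.+ s₂))) ℤ.* (d ℤ.+ q ℤ.* (j ℤ.+ (B ℤ.* s₁ ℤ.+ s₂))))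
            ≡ q ℤ.* ((B ℤ.* s₁ ℤ.+ s₂) ℤ.- (B ℤ.* t₁ ℤ.+ t₂)) ℤ.* (ℤ.+ 2 ℤ.* d ℤ.+ q ℤ.* ((B ℤ.* s₁ ℤ.+ s₂) ℤ.+ (B ℤ.* t₁ ℤ.+ t₂))) ℤ.+ ℤ.+ 2 ℤ.* q ℤ.* q ℤ.* (B ℤ.* (s₁ ℤ.- t₁) ℤ.+ (s₂ ℤ.- t₂)) ℤ.* j
          l2 = ℤS.solve-∀

      bdSh : Bd Sh
      bdSh = E-bd JM (λ j → E-bd (DS r) (λ σ → E-bd I (λ d → bdE4 (λ a a' b b' ω → bb d a a' b b' ω * YY (d ℤ.+ tt' j σ) a b b' ω) (λ a a' b b' ω → bd* (bd* (b₁ _) (bd* (bX _) (bX _))) (bdYY _ a b b' ω)))))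

      S0≤ : pw 2 S0 ≤ ι (kE 6) * (E (DD r) (λ e → N (dir1 (τ e) J) X) + κ)
      S0≤ = two-step 6 {S0} {RR} (0≤rec r) (rec≤1 r) (E-≥c (DD r) (λ e → N-nn (dir1 (τ e) J) X))
        -- 6κ is 2·2κ from squaring the approximation by `Sh` plus 2κ from `near-R`.
        (near-sq (E-bd I bdh) bdSh near1 ≤⟨⟩ +r (2ℚ * (κ + κ)) Sh²' ≤⟨⟩ ≡≤ (l RR κ)) RR²
        where l : ∀ R κ → R + (κ + κ) + 2ℚ * (κ + κ) ≡ R + ι 6 * κ
              l = solve-∀ ℚR
open LoweringStep

-- Degree lowering inside box norms, and a von Neumann inequality for linear forms.

module DegreeLowering where
  pw-nn' : ∀ n x → 0ℚ ≤ pw (suc n) x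
  pw-nn' n x = pw-nn n (nn-sq x) ≤⟨⟩ ≡≤ (sym (pw-suc n x))

  -- Even powers are monotone only on nonnegative numbers. For n = 0 the left side may be negative,
  -- hence the equality demanded in that case.
  pw-mono-eq : ∀ m n {x y} → (n ≡ 0 → x ≡ y) → pw n x ≤ y → pw (suc m) (pw n x) ≤ pw (suc m) y
  pw-mono-eq m zero {x} h p = ≡≤ (cong (pw (suc m)) (trans (pw-0 x) (h refl)))
  pw-mono-eq m (suc n) {x} h p = pw-mono (suc m) (pw-nn' n x) p

  kL : ℕ
  kL = trK 2 (kE 6) kC

  module Lowering (S : Sys) where
    open Sys S
    open Dyn S
    open Concat S
    open Lower S

    V-cong : ∀ μs {F F' : Fn} X → (∀ ω → F ω ≡ F' ω) → V μs F X ≡ V μs F' X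
    V-cong [] X e = E-cong mΩ e
    V-cong (μ ∷ μs) X e = E-cong μ (λ c → E-cong μ (λ c' → V-cong μs (Δ c c' X) (λ ω → cong (_* X (ω ⊕ c')) (e (ω ⊕ c)))))

    V-E : {A : Set} (ν : Mean A) → ∀ μs (F : A → Fn) X → V μs (λ ω → E ν (λ a → F a ω)) X ≡ E ν (λ a → V μs (F a) X)
    V-E ν [] F X = E-swap mΩ ν _
    V-E ν (μ ∷ μs) F X = trans (E-cong μ (λ c → E-cong μ (λ c' → trans (V-cong μs (Δ c c' X) (λ ω → sym (E-*ʳ ν (X (ω ⊕ c')) (λ a → F a (ω ⊕ c)))))
        (V-E ν μs (λ a ω → F a (ω ⊕ c) * X (ω ⊕ c')) (Δ c c' X))))) (swap3 μ μ ν _)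

    V-* : ∀ s μs F X → V μs (λ ω → s * F ω) X ≡ s * V μs F X
    V-* s [] F X = E-* mΩ s F
    V-* s (μ ∷ μs) F X = trans (E-cong μ (λ c → trans (E-cong μ (λ c' → trans (V-cong μs (Δ c c' X) (λ ω → ℚP.*-assoc s (F (ω ⊕ c)) (X (ω ⊕ c')))) (V-* s μs _ (Δ c c' X)))) (E-* μ s _))) (E-* μ s _)

    V-U : ∀ μs X → V μs X X ≡ U μs X
    V-U [] X = refl
    V-U (μ ∷ μs) X = E-cong μ (λ c → E-cong μ (λ c' → V-U μs (Δ c c' X)))

    module _ (r m : ℕ) (k q : ℤ) (b J ℓ : ℕ) (μ₁ μ₂ : Mean ℤ) (μs : List (Mean ℤ)) (g₁ g₂ X : Fn)
             (b₁ : BdF g₁) (b₂ : BdF g₂) (bX : BdF X) (hyp : Absorbing r m k q (suc b) J μ₁ μ₂)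
             (cond : Cond r b J) (ℓB : suc ℓ ℕ.≤ suc b ℕ.* suc b) where
      private
        B = suc b
        n = length μs
        CM = cubeM μs
        κ = rec r
        I = Iv m
        F = dual m k g₁ g₂
        v = V (μ₁ ∷ μ₂ ∷ μs) F X
        module Kγ (γ : List (ℤ × ℤ)) = K0 r m k q B J μ₁ μ₂ (cube γ g₁) (cube γ g₂) (cube γ X) (cube-bd γ b₁) (cube-bd γ b₂) (cube-bd γ bX) hyp

        G : ℤ → Fn
        G d ω = g₁ (ω ⊕ d ℤ.* d) * g₂ (ω ⊕ (d ℤ.+ k) ℤ.* (d ℤ.+ k))

        top : ℤ → ℤ → ℤ → ℤ → ℤ → Fn
        top a a' b b' d ω = (G d ((ω ⊕ b) ⊕ a) * X ((ω ⊕ b) ⊕ a')) * Δ a a' X (ω ⊕ b')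

        Wt : ℚ
        Wt = E μ₁ (λ a → E μ₁ (λ a' → E μ₂ (λ b → E μ₂ (λ b' → E I (λ d → U μs (top a a' b b' d))))))

        v≡ : v ≡ E μ₁ (λ a → E μ₁ (λ a' → E μ₂ (λ b → E μ₂ (λ b' → E I (λ d → V μs (top a a' b b' d) (Δ b b' (Δ a a' X)))))))
        v≡ = E-cong μ₁ (λ a → E-cong μ₁ (λ a' → E-cong μ₂ (λ b → E-cong μ₂ (λ b' → trans
          (V-cong μs (Δ b b' (Δ a a' X)) (λ ω → trans (cong (_* Δ a a' X (ω ⊕ b')) (sym (E-*ʳ I (X ((ω ⊕ b) ⊕ a')) (λ d → G d ((ω ⊕ b) ⊕ a))))) (sym (E-*ʳ I (Δ a a' X (ω ⊕ b')) (λ d → G d ((ω ⊕ b) ⊕ a) * X ((ω ⊕ b) ⊕ a'))))))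
          (V-E I μs (top a a' b b') (Δ b b' (Δ a a' X)))))))

        v≤Wt : pw n v ≤ Wt
        v≤Wt = ≡≤ (cong (pw n) v≡) ≤⟨⟩ pw-jensen n μ₁ _ ≤⟨⟩ E-mono μ₁ (λ a → pw-jensen n μ₁ _ ≤⟨⟩ E-mono μ₁ (λ a' → pw-jensen n μ₂ _ ≤⟨⟩ E-mono μ₂ (λ b → pw-jensen n μ₂ _ ≤⟨⟩
          E-mono μ₂ (λ b' → pw-jensen n I _ ≤⟨⟩ E-mono I (λ d → gcs μs (top a a' b b' d) (Δ b b' (Δ a a' X)) (bdΔ b b' (bdΔ a a' bX)))))))

        v≡Wt : n ≡ 0 → v ≡ Wt
        v≡Wt e = trans v≡ (E-cong μ₁ (λ a → E-cong μ₁ (λ a' → E-cong μ₂ (λ b → E-cong μ₂ (λ b' → E-cong I (λ d → nil μs e (top a a' b b' d) _))))))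
          where
          nil : ∀ μs → length μs ≡ 0 → ∀ F X → V μs F X ≡ U μs F
          nil [] e F X = refl

        cube-top : ∀ γ a a' b b' d ω → cube γ (top a a' b b' d) ω ≡ Kγ.top γ d a a' b b' ω
        cube-top γ a a' b b' d ω = trans (cube-cong γ (λ ω → cong₂ _*_ (cong₂ _*_ (cong₂ _*_ (e3 g₁ ω b a (d ℤ.* d)) (e3 g₂ ω b a ((d ℤ.+ k) ℤ.* (d ℤ.+ k)))) (⊕-X ω b a')) (cong₂ _*_ (⊕-X ω b' a) (⊕-X ω b' a'))) ω)
          (trans (cube-* γ _ _ ω) (cong₂ _*_ (trans (cube-* γ _ _ ω) (cong₂ _*_ (trans (cube-* γ _ _ ω) (cong₂ _*_ (cube-↑ γ g₁ _ ω) (cube-↑ γ g₂ _ ω))) (cube-↑ γ X _ ω)))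
             (trans (cube-* γ _ _ ω) (cong₂ _*_ (cube-↑ γ X _ ω) (cube-↑ γ X _ ω)))))
          where
          ⊕-X : ∀ ω b a → X ((ω ⊕ b) ⊕ a) ≡ X (ω ⊕ (b ℤ.+ a))
          ⊕-X ω b a = sh X ω b a refl
          e3 : ∀ (g : Fn) ω b a x → g (((ω ⊕ b) ⊕ a) ⊕ x) ≡ g (ω ⊕ (b ℤ.+ a ℤ.+ x))
          e3 g ω b a x = trans (cong (λ z → g (z ⊕ x)) (⊕-⊕ ω b a)) (sh g ω _ x refl)

        Wt≡ : Wt ≡ E CM Kγ.S0
        Wt≡ = trans (E-cong μ₁ (λ a → E-cong μ₁ (λ a' → E-cong μ₂ (λ b → E-cong μ₂ (λ b' → E-cong I (λ d → trans (U-cube μs (top a a' b b' d)) (E-cong CM (λ γ → E-cong mΩ (cube-top γ a a' b b' d)))))))))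
          (trans (E-cong μ₁ (λ a → trans (E-cong μ₁ (λ a' → trans (E-cong μ₂ (λ b → trans (E-cong μ₂ (λ b' → E-swap I CM _)) (E-swap μ₂ CM _))) (E-swap μ₂ CM _))) (E-swap μ₁ CM _)))
          (trans (E-swap μ₁ CM _) (E-cong CM (λ γ → trans (E-cong μ₁ (λ a → trans (E-cong μ₁ (λ a' → trans (E-cong μ₂ (λ b → E-swap μ₂ I _)) (E-swap μ₂ I _))) (E-swap μ₁ I _))) (E-swap μ₁ I _)))))

        Z : Mean ℤ
        Z = dir1 (ℤ.+ 2 ℤ.* q ℤ.* q ℤ.* ℤ.+ Qr r) ℓ

        Nτ : Fn → ℚ
        Nτ H = E (DD r) (λ e → N (dir1 (ℤ.+ 2 ℤ.* q ℤ.* q ℤ.* val B e) J) H)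

        y : ℚ
        y = E CM (λ γ → Nτ (cube γ X))

      -- The directions `μs` are frozen into a cube γ by Gowers-Cauchy-Schwarz. For each γ the
      -- directions `μ₁` and `μ₂` are traded for a random one, and `concat` turns that into the
      -- fixed direction `Z`, so the number of directions drops by one.
      lower : pw 2 (pw 2 (pw n v)) ≤ ι kL * (U (Z ∷ μs) X + κ)
      lower = le-trans (0≤rec r) (rec≤1 r) 2 {kE 6} {kC} {pw 2 (pw n v)} {y} {U (Z ∷ μs) X} (pw-nn' 1 (pw n v)) (U-nn Z μs X) s1 s2
        where
        s1 : pw 2 (pw n v) ≤ ι (kE 6) * (y + κ)
        s1 = pw-mono-eq 1 n v≡Wt v≤Wt ≤⟨⟩ ≡≤ (cong (pw 2) Wt≡) ≤⟨⟩ pw-jensen 2 CM Kγ.S0 ≤⟨⟩ E-mono CM (λ γ → Kγ.S0≤ γ) ≤⟨⟩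
          ≡≤ (trans (E-* CM (ι (kE 6)) _) (cong (ι (kE 6) *_) (trans (E-+ CM _ _) (cong (y +_) (E-const CM κ)))))
        s2 : pw 2 y ≤ ι kC * (U (Z ∷ μs) X + κ)
        s2 = pw-jensen 2 CM _ ≤⟨⟩ E-mono CM (λ γ → concat r b J (ℤ.+ 2 ℤ.* q ℤ.* q) ℓ (cube-bd γ bX) cond ℓB) ≤⟨⟩
          ≡≤ (trans (E-* CM (ι kC) _) (cong (ι kC *_) (trans (E-+ CM _ _) (cong₂ _+_ (sym (U-N Z μs X)) (E-const CM κ)))))

  gK : ℕ → ℕ
  gK zero = 1
  gK (suc n) = trK n 4 (gK n)

  module GvN (S : Sys) where
    open Sys S
    open Dyn S

    Form : Set
    Form = Fn × ℤ²

    infix 8 _·_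
    _·_ : ℤ² → ℤ² → ℤ
    (a , b) · (c , d) = a ℤ.* c ℤ.+ b ℤ.* d

    infixl 6 _⊹_
    _⊹_ : ℤ² → ℤ² → ℤ²
    (a , b) ⊹ (c , d) = (a ℤ.+ c , b ℤ.+ d)

    body : List Form → Fn → ℤ² → ℤ² → Fn
    body [] X l d ω = X (ω ⊕ l · d)
    body ((f , l') ∷ fs) X l d ω = f (ω ⊕ l' · d) * body fs X l d ω

    sub : ℤ² → List Form → List Form
    sub l [] = []
    sub l ((f , l') ∷ fs) = (f , l' ⊝ l) ∷ sub l fs

    der : ℤ² → ℤ² → List Form → List Form
    der s t [] = []
    der s t ((f , l) ∷ fs) = (Δ (l · s) (l · t) f , l) ∷ der s t fs

    BdFs : List Form → Set
    BdFs [] = ⊤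
    BdFs ((f , l) ∷ fs) = BdF f × BdFs fs

    dirs : ℕ → ℤ² → List Form → List (Mean ℤ)
    dirs L l [] = []
    dirs L l ((f , l') ∷ fs) = dirV (proj₁ (l ⊝ l')) (proj₂ (l ⊝ l')) L ∷ dirs L l fs

    body-sub : ∀ fs X l l₁ d ω → body fs X l d (ω ⊕ ℤ.- (l₁ · d)) ≡ body (sub l₁ fs) X (l ⊝ l₁) d ω
    body-sub [] X l l₁ d ω = sh X ω _ _ (e (proj₁ l) (proj₂ l) (proj₁ l₁) (proj₂ l₁) (proj₁ d) (proj₂ d))
      where e : ∀ a b a' b' c d → ℤ.- (a' ℤ.* c ℤ.+ b' ℤ.* d) ℤ.+ (a ℤ.* c ℤ.+ b ℤ.* d) ≡ (a ℤ.- a') ℤ.* c ℤ.+ (b ℤ.- b') ℤ.* d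
            e = ℤS.solve-∀
    body-sub ((f , l') ∷ fs) X l l₁ d ω = cong₂ _*_ (body-sub [] f l' l₁ d ω) (body-sub fs X l l₁ d ω)

    body-der : ∀ fs X l d s t ω → body fs X l (d ⊹ s) ω * body fs X l (d ⊹ t) ω ≡ body (der s t fs) (Δ (l · s) (l · t) X) l d ω
    body-der [] X l d s t ω = sym (cong₂ _*_ (sh X ω _ _ (e (proj₁ l) (proj₂ l) (proj₁ d) (proj₂ d) (proj₁ s) (proj₂ s))) (sh X ω _ _ (e (proj₁ l) (proj₂ l) (proj₁ d) (proj₂ d) (proj₁ t) (proj₂ t))))
      where e : ∀ a b c d s t → a ℤ.* c ℤ.+ b ℤ.* d ℤ.+ (a ℤ.* s ℤ.+ b ℤ.* t) ≡ a ℤ.* (c ℤ.+ s) ℤ.+ b ℤ.* (d ℤ.+ t)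
            e = ℤS.solve-∀
    body-der ((f , l') ∷ fs) X l d s t ω = trans (e (f (ω ⊕ l' · (d ⊹ s))) (body fs X l (d ⊹ s) ω) (f (ω ⊕ l' · (d ⊹ t))) (body fs X l (d ⊹ t) ω))
        (cong₂ _*_ (body-der [] f l' d s t ω) (body-der fs X l d s t ω))
      where e : ∀ a b c d → a * b * (c * d) ≡ a * c * (b * d)
            e = solve-∀ ℚR

    bd-body : ∀ fs {X} l d → BdF X → BdFs fs → BdF (body fs X l d)
    bd-body [] l d bX _ ω = bX _
    bd-body ((f , l') ∷ fs) l d bX (bf , bfs) ω = bd* (bf _) (bd-body fs l d bX bfs ω)

    bd-sub : ∀ l fs → BdFs fs → BdFs (sub l fs)
    bd-sub l [] b = tt
    bd-sub l ((f , l') ∷ fs) (b , bs) = b , bd-sub l fs bs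

    bd-der : ∀ s t fs → BdFs fs → BdFs (der s t fs)
    bd-der s t [] b = tt
    bd-der s t ((f , l') ∷ fs) (b , bs) = bdΔ _ _ b , bd-der s t fs bs

    len-der : ∀ s t l fs → length (der s t (sub l fs)) ≡ length fs
    len-der s t l [] = refl
    len-der s t l (f ∷ fs) = cong suc (len-der s t l fs)

    -- Subtracting one form from all the others leaves their differences unchanged, so the
    -- directions survive the induction in `gvn`.
    dirs-der : ∀ L s t l l₁ fs → dirs L (l ⊝ l₁) (der s t (sub l₁ fs)) ≡ dirs L l fs
    dirs-der L s t l l₁ [] = refl
    dirs-der L s t l l₁ ((f , l') ∷ fs) = cong₂ _∷_ (cong₂ (λ x y → dirV x y L) (e (proj₁ l) (proj₁ l₁) (proj₁ l')) (e (proj₂ l) (proj₂ l₁) (proj₂ l'))) (dirs-der L s t l l₁ fs)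
      where e : ∀ a b c → (a ℤ.- b) ℤ.- (c ℤ.- b) ≡ a ℤ.- c
            e = ℤS.solve-∀

    module _ (r m L : ℕ) (absL : Supp (Iv L) (λ x → Abs (Iv m) x (rec r))) where
      private
        κ = rec r
        I = Iv m
        T = Iv L

      I² : Mean ℤ²
      I² = bind I (λ d → bind I (λ d' → pure (d , d')))

      T² : Mean ℤ²
      T² = bind T (λ d → bind T (λ d' → pure (d , d')))

      Θ : List Form → Fn → ℤ² → ℚ
      Θ fs X l = E I² (λ d → E mΩ (body fs X l d))

      avg2 : ∀ (h : ℤ² → ℚ) → (∀ d → Bd (h d)) → Near (E I² h) (E T² (λ s → E I² (λ d → h (d ⊹ s)))) (κ + κ)
      avg2 h bh = near-trans
        (avgAbs I T id (λ d → E I (λ d' → h (d , d'))) (λ d → E-bd I (λ d' → bh _)) absL)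
        (E-near T (λ s → near-≡ refl (E-swap I T _) (E-near I (λ d → avgAbs I T id (λ d' → h (d ℤ.+ s , d')) (λ d' → bh _) absL))))

      -- Translating by -l₁·d makes f independent of d, so it can be discarded. Duplicating the
      -- random shift differentiates every other function, and X by the two values of l - l₁ on the
      -- shifts: each discarded form leaves one direction in the box norm of X.
      gvn : ∀ n fs → length fs ≡ n → ∀ X l → BdF X → BdFs fs → pw n (Θ fs X l) ≤ ι (gK n) * (U (dirs L l fs) X + κ)
      gvn zero [] _ X l bX _ = ≡≤ (trans (pw-0 _) (trans (E-cong I (λ d → trans (E-cong I (λ d' → inv (l · (d , d')) X)) (E-const I _))) (E-const I _))) ≤⟨⟩
        by (0≤rec r) (e (E mΩ X) κ)
        where e : ∀ x κ → (1ℚ + 0ℚ) * (x + κ) ≡ x + κ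
              e = solve-∀ ℚR
      gvn (suc n) ((f , l₁) ∷ fs) len X l bX (bf , bfs) =
        ≡≤ (pw-suc n θ) ≤⟨⟩ le-trans (0≤rec r) (rec≤1 r) n {4} {gK n} {sq θ} {Y} {U (dirs L l ((f , l₁) ∷ fs)) X} (nn-sq θ) (U-nn (dirV (proj₁ (l ⊝ l₁)) (proj₂ (l ⊝ l₁)) L) (dirs L l fs) X) s1 s2
        where
        θ = Θ ((f , l₁) ∷ fs) X l
        fs' = sub l₁ fs
        l' = l ⊝ l₁
        ψ : ℤ² → Fn
        ψ d ω = body fs' X l' d ω
        bdψ : ∀ d → BdF (ψ d)
        bdψ d = bd-body fs' l' d bX (bd-sub l₁ fs bfs)
        h : ℤ² → ℚ
        h d = E mΩ (λ ω → f ω * ψ d ω)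
        bdh : ∀ d → Bd (h d)
        bdh d = E-bd mΩ (λ ω → bd* (bf ω) (bdψ d ω))
        θ≡ : θ ≡ E I² h
        θ≡ = E-cong I² (λ d → trans (sym (inv (ℤ.- (l₁ · d)) _)) (E-cong mΩ (λ ω → cong₂ _*_ (trans (sh f ω _ _ (ℤP.+-inverseˡ (l₁ · d))) (cong f (⊕-0 ω))) (body-sub fs X l l₁ d ω))))
        θ~ = E T² (λ s → E I² (λ d → h (d ⊹ s)))
        θ~≡ : θ~ ≡ E I² (λ d → E mΩ (λ ω → f ω * E T² (λ s → ψ (d ⊹ s) ω)))
        θ~≡ = trans (E-swap T² I² (λ s d → h (d ⊹ s))) (E-cong I² (λ d → trans (E-swap T² mΩ (λ s ω → f ω * ψ (d ⊹ s) ω)) (E-cong mΩ (λ ω → E-* T² (f ω) (λ s → ψ (d ⊹ s) ω)))))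
        Y : ℚ
        Y = E T² (λ s → E T² (λ t → Θ (der s t fs') (Δ (l' · s) (l' · t) X) l'))
        θ~² : sq θ~ ≤ Y
        θ~² = ≡≤ (cong sq θ~≡) ≤⟨⟩ jensen I² (λ d → E mΩ (λ ω → f ω * E T² (λ s → ψ (d ⊹ s) ω))) ≤⟨⟩
          E-mono I² (λ d → kill mΩ f (λ ω → E T² (λ s → ψ (d ⊹ s) ω)) bf) ≤⟨⟩
          ≡≤ (trans (E-cong I² (λ d → trans (E-cong mΩ (λ ω → trans (E-sq T² T² (λ s → ψ (d ⊹ s) ω) (λ s → ψ (d ⊹ s) ω)) (E-cong T² (λ s → E-cong T² (λ t → body-der fs' X l' d s t ω)))))
               (sym (swap3 T² T² mΩ (λ s t ω → body (der s t fs') (Δ (l' · s) (l' · t) X) l' d ω)))))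
            (sym (swap3 T² T² I² (λ s t d → E mΩ (body (der s t fs') (Δ (l' · s) (l' · t) X) l' d)))))
        s1 : sq θ ≤ ι 4 * (Y + κ)
        s1 = near-sq (subst Bd (sym θ≡) (E-bd I² bdh)) (E-bd T² (λ s → E-bd I² (λ d → bdh (d ⊹ s)))) (near-≡ (sym θ≡) refl (avg2 h bdh)) ≤⟨⟩
          by (nn+ (diff θ~²) (nn* (0≤ι 3) (nn-sq θ~ ≤⟨⟩ θ~²))) (e (sq θ~) Y κ)
          where e : ∀ x y κ → ι 4 * (y + κ) ≡ x + 2ℚ * (κ + κ) + (y - x + ι 3 * y)
                e = solve-∀ ℚR
        s2 : pw n Y ≤ ι (gK n) * (U (dirs L l ((f , l₁) ∷ fs)) X + κ)
        s2 = pw-jensen n T² _ ≤⟨⟩ E-mono T² (λ s → pw-jensen n T² _ ≤⟨⟩ E-mono T² (λ t →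
             gvn n (der s t fs') (trans (len-der s t l₁ fs) (ℕP.suc-injective len)) (Δ (l' · s) (l' · t) X) l' (bdΔ _ _ bX) (bd-der s t fs' (bd-sub l₁ fs bfs)) ≤⟨⟩
             ≡≤ (cong (λ z → ι (gK n) * (U z (Δ (l' · s) (l' · t) X) + κ)) (dirs-der L s t l l₁ fs)))) ≤⟨⟩
          ≡≤ (trans (E-cong T² (λ s → E-aff T² (ι (gK n)) κ (λ t → U (dirs L l fs) (Δ (l' · s) (l' · t) X))))
               (E-aff T² (ι (gK n)) κ (λ s → E T² (λ t → U (dirs L l fs) (Δ (l' · s) (l' · t) X)))))
open DegreeLowering

-- From the quadratic average to a box norm in five fixed directions.

module PETInduction where
  kP1 kP2 kP3 kP4 kP : ℕ
  kP1 = trK 1 (kE 2) 8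
  kP2 = trK 5 kP1 (gK 5)
  kP3 = trK 0 kP2 12
  kP4 = trK 2 kP3 kC
  kP = trK 2 kP4 kC

  module PET (S : Sys) where
    open Sys S
    open Dyn S
    open Concat S
    open Lower S
    open GvN S

    concat-U : ∀ r b n k ℓ μs {X} → BdF X → Cond r b n → suc ℓ ℕ.≤ suc b ℕ.* suc b →
      pw 2 (E (DD r) (λ e → U (dir1 (k ℤ.* val (suc b) e) n ∷ μs) X)) ≤ ι kC * (U (dir1 (k ℤ.* ℤ.+ Qr r) ℓ ∷ μs) X + rec r)
    concat-U r b n k ℓ μs {X} bX cond ℓB =
      ≡≤ (cong (pw 2) (trans (E-cong (DD r) (λ e → U-N (dir1 (k ℤ.* val (suc b) e) n) μs X)) (E-swap (DD r) (cubeM μs) _))) ≤⟨⟩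
      pw-jensen 2 (cubeM μs) _ ≤⟨⟩ E-mono (cubeM μs) (λ γ → concat r b n k ℓ (cube-bd γ bX) cond ℓB) ≤⟨⟩
      ≡≤ (trans (E-aff (cubeM μs) (ι kC) (rec r) _) (cong (λ z → ι kC * (z + rec r)) (sym (U-N (dir1 (k ℤ.* ℤ.+ Qr r) ℓ) μs X))))

    U-nn-dirs : ∀ L l f fs X → 0ℚ ≤ U (dirs L l (f ∷ fs)) X
    U-nn-dirs L l (f , l') fs X = U-nn (dirV (proj₁ (l ⊝ l')) (proj₂ (l ⊝ l')) L) (dirs L l fs) X

    N-P : ∀ μ ν {H : Fn} → (∀ ω → P μ H ω ≡ P ν H ω) → N μ H ≡ N ν H
    N-P μ ν e = E-cong mΩ (λ ω → cong sq (e ω))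

    U-swapdir : ∀ μ ν μs X → (∀ (H : Fn) ω → P μ H ω ≡ P ν H ω) → U (μ ∷ μs) X ≡ U (ν ∷ μs) X
    U-swapdir μ ν μs X e = trans (U-N μ μs X) (trans (E-cong (cubeM μs) (λ γ → N-P μ ν {cube γ X} (e (cube γ X)))) (sym (U-N ν μs X)))

    P-dirV0 : ∀ u L (H : Fn) ω → P (dirV u ℤ.0ℤ L) H ω ≡ P (dir1 u L) H ω
    P-dirV0 u L H ω = E-cong (Iv L) (λ i → trans (E-cong (Iv L) (λ j → cong (λ z → H (ω ⊕ z)) (l u i j))) (E-const (Iv L) _))
      where l : ∀ u i j → u ℤ.* i ℤ.+ ℤ.0ℤ ℤ.* j ≡ u ℤ.* i
            l = ℤS.solve-∀

    U-coarsen : ∀ μ ν μs {η X} → BdF X → Supp ν (λ y → Abs μ y η) → U (μ ∷ μs) X ≤ U (ν ∷ μs) X + 2ℚ * η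
    U-coarsen μ ν μs {η} {X} bX s = ≡≤ (U-N μ μs X) ≤⟨⟩ E-mono (cubeM μs) (λ γ → coarsen μ ν {η} {cube γ X} (cube-bd γ bX) s) ≤⟨⟩
      ≡≤ (trans (E-+ (cubeM μs) _ _) (cong₂ _+_ (sym (U-N ν μs X)) (E-const (cubeM μs) _)))

    U-under : ∀ μ μs νs {c} X → (∀ X → BdF X → U μs X ≤ U νs X + c) → BdF X → U (μ ∷ μs) X ≤ U (μ ∷ νs) X + c
    U-under μ μs νs {c} X h bX = E-mono μ (λ a → E-mono μ (λ a' → h (Δ a a' X) (bdΔ a a' bX)) ≤⟨⟩ ≡≤ (trans (E-+ μ _ _) (cong (E μ (λ a' → U νs (Δ a a' X)) +_) (E-const μ c)))) ≤⟨⟩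
      ≡≤ (trans (E-+ μ _ _) (cong (U (μ ∷ νs) X +_) (E-const μ c)))

    coarsen3 : ∀ (Z : Mean ℤ) (κ : ℚ) (V₃ V₄ V₅ : Mean ℤ) → Supp Z (λ z → Abs V₃ z κ) → Supp Z (λ z → Abs V₄ z κ) → Supp Z (λ z → Abs V₅ z κ) →
      ∀ Y → BdF Y → U (V₃ ∷ V₄ ∷ V₅ ∷ []) Y ≤ U (Z ∷ Z ∷ Z ∷ []) Y + (2ℚ * κ + 2ℚ * κ + 2ℚ * κ)
    coarsen3 Z κ V₃ V₄ V₅ a₃ a₄ a₅ Y bY =
      U-coarsen V₃ Z (V₄ ∷ V₅ ∷ []) bY a₃ ≤⟨⟩ +r (2ℚ * κ) (U-under Z (V₄ ∷ V₅ ∷ []) (Z ∷ Z ∷ []) {2ℚ * κ + 2ℚ * κ} Y (λ Y bY →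
        U-coarsen V₄ Z (V₅ ∷ []) bY a₄ ≤⟨⟩ +r (2ℚ * κ) (U-under Z (V₅ ∷ []) (Z ∷ []) Y (λ Y bY → U-coarsen V₅ Z [] bY a₅) bY) ≤⟨⟩ ≡≤ (ℚP.+-assoc (U (Z ∷ Z ∷ []) Y) (2ℚ * κ) (2ℚ * κ))) bY) ≤⟨⟩
        ≡≤ (ℚP.+-assoc (U (Z ∷ Z ∷ Z ∷ []) Y) (2ℚ * κ + 2ℚ * κ) (2ℚ * κ))

    pw-under : ∀ (ν : Mean ℤ) n c κ (f g : Fn → ℚ) X → (∀ Y → BdF Y → pw n (f Y) ≤ c * (g Y + κ)) → BdF X →
      pw n (E ν (λ a → E ν (λ a' → f (Δ a a' X)))) ≤ c * (E ν (λ a → E ν (λ a' → g (Δ a a' X))) + κ)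
    pw-under ν n c κ f g X h bX = pw-jensen n ν _ ≤⟨⟩ E-mono ν (λ a → pw-jensen n ν _ ≤⟨⟩ E-mono ν (λ a' → h (Δ a a' X) (bdΔ a a' bX))) ≤⟨⟩
      ≡≤ (trans (E-cong ν (λ a → E-aff ν c κ (λ a' → g (Δ a a' X)))) (E-aff ν c κ (λ a → E ν (λ a' → g (Δ a a' X)))))

    module _ (r m : ℕ) (k : ℤ) (b L ℓ : ℕ) (X g₁ g₂ : Fn) (bX : BdF X) (b₁ : BdF g₁) (b₂ : BdF g₂)
             (cond : Cond r b L) (ℓB : suc ℓ ℕ.≤ suc b ℕ.* suc b)
             (absL : Supp (Iv L) (λ x → Abs (Iv m) x (rec r)))
             (absS : Supp (DS r) (λ σ → Abs (Iv m) (val (suc b) σ) (rec r))) where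
      private
        B = suc b
        κ = rec r
        I = Iv m
        D = DS r
        v : ℤ² → ℤ
        v = val B
        κ0 : 0ℚ ≤ κ
        κ0 = 0≤rec r
        κ1 : κ ≤ 1ℚ
        κ1 = rec≤1 r
        Z : Mean ℤ
        Z = dir1 (ℤ.+ 2 ℤ.* ℤ.+ Qr r) ℓ

      Λ : ℚ
      Λ = E mΩ (λ ω → X ω * dual m k g₁ g₂ ω)

      private
        open VdC S r m b absS using (vdc)

        y₁ : ℤ → Fn
        y₁ d ω = X (ω ⊕ ℤ.- (d ℤ.* d)) * g₂ (ω ⊕ (ℤ.+ 2 ℤ.* k ℤ.* d ℤ.+ k ℤ.* k))

        -- Translating by -d² frees `g₁` from d, which prepares its removal.
        Λ≡ : Λ ≡ E I (λ d → E mΩ (λ ω → g₁ ω * y₁ d ω))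
        Λ≡ = trans (E-cong mΩ (λ ω → sym (E-* I (X ω) _))) (trans (E-swap mΩ I _) (E-cong I (λ d → trans (sym (inv (ℤ.- (d ℤ.* d)) _)) (E-cong mΩ (λ ω →
           trans (cong (X (ω ⊕ ℤ.- (d ℤ.* d)) *_) (cong₂ _*_ (trans (sh g₁ ω _ _ (ℤP.+-inverseˡ (d ℤ.* d))) (cong g₁ (⊕-0 ω))) (sh g₂ ω _ _ (l d k))))
             (l' (X (ω ⊕ ℤ.- (d ℤ.* d))) (g₁ ω) (g₂ (ω ⊕ (ℤ.+ 2 ℤ.* k ℤ.* d ℤ.+ k ℤ.* k)))))))))
          where
          l : ∀ d k → ℤ.- (d ℤ.* d) ℤ.+ (d ℤ.+ k) ℤ.* (d ℤ.+ k) ≡ ℤ.+ 2 ℤ.* k ℤ.* d ℤ.+ k ℤ.* k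
          l = ℤS.solve-∀
          l' : ∀ x g g' → x * (g * g') ≡ g * (x * g')
          l' = solve-∀ ℚR

        γ₂ : ℤ² → ℤ² → Fn
        γ₂ σ σ' ω = g₂ (ω ⊕ (ℤ.+ 2 ℤ.* k ℤ.* v σ ℤ.+ k ℤ.* k)) * g₂ (ω ⊕ (ℤ.+ 2 ℤ.* k ℤ.* v σ' ℤ.+ k ℤ.* k))

        e₂ : ℤ → ℤ → ℤ
        e₂ d s = ℤ.- (ℤ.+ 2 ℤ.* k ℤ.* d) ℤ.+ ℤ.- ((d ℤ.+ s) ℤ.* (d ℤ.+ s))

        y₂ : ℤ² → ℤ² → ℤ → Fn
        y₂ σ σ' d ω = X (ω ⊕ e₂ d (v σ)) * X (ω ⊕ e₂ d (v σ'))

        -- Translating by -2kd frees both copies of `g₂` from d, so that their product can be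
        -- discarded next.
        A≡ : ∀ σ σ' → E I (λ d → E mΩ (λ ω → y₁ (d ℤ.+ v σ) ω * y₁ (d ℤ.+ v σ') ω)) ≡ E I (λ d → E mΩ (λ ω → γ₂ σ σ' ω * y₂ σ σ' d ω))
        A≡ σ σ' = E-cong I (λ d → trans (sym (inv (ℤ.- (ℤ.+ 2 ℤ.* k ℤ.* d)) _)) (E-cong mΩ (λ ω → trans
            (cong₂ _*_ (cong₂ _*_ (sh X ω _ _ refl) (sh g₂ ω _ _ (l d k (v σ)))) (cong₂ _*_ (sh X ω _ _ refl) (sh g₂ ω _ _ (l d k (v σ')))))
            (l' (X _) (g₂ _) (X _) (g₂ _)))))
          where
          l : ∀ d k s → ℤ.- (ℤ.+ 2 ℤ.* k ℤ.* d) ℤ.+ (ℤ.+ 2 ℤ.* k ℤ.* (d ℤ.+ s) ℤ.+ k ℤ.* k) ≡ ℤ.+ 2 ℤ.* k ℤ.* s ℤ.+ k ℤ.* k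
          l = ℤS.solve-∀
          l' : ∀ a b c d → a * b * (c * d) ≡ b * d * (a * c)
          l' = solve-∀ ℚR

      -- The digit vectors drawn by the two differencing steps: σ₀, σ₁ by the first, ρ₀, ρ₁ by the
      -- second.
      record Pt : Set where
        constructor pt
        field σ₀ σ₁ ρ₀ ρ₁ : ℤ²
      open Pt

      private
        PM : Mean Pt
        PM = bind D (λ σ₀ → bind D (λ σ₁ → bind D (λ ρ₀ → bind D (λ ρ₁ → pure (pt σ₀ σ₁ ρ₀ ρ₁)))))

        cc : ℤ² → ℤ² → ℤ
        cc ρ σ = ℤ.- (ℤ.+ 2 ℤ.* k ℤ.* v ρ) ℤ.+ ℤ.- ((v ρ ℤ.+ v σ) ℤ.* (v ρ ℤ.+ v σ))

        ss : ℤ² → ℤ² → ℤ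
        ss ρ σ = ℤ.- (ℤ.+ 2 ℤ.* (v ρ ℤ.+ v σ))

        Xp : ℤ² → ℤ² → ℤ → Fn
        Xp ρ σ d ω = X (ω ⊕ (cc ρ σ ℤ.+ d ℤ.* ss ρ σ))

        Ξ : Pt → ℚ
        Ξ p = E I (λ d → E mΩ (λ ω → Xp (ρ₁ p) (σ₁ p) d ω * (Xp (ρ₀ p) (σ₁ p) d ω * (Xp (ρ₁ p) (σ₀ p) d ω * Xp (ρ₀ p) (σ₀ p) d ω))))

        -- All four copies of X share the terms -d² - 2kd; once these are translated away, the forms
        -- are linear in d.
        Ξ≡ : ∀ σ σ' ρ ρ' → E I (λ d → E mΩ (λ ω → y₂ σ σ' (d ℤ.+ v ρ) ω * y₂ σ σ' (d ℤ.+ v ρ') ω)) ≡ Ξ (pt σ σ' ρ ρ')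
        Ξ≡ σ σ' ρ ρ' = E-cong I (λ d → trans (sym (inv (d ℤ.* d ℤ.+ ℤ.+ 2 ℤ.* k ℤ.* d) _)) (E-cong mΩ (λ ω → trans
            (cong₂ _*_ (cong₂ _*_ (sh X ω _ _ (l d k (v ρ) (v σ))) (sh X ω _ _ (l d k (v ρ) (v σ')))) (cong₂ _*_ (sh X ω _ _ (l d k (v ρ') (v σ))) (sh X ω _ _ (l d k (v ρ') (v σ')))))
            (l' (Xp ρ σ d ω) (Xp ρ σ' d ω) (Xp ρ' σ d ω) (Xp ρ' σ' d ω)))))
          where
          l : ∀ d k ρ σ → (d ℤ.* d ℤ.+ ℤ.+ 2 ℤ.* k ℤ.* d) ℤ.+ (ℤ.- (ℤ.+ 2 ℤ.* k ℤ.* (d ℤ.+ ρ)) ℤ.+ ℤ.- ((d ℤ.+ ρ ℤ.+ σ) ℤ.* (d ℤ.+ ρ ℤ.+ σ)))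
             ≡ (ℤ.- (ℤ.+ 2 ℤ.* k ℤ.* ρ) ℤ.+ ℤ.- ((ρ ℤ.+ σ) ℤ.* (ρ ℤ.+ σ))) ℤ.+ d ℤ.* (ℤ.- (ℤ.+ 2 ℤ.* (ρ ℤ.+ σ)))
          l = ℤS.solve-∀
          l' : ∀ a b c d → a * b * (c * d) ≡ d * (b * (c * a))
          l' = solve-∀ ℚR

        y0 : ℚ
        y0 = E PM Ξ

        step1 : pw 2 Λ ≤ ι (kE 2) * (y0 + ι 2 * κ + κ)
        step1 = two-step 2 {Λ} {E D (λ σ → E D (λ σ' → E I (λ d → E mΩ (λ ω → γ₂ σ σ' ω * y₂ σ σ' d ω))))} {y0 + ι 2 * κ} κ0 κ1 (nn-sq A ≤⟨⟩ A²)
          (≡≤ (cong sq Λ≡) ≤⟨⟩ vdc g₁ y₁ b₁ (λ d ω → bd* (bX _) (b₂ _)) ≤⟨⟩ +r (2ℚ * κ) (≡≤ (E-cong D (λ σ → E-cong D (λ σ' → A≡ σ σ'))))) A²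
          where
          A = E D (λ σ → E D (λ σ' → E I (λ d → E mΩ (λ ω → γ₂ σ σ' ω * y₂ σ σ' d ω))))
          A² : sq A ≤ y0 + ι 2 * κ
          A² = jensen D _ ≤⟨⟩ E-mono D (λ σ → jensen D _ ≤⟨⟩ E-mono D (λ σ' → vdc (γ₂ σ σ') (y₂ σ σ') (λ ω → bd* (b₂ _) (b₂ _)) (λ d ω → bd* (bX _) (bX _)))) ≤⟨⟩
            ≡≤ (trans (E-cong D (λ σ → E-+c D (2ℚ * κ) (λ σ' → V4 σ σ'))) (trans (E-+c D (2ℚ * κ) (λ σ → E D (λ σ' → V4 σ σ')))
               (cong (_+ 2ℚ * κ) (E-cong D (λ σ → E-cong D (λ σ' → E-cong D (λ ρ → E-cong D (λ ρ' → Ξ≡ σ σ' ρ ρ'))))))))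
            where
            V4 : ℤ² → ℤ² → ℚ
            V4 σ σ' = E D (λ ρ → E D (λ ρ' → E I (λ d → E mΩ (λ ω → y₂ σ σ' (d ℤ.+ v ρ) ω * y₂ σ σ' (d ℤ.+ v ρ') ω))))

        ψ : Pt → ℤ → Fn
        ψ p d ω = X (ω ⊕ (ex (ρ₀ p) (σ₁ p))) * (X (ω ⊕ (ex (ρ₁ p) (σ₀ p))) * X (ω ⊕ (ex (ρ₀ p) (σ₀ p))))
          where
          ex : ℤ² → ℤ² → ℤ
          ex ρ σ = (cc ρ σ ℤ.- cc (ρ₁ p) (σ₁ p)) ℤ.+ d ℤ.* (ss ρ σ ℤ.- ss (ρ₁ p) (σ₁ p))

        y0≡ : y0 ≡ E mΩ (λ ω → X ω * E PM (λ p → E I (λ d → ψ p d ω)))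
        y0≡ = trans (E-cong PM (λ p → trans (E-cong I (λ d → trans (sym (inv (ℤ.- (cc (ρ₁ p) (σ₁ p) ℤ.+ d ℤ.* ss (ρ₁ p) (σ₁ p))) _)) (E-cong mΩ (λ ω → cong₂ _*_
              (trans (sh X ω _ _ (ℤP.+-inverseˡ (cc (ρ₁ p) (σ₁ p) ℤ.+ d ℤ.* ss (ρ₁ p) (σ₁ p)))) (cong X (⊕-0 ω)))
              (cong₂ _*_ (lx p d ω (ρ₀ p) (σ₁ p)) (cong₂ _*_ (lx p d ω (ρ₁ p) (σ₀ p)) (lx p d ω (ρ₀ p) (σ₀ p))))))))
            (trans (E-swap I mΩ (λ d ω → X ω * ψ p d ω)) (E-cong mΩ (λ ω → E-* I (X ω) (λ d → ψ p d ω))))))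
          (trans (E-swap PM mΩ (λ p ω → X ω * E I (λ d → ψ p d ω))) (E-cong mΩ (λ ω → E-* PM (X ω) (λ p → E I (λ d → ψ p d ω)))))
          where
          l : ∀ c s d c' s' → ℤ.- (c ℤ.+ d ℤ.* s) ℤ.+ (c' ℤ.+ d ℤ.* s') ≡ (c' ℤ.- c) ℤ.+ d ℤ.* (s' ℤ.- s)
          l = ℤS.solve-∀
          lx : ∀ p d ω ρ σ → Xp ρ σ d (ω ⊕ ℤ.- (cc (ρ₁ p) (σ₁ p) ℤ.+ d ℤ.* ss (ρ₁ p) (σ₁ p))) ≡ X (ω ⊕ ((cc ρ σ ℤ.- cc (ρ₁ p) (σ₁ p)) ℤ.+ d ℤ.* (ss ρ σ ℤ.- ss (ρ₁ p) (σ₁ p))))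
          lx p d ω ρ σ = sh X ω _ _ (l (cc (ρ₁ p) (σ₁ p)) (ss (ρ₁ p) (σ₁ p)) d (cc ρ σ) (ss ρ σ))

        fn : Pt → ℤ² → ℤ² → Fn
        fn p ρ σ = X ↑ (cc ρ σ ℤ.- cc (ρ₁ p) (σ₁ p))

        sl : Pt → ℤ² → ℤ² → ℤ
        sl p ρ σ = ss ρ σ ℤ.- ss (ρ₁ p) (σ₁ p)

        f0 : Pt → Form
        f0 p = (fn p (ρ₀ p) (σ₁ p) , (sl p (ρ₀ p) (σ₁ p) , ℤ.0ℤ))

        fs' : Pt → Pt → List Form
        fs' p p' = (fn p (ρ₁ p) (σ₀ p) , (sl p (ρ₁ p) (σ₀ p) , ℤ.0ℤ)) ∷
          (fn p' (ρ₀ p') (σ₁ p') , (ℤ.0ℤ , sl p' (ρ₀ p') (σ₁ p'))) ∷ (fn p' (ρ₁ p') (σ₀ p') , (ℤ.0ℤ , sl p' (ρ₁ p') (σ₀ p'))) ∷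
          (fn p' (ρ₀ p') (σ₀ p') , (ℤ.0ℤ , sl p' (ρ₀ p') (σ₀ p'))) ∷ []

        fs : Pt → Pt → List Form
        fs p p' = f0 p ∷ fs' p p'

        XT : Pt → Fn
        XT p = fn p (ρ₀ p) (σ₀ p)

        lT : Pt → ℤ²
        lT p = (sl p (ρ₀ p) (σ₀ p) , ℤ.0ℤ)

        Θ' : Pt → Pt → ℚ
        Θ' p p' = Θ r m L absL (fs p p') (XT p) (lT p)

        -- The relative directions of X are mm, hh and their sum up to a common factor: three
        -- directions built from two independent vectors. Squaring adds an independent copy p', so
        -- the sum of p gets paired with each direction of p', and such pairs have nonzero
        -- determinant almost always.
        y0² : sq y0 ≤ E PM (λ p → E PM (λ p' → Θ' p p'))
        y0² = ≡≤ (cong sq y0≡) ≤⟨⟩ kill mΩ X (λ ω → E PM (λ p → E I (λ d → ψ p d ω))) bX ≤⟨⟩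
          ≡≤ (trans (E-cong mΩ (λ ω → trans (E-sq PM PM (λ p → E I (λ d → ψ p d ω)) (λ p → E I (λ d → ψ p d ω))) (E-cong PM (λ p → E-cong PM (λ p' → E-sq I I (λ d → ψ p d ω) (λ d → ψ p' d ω))))))
           (trans (sym (swap3 PM PM mΩ (λ p p' ω → E I (λ d → E I (λ d' → ψ p d ω * ψ p' d' ω)))))
            (E-cong PM (λ p → E-cong PM (λ p' → trans (sym (swap3 I I mΩ (λ d d' ω → ψ p d ω * ψ p' d' ω))) (E-cong I (λ d → E-cong I (λ d' → E-cong mΩ (λ ω → pe p p' d d' ω)))))))))
          where
          l1 : ∀ c s d d' → c ℤ.+ d ℤ.* s ≡ s ℤ.* d ℤ.+ ℤ.0ℤ ℤ.* d' ℤ.+ c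
          l1 = ℤS.solve-∀
          l2 : ∀ c s d d' → c ℤ.+ d' ℤ.* s ≡ ℤ.0ℤ ℤ.* d ℤ.+ s ℤ.* d' ℤ.+ c
          l2 = ℤS.solve-∀
          l' : ∀ a b c d e f → a * (b * c) * (d * (e * f)) ≡ a * (b * (d * (e * (f * c))))
          l' = solve-∀ ℚR
          q1 : ∀ c s d d' ω → X (ω ⊕ (c ℤ.+ d ℤ.* s)) ≡ (X ↑ c) (ω ⊕ (s ℤ.* d ℤ.+ ℤ.0ℤ ℤ.* d'))
          q1 c s d d' ω = sym (sh X ω _ c (sym (l1 c s d d')))
          q2 : ∀ c s d d' ω → X (ω ⊕ (c ℤ.+ d' ℤ.* s)) ≡ (X ↑ c) (ω ⊕ (ℤ.0ℤ ℤ.* d ℤ.+ s ℤ.* d'))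
          q2 c s d d' ω = sym (sh X ω _ c (sym (l2 c s d d')))
          pe : ∀ p p' d d' ω → ψ p d ω * ψ p' d' ω ≡ body (fs p p') (XT p) (lT p) (d , d') ω
          pe p p' d d' ω = trans (cong₂ _*_ (cong₂ _*_ (t1 (ρ₀ p) (σ₁ p)) (cong₂ _*_ (t1 (ρ₁ p) (σ₀ p)) (t1 (ρ₀ p) (σ₀ p))))
               (cong₂ _*_ (t2 (ρ₀ p') (σ₁ p')) (cong₂ _*_ (t2 (ρ₁ p') (σ₀ p')) (t2 (ρ₀ p') (σ₀ p')))))
            (l' (A (ρ₀ p) (σ₁ p)) (A (ρ₁ p) (σ₀ p)) (A (ρ₀ p) (σ₀ p)) (A' (ρ₀ p') (σ₁ p')) (A' (ρ₁ p') (σ₀ p')) (A' (ρ₀ p') (σ₀ p')))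
            where
            A A' : ℤ² → ℤ² → ℚ
            A ρ σ = fn p ρ σ (ω ⊕ (sl p ρ σ ℤ.* d ℤ.+ ℤ.0ℤ ℤ.* d'))
            A' ρ σ = fn p' ρ σ (ω ⊕ (ℤ.0ℤ ℤ.* d ℤ.+ sl p' ρ σ ℤ.* d'))
            t1 : ∀ ρ σ → X (ω ⊕ (cc ρ σ ℤ.- cc (ρ₁ p) (σ₁ p) ℤ.+ d ℤ.* sl p ρ σ)) ≡ A ρ σ
            t1 ρ σ = q1 (cc ρ σ ℤ.- cc (ρ₁ p) (σ₁ p)) (sl p ρ σ) d d' ω
            t2 : ∀ ρ σ → X (ω ⊕ (cc ρ σ ℤ.- cc (ρ₁ p') (σ₁ p') ℤ.+ d' ℤ.* sl p' ρ σ)) ≡ A' ρ σ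
            t2 ρ σ = q2 (cc ρ σ ℤ.- cc (ρ₁ p') (σ₁ p')) (sl p' ρ σ) d d' ω

        z1 : ℚ
        z1 = E PM (λ p → E PM (λ p' → Θ' p p'))

        step2 : pw 3 Λ ≤ ι kP1 * (z1 + κ)
        step2 = ≡≤ (pw-+ 2 1 Λ) ≤⟨⟩ le-trans κ0 κ1 1 {kE 2} {8} {pw 2 Λ} {y0 + ι 2 * κ} {z1} (pw-nn' 1 Λ) (nn-sq y0 ≤⟨⟩ y0²) step1
          (≡≤ (trans (pw-suc 0 _) (pw-0 _)) ≤⟨⟩ by (nn-sq (y0 - ι 2 * κ)) (e1 y0 κ) ≤⟨⟩
           (*mono 2ℚ 0≤2 y0² +≤ *mono (ι 8) (0≤ι 8) (*mono κ κ0 κ1 ≤⟨⟩ ≡≤ (ℚP.*-identityʳ κ))) ≤⟨⟩ by (nn* (0≤ι 6) (nn-sq y0 ≤⟨⟩ y0²)) (e2 z1 κ))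
          where
          e1 : ∀ y κ → 2ℚ * (y * y) + ι 8 * (κ * κ) ≡ (y + ι 2 * κ) * (y + ι 2 * κ) + (y - ι 2 * κ) * (y - ι 2 * κ)
          e1 = solve-∀ ℚR
          e2 : ∀ z κ → ι 8 * (z + κ) ≡ 2ℚ * z + ι 8 * κ + ι 6 * z
          e2 = solve-∀ ℚR

        U5 : Pt → Pt → ℚ
        U5 p p' = U (dirs L (lT p) (fs p p')) (XT p)

        z2 : ℚ
        z2 = E PM (λ p → E PM (λ p' → U5 p p'))

        bdfs : ∀ p p' → BdFs (fs p p')
        bdfs p p' = bd↑ _ bX , bd↑ _ bX , bd↑ _ bX , bd↑ _ bX , bd↑ _ bX , tt

        z2nn : 0ℚ ≤ z2
        z2nn = E-≥c PM (λ p → E-≥c PM (λ p' → U-nn-dirs L (lT p) (f0 p) (fs' p p') (XT p)))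

        step3 : pw 8 Λ ≤ ι kP2 * (z2 + κ)
        step3 = ≡≤ (pw-+ 3 5 Λ) ≤⟨⟩ le-trans κ0 κ1 5 {kP1} {gK 5} {pw 3 Λ} {z1} {z2} (pw-nn' 2 Λ) z2nn step2
          (pw-jensen 5 PM _ ≤⟨⟩ E-mono PM (λ p → pw-jensen 5 PM _ ≤⟨⟩ E-mono PM (λ p' → gvn r m L absL 5 (fs p p') refl (XT p) (lT p) (bd↑ _ bX) (bdfs p p'))) ≤⟨⟩
           ≡≤ (trans (E-cong PM (λ p → E-aff PM (ι (gK 5)) κ (U5 p))) (E-aff PM (ι (gK 5)) κ (λ p → E PM (U5 p)))))

        mm hh sm : Pt → ℤ²
        mm p = σ₁ p ⊝ σ₀ p
        hh p = ρ₁ p ⊝ ρ₀ p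
        sm p = hh p ⊹ mm p

        v⊝ : ∀ a b → v (a ⊝ b) ≡ v a ℤ.- v b
        v⊝ (a , a') (b , b') = l (ℤ.+ B) a a' b b'
          where l : ∀ B a a' b b' → B ℤ.* (a ℤ.- b) ℤ.+ (a' ℤ.- b') ≡ B ℤ.* a ℤ.+ a' ℤ.- (B ℤ.* b ℤ.+ b')
                l = ℤS.solve-∀

        v⊹ : ∀ a b → v (a ⊹ b) ≡ v a ℤ.+ v b
        v⊹ (a , a') (b , b') = l (ℤ.+ B) a a' b b'
          where l : ∀ B a a' b b' → B ℤ.* (a ℤ.+ b) ℤ.+ (a' ℤ.+ b') ≡ B ℤ.* a ℤ.+ a' ℤ.+ (B ℤ.* b ℤ.+ b')
                l = ℤS.solve-∀

        2v : ℤ² → ℤ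
        2v u = ℤ.+ 2 ℤ.* v u

        Vd : ℤ² → ℤ² → Mean ℤ
        Vd u w = dirV (2v u) (ℤ.- 2v w) L

        dEq : ∀ p p' → dirs L (lT p) (fs p p') ≡ dirV (2v (mm p)) ℤ.0ℤ L ∷ dirV (2v (hh p)) ℤ.0ℤ L ∷ Vd (sm p) (hh p') ∷ Vd (sm p) (mm p') ∷ Vd (sm p) (sm p') ∷ []
        dEq (pt σ₀ σ₁ ρ₀ ρ₁) (pt τ₀ τ₁ υ₀ υ₁) = cong₂ _∷_ (cong (λ z → dirV z ℤ.0ℤ L) (trans (a1 (v σ₀) (v σ₁) (v ρ₀) (v ρ₁)) (cong (ℤ.+ 2 ℤ.*_) (sym (v⊝ σ₁ σ₀)))))
          (cong₂ _∷_ (cong (λ z → dirV z ℤ.0ℤ L) (trans (a2 (v σ₀) (v σ₁) (v ρ₀) (v ρ₁)) (cong (ℤ.+ 2 ℤ.*_) (sym (v⊝ ρ₁ ρ₀)))))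
          (cong₂ _∷_ (cong₂ (λ y z → dirV y z L) e3 (trans (b1 (v τ₀) (v τ₁) (v υ₀) (v υ₁)) (cong (λ z → ℤ.- (ℤ.+ 2 ℤ.* z)) (sym (v⊝ υ₁ υ₀)))))
          (cong₂ _∷_ (cong₂ (λ y z → dirV y z L) e3 (trans (b2 (v τ₀) (v τ₁) (v υ₀) (v υ₁)) (cong (λ z → ℤ.- (ℤ.+ 2 ℤ.* z)) (sym (v⊝ τ₁ τ₀)))))
          (cong₂ _∷_ (cong₂ (λ y z → dirV y z L) e3 (trans (b3 (v τ₀) (v τ₁) (v υ₀) (v υ₁)) (cong (λ z → ℤ.- (ℤ.+ 2 ℤ.* z)) (sym (sm≡ τ₀ τ₁ υ₀ υ₁))))) refl))))
          where
          sm≡ : ∀ τ₀ τ₁ υ₀ υ₁ → v ((υ₁ ⊝ υ₀) ⊹ (τ₁ ⊝ τ₀)) ≡ (v υ₁ ℤ.- v υ₀) ℤ.+ (v τ₁ ℤ.- v τ₀)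
          sm≡ τ₀ τ₁ υ₀ υ₁ = trans (v⊹ (υ₁ ⊝ υ₀) (τ₁ ⊝ τ₀)) (cong₂ ℤ._+_ (v⊝ υ₁ υ₀) (v⊝ τ₁ τ₀))
          a1 : ∀ a b c d → (ℤ.- (ℤ.+ 2 ℤ.* (c ℤ.+ a)) ℤ.- ℤ.- (ℤ.+ 2 ℤ.* (d ℤ.+ b))) ℤ.- (ℤ.- (ℤ.+ 2 ℤ.* (c ℤ.+ b)) ℤ.- ℤ.- (ℤ.+ 2 ℤ.* (d ℤ.+ b))) ≡ ℤ.+ 2 ℤ.* (b ℤ.- a)
          a1 = ℤS.solve-∀
          a2 : ∀ a b c d → (ℤ.- (ℤ.+ 2 ℤ.* (c ℤ.+ a)) ℤ.- ℤ.- (ℤ.+ 2 ℤ.* (d ℤ.+ b))) ℤ.- (ℤ.- (ℤ.+ 2 ℤ.* (d ℤ.+ a)) ℤ.- ℤ.- (ℤ.+ 2 ℤ.* (d ℤ.+ b))) ≡ ℤ.+ 2 ℤ.* (d ℤ.- c)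
          a2 = ℤS.solve-∀
          a3 : ∀ a b c d → (ℤ.- (ℤ.+ 2 ℤ.* (c ℤ.+ a)) ℤ.- ℤ.- (ℤ.+ 2 ℤ.* (d ℤ.+ b))) ℤ.- ℤ.0ℤ ≡ ℤ.+ 2 ℤ.* ((d ℤ.- c) ℤ.+ (b ℤ.- a))
          a3 = ℤS.solve-∀
          b1 : ∀ a b c d → ℤ.0ℤ ℤ.- (ℤ.- (ℤ.+ 2 ℤ.* (c ℤ.+ b)) ℤ.- ℤ.- (ℤ.+ 2 ℤ.* (d ℤ.+ b))) ≡ ℤ.- (ℤ.+ 2 ℤ.* (d ℤ.- c))
          b1 = ℤS.solve-∀
          b2 : ∀ a b c d → ℤ.0ℤ ℤ.- (ℤ.- (ℤ.+ 2 ℤ.* (d ℤ.+ a)) ℤ.- ℤ.- (ℤ.+ 2 ℤ.* (d ℤ.+ b))) ≡ ℤ.- (ℤ.+ 2 ℤ.* (b ℤ.- a))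
          b2 = ℤS.solve-∀
          b3 : ∀ a b c d → ℤ.0ℤ ℤ.- (ℤ.- (ℤ.+ 2 ℤ.* (c ℤ.+ a)) ℤ.- ℤ.- (ℤ.+ 2 ℤ.* (d ℤ.+ b))) ≡ ℤ.- (ℤ.+ 2 ℤ.* ((d ℤ.- c) ℤ.+ (b ℤ.- a)))
          b3 = ℤS.solve-∀
          e3 = trans (a3 (v σ₀) (v σ₁) (v ρ₀) (v ρ₁)) (cong (ℤ.+ 2 ℤ.*_) (sym (sm≡ σ₀ σ₁ ρ₀ ρ₁)))

        D1 : ℤ² → Mean ℤ
        D1 e = dir1 (ℤ.+ 2 ℤ.* v e) L

        ZZ : List (Mean ℤ)
        ZZ = Z ∷ Z ∷ Z ∷ []

        absV : ∀ u w → Small (C4 r) u → Small (C4 r) w → det u w ≢ ℤ.0ℤ → Supp Z (λ z → Abs (Vd u w) z κ)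
        absV u w su sw dn = zabs r b L (Vd u w) (ℤ.+ 2) ℓ u w cond ℓB su sw dn (abs-dirV₁ (2v u) (ℤ.- 2v w) L)
          (subst (λ z → Abs (Vd u w) z (rec L * 2ℚ)) (ℤP.neg-involutive (2v w)) (abs-neg (Vd u w) (abs-dirV₂ (2v u) (ℤ.- 2v w) L)))

        c3 : ∀ (V₃ V₄ V₅ : Mean ℤ) → Supp Z (λ z → Abs V₃ z κ) → Supp Z (λ z → Abs V₄ z κ) → Supp Z (λ z → Abs V₅ z κ) →
          ∀ Y → BdF Y → U (V₃ ∷ V₄ ∷ V₅ ∷ []) Y ≤ U ZZ Y + (2ℚ * κ + 2ℚ * κ + 2ℚ * κ)
        c3 = coarsen3 Z κ

        UZ : Pt → ℚ
        UZ p = U (D1 (mm p) ∷ D1 (hh p) ∷ ZZ) X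

        X3 : Pt → Pt → ℚ
        X3 p p' = χ (det (sm p) (hh p')) + (χ (det (sm p) (mm p')) + χ (det (sm p) (sm p')))

        k6 : ℚ
        k6 = 2ℚ * κ + 2ℚ * κ + 2ℚ * κ

        U5≡ : ∀ p p' → U5 p p' ≡ U (D1 (mm p) ∷ D1 (hh p) ∷ Vd (sm p) (hh p') ∷ Vd (sm p) (mm p') ∷ Vd (sm p) (sm p') ∷ []) X
        U5≡ p p' = trans (cong (λ z → U z (XT p)) (dEq p p')) (trans (U-↑ (dirV (2v (mm p)) ℤ.0ℤ L ∷ dirV (2v (hh p)) ℤ.0ℤ L ∷ V3) X (cc (ρ₀ p) (σ₀ p) ℤ.- cc (ρ₁ p) (σ₁ p)))
          (trans (U-swapdir (dirV (2v (mm p)) ℤ.0ℤ L) (D1 (mm p)) (dirV (2v (hh p)) ℤ.0ℤ L ∷ V3) X (P-dirV0 (2v (mm p)) L))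
            (E-cong (D1 (mm p)) (λ c → E-cong (D1 (mm p)) (λ c' → U-swapdir (dirV (2v (hh p)) ℤ.0ℤ L) (D1 (hh p)) V3 (Δ c c' X) (P-dirV0 (2v (hh p)) L))))))
          where
          V3 = Vd (sm p) (hh p') ∷ Vd (sm p) (mm p') ∷ Vd (sm p) (sm p') ∷ []

        smallP : Pt → Set
        smallP p = Small (C4 r) (mm p) × Small (C4 r) (hh p) × Small (C4 r) (sm p)

        PM-supp : Supp PM smallP
        PM-supp = supp-map D (λ σ₀ a → supp-map D (λ σ₁ b → supp-map D (λ ρ₀ c → supp-map D (λ ρ₁ d →
            small-mono (ℕP.m≤m+n _ _) (small-⊝ b a) , small-mono (ℕP.m≤m+n _ _) (small-⊝ d c) , small-⊹ (small-⊝ d c) (small-⊝ b a)) (DS-supp r)) (DS-supp r)) (DS-supp r)) (DS-supp r)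
          where
          small-⊹ : ∀ {C u w} → Small C u → Small C w → Small (C ℕ.+ C) (u ⊹ w)
          small-⊹ {u = a , b} {c , d} (p ,, q) (p' ,, q') =
            ℕP.≤-trans (ℤP.∣i+j∣≤∣i∣+∣j∣ a c) (ℕP.+-mono-≤ p p') ,, ℕP.≤-trans (ℤP.∣i+j∣≤∣i∣+∣j∣ b d) (ℕP.+-mono-≤ q q')

        -- The box norm is at most 1, so a pair with some vanishing determinant is paid for by `X3`.
        bad : ∀ p p' → 1ℚ ≤ X3 p p' → U5 p p' ≤ UZ p + (k6 + X3 p p')
        bad p p' h = proj₂ (U-bd (dirs L (lT p) (fs p p')) (bd↑ _ bX)) ≤⟨⟩ h ≤⟨⟩ by (nn+ (U-nn (D1 (mm p)) (D1 (hh p) ∷ ZZ) X) kk) (l (X3 p p') (UZ p) k6)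
          where
          l : ∀ x u k → u + (k + x) ≡ x + (u + k)
          l = solve-∀ ℚR
          kk : 0ℚ ≤ k6
          kk = nn+ (nn+ (nn* 0≤2 κ0) (nn* 0≤2 κ0)) (nn* 0≤2 κ0)

        U5≤ : ∀ p p' → smallP p → smallP p' → U5 p p' ≤ UZ p + (k6 + X3 p p')
        U5≤ p p' (_ , _ , sp) (mp' , hp' , sp') = go₁ (det (sm p) (hh p') ℤP.≟ ℤ.0ℤ)
          where
          x₁ x₂ x₃ : ℚ
          x₁ = χ (det (sm p) (hh p'))
          x₂ = χ (det (sm p) (mm p'))
          x₃ = χ (det (sm p) (sm p'))
          l₂ : ∀ a b c → a + (b + c) ≡ b + (a + c)
          l₂ = solve-∀ ℚR
          l₃ : ∀ a b c → a + (b + c) ≡ c + (a + b)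
          l₃ = solve-∀ ℚR
          V3 = Vd (sm p) (hh p') ∷ Vd (sm p) (mm p') ∷ Vd (sm p) (sm p') ∷ []
          go₃ : det (sm p) (hh p') ≢ ℤ.0ℤ → det (sm p) (mm p') ≢ ℤ.0ℤ → Dec (det (sm p) (sm p') ≡ ℤ.0ℤ) → U5 p p' ≤ UZ p + (k6 + X3 p p')
          go₃ n₁ n₂ (yes z) = bad p p' (≡≤ (sym (χ-0 z)) ≤⟨⟩ by (nn+ (0≤χ (det (sm p) (hh p'))) (0≤χ (det (sm p) (mm p')))) (l₃ x₁ x₂ x₃))
          go₃ n₁ n₂ (no n₃) = ≡≤ (U5≡ p p') ≤⟨⟩ U-under (D1 (mm p)) (D1 (hh p) ∷ V3) (D1 (hh p) ∷ ZZ) X (λ Y bY → U-under (D1 (hh p)) V3 ZZ Y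
                      (c3 (Vd (sm p) (hh p')) (Vd (sm p) (mm p')) (Vd (sm p) (sm p')) (absV (sm p) (hh p') sp hp' n₁) (absV (sm p) (mm p') sp mp' n₂) (absV (sm p) (sm p') sp sp' n₃)) bY) bX ≤⟨⟩
                    +l (UZ p) (by (nn+ (0≤χ (det (sm p) (hh p'))) (nn+ (0≤χ (det (sm p) (mm p'))) (0≤χ (det (sm p) (sm p'))))) refl)
          go₂ : det (sm p) (hh p') ≢ ℤ.0ℤ → Dec (det (sm p) (mm p') ≡ ℤ.0ℤ) → U5 p p' ≤ UZ p + (k6 + X3 p p')
          go₂ n₁ (yes z) = bad p p' (≡≤ (sym (χ-0 z)) ≤⟨⟩ by (nn+ (0≤χ (det (sm p) (hh p'))) (0≤χ (det (sm p) (sm p')))) (l₂ x₁ x₂ x₃))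
          go₂ n₁ (no n₂) = go₃ n₁ n₂ (det (sm p) (sm p') ℤP.≟ ℤ.0ℤ)
          go₁ : Dec (det (sm p) (hh p') ≡ ℤ.0ℤ) → U5 p p' ≤ UZ p + (k6 + X3 p p')
          go₁ (yes z) = bad p p' (≡≤ (sym (χ-0 z)) ≤⟨⟩ by (nn+ (0≤χ (det (sm p) (mm p'))) (0≤χ (det (sm p) (sm p')))) refl)
          go₁ (no n₁) = go₂ n₁ (det (sm p) (mm p') ℤP.≟ ℤ.0ℤ)

        χ-neg : ∀ z → χ (ℤ.- z) ≡ χ z
        χ-neg z = case z ℤP.≟ ℤ.0ℤ of λ
          { (yes refl) → refl
          ; (no n) → trans (χ-n (λ e → n (trans (sym (ℤP.neg-involutive z)) (cong ℤ.-_ e)))) (sym (χ-n n)) }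

        χ-anti : ∀ u w → χ (det u w) ≡ χ (det w u)
        χ-anti (a , b) (c , d) = trans (cong χ (l a b c d)) (χ-neg (c ℤ.* b ℤ.- d ℤ.* a))
          where l : ∀ a b c d → a ℤ.* d ℤ.- b ℤ.* c ≡ ℤ.- (c ℤ.* b ℤ.- d ℤ.* a)
                l = ℤS.solve-∀

        sm-c : ∀ σ₀ σ₁ ρ₀ ρ₁ → sm (pt σ₀ σ₁ ρ₀ ρ₁) ≡ ρ₁ ⊝ (ρ₀ ⊝ (σ₁ ⊝ σ₀))
        sm-c (a , a') (b , b') (c , c') (d , d') = cong₂ _,_ (l a b c d) (l a' b' c' d')
          where l : ∀ a b c d → (d ℤ.- c) ℤ.+ (b ℤ.- a) ≡ d ℤ.- (c ℤ.- (b ℤ.- a))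
                l = ℤS.solve-∀

        -- ρ₁ enters `sm p` but not `u p'`. With everything else fixed it is a fresh digit vector,
        -- as `detP` requires.
        Pχ : ∀ (u : Pt → ℤ²) → E PM (λ p' → χ (proj₁ (u p'))) ≤ κ → E PM (λ p → E PM (λ p' → χ (det (sm p) (u p')))) ≤ 2ℚ * κ
        Pχ u h = E-≤c D (λ σ₀ → E-≤c D (λ σ₁ → E-≤c D (λ ρ₀ →
           ≡≤ (trans (E-swap D PM (λ ρ₁ p' → χ (det (sm (pt σ₀ σ₁ ρ₀ ρ₁)) (u p')))) (E-cong PM (λ p' → E-cong D (λ ρ₁ → trans (χ-anti (sm (pt σ₀ σ₁ ρ₀ ρ₁)) (u p')) (cong (λ z → χ (det (u p') z)) (sm-c σ₀ σ₁ ρ₀ ρ₁)))))) ≤⟨⟩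
           detP r PM u (λ _ → ρ₀ ⊝ (σ₁ ⊝ σ₀)) h)))

        X3≤ : E PM (λ p → E PM (λ p' → X3 p p')) ≤ k6
        X3≤ = ≡≤ (trans (E-cong PM (λ p → trans (E-+ PM _ _) (cong (E PM (λ p' → χ (det (sm p) (hh p'))) +_) (E-+ PM _ _)))) (trans (E-+ PM _ _) (cong (E PM (λ p → E PM (λ p' → χ (det (sm p) (hh p')))) +_) (E-+ PM _ _)))) ≤⟨⟩
          (Pχ hh (E-≤c D (λ σ₀ → E-≤c D (λ σ₁ → E-≤c D (λ ρ₀ → fstχ r (proj₁ ρ₀))))) +≤
           (Pχ mm (E-≤c D (λ σ₀ → ≡≤ (E-cong D (λ σ₁ → trans (E-cong D (λ ρ₀ → E-const D _)) (E-const D _))) ≤⟨⟩ fstχ r (proj₁ σ₀))) +≤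
            Pχ sm (E-≤c D (λ σ₀ → E-≤c D (λ σ₁ → E-≤c D (λ ρ₀ → ≡≤ (E-cong D (λ ρ₁ → cong (λ z → χ (proj₁ z)) (sm-c σ₀ σ₁ ρ₀ ρ₁))) ≤⟨⟩ fstχ r (proj₁ (ρ₀ ⊝ (σ₁ ⊝ σ₀))))))))) ≤⟨⟩ ≡≤ (sym (ℚP.+-assoc (2ℚ * κ) (2ℚ * κ) (2ℚ * κ)))

        z3 : ℚ
        z3 = E (DD r) (λ h → E (DD r) (λ m → U (D1 m ∷ D1 h ∷ ZZ) X))

        z3≡ : E PM UZ ≡ z3
        z3≡ = trans (E-cong D (λ σ₀ → E-cong D (λ σ₁ → sym (E-DD r (λ h → U (D1 (σ₁ ⊝ σ₀) ∷ D1 h ∷ ZZ) X)))))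
           (trans (sym (E-DD r (λ m → E (DD r) (λ h → U (D1 m ∷ D1 h ∷ ZZ) X)))) (E-swap (DD r) (DD r) (λ m h → U (D1 m ∷ D1 h ∷ ZZ) X)))

        z3nn : 0ℚ ≤ z3
        z3nn = E-≥c (DD r) (λ h → E-≥c (DD r) (λ m → U-nn (D1 m) (D1 h ∷ ZZ) X))

        z2≤ : z2 ≤ z3 + ι 12 * κ
        z2≤ = E-monoS PM (supp-map PM (λ p sp → E-monoS PM (supp-map PM (λ p' sp' → U5≤ p p' sp sp') PM-supp)) PM-supp) ≤⟨⟩
          ≡≤ (trans (E-cong PM (λ p → trans (E-+ PM _ _) (cong₂ _+_ (E-const PM (UZ p)) (trans (E-+ PM _ _) (cong (_+ E PM (X3 p)) (E-const PM k6))))))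
              (trans (E-+ PM UZ (λ p → k6 + E PM (X3 p))) (cong₂ _+_ z3≡ (trans (E-+ PM _ _) (cong (_+ E PM (λ p → E PM (X3 p))) (E-const PM k6)))))) ≤⟨⟩
          +l z3 (+l k6 X3≤ ≤⟨⟩ ≡≤ (l κ))
          where
          l : ∀ κ → (2ℚ * κ + 2ℚ * κ + 2ℚ * κ) + (2ℚ * κ + 2ℚ * κ + 2ℚ * κ) ≡ ι 12 * κ
          l = solve-∀ ℚR

        step4 : pw 8 Λ ≤ ι kP3 * (z3 + κ)
        step4 = ≡≤ (sym (pw-0 _)) ≤⟨⟩ le-trans κ0 κ1 0 {kP2} {12} {pw 8 Λ} {z2} {z3} (pw-nn' 7 Λ) z3nn step3
          (≡≤ (pw-0 z2) ≤⟨⟩ z2≤ ≤⟨⟩ by (nn* (0≤ι 11) z3nn) (l z3 κ))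
          where
          l : ∀ z κ → ι 12 * (z + κ) ≡ z + ι 12 * κ + ι 11 * z
          l = solve-∀ ℚR

        z4 : ℚ
        z4 = E (DD r) (λ h → U (Z ∷ D1 h ∷ ZZ) X)

        step5 : pw 10 Λ ≤ ι kP4 * (z4 + κ)
        step5 = ≡≤ (pw-+ 8 2 Λ) ≤⟨⟩ le-trans κ0 κ1 2 {kP3} {kC} {pw 8 Λ} {z3} {z4} (pw-nn' 7 Λ) (E-≥c (DD r) (λ h → U-nn Z (D1 h ∷ ZZ) X)) step4
          (pw-jensen 2 (DD r) _ ≤⟨⟩ E-mono (DD r) (λ h → concat-U r b L (ℤ.+ 2) ℓ (D1 h ∷ ZZ) bX cond ℓB) ≤⟨⟩ ≡≤ (E-aff (DD r) (ι kC) κ (λ h → U (Z ∷ D1 h ∷ ZZ) X)))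

      -- The directions `mm p` and `hh p` that are still random are independent digit differences,
      -- and `concat-U` is applied to one after the other. The exponent 12 counts 2 + 1 + 5 + 2 + 2
      -- squarings.
      pet : pw 12 Λ ≤ ι kP * (U (Z ∷ Z ∷ Z ∷ Z ∷ Z ∷ []) X + κ)
      pet = ≡≤ (pw-+ 10 2 Λ) ≤⟨⟩ le-trans κ0 κ1 2 {kP4} {kC} {pw 10 Λ} {z4} {U (Z ∷ Z ∷ ZZ) X} (pw-nn' 9 Λ) (U-nn Z (Z ∷ ZZ) X) step5
        (≡≤ (cong (pw 2) (sym (swap3 Z Z (DD r) (λ c c' h → U (D1 h ∷ ZZ) (Δ c c' X))))) ≤⟨⟩
         pw-under Z 2 (ι kC) κ (λ Y → E (DD r) (λ h → U (D1 h ∷ ZZ) Y)) (U (Z ∷ ZZ)) X (λ Y bY → concat-U r b L (ℤ.+ 2) ℓ ZZ bY cond ℓB) bX)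
open PETInduction

-- Dual functions are almost invariant along a progression.

module OneDimensional where
  -- A mean on ℤ is at stage (q , A) if it absorbs q·t whenever |t|·A ≤ M².
  record St : Set where
    constructor st
    field
      qs : ℤ
      As : ℕ
  open St public

  E-bdS : {A : Set} (μ : Mean A) (f : A → ℚ) → Supp μ (λ a → Bd (f a)) → Bd (E μ f)
  E-bdS μ f h = (≡≤ (sym (E-const μ (- 1ℚ))) ≤⟨⟩ E-monoS μ (supp-map μ (λ _ → proj₁) h)) , (E-monoS μ (supp-map μ (λ _ → proj₂) h) ≤⟨⟩ ≡≤ (E-const μ 1ℚ))

  k4 k3 k2 k1 k1D : ℕ
  k4 = trK 7 kP kL
  k3 = trK 6 k4 kL
  k2 = trK 5 k3 kL
  k1 = trK 4 k2 kL
  k1D = pwℕ 34 4 ℕ.* (3 ℕ.* k1)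

  module Par (r : ℕ) where
    R = suc r

    Ok : St → Set
    Ok s = (1 ℕ.≤ ℤ.∣ qs s ∣) × (1 ℕ.≤ As s)

    abstract
      Ec : ℕ
      Ec = Qr r ℕ.* Dr r ℕ.* (4 ℕ.* R)

      Ec≡ : ∀ B → Qr r ℕ.* B ℕ.* Dr r ℕ.* (4 ℕ.* R) ≡ Ec ℕ.* B
      Ec≡ B = l (Qr r) B (Dr r) R
        where l : ∀ q b d r → q ℕ.* b ℕ.* d ℕ.* (4 ℕ.* r) ≡ q ℕ.* d ℕ.* (4 ℕ.* r) ℕ.* b
              l = ℕS.solve-∀

      1≤Dr : 1 ℕ.≤ Dr r
      1≤Dr = ℕP.≤-trans (ℕ.s≤s ℕ.z≤n) (Dr-C4 r)

      2R≤Ec : R ℕ.+ R ℕ.≤ Ec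
      2R≤Ec = ℕP.≤-trans (ℕP.≤-trans (ℕP.m≤m+n (R ℕ.+ R) (R ℕ.+ R)) (ℕP.≤-reflexive (l R))) (ℕP.*-mono-≤ {1} {Qr r ℕ.* Dr r} (ℕP.*-mono-≤ (1≤Qr r) 1≤Dr) ℕP.≤-refl)
        where l : ∀ r → r ℕ.+ r ℕ.+ (r ℕ.+ r) ≡ 1 ℕ.* (4 ℕ.* r)
              l = ℕS.solve-∀

      1≤Ec : 1 ℕ.≤ Ec
      1≤Ec = ℕP.≤-trans (ℕ.s≤s ℕ.z≤n) 2R≤Ec

      c5 : ℕ
      c5 = 2 ℕ.* R ℕ.* Ec

      -- If M = `cS s`·B, the first summand lets the interval absorb q·x with x = j + val σ of size
      -- at most 2·Ec·B, and the second bounds the cofactor of D² - d²: the 6 comes from x ≤ 2·Ec·B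
      -- and 2d + qx ≤ 3M.
      cS : St → ℕ
      cS (st q A) = (4 ℕ.* R ℕ.* ℤ.∣ q ∣ ℕ.+ 6 ℕ.* A) ℕ.* Ec

      s5 : St
      s5 = st (ℤ.+ 2 ℤ.* ℤ.+ Qr r) (2 ℕ.* R ℕ.* (c5 ℕ.* c5))

      qs-s5 : qs s5 ≡ ℤ.+ 2 ℤ.* ℤ.+ Qr r
      qs-s5 = refl

      -- 2q²·Qr is the step produced by one lowering. The factor with `cS` makes the new direction
      -- good at this stage; the last factor makes every mean that was good at s good here too.
      next : St → St
      next s = st (ℤ.+ 2 ℤ.* qs s ℤ.* qs s ℤ.* ℤ.+ Qr r) (2 ℕ.* R ℕ.* (cS s ℕ.* cS s) ℕ.* (2 ℕ.* ℤ.∣ qs s ∣ ℕ.* Qr r ℕ.* As s))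

      qs-next : ∀ s → qs (next s) ≡ ℤ.+ 2 ℤ.* qs s ℤ.* qs s ℤ.* ℤ.+ Qr r
      qs-next s = refl

      Ec-def : Ec ≡ Qr r ℕ.* Dr r ℕ.* (4 ℕ.* R)
      Ec-def = refl

      c5-def : c5 ≡ 2 ℕ.* R ℕ.* Ec
      c5-def = refl

      cS-def : ∀ s → cS s ≡ (4 ℕ.* R ℕ.* ℤ.∣ qs s ∣ ℕ.+ 6 ℕ.* As s) ℕ.* Ec
      cS-def s = refl

      As-s5 : As s5 ≡ 2 ℕ.* R ℕ.* (c5 ℕ.* c5)
      As-s5 = refl

      As-next : ∀ s → As (next s) ≡ 2 ℕ.* R ℕ.* (cS s ℕ.* cS s) ℕ.* (2 ℕ.* ℤ.∣ qs s ∣ ℕ.* Qr r ℕ.* As s)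
      As-next s = refl

      ok5 : Ok s5
      ok5 = subst (1 ℕ.≤_) (sym (ℤP.abs-* (ℤ.+ 2) (ℤ.+ Qr r))) (ℕP.*-mono-≤ {1} {2} (ℕ.s≤s ℕ.z≤n) (1≤Qr r)) ,
        ℕP.*-mono-≤ {1} {2 ℕ.* R} (ℕ.s≤s ℕ.z≤n) (ℕP.*-mono-≤ 1≤c5 1≤c5)
        where
        1≤c5 : 1 ℕ.≤ c5
        1≤c5 = ℕP.*-mono-≤ {1} {2 ℕ.* R} (ℕ.s≤s ℕ.z≤n) 1≤Ec

      1≤cS : ∀ s → Ok s → 1 ℕ.≤ cS s
      1≤cS (st q A) (a , b) = ℕP.*-mono-≤ {1} (ℕP.≤-trans (ℕP.*-mono-≤ {1} {6} (ℕ.s≤s ℕ.z≤n) b) (ℕP.m≤n+m (6 ℕ.* A) (4 ℕ.* R ℕ.* ℤ.∣ q ∣))) 1≤Ec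

      abs-next : ∀ s → ℤ.∣ qs (next s) ∣ ≡ 2 ℕ.* ℤ.∣ qs s ∣ ℕ.* ℤ.∣ qs s ∣ ℕ.* Qr r
      abs-next (st q A) = trans (ℤP.abs-* (ℤ.+ 2 ℤ.* q ℤ.* q) (ℤ.+ Qr r)) (cong (ℕ._* Qr r) (trans (ℤP.abs-* (ℤ.+ 2 ℤ.* q) q) (cong (ℕ._* ℤ.∣ q ∣) (ℤP.abs-* (ℤ.+ 2) q))))

      ok-next : ∀ s → Ok s → Ok (next s)
      ok-next s o@(a , b) = subst (1 ℕ.≤_) (sym (abs-next s)) (ℕP.*-mono-≤ {1} (ℕP.*-mono-≤ {1} (ℕP.*-mono-≤ {1} {2} (ℕ.s≤s ℕ.z≤n) a) a) (1≤Qr r)) ,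
        ℕP.*-mono-≤ {1} (ℕP.*-mono-≤ {1} {2 ℕ.* R} (ℕ.s≤s ℕ.z≤n) (ℕP.*-mono-≤ (1≤cS s o) (1≤cS s o))) (ℕP.*-mono-≤ {1} (ℕP.*-mono-≤ {1} (ℕP.*-mono-≤ {1} {2} (ℕ.s≤s ℕ.z≤n) a) (1≤Qr r)) b)

    module WithM (m : ℕ) where
      M = suc m
      κ = rec r

      record Good (μ : Mean ℤ) (s : St) : Set where
        constructor good
        field gd : ∀ t → ℤ.∣ t ∣ ℕ.* As s ℕ.≤ M ℕ.* M → Abs μ (qs s ℤ.* t) κ
      open Good public

      abs-Iv≤ : ∀ x → ℤ.∣ x ∣ ℕ.* (2 ℕ.* R) ℕ.≤ M → Abs (Iv m) x κ
      abs-Iv≤ x p = abs-weaken (recle ℤ.∣ x ∣ m r (subst (ℕ._≤ M) (sym (ℕP.*-assoc ℤ.∣ x ∣ 2 R)) p)) (abs-Iv* m x)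

      dir-good : ∀ u ℓ t → ℤ.∣ t ∣ ℕ.* (2 ℕ.* R) ℕ.≤ suc ℓ → Abs (dir1 u ℓ) (u ℤ.* t) κ
      dir-good u ℓ t p = subst (λ z → Abs (dir1 u ℓ) z κ) (ℤP.*-comm t u)
        (abs-weaken (recle ℤ.∣ t ∣ ℓ r (subst (ℕ._≤ suc ℓ) (sym (ℕP.*-assoc ℤ.∣ t ∣ 2 R)) p)) (abs-ℤ* (dir1 u ℓ) t (abs-dir1 u ℓ)))

      scale : ∀ t A c B → 1 ℕ.≤ c → M ≡ c ℕ.* B → 2 ℕ.* R ℕ.* (c ℕ.* c) ℕ.≤ A → t ℕ.* A ℕ.≤ M ℕ.* M → t ℕ.* (2 ℕ.* R) ℕ.≤ B ℕ.* B
      scale t A c B 1c e h p = ℕP.*-cancelʳ-≤ (t ℕ.* (2 ℕ.* R)) (B ℕ.* B) (c ℕ.* c) {{ℕ.>-nonZero (ℕP.*-mono-≤ 1c 1c)}}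
        (ℕP.≤-trans (ℕP.≤-reflexive (ℕP.*-assoc t (2 ℕ.* R) (c ℕ.* c))) (ℕP.≤-trans (ℕP.*-monoʳ-≤ t h) (ℕP.≤-trans p (ℕP.≤-reflexive (trans (cong₂ ℕ._*_ e e) (l c B))))))
        where l : ∀ c b → c ℕ.* b ℕ.* (c ℕ.* b) ≡ b ℕ.* b ℕ.* (c ℕ.* c)
              l = ℕS.solve-∀

      val≤ : ∀ b s → Small R s → ℤ.∣ val (suc b) s ∣ ℕ.≤ Ec ℕ.* suc b
      val≤ b (x , y) (p ,, q) = ℕP.≤-trans (ℤP.∣i+j∣≤∣i∣+∣j∣ (ℤ.+ suc b ℤ.* x) y) (ℕP.≤-trans
        (ℕP.+-mono-≤ (subst (ℕ._≤ suc b ℕ.* R) (sym (ℤP.abs-* (ℤ.+ suc b) x)) (ℕP.*-monoʳ-≤ (suc b) p)) (ℕP.≤-trans q (ℕP.m≤n*m R (suc b))))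
        (ℕP.≤-trans (ℕP.≤-reflexive (trans (sym (ℕP.*-distribˡ-+ (suc b) R R)) (ℕP.*-comm (suc b) (R ℕ.+ R)))) (ℕP.*-monoˡ-≤ (suc b) 2R≤Ec)))

      Iv≤ : ∀ n → Supp (Iv n) (λ d → ℤ.∣ d ∣ ℕ.≤ suc n)
      Iv≤ n = supp-map (Iv n) (λ { d (k , refl , p) → ℕ.s≤s p }) (Iv-supp n)

      good-next : ∀ s {μ} → Ok s → Good μ s → Good μ (next s)
      gd (good-next s {μ} o g) t p = subst (λ z → Abs μ z κ) (trans (l (qs s) (ℤ.+ Qr r) t) (cong (ℤ._* t) (sym (qs-next s)))) (gd g (ℤ.+ 2 ℤ.* qs s ℤ.* ℤ.+ Qr r ℤ.* t) (gn s o p))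
        where
        l : ∀ q Q t → q ℤ.* (ℤ.+ 2 ℤ.* q ℤ.* Q ℤ.* t) ≡ ℤ.+ 2 ℤ.* q ℤ.* q ℤ.* Q ℤ.* t
        l = ℤS.solve-∀
        abstract
          gn : ∀ s → Ok s → ℤ.∣ t ∣ ℕ.* As (next s) ℕ.≤ M ℕ.* M → ℤ.∣ ℤ.+ 2 ℤ.* qs s ℤ.* ℤ.+ Qr r ℤ.* t ∣ ℕ.* As s ℕ.≤ M ℕ.* M
          gn s o p = ℕP.≤-trans (ℕP.≤-reflexive (trans (cong (ℕ._* As s) (trans (ℤP.abs-* (ℤ.+ 2 ℤ.* qs s ℤ.* ℤ.+ Qr r) t) (cong (ℕ._* ℤ.∣ t ∣) (trans (ℤP.abs-* (ℤ.+ 2 ℤ.* qs s) (ℤ.+ Qr r)) (cong (ℕ._* Qr r) (ℤP.abs-* (ℤ.+ 2) (qs s)))))))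
               (l' (2 ℕ.* ℤ.∣ qs s ∣ ℕ.* Qr r) ℤ.∣ t ∣ (As s))))
            (ℕP.≤-trans (ℕP.*-monoʳ-≤ ℤ.∣ t ∣ (ℕP.≤-trans (ℕP.≤-reflexive (sym (ℕP.*-identityˡ _))) (ℕP.*-monoˡ-≤ _ (ℕP.*-mono-≤ {1} {2 ℕ.* R} (ℕ.s≤s ℕ.z≤n) (ℕP.*-mono-≤ (1≤cS s o) (1≤cS s o)))))) p)
            where l' : ∀ x t a → x ℕ.* t ℕ.* a ≡ t ℕ.* (x ℕ.* a)
                  l' = ℕS.solve-∀

      module _ (S : Sys) where
        open Sys S
        open Dyn S
        open Lower S
        open Lowering S
        open PET S

        record Stage (s : St) : Set where
          constructor stg
          field
            bB : ℕ
            M≡ : M ≡ cS s ℕ.* suc bB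
            okS : Ok s
        open Stage public

        Jn : ℕ → ℕ
        Jn b = ℕ.pred (Ec ℕ.* suc b)

        Jn≡ : ∀ b → suc (Jn b) ≡ Ec ℕ.* suc b
        Jn≡ b = ℕP.suc-pred (Ec ℕ.* suc b) {{ℕ.>-nonZero (ℕP.*-mono-≤ 1≤Ec (ℕ.s≤s (ℕ.z≤n {b})))}}

        -- (b + 1)² - 1, written so that its successor computes to `suc b ℕ.* suc b`.
        ℓn : ℕ → ℕ
        ℓn b = b ℕ.+ b ℕ.* suc b

        condJ : ∀ b → Cond r b (Jn b)
        condJ b = ℕP.≤-reflexive (trans (Ec≡ (suc b)) (sym (Jn≡ b)))

        Zs : ∀ s → Stage s → Mean ℤ
        Zs s g = dir1 (ℤ.+ 2 ℤ.* qs s ℤ.* qs s ℤ.* ℤ.+ Qr r) (ℓn (bB g))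

        goodZ : ∀ s (g : Stage s) → Good (Zs s g) (next s)
        gd (goodZ s g) t p = subst (λ z → Abs (Zs s g) (z ℤ.* t) κ) (sym (qs-next s))
          (dir-good (ℤ.+ 2 ℤ.* qs s ℤ.* qs s ℤ.* ℤ.+ Qr r) (ℓn (bB g)) t (scale ℤ.∣ t ∣ (As (next s)) (cS s) (suc (bB g)) (1≤cS s (okS g)) (M≡ g) (An s (okS g)) p))
          where
          abstract
            An : ∀ s → Ok s → 2 ℕ.* R ℕ.* (cS s ℕ.* cS s) ℕ.≤ As (next s)
            An s (a , b) = ℕP.≤-trans (ℕP.≤-reflexive (sym (ℕP.*-identityʳ _))) (ℕP.*-monoʳ-≤ (2 ℕ.* R ℕ.* (cS s ℕ.* cS s)) (ℕP.*-mono-≤ {1} (ℕP.*-mono-≤ {1} (ℕP.*-mono-≤ {1} {2} (ℕ.s≤s ℕ.z≤n) a) (1≤Qr r)) b))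

        module _ (k : ℤ) (k≤ : ℤ.∣ k ∣ ℕ.≤ M) where
          -- With x = j + val σ, D² - d² = q·x(2d + qx) and 2kqx are multiples of q, and their
          -- cofactors stay within the range M²/A in which a good mean absorbs.
          absorbing : ∀ s (g : Stage s) μ₁ μ₂ → Good μ₁ s → Good μ₂ s → Absorbing r m k (qs s) (suc (bB g)) (Jn (bB g)) μ₁ μ₂
          absorbing s g μ₁ μ₂ g₁ g₂ = record
            { absM = supp-map (Iv J) (λ j pj → supp-map (DS r) (λ σ pσ → abs-Iv≤ (q ℤ.* (j ℤ.+ val B σ)) (num1 j σ pj pσ)) (DS-supp r)) (Iv≤ J)
            ; absδ₁ = supp-map (Iv J) (λ j pj → supp-map (DS r) (λ σ pσ → supp-map (Iv m) (λ d pd → aδ μ₁ g₁ j σ d pj pσ pd) (Iv≤ m)) (DS-supp r)) (Iv≤ J)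
            ; absδ₂ = supp-map (Iv J) (λ j pj → supp-map (DS r) (λ σ pσ → supp-map (Iv m) (λ d pd → aδ μ₂ g₂ j σ d pj pσ pd) (Iv≤ m)) (DS-supp r)) (Iv≤ J)
            ; absk = supp-map (Iv J) (λ j pj → supp-map (DS r) (λ σ pσ → subst (λ z → Abs μ₂ z κ) (l2 q k (j ℤ.+ val B σ)) (gd g₂ (ℤ.+ 2 ℤ.* k ℤ.* (j ℤ.+ val B σ)) (num3 j σ pj pσ))) (DS-supp r)) (Iv≤ J) }
            where
            q = qs s
            J = Jn (bB g)
            B = suc (bB g)
            EB = Ec ℕ.* B
            l1 : ∀ q d x → q ℤ.* (x ℤ.* (ℤ.+ 2 ℤ.* d ℤ.+ q ℤ.* x)) ≡ (d ℤ.+ q ℤ.* x) ℤ.* (d ℤ.+ q ℤ.* x) ℤ.- d ℤ.* d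
            l1 = ℤS.solve-∀
            l2 : ∀ q k x → q ℤ.* (ℤ.+ 2 ℤ.* k ℤ.* x) ≡ ℤ.+ 2 ℤ.* k ℤ.* (q ℤ.* x)
            l2 = ℤS.solve-∀
            jv : ∀ j σ → ℤ.∣ j ∣ ℕ.≤ suc J → Small R σ → ℤ.∣ j ℤ.+ val B σ ∣ ℕ.≤ EB ℕ.+ EB
            jv j σ p q = ℕP.≤-trans (ℤP.∣i+j∣≤∣i∣+∣j∣ j (val B σ)) (ℕP.+-mono-≤ (subst (ℤ.∣ j ∣ ℕ.≤_) (Jn≡ (bB g)) p) (val≤ (bB g) σ q))
            abstract
              M-big : ∀ s' → cS s' ℕ.* B ≡ (4 ℕ.* R ℕ.* ℤ.∣ qs s' ∣ ℕ.+ 6 ℕ.* As s') ℕ.* (Ec ℕ.* B)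
              M-big (st q A) = ℕP.*-assoc (4 ℕ.* R ℕ.* ℤ.∣ q ∣ ℕ.+ 6 ℕ.* A) Ec B
            Mb : M ≡ (4 ℕ.* R ℕ.* ℤ.∣ q ∣ ℕ.+ 6 ℕ.* As s) ℕ.* EB
            Mb = trans (M≡ g) (M-big s)
            num1 : ∀ j σ → ℤ.∣ j ∣ ℕ.≤ suc J → Small R σ → ℤ.∣ q ℤ.* (j ℤ.+ val B σ) ∣ ℕ.* (2 ℕ.* R) ℕ.≤ M
            num1 j σ pj pσ = ℕP.≤-trans (ℕP.*-monoˡ-≤ (2 ℕ.* R) (ℕP.≤-trans (ℕP.≤-reflexive (ℤP.abs-* q (j ℤ.+ val B σ))) (ℕP.*-monoʳ-≤ ℤ.∣ q ∣ (jv j σ pj pσ))))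
              (ℕP.≤-trans (ℕP.≤-reflexive (l ℤ.∣ q ∣ EB R)) (ℕP.≤-trans (ℕP.*-monoˡ-≤ EB (ℕP.m≤m+n (4 ℕ.* R ℕ.* ℤ.∣ q ∣) (6 ℕ.* As s))) (ℕP.≤-reflexive (sym Mb))))
              where l : ∀ q e r → q ℕ.* (e ℕ.+ e) ℕ.* (2 ℕ.* r) ≡ 4 ℕ.* r ℕ.* q ℕ.* e
                    l = ℕS.solve-∀
            6AE : 6 ℕ.* As s ℕ.* EB ℕ.≤ M
            6AE = ℕP.≤-trans (ℕP.*-monoˡ-≤ EB (ℕP.m≤n+m (6 ℕ.* As s) (4 ℕ.* R ℕ.* ℤ.∣ q ∣))) (ℕP.≤-reflexive (sym Mb))
            qx≤M : ∀ j σ → ℤ.∣ j ∣ ℕ.≤ suc J → Small R σ → ℤ.∣ q ℤ.* (j ℤ.+ val B σ) ∣ ℕ.≤ M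
            qx≤M j σ pj pσ = ℕP.≤-trans (ℕP.m≤m*n ℤ.∣ q ℤ.* (j ℤ.+ val B σ) ∣ (2 ℕ.* R)) (num1 j σ pj pσ)
            fin : ∀ x y → ℤ.∣ x ∣ ℕ.≤ EB ℕ.+ EB → ℤ.∣ y ∣ ℕ.≤ M ℕ.+ M ℕ.+ M → ℤ.∣ x ℤ.* y ∣ ℕ.* As s ℕ.≤ M ℕ.* M
            fin x y px py = ℕP.≤-trans (ℕP.*-monoˡ-≤ (As s) (ℕP.≤-trans (ℕP.≤-reflexive (ℤP.abs-* x y)) (ℕP.*-mono-≤ px py)))
              (ℕP.≤-trans (ℕP.≤-reflexive (l EB M (As s))) (ℕP.*-monoˡ-≤ M 6AE))
              where l : ∀ e m a → (e ℕ.+ e) ℕ.* (m ℕ.+ m ℕ.+ m) ℕ.* a ≡ 6 ℕ.* a ℕ.* e ℕ.* m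
                    l = ℕS.solve-∀
            aδ : ∀ μ → Good μ s → ∀ j σ d → ℤ.∣ j ∣ ℕ.≤ suc J → Small R σ → ℤ.∣ d ∣ ℕ.≤ M →
              Abs μ ((d ℤ.+ q ℤ.* (j ℤ.+ val B σ)) ℤ.* (d ℤ.+ q ℤ.* (j ℤ.+ val B σ)) ℤ.- d ℤ.* d) κ
            aδ μ gμ j σ d pj pσ pd = subst (λ z → Abs μ z κ) (l1 q d (j ℤ.+ val B σ)) (gd gμ ((j ℤ.+ val B σ) ℤ.* (ℤ.+ 2 ℤ.* d ℤ.+ q ℤ.* (j ℤ.+ val B σ))) (fin (j ℤ.+ val B σ) (ℤ.+ 2 ℤ.* d ℤ.+ q ℤ.* (j ℤ.+ val B σ)) (jv j σ pj pσ)
               (ℕP.≤-trans (ℤP.∣i+j∣≤∣i∣+∣j∣ (ℤ.+ 2 ℤ.* d) (q ℤ.* (j ℤ.+ val B σ))) (ℕP.+-mono-≤ (ℕP.≤-trans (ℕP.≤-reflexive (ℤP.abs-* (ℤ.+ 2) d)) (ℕP.≤-trans (ℕP.*-monoʳ-≤ 2 pd) (ℕP.≤-reflexive (l M)))) (qx≤M j σ pj pσ)))))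
              where l : ∀ m → 2 ℕ.* m ≡ m ℕ.+ m
                    l = ℕS.solve-∀
            num3 : ∀ j σ → ℤ.∣ j ∣ ℕ.≤ suc J → Small R σ → ℤ.∣ ℤ.+ 2 ℤ.* k ℤ.* (j ℤ.+ val B σ) ∣ ℕ.* As s ℕ.≤ M ℕ.* M
            num3 j σ pj pσ = subst (λ z → ℤ.∣ z ∣ ℕ.* As s ℕ.≤ M ℕ.* M) (ℤP.*-comm (j ℤ.+ val B σ) (ℤ.+ 2 ℤ.* k)) (fin (j ℤ.+ val B σ) (ℤ.+ 2 ℤ.* k) (jv j σ pj pσ)
                (ℕP.≤-trans (ℕP.≤-reflexive (ℤP.abs-* (ℤ.+ 2) k)) (ℕP.≤-trans (ℕP.*-monoʳ-≤ 2 k≤) (ℕP.≤-trans (ℕP.≤-reflexive (l M)) (ℕP.m≤m+n (M ℕ.+ M) M)))))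
              where l : ∀ m → 2 ℕ.* m ≡ m ℕ.+ m
                    l = ℕS.solve-∀

          dual-↑ : ∀ g₁ g₂ a ω → (dual m k g₁ g₂ ↑ a) ω ≡ dual m k (g₁ ↑ a) (g₂ ↑ a) ω
          dual-↑ g₁ g₂ a ω = E-cong (Iv m) (λ d → cong₂ _*_ (c g₁ (d ℤ.* d)) (c g₂ ((d ℤ.+ k) ℤ.* (d ℤ.+ k))))
            where
            c : ∀ (g : Fn) x → g ((ω ⊕ a) ⊕ x) ≡ g ((ω ⊕ x) ⊕ a)
            c g x = trans (sh g ω a x refl) (sym (sh g ω x a (ℤP.+-comm x a)))

          -- A box norm of X is the Gowers product with X at every vertex. Writing X at one vertex
          -- as a signed average of translates of a dual function, which are again dual functions,
          -- makes `lower` applicable.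
          module Chain (g₁ g₂ : Fn) (b₁ : BdF g₁) (b₂ : BdF g₂) (Sg : Mean (ℚ × ℤ)) (bS : Supp Sg (λ { (s , a) → Bd s }))
                       (X : Fn) (bX : BdF X) (X≡ : ∀ ω → X ω ≡ E Sg (λ { (s , a) → s * dual m k g₁ g₂ (ω ⊕ a) })) where
            F = dual m k g₁ g₂

            lowU : ∀ s (g : Stage s) μ₁ μ₂ μs → Good μ₁ s → Good μ₂ s → pw (length μs ℕ.+ 4) (U (μ₁ ∷ μ₂ ∷ μs) X) ≤ ι kL * (U (Zs s g ∷ μs) X + κ)
            lowU s g μ₁ μ₂ μs h₁ h₂ = ≡≤ (cong (pw (n ℕ.+ 4)) e) ≤⟨⟩ pw-jensen (n ℕ.+ 4) Sg _ ≤⟨⟩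
              E-monoS Sg (supp-map Sg (λ { (s' , a) bs → ptw s' a bs }) bS) ≤⟨⟩ ≡≤ (E-const Sg _)
              where
              n = length μs
              mus = μ₁ ∷ μ₂ ∷ μs
              e : U mus X ≡ E Sg (λ { (s , a) → s * V mus (F ↑ a) X })
              e = trans (sym (V-U mus X)) (trans (V-cong mus X X≡) (trans (V-E Sg mus (λ { (s , a) ω → s * F (ω ⊕ a) }) X) (E-cong Sg (λ { (s , a) → V-* s mus (F ↑ a) X }))))
              pwbd : ∀ N s' x → Bd s' → pw (suc N) (s' * x) ≤ pw (suc N) x
              pwbd N s' x bs = ≡≤ (pw-* (suc N) s' x) ≤⟨⟩ *mono' (pw (suc N) x) (pw-nn' N x) (proj₂ (pw-bd (suc N) bs)) ≤⟨⟩ ≡≤ (ℚP.*-identityˡ _)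
              ptw : ∀ s' a → Bd s' → pw (n ℕ.+ 4) (s' * V mus (F ↑ a) X) ≤ ι kL * (U (Zs s g ∷ μs) X + κ)
              ptw s' a bs = ≡≤ (cong (λ N → pw N (s' * V mus (F ↑ a) X)) (ℕP.+-comm n 4)) ≤⟨⟩ pwbd (3 ℕ.+ n) s' (V mus (F ↑ a) X) bs ≤⟨⟩
                ≡≤ (trans (cong (λ N → pw N (V mus (F ↑ a) X)) (ℕP.+-comm 4 n)) (trans (cong (pw (n ℕ.+ 4)) (V-cong mus X (dual-↑ g₁ g₂ a)))
                   (trans (pw-+ n 4 _) (pw-+ 2 2 (pw n (V mus (dual m k (g₁ ↑ a) (g₂ ↑ a)) X)))))) ≤⟨⟩
                lower r m k (qs s) (bB g) (Jn (bB g)) (ℓn (bB g)) μ₁ μ₂ μs (g₁ ↑ a) (g₂ ↑ a) X (bd↑ a b₁) (bd↑ a b₂) bX (absorbing s g μ₁ μ₂ h₁ h₂) (condJ (bB g)) ℕP.≤-refl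

          module OneD (bs : ℕ) (M5 : M ≡ c5 ℕ.* suc bs) (g5 : Stage s5) (g4 : Stage (next s5)) (g3 : Stage (next (next s5))) (g2 : Stage (next (next (next s5))))
                      (G₁ G₂ : Fn) (b₁ : BdF G₁) (b₂ : BdF G₂) (Zm : Mean ℤ)
                      (hZ : Supp Zm (λ z → Σ ℤ λ t → (z ≡ qs (next (next (next (next s5)))) ℤ.* t) × (ℤ.∣ t ∣ ℕ.* As (next (next (next (next s5)))) ℕ.≤ M ℕ.* M))) where
            F = dual m k G₁ G₂

            bF : BdF F
            bF = bd-dual m k b₁ b₂

            Dn : ℚ
            Dn = E mΩ (λ ω → sq (F ω - P Zm F ω))

            -- The signs and shifts of (1 - P)(1 - P*)F, where P averages over `Zm` and P* over its
            -- negatives; the uniform mean over four terms supplies the factor 1/4.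
            four : ℤ → ℤ → Fin 4 → ℚ × ℤ
            four t t' zero = 1ℚ , ℤ.0ℤ
            four t t' (suc zero) = - 1ℚ , t
            four t t' (suc (suc zero)) = - 1ℚ , ℤ.- t'
            four t t' (suc (suc (suc zero))) = 1ℚ , t ℤ.- t'

            Sg : Mean (ℚ × ℤ)
            Sg = bind Zm (λ t → bind Zm (λ t' → uni 3 (four t t')))

            bdn : Bd (- 1ℚ)
            bdn = ℚP.≤-refl , ℚP.≤ᵇ⇒≤ _

            bS : Supp Sg (λ { (s , a) → Bd s })
            bS = supp-all Zm (λ t → supp-all Zm (λ t' → λ { zero → bd1 ; (suc zero) → bdn ; (suc (suc zero)) → bdn ; (suc (suc (suc zero))) → bd1 }))

            X : Fn
            X ω = E Sg (λ { (s , a) → s * F (ω ⊕ a) })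

            bX : BdF X
            bX ω = E-bdS Sg (λ { (s , a) → s * F (ω ⊕ a) }) (supp-map Sg {λ { (s , a) → Bd s }} (λ { (s , a) b → bd* {s} {F (ω ⊕ a)} b (bF (ω ⊕ a)) }) bS)

            open Chain G₁ G₂ b₁ b₂ Sg bS X bX (λ ω → refl) using (lowU)

            z5 : Mean ℤ
            z5 = dir1 (ℤ.+ 2 ℤ.* ℤ.+ Qr r) (ℓn bs)

            abstract
              c5-1 : 1 ℕ.≤ c5
              c5-1 = ℕP.*-mono-≤ {1} {2 ℕ.* R} (ℕ.s≤s ℕ.z≤n) 1≤Ec
              A5 : 2 ℕ.* R ℕ.* (c5 ℕ.* c5) ℕ.≤ As s5
              A5 = ℕP.≤-refl
              c5B : ∀ x → x ℕ.≤ Ec ℕ.* suc bs → x ℕ.* (2 ℕ.* R) ℕ.≤ c5 ℕ.* suc bs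
              c5B x p = ℕP.≤-trans (ℕP.*-monoˡ-≤ (2 ℕ.* R) p) (ℕP.≤-reflexive (l Ec (suc bs) R))
                where l : ∀ e b r → e ℕ.* b ℕ.* (2 ℕ.* r) ≡ 2 ℕ.* r ℕ.* e ℕ.* b
                      l = ℕS.solve-∀

            good5 : Good z5 s5
            gd good5 t p = subst (λ z → Abs z5 (z ℤ.* t) κ) (sym qs-s5) (dir-good (ℤ.+ 2 ℤ.* ℤ.+ Qr r) (ℓn bs) t (scale ℤ.∣ t ∣ (As s5) c5 (suc bs) c5-1 M5 A5 p))

            absI : ∀ x → ℤ.∣ x ∣ ℕ.≤ Ec ℕ.* suc bs → Abs (Iv m) x κ
            absI x p = abs-Iv≤ x (ℕP.≤-trans (c5B ℤ.∣ x ∣ p) (ℕP.≤-reflexive (sym M5)))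

            Λx : ℚ
            Λx = E mΩ (λ ω → X ω * F ω)

            p12 : pw 12 Λx ≤ ι kP * (U (z5 ∷ z5 ∷ z5 ∷ z5 ∷ z5 ∷ []) X + κ)
            p12 = pet r m k bs (Jn bs) (ℓn bs) X G₁ G₂ bX b₁ b₂ (condJ bs) ℕP.≤-refl
              (supp-map (Iv (Jn bs)) (λ x p → absI x (ℕP.≤-trans p (ℕP.≤-reflexive (Jn≡ bs)))) (Iv≤ (Jn bs)))
              (supp-map (DS r) (λ σ p → absI (val (suc bs) σ) (val≤ bs σ p)) (DS-supp r))

            s4 = next s5
            s3 = next s4
            s2 = next s3
            s1 = next s2
            y4 y3 y2 y1 : Mean ℤ
            y4 = Zs s5 g5
            y3 = Zs s4 g4
            y2 = Zs s3 g3
            y1 = Zs s2 g2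
            κ0 = 0≤rec r
            κ1 = rec≤1 r

            -- A lowering that leaves `μs` untouched costs 4 squarings plus one for each direction
            -- in `μs`; the four of them lead from 12 to 12 + 7 + 6 + 5 + 4 = 34.
            p19 : pw 19 Λx ≤ ι k4 * (U (y4 ∷ z5 ∷ z5 ∷ z5 ∷ []) X + κ)
            p19 = ≡≤ (pw-+ 12 7 Λx) ≤⟨⟩ le-trans κ0 κ1 7 {kP} {kL} {pw 12 Λx} {U (z5 ∷ z5 ∷ z5 ∷ z5 ∷ z5 ∷ []) X} {U (y4 ∷ z5 ∷ z5 ∷ z5 ∷ []) X} (pw-nn' 11 Λx) (U-nn y4 (z5 ∷ z5 ∷ z5 ∷ []) X) p12
              (lowU s5 g5 z5 z5 (z5 ∷ z5 ∷ z5 ∷ []) good5 good5)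

            h4 : Good z5 s4
            h4 = good-next s5 (okS g5) good5

            p25 : pw 25 Λx ≤ ι k3 * (U (y3 ∷ z5 ∷ z5 ∷ []) X + κ)
            p25 = ≡≤ (pw-+ 19 6 Λx) ≤⟨⟩ le-trans κ0 κ1 6 {k4} {kL} {pw 19 Λx} {U (y4 ∷ z5 ∷ z5 ∷ z5 ∷ []) X} {U (y3 ∷ z5 ∷ z5 ∷ []) X} (pw-nn' 18 Λx) (U-nn y3 (z5 ∷ z5 ∷ []) X) p19
              (lowU s4 g4 y4 z5 (z5 ∷ z5 ∷ []) (goodZ s5 g5) h4)

            h3 : Good z5 s3
            h3 = good-next s4 (okS g4) h4

            p30 : pw 30 Λx ≤ ι k2 * (U (y2 ∷ z5 ∷ []) X + κ)
            p30 = ≡≤ (pw-+ 25 5 Λx) ≤⟨⟩ le-trans κ0 κ1 5 {k3} {kL} {pw 25 Λx} {U (y3 ∷ z5 ∷ z5 ∷ []) X} {U (y2 ∷ z5 ∷ []) X} (pw-nn' 24 Λx) (U-nn y2 (z5 ∷ []) X) p25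
              (lowU s3 g3 y3 z5 (z5 ∷ []) (goodZ s4 g4) h3)

            p34 : pw 34 Λx ≤ ι k1 * (U (y1 ∷ []) X + κ)
            p34 = ≡≤ (pw-+ 30 4 Λx) ≤⟨⟩ le-trans κ0 κ1 4 {k2} {kL} {pw 30 Λx} {U (y2 ∷ z5 ∷ []) X} {U (y1 ∷ []) X} (pw-nn' 29 Λx) (U-nn y1 [] X) p30
              (lowU s2 g2 y2 z5 [] (goodZ s3 g3) (good-next s3 (okS g3) h3))

            absZ : Supp Zm (λ t → Abs y1 t κ)
            absZ = supp-map Zm (λ { z (t , refl , p) → gd (goodZ s2 g2) t p }) hZ

            -- `y1` absorbs every t drawn from `Zm`, so the terms with shifts 0 and t cancel, and so
            -- do those with shifts -t' and t - t'.
            PX-near : ∀ ω → Near (P y1 X ω) 0ℚ κ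
            PX-near ω = near-≡ (sym PX≡) (E-const Zm 0ℚ) (E-nearS Zm (supp-map Zm (λ t at → near-≡ refl (E-const Zm 0ℚ) (E-nearS Zm (supp-map Zm (λ t' at' → pw4 t t' at) absZ))) absZ))
              where
              f : ℤ → ℚ
              f x = F (ω ⊕ x)
              A : ℤ → ℚ
              A u = E y1 (λ x → f (x ℤ.+ u))
              PX≡ : P y1 X ω ≡ E Zm (λ t → E Zm (λ t' → rec 3 * (A ℤ.0ℤ + - A t + (- A (ℤ.- t') + A (t ℤ.- t')))))
              PX≡ = trans (gen y1) refl
                where
                gen : ∀ ν → E ν (λ x → X (ω ⊕ x)) ≡ E Zm (λ t → E Zm (λ t' → rec 3 * (E ν (λ x → f (x ℤ.+ ℤ.0ℤ)) + - E ν (λ x → f (x ℤ.+ t)) + (- E ν (λ x → f (x ℤ.+ ℤ.- t')) + E ν (λ x → f (x ℤ.+ (t ℤ.- t')))))))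
                gen ν = trans (E-cong ν (λ x → E-cong Zm (λ t → E-cong Zm (λ t' → trans (ex t t' (ω ⊕ x)) (cong (rec 3 *_) (cong₂ _+_ (cong₂ (λ a b → a + - b) (sh F ω x _ refl) (sh F ω x _ refl)) (cong₂ (λ a b → - a + b) (sh F ω x _ refl) (sh F ω x _ refl))))))))
                  (trans (E-swap ν Zm _) (E-cong Zm (λ t → trans (E-swap ν Zm _) (E-cong Zm (λ t' → trans (E-* ν (rec 3) _) (cong (rec 3 *_) (trans (E-+ ν _ _) (cong₂ _+_ (trans (E-+ ν _ _) (cong (E ν (λ x → f (x ℤ.+ ℤ.0ℤ)) +_) (E-neg ν _))) (trans (E-+ ν _ _) (cong (_+ E ν (λ x → f (x ℤ.+ (t ℤ.- t')))) (E-neg ν _)))))))))))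
                  where
                  l : ∀ r a b c d → r * (1ℚ * a + (- 1ℚ * b + (- 1ℚ * c + (1ℚ * d + 0ℚ)))) ≡ r * (a + - b + (- c + d))
                  l = solve-∀ ℚR
                  ex : ∀ t t' w → rec 3 * (1ℚ * F (w ⊕ ℤ.0ℤ) + (- 1ℚ * F (w ⊕ t) + (- 1ℚ * F (w ⊕ ℤ.- t') + (1ℚ * F (w ⊕ (t ℤ.- t')) + 0ℚ)))) ≡ rec 3 * (F (w ⊕ ℤ.0ℤ) + - F (w ⊕ t) + (- F (w ⊕ ℤ.- t') + F (w ⊕ (t ℤ.- t'))))
                  ex t t' w = l (rec 3) (F (w ⊕ ℤ.0ℤ)) (F (w ⊕ t)) (F (w ⊕ ℤ.- t')) (F (w ⊕ (t ℤ.- t')))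
              pw4 : ∀ t t' → Abs y1 t κ → Near (rec 3 * (A ℤ.0ℤ + - A t + (- A (ℤ.- t') + A (t ℤ.- t')))) 0ℚ κ
              pw4 t t' at = near4 n1 n2
                where
                n1 : Near (A t) (A ℤ.0ℤ) κ
                n1 = near-≡ refl (E-cong y1 (λ x → cong f (sym (ℤP.+-identityʳ x)))) (ab at f (λ x → bF _))
                n2 : Near (A (t ℤ.- t')) (A (ℤ.- t')) κ
                n2 = near-≡ (E-cong y1 (λ x → cong f (ℤP.+-assoc x t (ℤ.- t')))) refl (ab at (λ x → f (x ℤ.+ ℤ.- t')) (λ x → bF _))
                near4 : ∀ {a b c d} → Near b a κ → Near d c κ → Near (rec 3 * (a + - b + (- c + d))) 0ℚ κ
                near4 {a} {b} {c} {d} (p , q) (p' , q') =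
                  by (nn* (0≤rec 3) (nn+ (nn+ (diff q) (diff p')) (nn* 0≤2 κ0))) (trans (sym (l1 κ)) (trans (cong (λ z → 0ℚ + z * κ) (sym (rec-inv 3))) (l2 (rec 3) a b c d κ))) ,
                  by (nn* (0≤rec 3) (nn+ (nn+ (diff p) (diff q')) (nn* 0≤2 κ0))) (trans (cong (rec 3 * (a + - b + (- c + d)) +_) (trans (sym (ℚP.*-identityˡ κ)) (cong (_* κ) (sym (rec-inv 3))))) (l3 (rec 3) a b c d κ))
                  where
                  l1 : ∀ κ → 0ℚ + 1ℚ * κ ≡ 0ℚ + κ
                  l1 = solve-∀ ℚR
                  l2 : ∀ r a b c d κ → 0ℚ + r * ι 4 * κ ≡ r * (a + - b + (- c + d)) + r * ((b + κ - a) + (c + κ - d) + 2ℚ * κ)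
                  l2 = solve-∀ ℚR
                  l3 : ∀ r a b c d κ → r * (a + - b + (- c + d)) + r * ι 4 * κ ≡ 0ℚ + r * ((a + κ - b) + (d + κ - c) + 2ℚ * κ)
                  l3 = solve-∀ ℚR

            U1≤ : U (y1 ∷ []) X ≤ 2ℚ * κ
            U1≤ = ≡≤ (U-N y1 [] X) ≤⟨⟩ E-≤c mΩ (λ ω → near-sq (bdP y1 bX ω) bd0 (PX-near ω) ≤⟨⟩ ≡≤ (l κ))
              where l : ∀ κ → 0ℚ * 0ℚ + 2ℚ * κ ≡ 2ℚ * κ
                    l = solve-∀ ℚR

            cF : ℤ → ℚ
            cF a = E mΩ (λ ω → F ω * F (ω ⊕ a))

            -- Both sides expand into autocorrelations of F, which are even in the shift.
            D≡ : Dn ≡ ι 4 * Λx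
            D≡ = trans left (sym right)
              where
              mid : ℚ
              mid = E Zm (λ t → E Zm (λ t' → cF ℤ.0ℤ + - cF t + (- cF (ℤ.- t') + cF (t ℤ.- t'))))
              cneg : ∀ t → cF t ≡ cF (ℤ.- t)
              cneg t = trans (sym (inv (ℤ.- t) (λ ω → F ω * F (ω ⊕ t)))) (E-cong mΩ (λ ω → trans (cong (F (ω ⊕ ℤ.- t) *_) (trans (sh F ω (ℤ.- t) t (ℤP.+-inverseˡ t)) (cong F (⊕-0 ω)))) (ℚP.*-comm (F (ω ⊕ ℤ.- t)) (F ω))))
              cc2 : ∀ t t' → E mΩ (λ ω → F (ω ⊕ t) * F (ω ⊕ t')) ≡ cF (t ℤ.- t')
              cc2 t t' = trans (sym (inv (ℤ.- t') (λ ω → F (ω ⊕ t) * F (ω ⊕ t')))) (E-cong mΩ (λ ω → trans (cong₂ _*_ (sh F ω _ _ (ℤP.+-comm (ℤ.- t') t)) (trans (sh F ω (ℤ.- t') t' (ℤP.+-inverseˡ t')) (cong F (⊕-0 ω)))) (ℚP.*-comm (F (ω ⊕ (t ℤ.- t'))) (F ω))))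
              left : Dn ≡ mid
              left = trans (E-cong mΩ (λ ω → trans (cong sq (sym (trans (E-- Zm (λ _ → F ω) (λ t → F (ω ⊕ t))) (cong (_- P Zm F ω) (E-const Zm (F ω)))))) (E-sq Zm Zm (λ t → F ω - F (ω ⊕ t)) (λ t → F ω - F (ω ⊕ t)))))
                (trans (sym (swap3 Zm Zm mΩ (λ t t' ω → (F ω - F (ω ⊕ t)) * (F ω - F (ω ⊕ t'))))) (E-cong Zm (λ t → E-cong Zm (λ t' →
                  trans (E-cong mΩ (λ ω → l (F ω) (F (ω ⊕ t)) (F (ω ⊕ t')))) (trans (E-+ mΩ _ _) (cong₂ _+_ (trans (E-+ mΩ _ _) (cong₂ _+_ (E-cong mΩ (λ ω → cong (λ w → F ω * F w) (sym (⊕-0 ω)))) (E-neg mΩ _)))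
                    (trans (E-+ mΩ _ _) (cong₂ _+_ (trans (E-neg mΩ _) (cong -_ (cneg t'))) (cc2 t t')))))))))
                where l : ∀ a b c → (a - b) * (a - c) ≡ a * a + - (a * b) + (- (a * c) + b * c)
                      l = solve-∀ ℚR
              right : ι 4 * Λx ≡ mid
              right = trans (sym (E-* mΩ (ι 4) _)) (trans (E-cong mΩ (λ ω → trans (cong (ι 4 *_) (trans (sym (E-*ʳ Zm (F ω) _)) (E-cong Zm (λ t → sym (E-*ʳ Zm (F ω) _))))) (trans (sym (E-* Zm (ι 4) _)) (E-cong Zm (λ t → sym (E-* Zm (ι 4) _))))))
                (trans (sym (swap3 Zm Zm mΩ _)) (E-cong Zm (λ t → E-cong Zm (λ t' → trans (E-cong mΩ (λ ω → trans (l (rec 3) (F (ω ⊕ ℤ.0ℤ)) (F (ω ⊕ t)) (F (ω ⊕ ℤ.- t')) (F (ω ⊕ (t ℤ.- t'))) (F ω))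
                     (trans (cong (_* (F ω * F (ω ⊕ ℤ.0ℤ) + - (F ω * F (ω ⊕ t)) + (- (F ω * F (ω ⊕ ℤ.- t')) + F ω * F (ω ⊕ (t ℤ.- t'))))) (rec-inv 3)) (ℚP.*-identityˡ _))))
                   (trans (E-+ mΩ _ _) (cong₂ _+_ (trans (E-+ mΩ _ _) (cong (cF ℤ.0ℤ +_) (E-neg mΩ _))) (trans (E-+ mΩ _ _) (cong (_+ cF (t ℤ.- t')) (E-neg mΩ _)))))))))
                ) 
                where l : ∀ r a b c d f → ι 4 * (r * (1ℚ * a + (- 1ℚ * b + (- 1ℚ * c + (1ℚ * d + 0ℚ)))) * f) ≡ r * ι 4 * (f * a + - (f * b) + (- (f * c) + f * d))
                      l = solve-∀ ℚR

            -- F correlates with X to the extent that it fails to be invariant along `Zm`, while the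
            -- last box norm of X, the squared norm of `P y1 X`, is at most 2κ.
            oneD : pw 34 Dn ≤ ι k1D * κ
            oneD = ≡≤ (trans (cong (pw 34) D≡) (trans (pw-* 34 (ι 4) Λx) (cong (_* pw 34 Λx) (pw-ι 34 4)))) ≤⟨⟩
              *mono (ι (pwℕ 34 4)) (0≤ι (pwℕ 34 4)) (p34 ≤⟨⟩ *mono (ι k1) (0≤ι k1) (+r κ U1≤)) ≤⟨⟩
              ≡≤ (trans (l (ι (pwℕ 34 4)) (ι k1) κ) (cong (_* κ) (trans (cong (ι (pwℕ 34 4) *_) (sym (ι-* 3 k1))) (sym (ι-* (pwℕ 34 4) (3 ℕ.* k1))))))
              where l : ∀ a k κ → a * (k * (2ℚ * κ + κ)) ≡ a * (ι 3 * k) * κ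
                    l = solve-∀ ℚR
open OneDimensional

-- Control of the two-dimensional count by one vertical direction.

module TwoDimensional where
  record Sys2 : Set₁ where
    field
      sys : Sys
    open Sys sys public
    infixl 6 _⊞_
    field
      _⊞_ : Ω → ℤ → Ω
      ⊞-⊞ : ∀ ω a b → (ω ⊞ a) ⊞ b ≡ ω ⊞ (a ℤ.+ b)
      ⊞-0 : ∀ ω → ω ⊞ ℤ.0ℤ ≡ ω
      invH : ∀ a f → E mΩ (λ ω → f (ω ⊞ a)) ≡ E mΩ f
      comm : ∀ ω a b → (ω ⊞ a) ⊕ b ≡ (ω ⊕ b) ⊞ a

  kQ k2D : ℕ
  kQ = cN 34 ℕ.* (k1D ℕ.+ kC)
  k2D = trK 34 75 kQ

  -- x₁ is the error of replacing dual functions by their averages, x₂ the part that remains. 75 =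
  -- 3·5² comes from (a + b + c)² ≤ 3(a² + b² + c²).
  combine : ∀ {Λ x₁ x₂ D N Z κ} → 0ℚ ≤ κ → κ ≤ 1ℚ → 0ℚ ≤ Z → 0ℚ ≤ D → 0ℚ ≤ N → N ≤ 1ℚ →
    sq Λ ≤ x₁ + x₂ + ι 5 * κ → sq x₁ ≤ D → sq x₂ ≤ N → pw 34 D ≤ ι k1D * κ → pw 2 N ≤ ι kC * (Z + κ) →
    pw 36 Λ ≤ ι k2D * (Z + κ)
  combine {Λ} {x₁} {x₂} {D} {N} {Z} {κ} κ0 κ1 Z0 D0 N0 N1 h h₁ h₂ hD hN =
    ≡≤ (pw-+ 2 34 Λ) ≤⟨⟩ le-trans κ0 κ1 34 {75} {kQ} {pw 2 Λ} {D + N} {Z} (pw-nn' 1 Λ) Z0 s1 s2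
    where
    y = x₁ + x₂ + ι 5 * κ
    s1 : pw 2 Λ ≤ ι 75 * (D + N + κ)
    s1 = ≡≤ (trans (pw-suc 1 Λ) (trans (pw-suc 0 (sq Λ)) (pw-0 _))) ≤⟨⟩ *mono (sq Λ) (nn-sq Λ) h ≤⟨⟩ *mono' y (nn-sq Λ ≤⟨⟩ h) h ≤⟨⟩
      by (nn+ (nn+ (nn-sq (x₁ - x₂)) (nn-sq (x₁ - ι 5 * κ))) (nn-sq (x₂ - ι 5 * κ))) (l x₁ x₂ κ) ≤⟨⟩
      (*mono (ι 3) (0≤ι 3) h₁ +≤ *mono (ι 3) (0≤ι 3) h₂ +≤ *mono (ι 75) (0≤ι 75) (*mono κ κ0 κ1 ≤⟨⟩ ≡≤ (ℚP.*-identityʳ κ))) ≤⟨⟩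
      by (nn* (0≤ι 72) (nn+ D0 N0)) (l2 D N κ)
      where
      l : ∀ a b k → ι 3 * (a * a) + ι 3 * (b * b) + ι 75 * (k * k) ≡ (a + b + ι 5 * k) * (a + b + ι 5 * k) + ((a - b) * (a - b) + (a - ι 5 * k) * (a - ι 5 * k) + (b - ι 5 * k) * (b - ι 5 * k))
      l = solve-∀ ℚR
      l2 : ∀ D N k → ι 75 * (D + N + k) ≡ ι 3 * D + ι 3 * N + ι 75 * k + ι 72 * (D + N)
      l2 = solve-∀ ℚR
    pN : pw 34 N ≤ ι kC * (Z + κ)
    pN = ≡≤ (pw-+ 2 32 N) ≤⟨⟩ pw≤1 32 (pw-nn' 1 N) (pw≤1 2 N0 N1 ≤⟨⟩ N1) ≤⟨⟩ hN
    s2 : pw 34 (D + N) ≤ ι kQ * (Z + κ)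
    s2 = pw-split 34 D N ≤⟨⟩ *mono (ι (cN 34)) (0≤ι (cN 34)) ((hD ≤⟨⟩ *mono (ι k1D) (0≤ι k1D) (by Z0 (l3 Z κ))) +≤ pN) ≤⟨⟩
      ≡≤ (trans (l4 (ι (cN 34)) (ι k1D) (ι kC) (Z + κ)) (cong (_* (Z + κ)) (trans (cong (ι (cN 34) *_) (sym (ι-+ k1D kC))) (sym (ι-* (cN 34) (k1D ℕ.+ kC))))))
      where
      l3 : ∀ z k → z + k ≡ k + z
      l3 = solve-∀ ℚR
      l4 : ∀ c a b w → c * (a * w + b * w) ≡ c * (a + b) * w
      l4 = solve-∀ ℚR

  module Par2 (r : ℕ) where
    open Par r

    s1 : St
    s1 = next (next (next (next s5)))

    abstract
      -- The first summand lets the interval absorb qj, the second keeps the length of `Zm` within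
      -- the range M²/A.
      c° : ℕ
      c° = (2 ℕ.* R ℕ.* ℤ.∣ qs s1 ∣ ℕ.+ 6 ℕ.* R ℕ.* As s1) ℕ.* Ec

      c°≡ : c° ≡ (2 ℕ.* R ℕ.* ℤ.∣ qs s1 ∣ ℕ.+ 6 ℕ.* R ℕ.* As s1) ℕ.* Ec
      c°≡ = refl

      ok1 : Ok s1
      ok1 = ok-next _ (ok-next _ (ok-next _ (ok-next _ ok5)))

      1≤c° : 1 ℕ.≤ c°
      1≤c° = ℕP.*-mono-≤ {1} (ℕP.≤-trans (ℕP.*-mono-≤ {1} {6 ℕ.* R} (ℕ.s≤s ℕ.z≤n) (proj₂ ok1)) (ℕP.m≤n+m (6 ℕ.* R ℕ.* As s1) (2 ℕ.* R ℕ.* ℤ.∣ qs s1 ∣))) 1≤Ec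

    -- Every stage works in its own base B, so a single M must be a multiple of all the stage
    -- constants.
    record Scales (m : ℕ) : Set where
      open WithM m
      field
        bs : ℕ
        M5 : M ≡ c5 ℕ.* suc bs
        b₅ b₄ b₃ b₂ b° : ℕ
        e₅ : M ≡ cS s5 ℕ.* suc b₅
        e₄ : M ≡ cS (next s5) ℕ.* suc b₄
        e₃ : M ≡ cS (next (next s5)) ℕ.* suc b₃
        e₂ : M ≡ cS (next (next (next s5))) ℕ.* suc b₂
        e° : M ≡ c° ℕ.* suc b°

    -- Killing f₁ by van der Corput leaves dual functions of f₂, f₂(· ⊞ −k); the one-dimensional theorem
    -- makes them invariant under multiples of q, and expanding (d + qj)² turns this into averages of f₂
    -- along directions 2qk, which concatenate to Z°.
    module TwoD (m : ℕ) (sc : Scales m) (S2 : Sys2) (f₀ f₁ f₂ : Sys2.Ω S2 → ℚ)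
                (b₀ : ∀ ω → Bd (f₀ ω)) (b₁ : ∀ ω → Bd (f₁ ω)) (bf₂ : ∀ ω → Bd (f₂ ω)) where
      open Sys2 S2
      open Dyn sys
      open Concat sys
      open Lower sys
      open WithM m
      open Scales sc

      I = Iv m
      D = DS r
      v : ℤ² → ℤ
      v = val (suc b°)
      J = Jn sys b°
      EB = Ec ℕ.* suc b°
      q = qs s1
      A = As s1

      Λ2 : ℚ
      Λ2 = E I (λ d → E mΩ (λ ω → f₀ ω * f₁ (ω ⊞ d) * f₂ (ω ⊕ d ℤ.* d)))

      M° : M ≡ (2 ℕ.* R ℕ.* ℤ.∣ q ∣ ℕ.+ 6 ℕ.* R ℕ.* A) ℕ.* EB
      M° = trans e° (trans (cong (ℕ._* suc b°) c°≡) (ℕP.*-assoc (2 ℕ.* R ℕ.* ℤ.∣ q ∣ ℕ.+ 6 ℕ.* R ℕ.* A) Ec (suc b°)))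

      M°₁ : 2 ℕ.* R ℕ.* ℤ.∣ q ∣ ℕ.* EB ℕ.≤ M
      M°₁ = ℕP.≤-trans (ℕP.*-monoˡ-≤ EB (ℕP.m≤m+n (2 ℕ.* R ℕ.* ℤ.∣ q ∣) (6 ℕ.* R ℕ.* A))) (ℕP.≤-reflexive (sym M°))

      M°₂ : 6 ℕ.* R ℕ.* A ℕ.* EB ℕ.≤ M
      M°₂ = ℕP.≤-trans (ℕP.*-monoˡ-≤ EB (ℕP.m≤n+m (6 ℕ.* R ℕ.* A) (2 ℕ.* R ℕ.* ℤ.∣ q ∣))) (ℕP.≤-reflexive (sym M°))

      EBM : EB ℕ.* (2 ℕ.* R) ℕ.≤ M
      EBM = ℕP.≤-trans (ℕP.≤-trans (ℕP.≤-reflexive (l EB R)) (ℕP.*-monoˡ-≤ EB (ℕP.*-monoʳ-≤ (2 ℕ.* R) (proj₁ ok1)))) M°₁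
        where l : ∀ e r → e ℕ.* (2 ℕ.* r) ≡ 2 ℕ.* r ℕ.* 1 ℕ.* e
              l = ℕS.solve-∀

      absS : Supp D (λ σ → Abs I (v σ) κ)
      absS = supp-map D (λ σ p → abs-Iv≤ (v σ) (ℕP.≤-trans (ℕP.*-monoˡ-≤ (2 ℕ.* R) (val≤ b° σ p)) EBM)) (DS-supp r)

      open VdC sys r m b° absS using (vdc)

      y : ℤ → Fn
      y d ω = f₀ (ω ⊞ ℤ.- d) * f₂ ((ω ⊞ ℤ.- d) ⊕ d ℤ.* d)

      Λ2≡ : Λ2 ≡ E I (λ d → E mΩ (λ ω → f₁ ω * y d ω))
      Λ2≡ = E-cong I (λ d → trans (sym (invH (ℤ.- d) (λ ω → f₀ ω * f₁ (ω ⊞ d) * f₂ (ω ⊕ d ℤ.* d)))) (E-cong mΩ (λ ω →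
        trans (cong (λ z → f₀ (ω ⊞ ℤ.- d) * z * f₂ ((ω ⊞ ℤ.- d) ⊕ d ℤ.* d)) (trans (cong f₁ (trans (⊞-⊞ ω (ℤ.- d) d) (cong (ω ⊞_) (ℤP.+-inverseˡ d)))) (cong f₁ (⊞-0 ω))))
          (l (f₀ (ω ⊞ ℤ.- d)) (f₁ ω) (f₂ ((ω ⊞ ℤ.- d) ⊕ d ℤ.* d))))))
        where l : ∀ a b c → a * b * c ≡ b * (a * c)
              l = solve-∀ ℚR

      φ : ℤ → Fn
      φ k ω = f₀ ω * f₀ (ω ⊞ ℤ.- k)

      g₂ : ℤ → Fn
      g₂ k ω = f₂ (ω ⊞ ℤ.- k)

      bφ : ∀ k → BdF (φ k)
      bφ k ω = bd* (b₀ ω) (b₀ (ω ⊞ ℤ.- k))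

      bg₂ : ∀ k → BdF (g₂ k)
      bg₂ k ω = bf₂ (ω ⊞ ℤ.- k)

      Fk : ℤ → Fn
      Fk k = dual m k f₂ (g₂ k)

      ip : ℤ → ℚ
      ip k = E mΩ (λ ω → φ k ω * Fk k ω)

      hk : ℤ → ℤ → ℚ
      hk k x = E mΩ (λ ω → φ k ω * (f₂ (ω ⊕ x ℤ.* x) * g₂ k (ω ⊕ (x ℤ.+ k) ℤ.* (x ℤ.+ k))))

      bhk : ∀ k x → Bd (hk k x)
      bhk k x = E-bd mΩ (λ ω → bd* (bφ k ω) (bd* (bf₂ _) (bg₂ k _)))

      ip≡ : ∀ k → ip k ≡ E I (hk k)
      ip≡ k = trans (E-cong mΩ (λ ω → sym (E-* I (φ k ω) _))) (E-swap mΩ I _)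

      -- The shifts leave only k = s' - s in the horizontal direction, so for fixed k the functions
      -- `f₂` and `g₂ k` form a purely vertical dual function.
      yy : ∀ d s s' → E mΩ (λ ω → y (d ℤ.+ s) ω * y (d ℤ.+ s') ω) ≡ hk (s' ℤ.- s) (d ℤ.+ s)
      yy d s s' = trans (sym (invH (d ℤ.+ s) _)) (E-cong mΩ (λ ω → trans (cong₂ _*_
          (cong (λ w → f₀ w * f₂ (w ⊕ (d ℤ.+ s) ℤ.* (d ℤ.+ s))) (trans (⊞-⊞ ω _ _) (trans (cong (ω ⊞_) (ℤP.+-inverseʳ (d ℤ.+ s))) (⊞-0 ω))))
          (cong₂ (λ w z → f₀ w * f₂ z) (trans (⊞-⊞ ω _ _) (cong (ω ⊞_) (l1 d s s')))
             (trans (cong (_⊕ (d ℤ.+ s') ℤ.* (d ℤ.+ s')) (trans (⊞-⊞ ω _ _) (cong (ω ⊞_) (l1 d s s')))) (trans (comm ω _ _) (cong (λ z → (ω ⊕ z ℤ.* z) ⊞ (ℤ.- (s' ℤ.- s))) (l2 d s s'))))))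
        (l (f₀ ω) (f₂ (ω ⊕ (d ℤ.+ s) ℤ.* (d ℤ.+ s))) (f₀ (ω ⊞ ℤ.- (s' ℤ.- s))) (g₂ (s' ℤ.- s) (ω ⊕ (d ℤ.+ s ℤ.+ (s' ℤ.- s)) ℤ.* (d ℤ.+ s ℤ.+ (s' ℤ.- s)))))))
        where
        l : ∀ a b c d → a * b * (c * d) ≡ a * c * (b * d)
        l = solve-∀ ℚR
        l1 : ∀ d s s' → d ℤ.+ s ℤ.+ ℤ.- (d ℤ.+ s') ≡ ℤ.- (s' ℤ.- s)
        l1 = ℤS.solve-∀
        l2 : ∀ d s s' → d ℤ.+ s' ≡ d ℤ.+ s ℤ.+ (s' ℤ.- s)
        l2 = ℤS.solve-∀

      X0 : ℚ
      X0 = E D (λ σ → E D (λ σ' → ip (v σ' ℤ.- v σ)))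

      stepA : sq Λ2 ≤ X0 + ι 3 * κ
      stepA = ≡≤ (cong sq Λ2≡) ≤⟨⟩ vdc f₁ y b₁ (λ d ω → bd* (b₀ _) (bf₂ _)) ≤⟨⟩
        +r (2ℚ * κ) (≡≤ (E-cong D (λ σ → E-cong D (λ σ' → E-cong I (λ d → yy d (v σ) (v σ'))))) ≤⟨⟩
          proj₁ (E-nearS D (supp-map D (λ σ aσ → E-near D (λ σ' → near-≡ refl (sym (ip≡ (v σ' ℤ.- v σ))) (ab aσ (hk (v σ' ℤ.- v σ)) (bhk (v σ' ℤ.- v σ))))) absS))) ≤⟨⟩ ≡≤ (l X0 κ)
        where l : ∀ x κ → x + κ + 2ℚ * κ ≡ x + ι 3 * κ
              l = solve-∀ ℚR

      -- ℓ* + 1 = 6R·EB·M is what absorbing j(2d + qj), of size at most EB·3M, requires of `Zm`;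
      -- `M°₂` shows that it is not too long for `oneD`.
      ℓ* : ℕ
      ℓ* = ℕ.pred (6 ℕ.* R ℕ.* EB ℕ.* M)

      ℓ*≡ : suc ℓ* ≡ 6 ℕ.* R ℕ.* EB ℕ.* M
      ℓ*≡ = ℕP.suc-pred (6 ℕ.* R ℕ.* EB ℕ.* M) {{ℕ.>-nonZero (ℕP.*-mono-≤ {1} (ℕP.*-mono-≤ {1} {6 ℕ.* R} (ℕ.s≤s ℕ.z≤n) (ℕP.*-mono-≤ 1≤Ec (ℕ.s≤s (ℕ.z≤n {b°})))) (ℕ.s≤s (ℕ.z≤n {m})))}}

      Zm : Mean ℤ
      Zm = dir1 q ℓ*

      hZ : Supp Zm (λ z → Σ ℤ λ t → (z ≡ q ℤ.* t) × (ℤ.∣ t ∣ ℕ.* A ℕ.≤ M ℕ.* M))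
      hZ = supp-map (Iv ℓ*) (λ t p → t , refl , ℕP.≤-trans (ℕP.*-monoˡ-≤ A (ℕP.≤-trans p (ℕP.≤-reflexive ℓ*≡)))
          (ℕP.≤-trans (ℕP.≤-reflexive (l R EB M A)) (ℕP.*-monoˡ-≤ M M°₂))) (Iv≤ ℓ*)
        where l : ∀ r e m a → 6 ℕ.* r ℕ.* e ℕ.* m ℕ.* a ≡ 6 ℕ.* r ℕ.* a ℕ.* e ℕ.* m
              l = ℕS.solve-∀

      Dn : ℤ → ℚ
      Dn k = E mΩ (λ ω → sq (Fk k ω - P Zm (Fk k) ω))

      k≤M : ∀ σ σ' → Small R σ → Small R σ' → ℤ.∣ v σ' ℤ.- v σ ∣ ℕ.≤ M
      k≤M σ σ' p p' = ℕP.≤-trans (ℤP.∣i-j∣≤∣i∣+∣j∣ (v σ') (v σ)) (ℕP.≤-trans (ℕP.+-mono-≤ (val≤ b° σ' p') (val≤ b° σ p))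
         (ℕP.≤-trans (ℕP.≤-trans (ℕP.≤-reflexive (l EB)) (ℕP.*-monoʳ-≤ EB (ℕP.*-monoʳ-≤ 2 (ℕ.s≤s (ℕ.z≤n {r}))))) EBM))
        where l : ∀ e → e ℕ.+ e ≡ e ℕ.* (2 ℕ.* 1)
              l = ℕS.solve-∀

      Dbar : ℚ
      Dbar = E D (λ σ → E D (λ σ' → Dn (v σ' ℤ.- v σ)))

      pDbar : pw 34 Dbar ≤ ι k1D * κ
      pDbar = pw-jensen 34 D _ ≤⟨⟩ E-monoS D (supp-map D (λ σ p → pw-jensen 34 D _ ≤⟨⟩ E-monoS D (supp-map D (λ σ' p' →
          OneD.oneD sys (v σ' ℤ.- v σ) (k≤M σ σ' p p') bs M5 (stg b₅ e₅ ok5) (stg b₄ e₄ (ok-next _ ok5)) (stg b₃ e₃ (ok-next _ (ok-next _ ok5))) (stg b₂ e₂ (ok-next _ (ok-next _ (ok-next _ ok5))))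
            f₂ (g₂ (v σ' ℤ.- v σ)) bf₂ (bg₂ (v σ' ℤ.- v σ)) Zm hZ) (DS-supp r)) ≤⟨⟩ ≡≤ (E-const D _)) (DS-supp r)) ≤⟨⟩ ≡≤ (E-const D _)

      x₁ : ℚ
      x₁ = E D (λ σ → E D (λ σ' → let k = v σ' ℤ.- v σ in E mΩ (λ ω → φ k ω * (Fk k ω - P Zm (Fk k) ω))))

      x₁² : sq x₁ ≤ Dbar
      x₁² = jensen D _ ≤⟨⟩ E-mono D (λ σ → jensen D _ ≤⟨⟩ E-mono D (λ σ' → kill mΩ (φ (v σ' ℤ.- v σ)) _ (bφ (v σ' ℤ.- v σ))))

      xP : ℤ → ℚ
      xP k = E mΩ (λ ω → φ k ω * P Zm (Fk k) ω)

      X0≡ : X0 ≡ x₁ + E D (λ σ → E D (λ σ' → xP (v σ' ℤ.- v σ)))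
      X0≡ = sym (trans (sym (E-+ D _ _)) (E-cong D (λ σ → trans (sym (E-+ D _ _)) (E-cong D (λ σ' → let k = v σ' ℤ.- v σ in trans (sym (E-+ mΩ _ _)) (E-cong mΩ (λ ω → l (φ k ω) (Fk k ω) (P Zm (Fk k) ω))))))))
        where l : ∀ a b c → a * (b - c) + a * c ≡ a * b
              l = solve-∀ ℚR

      IJ : Mean ℤ
      IJ = Iv J

      w : ℤ → ℤ → ℤ → ℤ → ℚ
      w k x z e = E mΩ (λ ω → φ k ω * (f₂ (ω ⊕ (x ℤ.+ z)) * g₂ k (ω ⊕ (x ℤ.+ e ℤ.+ z))))

      bw : ∀ k x z e → Bd (w k x z e)
      bw k x z e = E-bd mΩ (λ ω → bd* (bφ k ω) (bd* (bf₂ _) (bg₂ k _)))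

      xQ : ℤ → ℚ
      xQ k = E IJ (λ j → E I (λ d → E Zm (λ z → w k (d ℤ.* d) z (ℤ.+ 2 ℤ.* d ℤ.* k ℤ.+ k ℤ.* k ℤ.+ ℤ.+ 2 ℤ.* q ℤ.* k ℤ.* j))))

      xP-gen : ∀ ν k → E mΩ (λ ω → φ k ω * P ν (Fk k) ω) ≡ E I (λ d → E ν (λ z → w k (d ℤ.* d) z (ℤ.+ 2 ℤ.* d ℤ.* k ℤ.+ k ℤ.* k)))
      xP-gen ν k = trans (E-cong mΩ (λ ω → trans (sym (E-* ν (φ k ω) _)) (E-cong ν (λ z → sym (E-* I (φ k ω) _)))))
        (trans (E-swap mΩ ν _) (trans (E-cong ν (λ z → E-swap mΩ I _)) (trans (E-swap ν I _) (E-cong I (λ d → E-cong ν (λ z → E-cong mΩ (λ ω →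
          cong (φ k ω *_) (cong₂ _*_ (sh f₂ ω z (d ℤ.* d) (ℤP.+-comm z (d ℤ.* d))) (sh (g₂ k) ω z ((d ℤ.+ k) ℤ.* (d ℤ.+ k)) (l z d k))))))))))
        where l : ∀ z d k → z ℤ.+ (d ℤ.+ k) ℤ.* (d ℤ.+ k) ≡ d ℤ.* d ℤ.+ (ℤ.+ 2 ℤ.* d ℤ.* k ℤ.+ k ℤ.* k) ℤ.+ z
              l = ℤS.solve-∀

      absq : Supp IJ (λ j → Abs I (q ℤ.* j) κ)
      absq = supp-map IJ (λ j p → abs-Iv≤ (q ℤ.* j) (ℕP.≤-trans (ℕP.*-monoˡ-≤ (2 ℕ.* R) (ℕP.≤-trans (ℕP.≤-reflexive (ℤP.abs-* q j)) (ℕP.*-monoʳ-≤ ℤ.∣ q ∣ (ℕP.≤-trans p (ℕP.≤-reflexive (Jn≡ sys b°))))))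
         (ℕP.≤-trans (ℕP.≤-reflexive (l ℤ.∣ q ∣ EB R)) M°₁))) (Iv≤ J)
        where l : ∀ q e r → q ℕ.* e ℕ.* (2 ℕ.* r) ≡ 2 ℕ.* r ℕ.* q ℕ.* e
              l = ℕS.solve-∀

      absZ : Supp IJ (λ j → Supp I (λ d → Abs Zm (q ℤ.* (j ℤ.* (ℤ.+ 2 ℤ.* d ℤ.+ q ℤ.* j))) κ))
      absZ = supp-map IJ (λ j pj → supp-map I (λ d pd → dir-good q ℓ* (j ℤ.* (ℤ.+ 2 ℤ.* d ℤ.+ q ℤ.* j)) (num j d pj pd)) (Iv≤ m)) (Iv≤ J)
        where
        num : ∀ j d → ℤ.∣ j ∣ ℕ.≤ suc J → ℤ.∣ d ∣ ℕ.≤ M → ℤ.∣ j ℤ.* (ℤ.+ 2 ℤ.* d ℤ.+ q ℤ.* j) ∣ ℕ.* (2 ℕ.* R) ℕ.≤ suc ℓ*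
        num j d pj pd = ℕP.≤-trans (ℕP.*-monoˡ-≤ (2 ℕ.* R) (ℕP.≤-trans (ℕP.≤-reflexive (ℤP.abs-* j (ℤ.+ 2 ℤ.* d ℤ.+ q ℤ.* j))) (ℕP.*-mono-≤ pj' (ℕP.≤-trans (ℤP.∣i+j∣≤∣i∣+∣j∣ (ℤ.+ 2 ℤ.* d) (q ℤ.* j))
             (ℕP.+-mono-≤ {_} {M ℕ.+ M} (ℕP.≤-trans (ℕP.≤-reflexive (ℤP.abs-* (ℤ.+ 2) d)) (ℕP.≤-trans (ℕP.*-monoʳ-≤ 2 pd) (ℕP.≤-reflexive (l2 M)))) qj)))))
           (ℕP.≤-reflexive (trans (l EB M R) (sym ℓ*≡)))
          where
          pj' : ℤ.∣ j ∣ ℕ.≤ EB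
          pj' = ℕP.≤-trans pj (ℕP.≤-reflexive (Jn≡ sys b°))
          qj : ℤ.∣ q ℤ.* j ∣ ℕ.≤ M
          qj = ℕP.≤-trans (ℕP.≤-reflexive (ℤP.abs-* q j)) (ℕP.≤-trans (ℕP.*-monoʳ-≤ ℤ.∣ q ∣ pj') (ℕP.≤-trans (ℕP.≤-trans (ℕP.m≤n*m (ℤ.∣ q ∣ ℕ.* EB) (2 ℕ.* R)) (ℕP.≤-reflexive (sym (ℕP.*-assoc (2 ℕ.* R) ℤ.∣ q ∣ EB)))) M°₁))
          l2 : ∀ m → 2 ℕ.* m ≡ m ℕ.+ m
          l2 = ℕS.solve-∀
          l : ∀ e m r → e ℕ.* (m ℕ.+ m ℕ.+ m) ℕ.* (2 ℕ.* r) ≡ 6 ℕ.* r ℕ.* e ℕ.* m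
          l = ℕS.solve-∀

      xPQ : ∀ k → Near (xP k) (xQ k) (κ + κ)
      xPQ k = near-≡ (sym (xP-gen Zm k)) refl (near-trans
        (avgAbs I IJ (q ℤ.*_) H (λ d → E-bd Zm (λ z → bw k (d ℤ.* d) z (ℤ.+ 2 ℤ.* d ℤ.* k ℤ.+ k ℤ.* k))) absq)
        (E-nearS IJ (supp-map IJ (λ j aj → E-nearS I (supp-map I (λ d ad → near-≡ (E-cong Zm (λ z → E-cong mΩ (λ ω → cong (φ k ω *_) (cong₂ _*_ (cong (λ x → f₂ (ω ⊕ x)) (l1 d q j z)) (cong (λ x → g₂ k (ω ⊕ x)) (l2 d q j z k)))))) refl
           (ab ad (λ z → w k (d ℤ.* d) z (ℤ.+ 2 ℤ.* d ℤ.* k ℤ.+ k ℤ.* k ℤ.+ ℤ.+ 2 ℤ.* q ℤ.* k ℤ.* j)) (λ z → bw k (d ℤ.* d) z (ℤ.+ 2 ℤ.* d ℤ.* k ℤ.+ k ℤ.* k ℤ.+ ℤ.+ 2 ℤ.* q ℤ.* k ℤ.* j)))) aj)) absZ)))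
        where
        H : ℤ → ℚ
        H d = E Zm (λ z → w k (d ℤ.* d) z (ℤ.+ 2 ℤ.* d ℤ.* k ℤ.+ k ℤ.* k))
        l1 : ∀ d q j z → d ℤ.* d ℤ.+ (z ℤ.+ q ℤ.* (j ℤ.* (ℤ.+ 2 ℤ.* d ℤ.+ q ℤ.* j))) ≡ (d ℤ.+ q ℤ.* j) ℤ.* (d ℤ.+ q ℤ.* j) ℤ.+ z
        l1 = ℤS.solve-∀
        l2 : ∀ d q j z k → d ℤ.* d ℤ.+ (ℤ.+ 2 ℤ.* d ℤ.* k ℤ.+ k ℤ.* k ℤ.+ ℤ.+ 2 ℤ.* q ℤ.* k ℤ.* j) ℤ.+ (z ℤ.+ q ℤ.* (j ℤ.* (ℤ.+ 2 ℤ.* d ℤ.+ q ℤ.* j)))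
           ≡ (d ℤ.+ q ℤ.* j) ℤ.* (d ℤ.+ q ℤ.* j) ℤ.+ (ℤ.+ 2 ℤ.* (d ℤ.+ q ℤ.* j) ℤ.* k ℤ.+ k ℤ.* k) ℤ.+ z
        l2 = ℤS.solve-∀

      τ : ℤ → ℤ
      τ k = ℤ.+ 2 ℤ.* q ℤ.* k

      xQ² : ∀ k → sq (xQ k) ≤ N (dir1 (τ k) J) f₂
      xQ² k = ≡≤ (cong sq (xQ≡ Zm)) ≤⟨⟩ jensen I _ ≤⟨⟩ E-≤c I (λ d → fin Zm d)
        where
        ζ : ℤ → ℤ → Fn
        ζ d z ω = φ k ω * f₂ (ω ⊕ (d ℤ.* d ℤ.+ z))
        c : ℤ → ℤ → ℤ
        c d z = d ℤ.* d ℤ.+ (ℤ.+ 2 ℤ.* d ℤ.* k ℤ.+ k ℤ.* k) ℤ.+ z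
        l : ∀ d z k t → d ℤ.* d ℤ.+ (ℤ.+ 2 ℤ.* d ℤ.* k ℤ.+ k ℤ.* k ℤ.+ t) ℤ.+ z ≡ d ℤ.* d ℤ.+ (ℤ.+ 2 ℤ.* d ℤ.* k ℤ.+ k ℤ.* k) ℤ.+ z ℤ.+ t
        l = ℤS.solve-∀
        G : ℤ → ℤ → Fn
        G d z ω = E IJ (λ j → g₂ k (ω ⊕ (c d z ℤ.+ τ k ℤ.* j)))
        xQ≡ : ∀ ν → E IJ (λ j → E I (λ d → E ν (λ z → w k (d ℤ.* d) z (ℤ.+ 2 ℤ.* d ℤ.* k ℤ.+ k ℤ.* k ℤ.+ τ k ℤ.* j)))) ≡ E I (λ d → E ν (λ z → E mΩ (λ ω → ζ d z ω * G d z ω)))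
        xQ≡ ν = trans (E-swap IJ I _) (E-cong I (λ d → trans (E-swap IJ ν _) (E-cong ν (λ z → trans (E-swap IJ mΩ _) (E-cong mΩ (λ ω →
           trans (E-cong IJ (λ j → trans (sym (ℚP.*-assoc (φ k ω) (f₂ (ω ⊕ (d ℤ.* d ℤ.+ z))) _)) (cong (λ x → ζ d z ω * g₂ k (ω ⊕ x)) (l d z k (τ k ℤ.* j))))) (E-* IJ (ζ d z ω) _)))))))
        fin : ∀ ν d → sq (E ν (λ z → E mΩ (λ ω → ζ d z ω * G d z ω))) ≤ N (dir1 (τ k) J) f₂
        fin ν d = jensen ν _ ≤⟨⟩ E-≤c ν (λ z → kill mΩ (ζ d z) (G d z) (λ ω → bd* (bφ k ω) (bf₂ _)) ≤⟨⟩
          ≡≤ (trans (E-cong mΩ (λ ω → cong sq (E-cong IJ (λ j → sym (sh (g₂ k) ω (c d z) _ refl))))) (trans (inv (c d z) (λ ω → sq (P (dir1 (τ k) J) (g₂ k) ω)))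
            (trans (E-cong mΩ (λ ω → cong sq (E-cong IJ (λ j → cong f₂ (sym (comm ω (ℤ.- k) (τ k ℤ.* j))))))) (invH (ℤ.- k) (λ ω → sq (P (dir1 (τ k) J) f₂ ω)))))))

      Z° : Mean ℤ
      Z° = dir1 (ℤ.+ 2 ℤ.* q ℤ.* ℤ.+ Qr r) (ℓn sys b°)

      Nbar : ℚ
      Nbar = E (DD r) (λ e → N (dir1 (ℤ.+ 2 ℤ.* q ℤ.* v e) J) f₂)

      x₂ : ℚ
      x₂ = E D (λ σ → E D (λ σ' → xQ (v σ' ℤ.- v σ)))

      x₂² : sq x₂ ≤ Nbar
      x₂² = jensen D _ ≤⟨⟩ E-mono D (λ σ → jensen D _ ≤⟨⟩ E-mono D (λ σ' → xQ² (v σ' ℤ.- v σ) ≤⟨⟩ ≡≤ (cong (λ z → N (dir1 (ℤ.+ 2 ℤ.* q ℤ.* z) J) f₂) (sym (l (ℤ.+ suc b°) (proj₁ σ) (proj₂ σ) (proj₁ σ') (proj₂ σ')))))) ≤⟨⟩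
        ≡≤ (sym (E-DD r _))
        where l : ∀ B a a' b b' → B ℤ.* (b ℤ.- a) ℤ.+ (b' ℤ.- a') ≡ B ℤ.* b ℤ.+ b' ℤ.- (B ℤ.* a ℤ.+ a')
              l = ℤS.solve-∀

      N≤1 : ∀ μ → N μ f₂ ≤ 1ℚ
      N≤1 μ = E-≤c mΩ (λ ω → sq≤1 (bdP μ bf₂ ω))

      twoD : pw 36 Λ2 ≤ ι k2D * (N Z° f₂ + κ)
      twoD = combine {Λ2} {x₁} {x₂} {Dbar} {Nbar} {N Z° f₂} {κ} (0≤rec r) (rec≤1 r) (N-nn Z° f₂)
        (E-≥c D (λ σ → E-≥c D (λ σ' → E-≥c mΩ (λ ω → nn-sq (Fk (v σ' ℤ.- v σ) ω - P Zm (Fk (v σ' ℤ.- v σ)) ω)))))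
        (E-≥c (DD r) (λ e → N-nn (dir1 (ℤ.+ 2 ℤ.* q ℤ.* v e) J) f₂)) (E-≤c (DD r) (λ e → N≤1 (dir1 (ℤ.+ 2 ℤ.* q ℤ.* v e) J)))
        (stepA ≤⟨⟩ ≡≤ (cong (_+ ι 3 * κ) X0≡) ≤⟨⟩ +r (ι 3 * κ) (+l x₁ (proj₁ (E-near D (λ σ → E-near D (λ σ' → xPQ (v σ' ℤ.- v σ)))))) ≤⟨⟩ ≡≤ (l x₁ x₂ κ))
        x₁² x₂² pDbar (concat r b° J (ℤ.+ 2 ℤ.* q) (ℓn sys b°) bf₂ (condJ sys b°) ℕP.≤-refl)
        where l : ∀ a b κ → a + (b + (κ + κ)) + ι 3 * κ ≡ a + b + ι 5 * κ
              l = solve-∀ ℚR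
open TwoDimensional

-- Cyclic groups and their partitions into progressions.

module CyclicBlocks where
  sumℕ : ℕ → (ℕ → ℚ) → ℚ
  sumℕ n g = Σs n (g ∘ toℕ)

  sumℕ-+ : ∀ x y g → sumℕ (x ℕ.+ y) g ≡ sumℕ x g + sumℕ y (λ k → g (x ℕ.+ k))
  sumℕ-+ zero y g = sym (ℚP.+-identityˡ _)
  sumℕ-+ (suc x) y g = trans (cong (g 0 +_) (sumℕ-+ x y (g ∘ suc))) (sym (ℚP.+-assoc (g 0) (sumℕ x (g ∘ suc)) (sumℕ y (λ k → g (suc (x ℕ.+ k))))))

  sumℕ-* : ∀ y x g → sumℕ (y ℕ.* x) g ≡ sumℕ y (λ t → sumℕ x (λ u → g (t ℕ.* x ℕ.+ u)))
  sumℕ-* zero x g = refl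
  sumℕ-* (suc y) x g = trans (sumℕ-+ x (y ℕ.* x) g) (cong (sumℕ x g +_) (trans (sumℕ-* y x (λ k → g (x ℕ.+ k)))
    (Σs-cong y (λ t → Σs-cong x (λ u → cong g (sym (ℕP.+-assoc x (toℕ t ℕ.* x) (toℕ u))))))))

  Rg : ℕ → Mean ℕ
  Rg m = uni m toℕ

  Rg-supp : ∀ m → Supp (Rg m) (ℕ._< suc m)
  Rg-supp m i = FP.toℕ<n i

  E-Rg : ∀ m (f g : ℕ → ℚ) → (∀ k → k ℕ.< suc m → f k ≡ g k) → E (Rg m) f ≡ E (Rg m) g
  E-Rg m f g h = E-congS (Rg m) {f} {g} (λ i → h (toℕ i) (FP.toℕ<n i))

  rec-* : ∀ n y x → suc n ≡ suc y ℕ.* suc x → rec n ≡ rec y * rec x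
  rec-* n y x e = trans (sym (ℚP.*-identityʳ (rec n))) (trans (cong (rec n *_) (trans (sym (ℚP.*-identityˡ 1ℚ)) (sym (cong₂ _*_ (rec-inv y) (rec-inv x)))))
    (trans (l (rec n) (rec y) (rec x) (ι (suc y)) (ι (suc x))) (trans (cong (_* (rec y * rec x)) (trans (cong (rec n *_) (trans (sym (ι-* (suc y) (suc x))) (cong ι (sym e)))) (rec-inv n))) (ℚP.*-identityˡ _))))
    where l : ∀ n y x a b → n * (y * a * (x * b)) ≡ n * (a * b) * (y * x)
          l = solve-∀ ℚR

  Rg-* : ∀ n y x → suc n ≡ suc y ℕ.* suc x → ∀ g → E (Rg n) g ≡ E (Rg y) (λ t → E (Rg x) (λ u → g (t ℕ.* suc x ℕ.+ u)))
  Rg-* n y x e g = trans (cong₂ _*_ (rec-* n y x e) (trans (cong (λ k → sumℕ k g) e) (sumℕ-* (suc y) (suc x) g)))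
    (trans (ℚP.*-assoc (rec y) (rec x) (sumℕ (suc y) (λ t → sumℕ (suc x) (λ u → g (t ℕ.* suc x ℕ.+ u))))) (cong (rec y *_) (sym (Σs-* (suc y) (rec x) (λ t → sumℕ (suc x) (λ u → g (toℕ t ℕ.* suc x ℕ.+ u)))))))

  tail-count : ∀ n c (g : ℕ → ℚ) → (∀ i → g i ≤ 1ℚ) → (∀ i → i ℕ.+ c ℕ.< n → g i ≡ 0ℚ) → sumℕ n g ≤ ι c
  tail-count zero c g h z = 0≤ι c
  tail-count (suc n) c g h z with c ℕP.<? suc n
  ... | yes p = ≡≤ (trans (cong (_+ sumℕ n (g ∘ suc)) (z 0 p)) (ℚP.+-identityˡ _)) ≤⟨⟩ tail-count n c (g ∘ suc) (h ∘ suc) (λ i q → z (suc i) (ℕ.s≤s q))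
  ... | no ¬p = Σs-mono (suc n) (λ i → h (toℕ i)) ≤⟨⟩ ≡≤ (trans (Σs-const (suc n) 1ℚ) (ℚP.*-identityʳ _)) ≤⟨⟩ ι-mono (ℕP.≮⇒≥ ¬p)

  -- A shift by X takes only the last X positions of a block out of it. They are a proportion at
  -- most κ, and each costs at most 2.
  near-tail : ∀ w X κ (g h : ℕ → ℚ) → (∀ u → Near (g u) (h u) 2ℚ) → (∀ u → u ℕ.+ X ℕ.< suc w → g u ≡ h u) → ι X ≤ κ * ι (suc w) →
    Near (E (Rg w) g) (E (Rg w) h) (2ℚ * κ)
  near-tail w X κ g h nr eq hX = half g h nr eq , half h g (near-sym ∘ nr) (λ u p → sym (eq u p))
    where
    half : ∀ (g h : ℕ → ℚ) → (∀ u → Near (g u) (h u) 2ℚ) → (∀ u → u ℕ.+ X ℕ.< suc w → g u ≡ h u) → E (Rg w) g ≤ E (Rg w) h + 2ℚ * κ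
    half g h nr eq = ≡≤ (trans (E-cong (Rg w) (λ u → l (g u) (h u))) (trans (E-+ (Rg w) h (λ u → 2ℚ * d u)) (cong (E (Rg w) h +_) (E-* (Rg w) 2ℚ d)))) ≤⟨⟩
      +l {2ℚ * E (Rg w) d} {2ℚ * κ} (E (Rg w) h) (*mono {E (Rg w) d} {κ} 2ℚ 0≤2 (*mono (rec w) (0≤rec w) (tail-count (suc w) X d d≤1 d0) ≤⟨⟩ rec≤ {κ} {ι X} w hX))
      where
      d : ℕ → ℚ
      d u = ½ * (g u - h u)
      l : ∀ g h → g ≡ h + 2ℚ * (½ * (g - h))
      l = solve-∀ ℚR
      l2 : ∀ h → ½ * (h + 2ℚ - h) ≡ 1ℚ
      l2 = solve-∀ ℚR
      l3 : ∀ h → ½ * (h - h) ≡ 0ℚ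
      l3 = solve-∀ ℚR
      d≤1 : ∀ u → d u ≤ 1ℚ
      d≤1 u = *mono ½ 0≤½ (+r (- h u) (proj₁ (nr u))) ≤⟨⟩ ≡≤ (l2 (h u))
      d0 : ∀ u → u ℕ.+ X ℕ.< suc w → d u ≡ 0ℚ
      d0 u p = trans (cong (λ z → ½ * (z - h u)) (eq u p)) (l3 (h u))

  module Zn (n' : ℕ) where
    n = suc n'

    π : ℤ → Fin n
    π z = DF.fromℕ< (ℤDM.n%ℕd<d z n)

    toℕπ : ∀ z → toℕ (π z) ≡ z ℤDM.%ℕ n
    toℕπ z = FP.toℕ-fromℕ< (ℤDM.n%ℕd<d z n)

    private
      pos-eq : ∀ r r' k → ℤ.+ r ≡ ℤ.+ r' ℤ.+ ℤ.+ k ℤ.* ℤ.+ n → r ≡ r' ℕ.+ k ℕ.* n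
      pos-eq r r' k e = ℤP.+-injective (trans e (cong (λ w → ℤ.+ r' ℤ.+ w) (sym (ℤP.pos-* k n))))

      uniq : ∀ r r' k → r ℕ.< n → r' ℕ.< n → ℤ.+ r ≡ ℤ.+ r' ℤ.+ k ℤ.* ℤ.+ n → r ≡ r'
      uniq r r' (ℤ.+ zero) p p' e = trans (pos-eq r r' 0 e) (ℕP.+-identityʳ r')
      uniq r r' (ℤ.+ suc k) p p' e = contradiction (subst (n ℕ.≤_) (sym (pos-eq r r' (suc k) e)) (ℕP.≤-trans (ℕP.m≤m+n n (k ℕ.* n)) (ℕP.m≤n+m _ r'))) (ℕP.<⇒≱ p)
      uniq r r' (ℤ.-[1+ k ]) p p' e = contradiction (subst (n ℕ.≤_) (sym (pos-eq r' r (suc k) (trans (l (ℤ.+ r') (ℤ.+ suc k) (ℤ.+ n)) (cong (ℤ._+ ℤ.+ suc k ℤ.* ℤ.+ n) (sym e)))))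
           (ℕP.≤-trans (ℕP.m≤m+n n (k ℕ.* n)) (ℕP.m≤n+m _ r))) (ℕP.<⇒≱ p')
        where l : ∀ r k n → r ≡ r ℤ.+ (ℤ.- k) ℤ.* n ℤ.+ k ℤ.* n
              l = ℤS.solve-∀

    π-≡ : ∀ z z' k → z ≡ z' ℤ.+ k ℤ.* ℤ.+ n → π z ≡ π z'
    π-≡ z z' k e = FP.toℕ-injective (trans (toℕπ z) (trans (uniq (z ℤDM.%ℕ n) (z' ℤDM.%ℕ n) (k ℤ.+ z' ℤDM./ℕ n ℤ.- z ℤDM./ℕ n) (ℤDM.n%ℕd<d z n) (ℤDM.n%ℕd<d z' n) eq) (sym (toℕπ z'))))
      where
      l : ∀ r a n → r ≡ (r ℤ.+ a ℤ.* n) ℤ.- a ℤ.* n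
      l r a n = l' r (a ℤ.* n)
        where l' : ∀ r x → r ≡ (r ℤ.+ x) ℤ.- x
              l' = ℤS.solve-∀
      l2 : ∀ r' b k n a → (r' ℤ.+ b ℤ.* n ℤ.+ k ℤ.* n) ℤ.- a ℤ.* n ≡ r' ℤ.+ (k ℤ.+ b ℤ.- a) ℤ.* n
      l2 = ℤS.solve-∀
      eq : ℤ.+ (z ℤDM.%ℕ n) ≡ ℤ.+ (z' ℤDM.%ℕ n) ℤ.+ (k ℤ.+ z' ℤDM./ℕ n ℤ.- z ℤDM./ℕ n) ℤ.* ℤ.+ n
      eq = trans (l (ℤ.+ (z ℤDM.%ℕ n)) (z ℤDM./ℕ n) (ℤ.+ n))
        (trans (cong (ℤ._- (z ℤDM./ℕ n) ℤ.* ℤ.+ n) (trans (sym (ℤDM.a≡a%ℕn+[a/ℕn]*n z n)) (trans e (cong (ℤ._+ k ℤ.* ℤ.+ n) (ℤDM.a≡a%ℕn+[a/ℕn]*n z' n)))))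
          (l2 (ℤ.+ (z' ℤDM.%ℕ n)) (z' ℤDM./ℕ n) k (ℤ.+ n) (z ℤDM./ℕ n)))

    infixl 6 _⊹_
    _⊹_ : Fin n → ℤ → Fin n
    i ⊹ a = π (ℤ.+ toℕ i ℤ.+ a)

    π-⊹ : ∀ z a → π z ⊹ a ≡ π (z ℤ.+ a)
    π-⊹ z a = π-≡ (ℤ.+ toℕ (π z) ℤ.+ a) (z ℤ.+ a) (ℤ.- (z ℤDM./ℕ n)) (trans (cong (λ k → ℤ.+ k ℤ.+ a) (toℕπ z))
       (trans (l (ℤ.+ (z ℤDM.%ℕ n)) a ((z ℤDM./ℕ n)) (ℤ.+ n)) (cong (λ w → w ℤ.+ a ℤ.+ ℤ.- (z ℤDM./ℕ n) ℤ.* ℤ.+ n) (sym (ℤDM.a≡a%ℕn+[a/ℕn]*n z n)))))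
      where l : ∀ r a q n → r ℤ.+ a ≡ (r ℤ.+ q ℤ.* n) ℤ.+ a ℤ.+ ℤ.- q ℤ.* n
            l = ℤS.solve-∀

    ⊹-⊹ : ∀ i a b → (i ⊹ a) ⊹ b ≡ i ⊹ (a ℤ.+ b)
    ⊹-⊹ i a b = trans (π-⊹ (ℤ.+ toℕ i ℤ.+ a) b) (cong π (ℤP.+-assoc (ℤ.+ toℕ i) a b))

    toℕ-π< : ∀ k → k ℕ.< n → toℕ (π (ℤ.+ k)) ≡ k
    toℕ-π< k p = trans (toℕπ (ℤ.+ k)) (ℕDM.m<n⇒m%n≡m p)

    π-toℕ : ∀ i → π (ℤ.+ toℕ i) ≡ i
    π-toℕ i = FP.toℕ-injective (toℕ-π< (toℕ i) (FP.toℕ<n i))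

    ⊹-0 : ∀ i → i ⊹ ℤ.0ℤ ≡ i
    ⊹-0 i = trans (cong π (ℤP.+-identityʳ (ℤ.+ toℕ i))) (π-toℕ i)

    mF : Mean (Fin n)
    mF = uni n' id

    mF-Rg : ∀ f → E mF f ≡ E (Rg n') (λ k → f (π (ℤ.+ k)))
    mF-Rg f = cong (rec n' *_) (Σs-cong n (λ i → cong f (sym (π-toℕ i))))

    private
      inv1 : ∀ f → E mF (λ i → f (i ⊹ ℤ.+ 1)) ≡ E mF f
      inv1 f = trans (cong (rec n' *_) (trans (Σs-cong n (λ i → cong (λ k → f (π (ℤ.+ k))) (ℕP.+-comm (toℕ i) 1))) (canc (trans (Tele.tele n g) (cong (Σs n (λ i → g (toℕ i)) +_) gn))))) (sym (mF-Rg f))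
        where
        g : ℕ → ℚ
        g k = f (π (ℤ.+ k))
        gn : g n ≡ g 0
        gn = cong f (π-≡ (ℤ.+ n) (ℤ.+ 0) (ℤ.+ 1) (l (ℤ.+ n)))
          where l : ∀ n → n ≡ ℤ.+ 0 ℤ.+ ℤ.+ 1 ℤ.* n
                l = ℤS.solve-∀
        canc : ∀ {x y z} → x + z ≡ y + z → x ≡ y
        canc {x} {y} {z} e = trans (l x z) (trans (cong (_- z) e) (sym (l y z)))
          where l : ∀ x z → x ≡ x + z - z
                l = solve-∀ ℚR

      invℕ : ∀ k f → E mF (λ i → f (i ⊹ ℤ.+ k)) ≡ E mF f
      invℕ zero f = E-cong mF (λ i → cong f (⊹-0 i))
      invℕ (suc k) f = trans (E-cong mF (λ i → cong f (sym (⊹-⊹ i (ℤ.+ 1) (ℤ.+ k))))) (trans (inv1 (λ i → f (i ⊹ ℤ.+ k))) (invℕ k f))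

    inv⊹ : ∀ a f → E mF (λ i → f (i ⊹ a)) ≡ E mF f
    inv⊹ (ℤ.+ k) f = invℕ k f
    inv⊹ (ℤ.-[1+ k ]) f = trans (sym (invℕ (suc k) (λ i → f (i ⊹ ℤ.-[1+ k ])))) (E-cong mF (λ i → cong f (trans (⊹-⊹ i (ℤ.+ suc k) ℤ.-[1+ k ]) (trans (cong (i ⊹_) (ℤP.+-inverseʳ (ℤ.+ suc k))) (⊹-0 i)))))

  -- Conditional expectation onto a partition into progressions of step a and length b,
  -- where the underlying space is cut into intervals of length b·a.
  record CE {Ω : Set} (mΩ : Mean Ω) (_⊕_ : Ω → ℤ → Ω) (a b : ℕ) : Set₁ where
    field
      ker : Ω → Mean Ω
    𝔼 : (Ω → ℚ) → Ω → ℚ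
    𝔼 f ω = E (ker ω) f
    field
      symm : ∀ φ f → E mΩ (λ ω → φ ω * 𝔼 f ω) ≡ E mΩ (λ ω → 𝔼 φ ω * f ω)
      meas : ∀ (ψ : ℚ → ℚ) f ω → 𝔼 (λ ω → ψ (𝔼 f ω)) ω ≡ ψ (𝔼 f ω)
      local : ∀ ω → Supp (ker ω) (λ ω' → Σ ℤ λ x → (ω' ≡ ω ⊕ (ℤ.+ a ℤ.* x)) × (ℤ.∣ x ∣ ℕ.≤ b))
      cross : ∀ f x → (∀ ω → Bd (f ω)) → (φ : Ω → ℚ) → (∀ ω → Bd (φ ω)) → ∀ κ → 0ℚ ≤ κ → ι (a ℕ.* x) ≤ κ * ι (b ℕ.* a) →
        Near (E mΩ (λ ω → φ ω * 𝔼 f (ω ⊕ (ℤ.+ (a ℕ.* x))))) (E mΩ (λ ω → φ ω * 𝔼 f ω)) (2ℚ * κ)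

  module Cell (n' a' b' c' : ℕ) (n≡ : suc n' ≡ suc c' ℕ.* (suc b' ℕ.* suc a')) where
    open Zn n'
    a = suc a'
    b = suc b'
    c = suc c'
    w = b ℕ.* a
    w' = a' ℕ.+ b' ℕ.* a

    hd md : ℕ → ℕ
    hd k = k ℕDM./ w
    md k = k ℕDM.% a

    -- Coordinates on ℤ/n: t is the block, r the residue modulo a, and s the place along the
    -- progression. A cell fixes t and r.
    pt : ℕ → ℕ → ℕ → ℕ
    pt t s r = t ℕ.* w ℕ.+ (s ℕ.* a ℕ.+ r)

    in-w : ∀ s r → s ℕ.< b → r ℕ.< a → s ℕ.* a ℕ.+ r ℕ.< w
    in-w s r p q = ℕP.≤-trans (ℕP.≤-trans (ℕP.≤-reflexive (sym (ℕP.+-suc (s ℕ.* a) r))) (ℕP.+-monoʳ-≤ (s ℕ.* a) q)) (ℕP.≤-trans (ℕP.≤-reflexive (ℕP.+-comm (s ℕ.* a) a)) (ℕP.*-monoˡ-≤ a p))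

    hd-lem : ∀ t u → u ℕ.< w → hd (t ℕ.* w ℕ.+ u) ≡ t
    hd-lem t u p = trans (ℕDM.+-distrib-/-∣ˡ {t ℕ.* w} u {w} (divides t refl)) (trans (cong₂ ℕ._+_ (ℕDM.m*n/n≡m t w) (ℕDM.m<n⇒m/n≡0 p)) (ℕP.+-identityʳ t))

    md-lem : ∀ t s r → r ℕ.< a → md (pt t s r) ≡ r
    md-lem t s r p = trans (cong md (l t s r)) (trans (ℕDM.[m+kn]%n≡m%n r (t ℕ.* b ℕ.+ s) a) (ℕDM.m<n⇒m%n≡m p))
      where l : ∀ t s r → t ℕ.* w ℕ.+ (s ℕ.* a ℕ.+ r) ≡ r ℕ.+ (t ℕ.* b ℕ.+ s) ℕ.* a
            l t s r = l' t s r a b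
              where l' : ∀ t s r a b → t ℕ.* (b ℕ.* a) ℕ.+ (s ℕ.* a ℕ.+ r) ≡ r ℕ.+ (t ℕ.* b ℕ.+ s) ℕ.* a
                    l' = ℕS.solve-∀

    pt<n : ∀ t s r → t ℕ.< c → s ℕ.< b → r ℕ.< a → pt t s r ℕ.< n
    pt<n t s r p q q' = subst (pt t s r ℕ.<_) (sym n≡) (ℕP.≤-trans (ℕP.≤-trans (ℕP.≤-reflexive (sym (ℕP.+-suc (t ℕ.* w) _))) (ℕP.+-monoʳ-≤ (t ℕ.* w) (in-w s r q q'))) (ℕP.≤-trans (ℕP.≤-reflexive (ℕP.+-comm (t ℕ.* w) w)) (ℕP.*-monoˡ-≤ w p)))

    hd<c : ∀ (i : Fin n) → hd (toℕ i) ℕ.< c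
    hd<c i = ℕDM.m<n*o⇒m/o<n (subst (toℕ i ℕ.<_) n≡ (FP.toℕ<n i))

    md<a : ∀ k → md k ℕ.< a
    md<a k = ℕDM.m%n<n k a

    sd : ℕ → ℕ
    sd k = (k ℕDM.% w) ℕDM./ a

    sd<b : ∀ k → sd k ℕ.< b
    sd<b k = ℕDM.m<n*o⇒m/o<n (ℕDM.m%n<n k w)

    k-pt : ∀ k → k ≡ pt (hd k) (sd k) (md k)
    k-pt k = trans (ℕDM.m≡m%n+[m/n]*n k w) (trans (ℕP.+-comm (k ℕDM.% w) (hd k ℕ.* w)) (cong (hd k ℕ.* w ℕ.+_)
       (trans (ℕDM.m≡m%n+[m/n]*n (k ℕDM.% w) a) (trans (ℕP.+-comm ((k ℕDM.% w) ℕDM.% a) (sd k ℕ.* a)) (cong (sd k ℕ.* a ℕ.+_) (ℕDM.m∣n⇒o%n%m≡o%m a w k (divides b refl)))))))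

    e : (Fin n → ℚ) → ℕ → ℕ → ℚ
    e f t r = E (Rg b') (λ s → f (π (ℤ.+ pt t s r)))

    kr : Fin n → Mean (Fin n)
    kr i = bind (Rg b') (λ s → pure (π (ℤ.+ pt (hd (toℕ i)) s (md (toℕ i)))))

    dec : ∀ f → E mF f ≡ E (Rg c') (λ t → E (Rg b') (λ s → E (Rg a') (λ r → f (π (ℤ.+ pt t s r)))))
    dec f = trans (mF-Rg f) (trans (Rg-* n' c' w' n≡ (λ k → f (π (ℤ.+ k)))) (E-cong (Rg c') (λ t → Rg-* w' b' a' refl (λ u → f (π (ℤ.+ (t ℕ.* w ℕ.+ u)))))))

    𝔼-pt : ∀ f t s r → t ℕ.< c → s ℕ.< b → r ℕ.< a → E (kr (π (ℤ.+ pt t s r))) f ≡ e f t r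
    𝔼-pt f t s r p q q' = cong₂ (e f) (trans (cong hd (toℕ-π< (pt t s r) (pt<n t s r p q q'))) (hd-lem t (s ℕ.* a ℕ.+ r) (in-w s r q q')))
      (trans (cong md (toℕ-π< (pt t s r) (pt<n t s r p q q'))) (md-lem t s r q'))

    -- In cell coordinates the pairing is symmetric in φ and f, which is why conditional expectation
    -- is self-adjoint.
    dec-E : ∀ φ f → E mF (λ i → φ i * E (kr i) f) ≡ E (Rg c') (λ t → E (Rg a') (λ r → e φ t r * e f t r))
    dec-E φ f = trans (dec (λ i → φ i * E (kr i) f)) (E-Rg c' (λ t → E (Rg b') (λ s → E (Rg a') (G t s))) (λ t → E (Rg a') (λ r → e φ t r * e f t r))
        (λ t p → trans (E-Rg b' (λ s → E (Rg a') (G t s)) (λ s → E (Rg a') (H t s)) (λ s q → E-Rg a' (G t s) (H t s) (λ r q' → cong (φ (π (ℤ.+ pt t s r)) *_) (𝔼-pt f t s r p q q'))))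
          (trans (E-swap (Rg b') (Rg a') (H t)) (E-cong (Rg a') (λ r → E-*ʳ (Rg b') (e f t r) (λ s → φ (π (ℤ.+ pt t s r))))))))
      where
      G H : ℕ → ℕ → ℕ → ℚ
      G t s r = φ (π (ℤ.+ pt t s r)) * E (kr (π (ℤ.+ pt t s r))) f
      H t s r = φ (π (ℤ.+ pt t s r)) * e f t r

    ce : CE mF _⊹_ a b
    ce = record
      { ker = kr
      ; symm = λ φ f → trans (dec-E φ f) (trans (E-cong (Rg c') (λ t → E-cong (Rg a') (λ r → ℚP.*-comm (e φ t r) (e f t r)))) (trans (sym (dec-E f φ)) (E-cong mF (λ i → ℚP.*-comm (f i) (E (kr i) φ)))))
      ; meas = ms
      ; local = lc
      ; cross = crs }
      where
      abs-⊖ : ∀ x y → ℤ.∣ x ℤ.⊖ y ∣ ℕ.≤ x ℕ.⊔ y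
      abs-⊖ x y with ℕP.≤-total x y
      ... | inj₁ p = ℕP.≤-trans (ℕP.≤-reflexive (ℤP.∣⊖∣-≤ p)) (ℕP.≤-trans (ℕP.m∸n≤m y x) (ℕP.m≤n⊔m x y))
      ... | inj₂ p = ℕP.≤-trans (ℕP.≤-reflexive (trans (ℤP.∣m⊖n∣≡∣n⊖m∣ x y) (ℤP.∣⊖∣-≤ p))) (ℕP.≤-trans (ℕP.m∸n≤m x y) (ℕP.m≤m⊔n x y))
      loc : ∀ i s → ℤ.+ pt (hd (toℕ i)) s (md (toℕ i)) ≡ ℤ.+ toℕ i ℤ.+ ℤ.+ a ℤ.* (ℤ.+ s ℤ.- ℤ.+ sd (toℕ i))
      loc i s = trans (P s) (trans (l (ℤ.+ (hd k ℕ.* w)) (ℤ.+ s) (ℤ.+ a) (ℤ.+ md k) (ℤ.+ sd k)) (cong (λ z → z ℤ.+ ℤ.+ a ℤ.* (ℤ.+ s ℤ.- ℤ.+ sd k)) (sym (trans (cong ℤ.+_ (k-pt k)) (P (sd k))))))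
        where
        k = toℕ i
        P : ∀ s → ℤ.+ pt (hd k) s (md k) ≡ ℤ.+ (hd k ℕ.* w) ℤ.+ (ℤ.+ s ℤ.* ℤ.+ a ℤ.+ ℤ.+ md k)
        P s = cong (λ z → ℤ.+ (hd k ℕ.* w) ℤ.+ (z ℤ.+ ℤ.+ md k)) (ℤP.pos-* s a)
        l : ∀ h s a m d → h ℤ.+ (s ℤ.* a ℤ.+ m) ≡ h ℤ.+ (d ℤ.* a ℤ.+ m) ℤ.+ a ℤ.* (s ℤ.- d)
        l = ℤS.solve-∀
      ms : ∀ (ψ : ℚ → ℚ) f i → E (kr i) (λ ω → ψ (E (kr ω) f)) ≡ ψ (E (kr i) f)
      ms ψ f i = trans (E-congS (Rg b') {λ s → ψ (E (kr (π (ℤ.+ pt (hd (toℕ i)) s (md (toℕ i))))) f)} {λ _ → ψ (E (kr i) f)}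
        (supp-map (Rg b') (λ s q → cong ψ (𝔼-pt f (hd (toℕ i)) s (md (toℕ i)) (hd<c i) q (md<a (toℕ i)))) (Rg-supp b'))) (E-const (Rg b') (ψ (E (kr i) f)))
      Loc : Fin n → Fin n → Set
      Loc i j = Σ ℤ λ x → (j ≡ i ⊹ (ℤ.+ a ℤ.* x)) × (ℤ.∣ x ∣ ℕ.≤ b)
      lc : ∀ i → Supp (kr i) (Loc i)
      lc i = supp-map (Rg b') {λ s → s ℕ.< b} {λ s → Loc i (π (ℤ.+ pt (hd (toℕ i)) s (md (toℕ i))))} (λ s q → ℤ.+ s ℤ.- ℤ.+ sd (toℕ i) , cong π (loc i s) ,
           ℕP.≤-trans (subst (ℕ._≤ s ℕ.⊔ sd (toℕ i)) (cong ℤ.∣_∣ (sym (ℤP.[+m]-[+n]≡m⊖n s (sd (toℕ i))))) (abs-⊖ s (sd (toℕ i)))) (ℕP.⊔-lub (ℕP.<⇒≤ q) (ℕP.<⇒≤ (sd<b (toℕ i))))) (Rg-supp b')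
      crs : ∀ f x → (∀ ω → Bd (f ω)) → (φ : Fin n → ℚ) → (∀ ω → Bd (φ ω)) → ∀ κ → 0ℚ ≤ κ → ι (a ℕ.* x) ≤ κ * ι (b ℕ.* a) →
        Near (E mF (λ ω → φ ω * E (kr (ω ⊹ (ℤ.+ (a ℕ.* x)))) f)) (E mF (λ ω → φ ω * E (kr ω) f)) (2ℚ * κ)
      crs f x bf φ bφ κ κ0 hx = near-≡ (sym (de (λ i → φ i * E (kr (i ⊹ (ℤ.+ X))) f))) (sym (de (λ i → φ i * E (kr i) f)))
        (E-nearS (Rg c') {λ t → E (Rg w') (λ u → φ (P t u) * E (kr (P t u ⊹ (ℤ.+ X))) f)} {λ t → E (Rg w') (λ u → φ (P t u) * E (kr (P t u)) f)} (supp-map (Rg c') (λ t p → near-tail w' X κ (λ u → φ (P t u) * E (kr (P t u ⊹ (ℤ.+ X))) f) (λ u → φ (P t u) * E (kr (P t u)) f)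
           (λ u → near-bd (bd* (bφ _) (E-bd (kr (P t u ⊹ (ℤ.+ X))) bf)) (bd* (bφ _) (E-bd (kr (P t u)) bf)))
           (λ u q → cong (φ (P t u) *_) (same t u p q)) hx) (Rg-supp c')))
        where
        X = a ℕ.* x
        P : ℕ → ℕ → Fin n
        P t u = π (ℤ.+ (t ℕ.* w ℕ.+ u))
        de : ∀ (g : Fin n → ℚ) → E mF g ≡ E (Rg c') (λ t → E (Rg w') (λ u → g (P t u)))
        de g = trans (mF-Rg g) (Rg-* n' c' w' n≡ (λ k → g (π (ℤ.+ k))))
        lt : ∀ t u → t ℕ.< c → u ℕ.< w → t ℕ.* w ℕ.+ u ℕ.< n
        lt t u p q = subst (t ℕ.* w ℕ.+ u ℕ.<_) (sym n≡) (ℕP.≤-trans (ℕP.≤-trans (ℕP.≤-reflexive (sym (ℕP.+-suc (t ℕ.* w) u))) (ℕP.+-monoʳ-≤ (t ℕ.* w) q)) (ℕP.≤-trans (ℕP.≤-reflexive (ℕP.+-comm (t ℕ.* w) w)) (ℕP.*-monoˡ-≤ w p)))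
        kr-P : ∀ t u → t ℕ.< c → u ℕ.< w → E (kr (P t u)) f ≡ e f t (md (t ℕ.* w ℕ.+ u))
        kr-P t u p q = cong₂ (e f) (trans (cong hd (toℕ-π< _ (lt t u p q))) (hd-lem t u q)) (cong md (toℕ-π< _ (lt t u p q)))
        same : ∀ t u → t ℕ.< c → u ℕ.+ X ℕ.< w → E (kr (P t u ⊹ (ℤ.+ X))) f ≡ E (kr (P t u)) f
        same t u p q = trans (cong (λ i → E (kr i) f) (trans (π-⊹ (ℤ.+ (t ℕ.* w ℕ.+ u)) (ℤ.+ X)) (cong (λ k → π (ℤ.+ k)) (ℕP.+-assoc (t ℕ.* w) u X))))
          (trans (kr-P t (u ℕ.+ X) p q) (trans (cong (e f t) (trans (cong (ℕDM._% a) (l (t ℕ.* w) u a x)) (ℕDM.[m+kn]%n≡m%n (t ℕ.* w ℕ.+ u) x a)))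
            (sym (kr-P t u p (ℕP.≤-<-trans (ℕP.m≤m+n u X) q)))))
          where l : ∀ t u a x → t ℕ.+ (u ℕ.+ a ℕ.* x) ≡ t ℕ.+ u ℕ.+ x ℕ.* a
                l = ℕS.solve-∀
open CyclicBlocks

-- Refinement of partitions, and the two actions on the torus.

module Torus where
  module Nest (n' a' b' c' : ℕ) (n≡ : suc n' ≡ suc c' ℕ.* (suc b' ℕ.* suc a'))
              (â' b̂' ĉ' : ℕ) (n̂≡ : suc n' ≡ suc ĉ' ℕ.* (suc b̂' ℕ.* suc â'))
              (g' : ℕ) (a∣â : suc a' ∣ suc â') (w≡ : suc b' ℕ.* suc a' ≡ (suc b̂' ℕ.* suc â') ℕ.* suc g') where
    private
      module C = Cell n' a' b' c' n≡
      module F = Cell n' â' b̂' ĉ' n̂≡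
    open Zn n'

    hd-hd : ∀ k → C.hd k ≡ F.hd k ℕDM./ suc g'
    hd-hd k = trans (ℕDM./-congʳ {m = k} w≡) (sym (ℕDM.m/n/o≡m/[n*o] k F.w (suc g')))

    md-md : ∀ k → C.md k ≡ C.md (F.md k)
    md-md k = sym (ℕDM.m∣n⇒o%n%m≡o%m C.a F.a k a∣â)

    -- The fine block and the fine residue determine the coarse ones: residues because a divides â,
    -- blocks because g fine blocks make up one coarse block.
    nest : ∀ f i → E (F.kr i) (λ j → E (C.kr j) f) ≡ E (C.kr i) f
    nest f i = trans (E-Rg b̂' (λ s → E (C.kr (π (ℤ.+ p s))) f) (λ _ → E (C.kr i) f) (λ s q →
        cong₂ (C.e f) (trans (cong C.hd (toℕ-π< (p s) (lt s q))) (trans (hd-hd (p s)) (trans (cong (ℕDM._/ suc g') (F.hd-lem t (s ℕ.* F.a ℕ.+ r) (F.in-w s r q (F.md<a k)))) (sym (hd-hd k)))))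
          (trans (cong C.md (toℕ-π< (p s) (lt s q))) (trans (md-md (p s)) (trans (cong C.md (F.md-lem t s r (F.md<a k))) (sym (md-md k)))))))
        (E-const (Rg b̂') (E (C.kr i) f))
      where
      k = toℕ i
      t = F.hd k
      r = F.md k
      p : ℕ → ℕ
      p s = F.pt t s r
      lt : ∀ s → s ℕ.< F.b → p s ℕ.< n
      lt s q = F.pt<n t s r (F.hd<c i) q (F.md<a k)

  -- The first partition is the coarser one; its averages are constant on cells of the second.
  Nested : {Ω : Set} {mΩ : Mean Ω} {_⊕_ : Ω → ℤ → Ω} {a b a' b' : ℕ} → CE mΩ _⊕_ a b → CE mΩ _⊕_ a' b' → Set
  Nested {Ω} C C' = ∀ (f : Ω → ℚ) ω → CE.𝔼 C' (CE.𝔼 C f) ω ≡ CE.𝔼 C f ω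

  module Square (n' : ℕ) where
    open Zn n'

    Pt : Set
    Pt = Fin n × Fin n

    m² : Mean Pt
    m² = bind mF (λ x → bind mF (λ y → pure (x , y)))

    _⬆_ _⮕_ : Pt → ℤ → Pt
    (x , y) ⬆ t = x , y ⊹ t
    (x , y) ⮕ t = x ⊹ t , y

    swap² : ∀ (f : Pt → ℚ) → E m² f ≡ E mF (λ y → E mF (λ x → f (x , y)))
    swap² f = E-swap mF mF (λ x y → f (x , y))

    S² : Sys2
    S² = record
      { sys = record
          { Ω = Pt ; mΩ = m² ; _⊕_ = _⬆_
          ; ⊕-⊕ = λ { (x , y) a b → cong (x ,_) (⊹-⊹ y a b) }
          ; ⊕-0 = λ { (x , y) → cong (x ,_) (⊹-0 y) }
          ; inv = λ a f → E-cong mF (λ x → inv⊹ a (λ y → f (x , y))) }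
      ; _⊞_ = _⮕_
      ; ⊞-⊞ = λ { (x , y) a b → cong (_, y) (⊹-⊹ x a b) }
      ; ⊞-0 = λ { (x , y) → cong (_, y) (⊹-0 x) }
      ; invH = λ a f → trans (swap² (λ ω → f (ω ⮕ a))) (trans (E-cong mF (λ y → inv⊹ a (λ x → f (x , y)))) (sym (swap² f)))
      ; comm = λ ω a b → refl }

    vert : ∀ {a b} → CE mF _⊹_ a b → CE m² _⬆_ a b
    vert {a} {b} C = record
      { ker = λ { (x , y) → bind (CE.ker C y) (λ y' → pure (x , y')) }
      ; symm = λ φ f → E-cong mF (λ x → CE.symm C (λ y → φ (x , y)) (λ y → f (x , y)))
      ; meas = λ { ψ f (x , y) → CE.meas C ψ (λ y → f (x , y)) y }
      ; local = λ { (x , y) → supp-map (CE.ker C y) (λ { y' (z , e , p) → z , cong (x ,_) e , p }) (CE.local C y) }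
      ; cross = λ f z bf φ bφ κ κ0 h → E-near mF (λ x → CE.cross C (λ y → f (x , y)) z (λ y → bf (x , y)) (λ y → φ (x , y)) (λ y → bφ (x , y)) κ κ0 h) }

    hori : ∀ {a b} → CE mF _⊹_ a b → CE m² _⮕_ a b
    hori {a} {b} C = record
      { ker = k
      ; symm = λ φ f → trans (swap² (λ ω → φ ω * E (k ω) f)) (trans (E-cong mF (λ y → CE.symm C (λ x → φ (x , y)) (λ x → f (x , y)))) (sym (swap² (λ ω → E (k ω) φ * f ω))))
      ; meas = λ { ψ f (x , y) → CE.meas C ψ (λ x → f (x , y)) x }
      ; local = λ { (x , y) → supp-map (CE.ker C x) (λ { x' (z , e , p) → z , cong (_, y) e , p }) (CE.local C x) }
      ; cross = λ f z bf φ bφ κ κ0 h → near-≡ (sym (swap² (λ ω → φ ω * E (k (ω ⮕ (ℤ.+ (a ℕ.* z)))) f))) (sym (swap² (λ ω → φ ω * E (k ω) f)))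
          (E-near mF (λ y → CE.cross C (λ x → f (x , y)) z (λ x → bf (x , y)) (λ x → φ (x , y)) (λ x → bφ (x , y)) κ κ0 h)) }
      where
      k : Pt → Mean Pt
      k (x , y) = bind (CE.ker C x) (λ x' → pure (x' , y))

    vert-nested : ∀ {a b a' b'} (C : CE mF _⊹_ a b) (C' : CE mF _⊹_ a' b') → Nested C C' → Nested (vert C) (vert C')
    vert-nested C C' h f (x , y) = h (λ y → f (x , y)) y

    hori-nested : ∀ {a b a' b'} (C : CE mF _⊹_ a b) (C' : CE mF _⊹_ a' b') → Nested C C' → Nested (hori C) (hori C')
    hori-nested C C' h f (x , y) = h (λ x → f (x , y)) x
open Torus

-- Conditional expectation, energy and the cubic lower bound.

module ConditionalExpectation where
  module CondExp {Ω : Set} {mΩ : Mean Ω} {_⊕_ : Ω → ℤ → Ω} {a b : ℕ} (C : CE mΩ _⊕_ a b) where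
    open CE C public

    𝔼-bd : ∀ {f} → (∀ ω → Bd (f ω)) → ∀ ω → Bd (𝔼 f ω)
    𝔼-bd h ω = E-bd (ker ω) h

    𝔼-≥0 : ∀ {f} → (∀ ω → 0ℚ ≤ f ω) → ∀ ω → 0ℚ ≤ 𝔼 f ω
    𝔼-≥0 h ω = E-≥c (ker ω) h

    𝔼-≤1 : ∀ {f} → (∀ ω → f ω ≤ 1ℚ) → ∀ ω → 𝔼 f ω ≤ 1ℚ
    𝔼-≤1 h ω = E-≤c (ker ω) h

    near-𝔼 : ∀ φ {η} → (∀ ω x → ℤ.∣ x ∣ ℕ.≤ b → Near (φ (ω ⊕ (ℤ.+ a ℤ.* x))) (φ ω) η) → ∀ ω → Near (𝔼 φ ω) (φ ω) η
    near-𝔼 φ {η} h ω = near-≡ refl (E-const (ker ω) (φ ω)) (E-nearS (ker ω) {φ} {λ _ → φ ω} (supp-map (ker ω) (λ { ω' (x , refl , p) → h ω x p }) (local ω)))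

    -- Self-adjointness moves the averaging to φ, which it hardly changes because φ is nearly
    -- constant on cells.
    ip-𝔼 : ∀ φ f {η} → (∀ ω → Bd (f ω)) → (∀ ω x → ℤ.∣ x ∣ ℕ.≤ b → Near (φ (ω ⊕ (ℤ.+ a ℤ.* x))) (φ ω) η) →
      Near (E mΩ (λ ω → φ ω * f ω)) (E mΩ (λ ω → φ ω * 𝔼 f ω)) η
    ip-𝔼 φ f bf h = near-sym (near-≡ (sym (symm φ f)) refl (E-near mΩ (λ ω → near-≡ (ℚP.*-comm (f ω) (𝔼 φ ω)) (ℚP.*-comm (f ω) (φ ω)) (near-* (bf ω) (near-𝔼 φ h ω)))))

    fψ : ∀ (ψ : ℚ → ℚ) f → E mΩ (λ ω → f ω * ψ (𝔼 f ω)) ≡ E mΩ (λ ω → 𝔼 f ω * ψ (𝔼 f ω))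
    fψ ψ f = trans (E-cong mΩ (λ ω → cong (f ω *_) (sym (meas ψ f ω)))) (symm f (λ ω → ψ (𝔼 f ω)))

    energy : (Ω → ℚ) → ℚ
    energy f = E mΩ (λ ω → sq (𝔼 f ω))

    energy≡ : ∀ f → energy f ≡ E mΩ (λ ω → 𝔼 f ω * f ω)
    energy≡ f = trans (sym (fψ id f)) (E-cong mΩ (λ ω → ℚP.*-comm (f ω) (𝔼 f ω)))

    energy≥0 : ∀ f → 0ℚ ≤ energy f
    energy≥0 f = E-≥c mΩ (λ ω → nn-sq (𝔼 f ω))

    energy≤1 : ∀ f → (∀ ω → Bd (f ω)) → energy f ≤ 1ℚ
    energy≤1 f bf = E-≤c mΩ (λ ω → sq≤1 (𝔼-bd bf ω))

  module Refine {Ω : Set} {mΩ : Mean Ω} {_⊕_ : Ω → ℤ → Ω} {a b a' b' : ℕ} (C : CE mΩ _⊕_ a b) (C' : CE mΩ _⊕_ a' b') (nst : Nested C C') where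
    private
      module C = CondExp C
      module F = CondExp C'

    -- Pythagoras: nestedness makes the inner product of the two averages equal to the coarse
    -- energy.
    increment : ∀ f → E mΩ (λ ω → sq (F.𝔼 f ω - C.𝔼 f ω)) ≡ F.energy f - C.energy f
    increment f = trans (E-cong mΩ (λ ω → l (F.𝔼 f ω) (C.𝔼 f ω))) (trans (E-+ mΩ (λ ω → sq (F.𝔼 f ω)) (λ ω → sq (C.𝔼 f ω) - (C.𝔼 f ω * F.𝔼 f ω + C.𝔼 f ω * F.𝔼 f ω)))
      (cong (F.energy f +_) (trans (E-- mΩ (λ ω → sq (C.𝔼 f ω)) (λ ω → C.𝔼 f ω * F.𝔼 f ω + C.𝔼 f ω * F.𝔼 f ω))
        (trans (cong (λ z → C.energy f - z) (trans (E-+ mΩ (λ ω → C.𝔼 f ω * F.𝔼 f ω) (λ ω → C.𝔼 f ω * F.𝔼 f ω)) (cong₂ _+_ cr cr))) (l2 (C.energy f))))))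
      where
      l : ∀ v w → (v - w) * (v - w) ≡ v * v + (w * w - (w * v + w * v))
      l = solve-∀ ℚR
      l2 : ∀ e → e - (e + e) ≡ - e
      l2 = solve-∀ ℚR
      cr : E mΩ (λ ω → C.𝔼 f ω * F.𝔼 f ω) ≡ C.energy f
      cr = trans (F.symm (C.𝔼 f) f) (trans (E-cong mΩ (λ ω → cong (_* f ω) (nst f ω))) (sym (C.energy≡ f)))

  dilate : Sys → ℤ → Sys
  dilate S q = record { Ω = Ω ; mΩ = mΩ ; _⊕_ = λ ω t → ω ⊕ q ℤ.* t
    ; ⊕-⊕ = λ ω a b → trans (⊕-⊕ ω (q ℤ.* a) (q ℤ.* b)) (cong (ω ⊕_) (sym (ℤP.*-distribˡ-+ q a b)))
    ; ⊕-0 = λ ω → trans (cong (ω ⊕_) (ℤP.*-zeroʳ q)) (⊕-0 ω)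
    ; inv = λ a → inv (q ℤ.* a) }
    where open Sys S

  horiz : Sys2 → Sys
  horiz S2 = record { Ω = Ω ; mΩ = mΩ ; _⊕_ = _⊞_ ; ⊕-⊕ = ⊞-⊞ ; ⊕-0 = ⊞-0 ; inv = invH }
    where open Sys2 S2

  dilate² : Sys2 → ℤ → ℤ → Sys2
  dilate² S2 p q = record { sys = dilate sys q ; _⊞_ = λ ω t → ω ⊞ p ℤ.* t
    ; ⊞-⊞ = Sys.⊕-⊕ (dilate (horiz S2) p)
    ; ⊞-0 = Sys.⊕-0 (dilate (horiz S2) p)
    ; invH = λ a → invH (p ℤ.* a)
    ; comm = λ ω a b → comm ω (p ℤ.* a) (q ℤ.* b) }
    where open Sys2 S2

  -- ‖P(f − 𝔼f)‖² is small up to the energy increment of a finer partition: P*P(f − 𝔼'f) is nearly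
  -- constant on the fine cells, to which f − 𝔼'f is orthogonal.
  module Step (S : Sys) (q q̃ : ℤ) {a b a' b' : ℕ} (C : CE (Sys.mΩ S) (Sys._⊕_ S) a b) (C' : CE (Sys.mΩ S) (Sys._⊕_ S) a' b') (nst : Nested C C')
              (a'≡ : ℤ.+ a' ≡ q ℤ.* q̃) (μ : Mean ℤ) (η : ℚ) (absμ : ∀ x → ℤ.∣ x ∣ ℕ.≤ b' → Abs μ (q̃ ℤ.* x) η)
              (f : Sys.Ω S → ℚ) (f0 : ∀ ω → 0ℚ ≤ f ω) (f1 : ∀ ω → f ω ≤ 1ℚ) where
    private
      module C = CondExp C
      module F = CondExp C'
    Sq = dilate S q
    open Sys Sq
    open Dyn Sq

    private
      bf : ∀ ω → Bd (f ω)
      bf ω = bd-nn (f0 ω) (f1 ω)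

      bd-diff : ∀ {x y} → 0ℚ ≤ x → x ≤ 1ℚ → 0ℚ ≤ y → y ≤ 1ℚ → Bd (x - y)
      bd-diff {x} {y} x0 x1 y0 y1 = (≡≤ (l) ≤⟨⟩ (x0 +≤ neg≤ y1)) , ((x1 +≤ neg≤ y0) ≤⟨⟩ ≡≤ refl)
        where
        l : - 1ℚ ≡ 0ℚ + - 1ℚ
        l = refl

      H : Fn
      H ω = f ω - F.𝔼 f ω

      bH : BdF H
      bH ω = bd-diff (f0 ω) (f1 ω) (F.𝔼-≥0 f0 ω) (F.𝔼-≤1 f1 ω)

      φ : Fn
      φ ω = E μ (λ x → P μ H (ω ⊕ ℤ.- x))

      N≡ : N μ H ≡ E mΩ (λ ω → φ ω * H ω)
      N≡ = trans (E-cong mΩ (λ ω → sym (E-* μ (P μ H ω) (λ x → H (ω ⊕ x))))) (trans (E-swap mΩ μ (λ ω x → P μ H ω * H (ω ⊕ x)))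
        (trans (E-cong μ (λ x → trans (sym (inv (ℤ.- x) (λ ω → P μ H ω * H (ω ⊕ x)))) (E-cong mΩ (λ ω → cong (P μ H (ω ⊕ ℤ.- x) *_) (cong H (trans (⊕-⊕ ω (ℤ.- x) x) (trans (cong (ω ⊕_) (ℤP.+-inverseˡ x)) (⊕-0 ω))))))))
          (trans (E-swap μ mΩ (λ x ω → P μ H (ω ⊕ ℤ.- x) * H ω)) (E-cong mΩ (λ ω → E-*ʳ μ (H ω) (λ x → P μ H (ω ⊕ ℤ.- x)))))))

      -- A move by a'·x inside a fine cell is, in the dilated action, a shift of the averaging
      -- variable by -q̃x, and μ absorbs it.
      φ-near : ∀ ω x → ℤ.∣ x ∣ ℕ.≤ b' → Near (φ (Sys._⊕_ S ω (ℤ.+ a' ℤ.* x))) (φ ω) η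
      φ-near ω x p = near-≡ (E-cong μ (λ y → cong (P μ H) (sym (trans (cong (λ w → w ⊕ ℤ.- y) (cong (Sys._⊕_ S ω) (trans (cong (ℤ._* x) a'≡) (ℤP.*-assoc q q̃ x))))
           (trans (⊕-⊕ ω (q̃ ℤ.* x) (ℤ.- y)) (cong (ω ⊕_) (l q̃ x y))))))) refl
        (ab (abs-neg μ (absμ x p)) (λ y → P μ H (ω ⊕ ℤ.- y)) (λ y → bdP μ bH _))
        where
        l : ∀ q x y → q ℤ.* x ℤ.+ ℤ.- y ≡ ℤ.- (y ℤ.+ ℤ.- (q ℤ.* x))
        l = ℤS.solve-∀

      N-fine : N μ H ≤ η
      N-fine = ≡≤ (trans N≡ (trans (E-cong mΩ (λ ω → l (φ ω) (f ω) (F.𝔼 f ω))) (E-- mΩ (λ ω → φ ω * f ω) (λ ω → φ ω * F.𝔼 f ω)))) ≤⟨⟩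
        +r (- E mΩ (λ ω → φ ω * F.𝔼 f ω)) (proj₁ (F.ip-𝔼 φ f bf φ-near)) ≤⟨⟩ ≡≤ (l2 (E mΩ (λ ω → φ ω * F.𝔼 f ω)) η)
        where
        l : ∀ a f g → a * (f - g) ≡ a * f - a * g
        l = solve-∀ ℚR
        l2 : ∀ x η → x + η - x ≡ η
        l2 = solve-∀ ℚR

    N-coarse : N μ (λ ω → f ω - C.𝔼 f ω) ≤ 2ℚ * η + 2ℚ * (F.energy f - C.energy f)
    N-coarse = E-mono mΩ (λ ω → ≡≤ (cong sq (trans (E-cong μ (λ x → l1 (f (ω ⊕ x)) (F.𝔼 f (ω ⊕ x)) (C.𝔼 f (ω ⊕ x)))) (E-+ μ (λ x → H (ω ⊕ x)) (λ x → G (ω ⊕ x))))) ≤⟨⟩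
         by (nn-sq (P μ H ω - P μ G ω)) (l2 (P μ H ω) (P μ G ω))) ≤⟨⟩
       ≡≤ (trans (E-+ mΩ (λ ω → 2ℚ * sq (P μ H ω)) (λ ω → 2ℚ * sq (P μ G ω))) (cong₂ _+_ (E-* mΩ 2ℚ (λ ω → sq (P μ H ω))) (E-* mΩ 2ℚ (λ ω → sq (P μ G ω))))) ≤⟨⟩
       (*mono 2ℚ 0≤2 N-fine +≤ *mono 2ℚ 0≤2 N-G)
      where
      G : Fn
      G ω = F.𝔼 f ω - C.𝔼 f ω
      l1 : ∀ f g h → f - h ≡ f - g + (g - h)
      l1 = solve-∀ ℚR
      l2 : ∀ x y → 2ℚ * (x * x) + 2ℚ * (y * y) ≡ (x + y) * (x + y) + (x - y) * (x - y)
      l2 = solve-∀ ℚR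
      N-G : N μ G ≤ F.energy f - C.energy f
      N-G = E-mono mΩ (λ ω → jensen μ (λ x → G (ω ⊕ x))) ≤⟨⟩ ≡≤ (trans (E-swap mΩ μ (λ ω x → sq (G (ω ⊕ x)))) (trans (E-cong μ (λ x → inv x (λ ω → sq (G ω)))) (trans (E-const μ (E mΩ (λ ω → sq (G ω)))) (Refine.increment C C' nst f))))

  abstract
    -- Total, because `fψ` takes a function on all of ℚ; the value 0 at nonpositive arguments keeps
    -- it nonnegative.
    inv⁺ : ℚ → ℚ
    inv⁺ y = go (0ℚ ℚP.<? y)
      where
      go : Dec (0ℚ ℚ.< y) → ℚ
      go (yes p) = (ℚ.1/ y) {{ℚP.pos⇒nonZero y {{ℚ.positive p}}}}
      go (no _) = 0ℚ

    inv⁺-inverse : ∀ {y} → 0ℚ ℚ.< y → inv⁺ y * y ≡ 1ℚ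
    inv⁺-inverse {y} p with 0ℚ ℚP.<? y
    ... | yes p' = ℚP.*-inverseˡ y {{ℚP.pos⇒nonZero y {{ℚ.positive p'}}}}
    ... | no ¬p = contradiction p ¬p

    0≤inv⁺ : ∀ y → 0ℚ ≤ inv⁺ y
    0≤inv⁺ y with 0ℚ ℚP.<? y
    ... | yes p' = ℚP.<⇒≤ (ℚP.positive⁻¹ _ {{ℚP.1/pos⇒pos y {{ℚ.positive p'}}}})
    ... | no ¬p = ℚP.≤-refl

  <⇒≱ : ∀ {x y} → x ℚ.< y → ¬ y ≤ x
  <⇒≱ p q = ℚP.<-irrefl refl (ℚP.<-≤-trans p q)

  0<rec : ∀ r → 0ℚ ℚ.< rec r
  0<rec r = ℚP.≰⇒> (λ p → <⇒≱ (ℚP.positive⁻¹ 1ℚ) (≡≤ (sym (rec-inv r)) ≤⟨⟩ *mono' (ι (suc r)) (0≤ι (suc r)) p ≤⟨⟩ ≡≤ (ℚP.*-zeroˡ (ι (suc r)))))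

  -- Completing the square in r gives p(r - (3 - p)/2)² + (1 - p)²(4 - p)/4, which settles p ≤ 4.
  -- For p ≥ 4 the term p²r alone dominates 3pr.
  amgm : ∀ p r → 0ℚ ≤ p → 0ℚ ≤ r → 0ℚ ≤ 1ℚ + p * p * r + p * r * r - ι 3 * (p * r)
  amgm p r p0 r0 with ℚP.≤-total p (ι 4)
  ... | inj₁ h = nn+ (nn* (nn-sq (p - 1ℚ)) (nn* 0≤¼ (diff h))) (nn* p0 (nn-sq (r - p - (ι 3 * ½) * (1ℚ - p)))) ≤⟨⟩ ≡≤ (l p r)
    where
    0≤¼ : 0ℚ ≤ ½ * ½
    0≤¼ = nn* 0≤½ 0≤½
    l : ∀ p r → (p - 1ℚ) * (p - 1ℚ) * (½ * ½ * (ι 4 - p)) + p * ((r - p - (ι 3 * ½) * (1ℚ - p)) * (r - p - (ι 3 * ½) * (1ℚ - p))) ≡ 1ℚ + p * p * r + p * r * r - ι 3 * (p * r)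
    l = solve-∀ ℚR
  ... | inj₂ h = nn+ (nn+ 0≤1 (nn* (nn* p0 r0) (nn+ (diff h) r0))) (nn* p0 r0) ≤⟨⟩ ≡≤ (l p r)
    where
    l : ∀ p r → 1ℚ + p * r * (p - ι 4 + r) + p * r ≡ 1ℚ + p * p * r + p * r * r - ι 3 * (p * r)
    l = solve-∀ ℚR

  -- AM-GM:  A B + m³/A + m³/B ≥ 3 m²,  with P = 1/A and Q = 1/B.
  amgm-inv : ∀ {A B P Q m} → 0ℚ ≤ A → 0ℚ ≤ B → 0ℚ ≤ P → 0ℚ ≤ Q → 0ℚ ≤ m → P * A ≡ 1ℚ → Q * B ≡ 1ℚ →
    ι 3 * (m * m) ≤ A * B + m * m * m * (P + Q)
  amgm-inv {A} {B} {P} {Q} {m} A0 B0 P0 Q0 m0 e e' = by (nn* (nn* A0 B0) (amgm (m * P) (m * Q) (nn* m0 P0) (nn* m0 Q0)))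
    (sym (trans (l A B P Q m) (trans (cong₂ (λ x y → ι 3 * (m * m) + (A * B + x * y * (m * m * m) * (P + Q) - ι 3 * (m * m) * (x * y))) e e') (l2 A B P Q m))))
    where
    l : ∀ A B P Q m → ι 3 * (m * m) + A * B * (1ℚ + m * P * (m * P) * (m * Q) + m * P * (m * Q) * (m * Q) - ι 3 * (m * P * (m * Q))) ≡
      ι 3 * (m * m) + (A * B + P * A * (Q * B) * (m * m * m) * (P + Q) - ι 3 * (m * m) * (P * A * (Q * B)))
    l = solve-∀ ℚR
    l2 : ∀ A B P Q m → ι 3 * (m * m) + (A * B + 1ℚ * 1ℚ * (m * m * m) * (P + Q) - ι 3 * (m * m) * (1ℚ * 1ℚ)) ≡ A * B + m * m * m * (P + Q)
    l2 = solve-∀ ℚR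

  -- If u and v are conditional expectations of f then 𝔼 f u v ≥ (𝔼 f)³: by AM-GM and 𝔼 f/u ≤ 1, 𝔼 f/v ≤ 1;
  -- u and v are shifted by rec r to make them invertible.
  module Chu {Ω : Set} {mΩ : Mean Ω} {_⊕_ _⊞_ : Ω → ℤ → Ω} {a b a' b' : ℕ} (C₁ : CE mΩ _⊕_ a b) (C₂ : CE mΩ _⊞_ a' b')
             (f : Ω → ℚ) (f0 : ∀ ω → 0ℚ ≤ f ω) (f1 : ∀ ω → f ω ≤ 1ℚ) where
    private
      module V = CondExp C₁
      module H = CondExp C₂
      u v : Ω → ℚ
      u = H.𝔼 f
      v = V.𝔼 f
      m = E mΩ f

    chu : ∀ r → m * m * m ≤ E mΩ (λ ω → f ω * u ω * v ω) + ι 3 * rec r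
    chu r = fin
      where
      τ = rec r
      ψ : ℚ → ℚ
      ψ x = inv⁺ (x + τ)
      m0 : 0ℚ ≤ m
      m0 = E-≥c mΩ f0
      u0 = H.𝔼-≥0 f0
      v0 = V.𝔼-≥0 f0
      pos : ∀ {x} → 0ℚ ≤ x → 0ℚ ℚ.< x + τ
      pos {x} p = ℚP.<-≤-trans (0<rec r) (≡≤ (sym (ℚP.+-identityˡ τ)) ≤⟨⟩ +r τ p)
      tower : ∀ {x} → 0ℚ ≤ x → x * ψ x ≤ 1ℚ
      tower {x} p = by (nn* (0≤inv⁺ (x + τ)) (0≤rec r)) (trans (sym (inv⁺-inverse (pos p))) (l (ψ x) x τ))
        where l : ∀ p x t → p * (x + t) ≡ x * p + p * t
              l = solve-∀ ℚR
      fu : E mΩ (λ ω → f ω * ψ (u ω)) ≤ 1ℚ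
      fu = ≡≤ (H.fψ ψ f) ≤⟨⟩ E-≤c mΩ (λ ω → tower (u0 ω))
      fv : E mΩ (λ ω → f ω * ψ (v ω)) ≤ 1ℚ
      fv = ≡≤ (V.fψ ψ f) ≤⟨⟩ E-≤c mΩ (λ ω → tower (v0 ω))
      M³ = m * m * m
      -- Replacing uv by (u + τ)(v + τ) costs τ(u + v + τ) ≤ 3τ, the source of the error in `chu`.
      pt : ∀ ω → f ω * (ι 3 * (m * m)) ≤ f ω * u ω * v ω + ι 3 * τ + M³ * (f ω * ψ (u ω) + f ω * ψ (v ω))
      pt ω = *mono (f ω) (f0 ω) (amgm-inv (ℚP.<⇒≤ (pos (u0 ω))) (ℚP.<⇒≤ (pos (v0 ω))) (0≤inv⁺ (u ω + τ)) (0≤inv⁺ (v ω + τ)) m0 (inv⁺-inverse (pos (u0 ω))) (inv⁺-inverse (pos (v0 ω)))) ≤⟨⟩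
        by (nn+ (nn* (0≤rec r) (nn+ (nn+ (nn* (f0 ω) (diff (H.𝔼-≤1 f1 ω))) (nn* (f0 ω) (diff (V.𝔼-≤1 f1 ω)))) (nn* (f0 ω) (diff (rec≤1 r))))) (nn* (0≤ι 3) (nn* (0≤rec r) (diff (f1 ω)))))
          (l (f ω) (u ω) (v ω) τ M³ (ψ (u ω)) (ψ (v ω)))
        where l : ∀ f u v t M p q → f * u * v + ι 3 * t + M * (f * p + f * q) ≡ f * ((u + t) * (v + t) + M * (p + q)) + (t * (f * (1ℚ - u) + f * (1ℚ - v) + f * (1ℚ - t)) + ι 3 * (t * (1ℚ - f)))
              l = solve-∀ ℚR
      X = E mΩ (λ ω → f ω * u ω * v ω)
      ave : m * (ι 3 * (m * m)) ≤ X + ι 3 * τ + M³ * (1ℚ + 1ℚ)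
      ave = ≡≤ (sym (E-*ʳ mΩ (ι 3 * (m * m)) f)) ≤⟨⟩ E-mono mΩ pt ≤⟨⟩
        ≡≤ (trans (E-+ mΩ (λ ω → f ω * u ω * v ω + ι 3 * τ) (λ ω → M³ * (f ω * ψ (u ω) + f ω * ψ (v ω)))) (cong₂ _+_ (E-+c mΩ (ι 3 * τ) (λ ω → f ω * u ω * v ω))
          (trans (E-* mΩ M³ (λ ω → f ω * ψ (u ω) + f ω * ψ (v ω))) (cong (M³ *_) (E-+ mΩ (λ ω → f ω * ψ (u ω)) (λ ω → f ω * ψ (v ω))))))) ≤⟨⟩
        +l (X + ι 3 * τ) (*mono M³ (nn* (nn* m0 m0) m0) (fu +≤ fv))
      fin : M³ ≤ X + ι 3 * τ
      fin = by (diff ave) (l m (X + ι 3 * τ))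
        where l : ∀ m y → y ≡ m * m * m + (y + m * m * m * (1ℚ + 1ℚ) - m * (ι 3 * (m * m)))
              l = solve-∀ ℚR

  1<pw : ∀ n {z} → 1ℚ ℚ.< z → 1ℚ ℚ.< pw n z
  1<pw zero {z} p = subst (1ℚ ℚ.<_) (sym (pw-0 z)) p
  1<pw (suc n) {z} p = subst (1ℚ ℚ.<_) (sym (pw-suc n z)) (1<pw n (ℚP.<-≤-trans p (≡≤ (sym (ℚP.*-identityˡ z)) ≤⟨⟩ *mono' z (0≤1 ≤⟨⟩ ℚP.<⇒≤ p) (ℚP.<⇒≤ p))))

  -- Stands in for taking a root: if z < -1, the power of -z exceeds 1. A lower bound is enough,
  -- since corners are counted from below.
  pw≤1⇒-1≤ : ∀ n {z} → pw (suc n) z ≤ 1ℚ → - 1ℚ ≤ z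
  pw≤1⇒-1≤ n {z} h = ℚP.≮⇒≥ (λ p → <⇒≱ (1<pw (suc n) (ℚP.neg-antimono-< p)) (≡≤ (trans (pw-suc n (- z)) (trans (cong (pw n) (l z)) (sym (pw-suc n z)))) ≤⟨⟩ h))
    where l : ∀ z → - z * - z ≡ z * z
          l = solve-∀ ℚR
open ConditionalExpectation

-- The lower bound at a scale where the energy is stable.

module SingleScale where
  -- Dilation turns d and d² into qd and q²d². `q̃` is the step of the direction `Z°` produced at
  -- this scale, so the next partition takes steps q·q̃ and (q·q̃)². The size conditions ensure that
  -- `Z°` and the interval absorb every move inside a cell of that partition.
  module Level (r m : ℕ) (sc : Par2.Scales r m) (S2 : Sys2) (q q̃ M' : ℕ)
    (q̃≡ : q̃ ≡ ℤ.∣ ℤ.+ 2 ℤ.* qs (Par2.s1 r) ℤ.* ℤ.+ Qr r ∣)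
    (V : CE (Sys2.mΩ S2) (Sys2._⊕_ S2) (q ℕ.* q) (suc r ℕ.* (suc m ℕ.* suc m)))
    (H : CE (Sys2.mΩ S2) (Sys2._⊞_ S2) q (suc r ℕ.* suc m))
    (V' : CE (Sys2.mΩ S2) (Sys2._⊕_ S2) ((q ℕ.* q̃) ℕ.* (q ℕ.* q̃)) (suc r ℕ.* (M' ℕ.* M')))
    (H' : CE (Sys2.mΩ S2) (Sys2._⊞_ S2) (q ℕ.* q̃) (suc r ℕ.* M'))
    (nV : Nested V V') (nH : Nested H H')
    (szV : q̃ ℕ.* (suc r ℕ.* (M' ℕ.* M')) ℕ.* (2 ℕ.* suc r) ℕ.≤ suc (Par2.Scales.b° sc) ℕ.* suc (Par2.Scales.b° sc))
    (szH : q̃ ℕ.* (suc r ℕ.* M') ℕ.* (2 ℕ.* suc r) ℕ.≤ suc m)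
    (f : Sys2.Ω S2 → ℚ) (f0 : ∀ ω → 0ℚ ≤ f ω) (f1 : ∀ ω → f ω ≤ 1ℚ)
    where
    open Par r
    open Par2 r
    open WithM m
    open Scales sc using (b°)
    private
      module V = CondExp V
      module H = CondExp H
      module V' = CondExp V'
      module H' = CondExp H'
      S' = dilate² S2 (ℤ.+ q) (ℤ.+ (q ℕ.* q))
      bf : ∀ ω → Bd (f ω)
      bf ω = bd-nn (f0 ω) (f1 ω)
      u v : Sys2.Ω S2 → ℚ
      u = H.𝔼 f
      v = V.𝔼 f
      g : Sys2.Ω S2 → ℚ
      g ω = f ω - v ω
      bd-diff : ∀ {x y} → 0ℚ ≤ x → x ≤ 1ℚ → 0ℚ ≤ y → y ≤ 1ℚ → Bd (x - y)
      bd-diff {x} {y} x0 x1 y0 y1 = (x0 +≤ neg≤ y1) , (x1 +≤ neg≤ y0)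
      bg : ∀ ω → Bd (g ω)
      bg ω = bd-diff (f0 ω) (f1 ω) (V.𝔼-≥0 f0 ω) (V.𝔼-≤1 f1 ω)
      bu = H.𝔼-bd {f} bf
      bv = V.𝔼-bd {f} bf

      z° : ℤ
      z° = ℤ.+ 2 ℤ.* qs s1 ℤ.* ℤ.+ Qr r

      z°² : ∀ z → ℤ.+ (ℤ.∣ z ∣ ℕ.* ℤ.∣ z ∣) ≡ z ℤ.* z
      z°² (ℤ.+ n) = ℤP.pos-* n n
      z°² (ℤ.-[1+ n ]) = refl

    open TwoD m sc S' f f g bf bf bg using (Λ2; Z°; twoD)
    open Sys2 S2
    private
      module DV = Dyn (dilate sys (ℤ.+ (q ℕ.* q)))
      module DH = Dyn (dilate (horiz S2) (ℤ.+ q))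
      I = Iv m

      absZ : ∀ x → ℤ.∣ x ∣ ℕ.≤ suc r ℕ.* (M' ℕ.* M') → Abs Z° (ℤ.+ (q̃ ℕ.* q̃) ℤ.* x) κ
      absZ x p = subst (λ z → Abs Z° z κ) (trans (l z° x) (cong (ℤ._* x) (trans (sym (z°² z°)) (cong (λ k → ℤ.+ (k ℕ.* k)) (sym q̃≡)))))
        (dir-good z° (ℓn (Sys2.sys S') b°) (z° ℤ.* x) (ℕP.≤-trans (ℕP.*-monoˡ-≤ (2 ℕ.* R) (ℕP.≤-trans (ℕP.≤-reflexive (trans (ℤP.abs-* z° x) (cong (ℕ._* ℤ.∣ x ∣) (sym q̃≡)))) (ℕP.*-monoʳ-≤ q̃ p))) szV))
        where l : ∀ z x → z ℤ.* (z ℤ.* x) ≡ z ℤ.* z ℤ.* x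
              l = ℤS.solve-∀

      absI : ∀ x → ℤ.∣ x ∣ ℕ.≤ suc r ℕ.* M' → Abs I (ℤ.+ q̃ ℤ.* x) κ
      absI x p = abs-Iv≤ (ℤ.+ q̃ ℤ.* x) (ℕP.≤-trans (ℕP.*-monoˡ-≤ (2 ℕ.* R) (ℕP.≤-trans (ℕP.≤-reflexive (ℤP.abs-* (ℤ.+ q̃) x)) (ℕP.*-monoʳ-≤ q̃ p))) szH)

      a'v : ℤ.+ ((q ℕ.* q̃) ℕ.* (q ℕ.* q̃)) ≡ ℤ.+ (q ℕ.* q) ℤ.* ℤ.+ (q̃ ℕ.* q̃)
      a'v = trans (cong ℤ.+_ (l q q̃)) (ℤP.pos-* (q ℕ.* q) (q̃ ℕ.* q̃))
        where l : ∀ q z → (q ℕ.* z) ℕ.* (q ℕ.* z) ≡ (q ℕ.* q) ℕ.* (z ℕ.* z)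
              l = ℕS.solve-∀

      incV incH : ℚ
      incV = V'.energy f - V.energy f
      incH = H'.energy f - H.energy f

      incV0 : 0ℚ ≤ incV
      incV0 = E-≥c mΩ (λ ω → nn-sq (V'.𝔼 f ω - V.𝔼 f ω)) ≤⟨⟩ ≡≤ (Refine.increment V V' nV f)

      incH0 : 0ℚ ≤ incH
      incH0 = E-≥c mΩ (λ ω → nn-sq (H'.𝔼 f ω - H.𝔼 f ω)) ≤⟨⟩ ≡≤ (Refine.increment H H' nH f)

      NV : DV.N Z° g ≤ 2ℚ * κ + 2ℚ * incV
      NV = Step.N-coarse sys (ℤ.+ (q ℕ.* q)) (ℤ.+ (q̃ ℕ.* q̃)) V V' nV a'v Z° κ absZ f f0 f1

      NH : DH.N I (λ ω → f ω - u ω) ≤ 2ℚ * κ + 2ℚ * incH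
      NH = Step.N-coarse (horiz S2) (ℤ.+ q) (ℤ.+ q̃) H H' nH (ℤP.pos-* q q̃) I κ absI f f0 f1

      κ0 : 0ℚ ≤ κ
      κ0 = 0≤rec r

      κR : ∀ X → ι X ≤ κ * ι (R ℕ.* X)
      κR X = ≡≤ (sym (trans (cong (κ *_) (ι-* R X)) (trans (sym (ℚP.*-assoc κ (ι R) (ι X))) (trans (cong (_* ι X) (rec-inv r)) (ℚP.*-identityˡ (ι X))))))

    T : ℚ
    T = E I (λ d → E mΩ (λ ω → f ω * f (ω ⊞ ℤ.+ q ℤ.* d) * f (ω ⊕ ℤ.+ (q ℕ.* q) ℤ.* (d ℤ.* d))))

    -- The vertical factor f becomes v with error `Λ2`, and the horizontal one becomes u with error
    -- `X₁`, each at least -rec t. The shifts q²d² of v and qd of u rarely leave a cell and cost 2κ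
    -- each; with 3κ from `chu` this makes 7κ.
    level : ∀ t → ι (suc k2D) * (ι 9 * κ) * pw 36 (ι (suc t)) ≤ 1ℚ →
      (V'.energy f + H'.energy f) - (V.energy f + H.energy f) ≤ ι 3 * κ →
      E mΩ f * E mΩ f * E mΩ f ≤ T + (2ℚ * rec t + ι 7 * κ)
    level t hκ hinc = fin
      where
      inc+ : incV + incH ≤ ι 3 * κ
      inc+ = ≡≤ (l (V'.energy f) (H'.energy f) (V.energy f) (H.energy f)) ≤⟨⟩ hinc
        where l : ∀ a b c d → (a - c) + (b - d) ≡ (a + b) - (c + d)
              l = solve-∀ ℚR
      -- By `hκ` the power of (t + 1)x is at most 1, so (t + 1)x ≥ -1.
      root : ∀ x → pw 36 x ≤ ι (suc k2D) * (ι 9 * κ) → 0ℚ ≤ x + rec t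
      root x h = *mono (rec t) (0≤rec t) (diff (pw≤1⇒-1≤ 35 (≡≤ (pw-* 36 (ι (suc t)) x) ≤⟨⟩ *mono (pw 36 (ι (suc t))) (pw-nn 36 (0≤ι (suc t))) h ≤⟨⟩
           ≡≤ (ℚP.*-comm (pw 36 (ι (suc t))) (ι (suc k2D) * (ι 9 * κ))) ≤⟨⟩ hκ))) |> λ p → ≡≤ (sym (ℚP.*-zeroʳ (rec t))) ≤⟨⟩ p ≤⟨⟩
           ≡≤ (trans (l (rec t) (ι (suc t)) x) (trans (cong (λ z → z * x + rec t) (rec-inv t)) (cong (_+ rec t) (ℚP.*-identityˡ x))))
        where
        _|>_ : ∀ {A B : Set} → A → (A → B) → B
        x |> k = k x
        l : ∀ r i x → r * (i * x - - 1ℚ) ≡ r * i * x + r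
        l = solve-∀ ℚR
      8κ : ∀ {x y} → 0ℚ ≤ y → x + y ≤ ι 3 * κ → 2ℚ * κ + 2ℚ * x ≤ ι 8 * κ
      8κ {x} {y} y0 h = by (nn* 0≤2 (nn+ y0 (diff h))) (l κ x y)
        where l : ∀ k x y → ι 8 * k ≡ 2ℚ * k + 2ℚ * x + 2ℚ * (y + (ι 3 * k - (x + y)))
              l = solve-∀ ℚR
      Λ0 : 0ℚ ≤ Λ2 + rec t
      Λ0 = root Λ2 (twoD ≤⟨⟩ *mono (ι k2D) (0≤ι k2D) (+r κ (NV ≤⟨⟩ 8κ {incV} {incH} incH0 inc+)) ≤⟨⟩ by (nn* (0≤ι 9) κ0) (l (ι k2D) κ))
        where l : ∀ k κ → (1ℚ + k) * (ι 9 * κ) ≡ k * (ι 8 * κ + κ) + ι 9 * κ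
              l = solve-∀ ℚR
      fv : Ω → ℚ
      fv ω = f ω * v ω
      bfv : ∀ ω → Bd (fv ω)
      bfv ω = bd* (bf ω) (bv ω)
      PH : (Ω → ℚ) → Ω → ℚ
      PH = DH.P I
      X₁ X₂ X₃ : ℚ
      X₁ = E mΩ (λ ω → fv ω * PH (λ ω → f ω - u ω) ω)
      X₂ = E mΩ (λ ω → fv ω * PH u ω)
      X₃ = E mΩ (λ ω → fv ω * u ω)
      X₁² : sq X₁ ≤ ι 8 * κ
      X₁² = kill mΩ fv (PH (λ ω → f ω - u ω)) bfv ≤⟨⟩ NH ≤⟨⟩ 8κ {incH} {incV} incV0 (≡≤ (ℚP.+-comm incH incV) ≤⟨⟩ inc+)
      X₁-bd : Bd X₁
      X₁-bd = E-bd mΩ (λ ω → bd* (bfv ω) (DH.bdP I (λ ω → bd-diff (f0 ω) (f1 ω) (H.𝔼-≥0 f0 ω) (H.𝔼-≤1 f1 ω)) ω))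
      -- Already the square of `X₁` is small. It is at most 1, so further squaring only decreases it
      -- and `root` applies.
      X0 : 0ℚ ≤ X₁ + rec t
      X0 = root X₁ (≡≤ (pw-suc 35 X₁) ≤⟨⟩ pw≤1 35 (nn-sq X₁) (sq≤1 X₁-bd) ≤⟨⟩ X₁² ≤⟨⟩ by (nn+ (nn* (0≤ι k2D) (nn* (0≤ι 9) κ0)) κ0) (l (ι k2D) κ))
        where l : ∀ k κ → (1ℚ + k) * (ι 9 * κ) ≡ ι 8 * κ + (k * (ι 9 * κ) + κ)
              l = solve-∀ ℚR
      X₂-near : Near X₂ X₃ (2ℚ * κ)
      X₂-near = near-≡ (trans (E-swap I mΩ (λ d ω → fv ω * u (ω ⊞ ℤ.+ q ℤ.* d))) (E-cong mΩ (λ ω → E-* I (fv ω) (λ d → u (ω ⊞ ℤ.+ q ℤ.* d))))) (E-const I X₃)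
        (E-nearS I {λ d → E mΩ (λ ω → fv ω * u (ω ⊞ ℤ.+ q ℤ.* d))} {λ _ → X₃} (supp-map I (λ { d (k , refl , p) →
          near-≡ (E-cong mΩ (λ ω → cong (λ z → fv ω * u (ω ⊞ z)) (ℤP.pos-* q (suc k)))) refl
            (H.cross f (suc k) bf fv bfv κ κ0 (ι-mono (ℕP.*-monoʳ-≤ q (ℕ.s≤s p)) ≤⟨⟩ κR (q ℕ.* M) ≤⟨⟩ ≡≤ (cong (λ z → κ * ι z) (l R q M)))) }) (Iv-supp m)))
        where l : ∀ r q m → r ℕ.* (q ℕ.* m) ≡ r ℕ.* m ℕ.* q
              l = ℕS.solve-∀
      Y₁ Y₂ : ℚ
      Y₁ = E I (λ d → E mΩ (λ ω → f ω * f (ω ⊞ ℤ.+ q ℤ.* d) * v (ω ⊕ ℤ.+ (q ℕ.* q) ℤ.* (d ℤ.* d))))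
      Y₂ = E I (λ d → E mΩ (λ ω → f ω * f (ω ⊞ ℤ.+ q ℤ.* d) * v ω))
      Y-near : Near Y₁ Y₂ (2ℚ * κ)
      Y-near = E-nearS I {λ d → E mΩ (λ ω → f ω * f (ω ⊞ ℤ.+ q ℤ.* d) * v (ω ⊕ ℤ.+ (q ℕ.* q) ℤ.* (d ℤ.* d)))} {λ d → E mΩ (λ ω → f ω * f (ω ⊞ ℤ.+ q ℤ.* d) * v ω)}
        (supp-map I (λ { d (k , refl , p) →
          near-≡ (E-cong mΩ (λ ω → cong (λ z → f ω * f (ω ⊞ ℤ.+ q ℤ.* ℤ.+ suc k) * v (ω ⊕ z)) (trans (ℤP.pos-* (q ℕ.* q) (suc k ℕ.* suc k)) (cong (ℤ.+ (q ℕ.* q) ℤ.*_) (ℤP.pos-* (suc k) (suc k)))))) refl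
            (V.cross f (suc k ℕ.* suc k) bf (λ ω → f ω * f (ω ⊞ ℤ.+ q ℤ.* ℤ.+ suc k)) (λ ω → bd* (bf ω) (bf _)) κ κ0
              (ι-mono (ℕP.*-monoʳ-≤ (q ℕ.* q) (ℕP.*-mono-≤ (ℕ.s≤s p) (ℕ.s≤s p))) ≤⟨⟩ κR (q ℕ.* q ℕ.* (M ℕ.* M)) ≤⟨⟩ ≡≤ (cong (λ z → κ * ι z) (l R (q ℕ.* q) (M ℕ.* M))))) }) (Iv-supp m))
        where l : ∀ r q m → r ℕ.* (q ℕ.* m) ≡ r ℕ.* m ℕ.* q
              l = ℕS.solve-∀
      Y₂≡ : Y₂ ≡ X₁ + X₂
      Y₂≡ = trans (E-swap I mΩ (λ d ω → f ω * f (ω ⊞ ℤ.+ q ℤ.* d) * v ω)) (trans (E-cong mΩ (λ ω → trans (E-cong I (λ d → l (f ω) (f (ω ⊞ ℤ.+ q ℤ.* d)) (v ω) (u (ω ⊞ ℤ.+ q ℤ.* d))))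
          (trans (E-+ I (λ d → fv ω * (f (ω ⊞ ℤ.+ q ℤ.* d) - u (ω ⊞ ℤ.+ q ℤ.* d))) (λ d → fv ω * u (ω ⊞ ℤ.+ q ℤ.* d)))
            (cong₂ _+_ (E-* I (fv ω) (λ d → f (ω ⊞ ℤ.+ q ℤ.* d) - u (ω ⊞ ℤ.+ q ℤ.* d))) (E-* I (fv ω) (λ d → u (ω ⊞ ℤ.+ q ℤ.* d)))))))
          (E-+ mΩ (λ ω → fv ω * PH (λ ω → f ω - u ω) ω) (λ ω → fv ω * PH u ω)))
        where l : ∀ a b c d → a * b * c ≡ a * c * (b - d) + a * c * d
              l = solve-∀ ℚR
      T≡ : T ≡ Λ2 + Y₁
      T≡ = trans (E-cong I (λ d → trans (E-cong mΩ (λ ω → l (f ω) (f (ω ⊞ ℤ.+ q ℤ.* d)) (f (ω ⊕ ℤ.+ (q ℕ.* q) ℤ.* (d ℤ.* d))) (v (ω ⊕ ℤ.+ (q ℕ.* q) ℤ.* (d ℤ.* d)))))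
          (E-+ mΩ (λ ω → f ω * f (ω ⊞ ℤ.+ q ℤ.* d) * g (ω ⊕ ℤ.+ (q ℕ.* q) ℤ.* (d ℤ.* d))) (λ ω → f ω * f (ω ⊞ ℤ.+ q ℤ.* d) * v (ω ⊕ ℤ.+ (q ℕ.* q) ℤ.* (d ℤ.* d))))))
        (E-+ I (λ d → E mΩ (λ ω → f ω * f (ω ⊞ ℤ.+ q ℤ.* d) * g (ω ⊕ ℤ.+ (q ℕ.* q) ℤ.* (d ℤ.* d)))) (λ d → E mΩ (λ ω → f ω * f (ω ⊞ ℤ.+ q ℤ.* d) * v (ω ⊕ ℤ.+ (q ℕ.* q) ℤ.* (d ℤ.* d)))))
        where l : ∀ a b c d → a * b * c ≡ a * b * (c - d) + a * b * d
              l = solve-∀ ℚR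
      chu : E mΩ f * E mΩ f * E mΩ f ≤ X₃ + ι 3 * κ
      chu = Chu.chu V H f f0 f1 r ≤⟨⟩ ≡≤ (cong (_+ ι 3 * κ) (E-cong mΩ (λ ω → l (f ω) (u ω) (v ω))))
        where l : ∀ a b c → a * b * c ≡ a * c * b
              l = solve-∀ ℚR
      fin : E mΩ f * E mΩ f * E mΩ f ≤ T + (2ℚ * rec t + ι 7 * κ)
      fin = chu ≤⟨⟩ by (nn+ (nn+ (diff (proj₂ X₂-near)) (diff (proj₂ Y-near))) (nn+ Λ0 X0))
          (trans (cong (_+ (2ℚ * rec t + ι 7 * κ)) T≡) (trans (l Λ2 Y₁ (rec t) κ X₃ X₁ X₂) (cong (λ z → X₃ + ι 3 * κ + (X₂ + 2ℚ * κ - X₃ + (Y₁ + 2ℚ * κ - z) + (Λ2 + rec t + (X₁ + rec t)))) (sym Y₂≡))))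
        where l : ∀ L Y t k x₃ x₁ x₂ → L + Y + (2ℚ * t + ι 7 * k) ≡ x₃ + ι 3 * k + (x₂ + 2ℚ * k - x₃ + (Y + 2ℚ * k - (x₁ + x₂)) + (L + t + (x₁ + t)))
              l = solve-∀ ℚR
open SingleScale

-- The tower of scales and the energy increment.

module EnergyIncrement where
  cell : ∀ n' a b → b ℕ.* a ∣ suc n' → CE (Zn.mF n') (Zn._⊹_ n') a b
  cell n' (suc a) (suc b) (divides (suc c) e) = Cell.ce n' a b c e
  cell n' zero b (divides c e) = contradiction (trans e (trans (cong (c ℕ.*_) (ℕP.*-zeroʳ b)) (ℕP.*-zeroʳ c))) λ ()
  cell n' (suc a) zero (divides c e) = contradiction (trans e (ℕP.*-zeroʳ c)) λ ()

  cell-nested : ∀ n' a b a' b' (p : b ℕ.* a ∣ suc n') (p' : b' ℕ.* a' ∣ suc n') g → a ∣ a' → b ℕ.* a ≡ (b' ℕ.* a') ℕ.* g → Nested (cell n' a b p) (cell n' a' b' p')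
  cell-nested n' (suc a) (suc b) (suc a') (suc b') (divides (suc c) e) (divides (suc c') e') (suc g) h w = Nest.nest n' a b c e a' b' c' e' g h w
  cell-nested n' (suc a) (suc b) a' b' (divides (suc c) e) _ zero h w = contradiction (trans w (ℕP.*-zeroʳ (b' ℕ.* a'))) λ ()
  cell-nested n' (suc a) (suc b) zero b' (divides (suc c) e) (divides c' e') (suc g) h w = contradiction (trans e' (trans (cong (c' ℕ.*_) (ℕP.*-zeroʳ b')) (ℕP.*-zeroʳ c'))) λ ()
  cell-nested n' (suc a) (suc b) (suc a') zero (divides (suc c) e) (divides c' e') (suc g) h w = contradiction (trans e' (ℕP.*-zeroʳ c')) λ ()
  cell-nested n' zero b a' b' (divides c e) = contradiction (trans e (trans (cong (c ℕ.*_) (ℕP.*-zeroʳ b)) (ℕP.*-zeroʳ c))) λ ()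
  cell-nested n' (suc a) zero a' b' (divides c e) = contradiction (trans e (ℕP.*-zeroʳ c)) λ ()

  Σs-< : ∀ n (g : Fin (suc n) → ℚ) c → (∀ i → g i ℚ.< c) → Σs (suc n) g ℚ.< ι (suc n) * c
  Σs-< zero g c h = ℚP.<-≤-trans (ℚP.≤-<-trans (≡≤ (ℚP.+-identityʳ (g zero))) (h zero)) (≡≤ (sym (l c)))
    where l : ∀ c → (1ℚ + 0ℚ) * c ≡ c
          l = solve-∀ ℚR
  Σs-< (suc n) g c h = ℚP.<-≤-trans (ℚP.+-mono-< (h zero) (Σs-< n (g ∘ suc) c (h ∘ suc))) (≡≤ (l (ι (suc n)) c))
    where l : ∀ n c → c + n * c ≡ (1ℚ + n) * c
          l = solve-∀ ℚR

  Iv-max : ∀ m (g : ℤ → ℚ) c → c ≤ E (Iv m) g → Σ ℕ λ k → (k ℕ.≤ m) × (c ≤ g (ℤ.+ suc k))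
  Iv-max m g c h with FP.any? (λ i → c ℚP.≤? g (ℤ.+ suc (toℕ {suc m} i)))
  ... | yes (i , p) = toℕ i , ℕP.≤-pred (FP.toℕ<n i) , p
  ... | no ¬p = contradiction (*mono (ι (suc m)) (0≤ι (suc m)) (h ≤⟨⟩ ≡≤ (E-Iv m g)) ≤⟨⟩ ≡≤ (trans (sym (ℚP.*-assoc (ι (suc m)) (rec m) S)) (trans (cong (_* S) (trans (ℚP.*-comm (ι (suc m)) (rec m)) (rec-inv m))) (ℚP.*-identityˡ S))))
      (<⇒≱ (Σs-< m (λ i → g (ℤ.+ suc (toℕ i))) c (λ i → ℚP.≰⇒> (λ q → ¬p (i , q)))))
    where S = Σs (suc m) (λ i → g (ℤ.+ suc (toℕ i)))

  module Scale (r : ℕ) where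
    open Par r
    open Par2 r

    cf : ℕ
    cf = cS s5 ℕ.* cS (next s5) ℕ.* cS (next (next s5)) ℕ.* cS (next (next (next s5)))

    -- `M₀` is a multiple of all constants required by `Scales`, `q°` is the factor by which steps
    -- grow, and `G₁` is the further room that `szV` needs to fit vertical cells into the direction
    -- `Z°`.
    M₀ q° G₁ G : ℕ
    M₀ = c5 ℕ.* cf ℕ.* c°
    q° = ℤ.∣ ℤ.+ 2 ℤ.* qs s1 ℤ.* ℤ.+ Qr r ∣
    G₁ = 2 ℕ.* R ℕ.* R ℕ.* c° ℕ.* c°
    G = q° ℕ.* G₁

    private
      o₁ = ok5
      o₂ = ok-next s5 o₁
      o₃ = ok-next (next s5) o₂
      o₄ = ok-next (next (next s5)) o₃

    1≤c5 : 1 ℕ.≤ c5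
    1≤c5 = ℕP.≤-trans (ℕP.*-mono-≤ {1} {2 ℕ.* R} (ℕ.s≤s ℕ.z≤n) 1≤Ec) (ℕP.≤-reflexive (sym c5-def))

    1≤M₀ : 1 ℕ.≤ M₀
    1≤M₀ = ℕP.*-mono-≤ {1} {c5 ℕ.* cf} (ℕP.*-mono-≤ 1≤c5 (ℕP.*-mono-≤ {1} {cS s5 ℕ.* cS (next s5) ℕ.* cS (next (next s5))}
       (ℕP.*-mono-≤ {1} {cS s5 ℕ.* cS (next s5)} (ℕP.*-mono-≤ (1≤cS s5 o₁) (1≤cS (next s5) o₂)) (1≤cS (next (next s5)) o₃)) (1≤cS (next (next (next s5))) o₄))) 1≤c°

    1≤q° : 1 ℕ.≤ q°
    1≤q° = ℕP.≤-trans (ℕP.*-mono-≤ {1} {2 ℕ.* ℤ.∣ qs s1 ∣} (ℕP.*-mono-≤ {1} {2} (ℕ.s≤s ℕ.z≤n) (proj₁ ok1)) (1≤Qr r))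
      (ℕP.≤-reflexive (sym (trans (ℤP.abs-* (ℤ.+ 2 ℤ.* qs s1) (ℤ.+ Qr r)) (cong (ℕ._* Qr r) (ℤP.abs-* (ℤ.+ 2) (qs s1))))))

    1≤G₁ : 1 ℕ.≤ G₁
    1≤G₁ = ℕP.*-mono-≤ {1} {2 ℕ.* R ℕ.* R ℕ.* c°} (ℕP.*-mono-≤ {1} {2 ℕ.* R ℕ.* R} (ℕ.s≤s ℕ.z≤n) 1≤c°) 1≤c°

    1≤G : 1 ℕ.≤ G
    1≤G = ℕP.*-mono-≤ 1≤q° 1≤G₁

    Mℓ : ℕ → ℕ
    Mℓ j = M₀ ℕ.* G ℕ.^ j

    1≤^ : ∀ {x} k → 1 ℕ.≤ x → 1 ℕ.≤ x ℕ.^ k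
    1≤^ zero h = ℕP.≤-refl
    1≤^ (suc k) h = ℕP.*-mono-≤ h (1≤^ k h)

    abstract
      mℓ : ℕ → ℕ
      mℓ j = ℕ.pred (Mℓ j)

      mℓ≡ : ∀ j → suc (mℓ j) ≡ Mℓ j
      mℓ≡ j = ℕP.suc-pred (Mℓ j) {{ℕ.>-nonZero (ℕP.*-mono-≤ 1≤M₀ (1≤^ j 1≤G))}}

    mℓ-suc : ∀ j → suc (mℓ (suc j)) ≡ suc (mℓ j) ℕ.* G
    mℓ-suc j = trans (mℓ≡ (suc j)) (trans (l M₀ G (G ℕ.^ j)) (cong (ℕ._* G) (sym (mℓ≡ j))))
      where l : ∀ a g x → a ℕ.* (g ℕ.* x) ≡ a ℕ.* x ℕ.* g
            l = ℕS.solve-∀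

    private
      part : ∀ {m c} y → suc m ≡ c ℕ.* y → Σ ℕ λ b → suc m ≡ c ℕ.* suc b
      part {m} {c} zero e = contradiction (trans e (ℕP.*-zeroʳ c)) λ ()
      part (suc y) e = y , e

      mkScales : ∀ m x → suc m ≡ M₀ ℕ.* x → Scales m
      mkScales m x e = record
        { bs = proj₁ p ; M5 = proj₂ p ; b₅ = proj₁ p₅ ; b₄ = proj₁ p₄ ; b₃ = proj₁ p₃ ; b₂ = proj₁ p₂ ; b° = proj₁ p₀
        ; e₅ = proj₂ p₅ ; e₄ = proj₂ p₄ ; e₃ = proj₂ p₃ ; e₂ = proj₂ p₂ ; e° = proj₂ p₀ }
        where
        A = c5
        B = cS s5
        C = cS (next s5)
        D = cS (next (next s5))
        F = cS (next (next (next s5)))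
        p = part {m} {A} (cf ℕ.* c° ℕ.* x) (trans e (l A cf c° x))
          where l : ∀ a b c x → a ℕ.* b ℕ.* c ℕ.* x ≡ a ℕ.* (b ℕ.* c ℕ.* x)
                l = ℕS.solve-∀
        p₅ = part {m} {B} (A ℕ.* C ℕ.* D ℕ.* F ℕ.* c° ℕ.* x) (trans e (l A B C D F c° x))
          where l : ∀ a b c d f g x → a ℕ.* (b ℕ.* c ℕ.* d ℕ.* f) ℕ.* g ℕ.* x ≡ b ℕ.* (a ℕ.* c ℕ.* d ℕ.* f ℕ.* g ℕ.* x)
                l = ℕS.solve-∀
        p₄ = part {m} {C} (A ℕ.* B ℕ.* D ℕ.* F ℕ.* c° ℕ.* x) (trans e (l A B C D F c° x))
          where l : ∀ a b c d f g x → a ℕ.* (b ℕ.* c ℕ.* d ℕ.* f) ℕ.* g ℕ.* x ≡ c ℕ.* (a ℕ.* b ℕ.* d ℕ.* f ℕ.* g ℕ.* x)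
                l = ℕS.solve-∀
        p₃ = part {m} {D} (A ℕ.* B ℕ.* C ℕ.* F ℕ.* c° ℕ.* x) (trans e (l A B C D F c° x))
          where l : ∀ a b c d f g x → a ℕ.* (b ℕ.* c ℕ.* d ℕ.* f) ℕ.* g ℕ.* x ≡ d ℕ.* (a ℕ.* b ℕ.* c ℕ.* f ℕ.* g ℕ.* x)
                l = ℕS.solve-∀
        p₂ = part {m} {F} (A ℕ.* B ℕ.* C ℕ.* D ℕ.* c° ℕ.* x) (trans e (l A B C D F c° x))
          where l : ∀ a b c d f g x → a ℕ.* (b ℕ.* c ℕ.* d ℕ.* f) ℕ.* g ℕ.* x ≡ f ℕ.* (a ℕ.* b ℕ.* c ℕ.* d ℕ.* g ℕ.* x)
                l = ℕS.solve-∀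
        p₀ = part {m} {c°} (A ℕ.* cf ℕ.* x) (trans e (l A cf c° x))
          where l : ∀ a b c x → a ℕ.* b ℕ.* c ℕ.* x ≡ c ℕ.* (a ℕ.* b ℕ.* x)
                l = ℕS.solve-∀

    abstract
     scales : ∀ j → Scales (mℓ j)
     scales j = mkScales (mℓ j) (G ℕ.^ j) (mℓ≡ j)

    qℓ : ℕ → ℕ
    qℓ zero = 1
    qℓ (suc i) = qℓ i ℕ.* q°

    1≤qℓ : ∀ i → 1 ℕ.≤ qℓ i
    1≤qℓ zero = ℕP.≤-refl
    1≤qℓ (suc i) = ℕP.*-mono-≤ (1≤qℓ i) 1≤q°

    -- Used with i + j = R. Refining multiplies the step by `q°` and divides M by `G` = q°·G₁, so a
    -- fine horizontal block is a G₁-th part of a coarse one, and a vertical block a G₁²-th part.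
    aV bV bH : ℕ → ℕ
    aV i = qℓ i ℕ.* qℓ i
    bV j = R ℕ.* (suc (mℓ j) ℕ.* suc (mℓ j))
    bH j = R ℕ.* suc (mℓ j)

    wV≡ : ∀ i j → bV (suc j) ℕ.* aV i ≡ (bV j ℕ.* aV (suc i)) ℕ.* (G₁ ℕ.* G₁)
    wV≡ i j = trans (cong (λ M → R ℕ.* (M ℕ.* M) ℕ.* aV i) (mℓ-suc j)) (l R (suc (mℓ j)) q° G₁ (qℓ i))
      where l : ∀ r m q g x → r ℕ.* (m ℕ.* (q ℕ.* g) ℕ.* (m ℕ.* (q ℕ.* g))) ℕ.* (x ℕ.* x) ≡ (r ℕ.* (m ℕ.* m)) ℕ.* ((x ℕ.* q) ℕ.* (x ℕ.* q)) ℕ.* (g ℕ.* g)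
            l = ℕS.solve-∀

    wH≡ : ∀ i j → bH (suc j) ℕ.* qℓ i ≡ (bH j ℕ.* qℓ (suc i)) ℕ.* G₁
    wH≡ i j = trans (cong (λ M → R ℕ.* M ℕ.* qℓ i) (mℓ-suc j)) (l R (suc (mℓ j)) q° G₁ (qℓ i))
      where l : ∀ r m q g x → r ℕ.* (m ℕ.* (q ℕ.* g)) ℕ.* x ≡ r ℕ.* m ℕ.* (x ℕ.* q) ℕ.* g
            l = ℕS.solve-∀

    -- A common multiple of all block lengths, so that one modulus carries every partition. It also
    -- bounds d and d² for the corners found.
    W : ℕ
    W = bV R ℕ.* bH R

    dV : ∀ i j → i ℕ.+ j ≡ R → bV j ℕ.* aV i ∣ W
    dV zero j refl = divides (bH R) (trans (ℕP.*-comm (bV R) (bH R)) (cong (bH R ℕ.*_) (sym (ℕP.*-identityʳ (bV R)))))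
    dV (suc i) j e = ∣-trans (divides (G₁ ℕ.* G₁) (trans (wV≡ i j) (ℕP.*-comm (bV j ℕ.* aV (suc i)) (G₁ ℕ.* G₁)))) (dV i (suc j) (trans (ℕP.+-suc i j) e))

    dH : ∀ i j → i ℕ.+ j ≡ R → bH j ℕ.* qℓ i ∣ W
    dH zero j refl = divides (bV R) (cong (bV R ℕ.*_) (sym (ℕP.*-identityʳ (bH R))))
    dH (suc i) j e = ∣-trans (divides G₁ (trans (wH≡ i j) (ℕP.*-comm (bH j ℕ.* qℓ (suc i)) G₁))) (dH i (suc j) (trans (ℕP.+-suc i j) e))

    1≤W : 1 ℕ.≤ W
    1≤W = ℕ.s≤s ℕ.z≤n

    szH : ∀ j → q° ℕ.* (R ℕ.* suc (mℓ j)) ℕ.* (2 ℕ.* R) ℕ.≤ suc (mℓ (suc j))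
    szH j = ℕP.≤-trans (ℕP.≤-reflexive (l q° R (suc (mℓ j)))) (ℕP.≤-trans (ℕP.*-monoʳ-≤ (suc (mℓ j)) (ℕP.*-monoʳ-≤ q° (ℕP.*-mono-≤ (ℕP.*-mono-≤ (ℕP.≤-refl {2 ℕ.* R ℕ.* R}) 1≤c°) 1≤c°))) (ℕP.≤-reflexive (sym (mℓ-suc j))))
      where l : ∀ q r m → q ℕ.* (r ℕ.* m) ℕ.* (2 ℕ.* r) ≡ m ℕ.* (q ℕ.* (2 ℕ.* r ℕ.* r ℕ.* 1 ℕ.* 1))
            l = ℕS.solve-∀

    szV : ∀ M B → M ℕ.* G ≡ c° ℕ.* B → q° ℕ.* (R ℕ.* (M ℕ.* M)) ℕ.* (2 ℕ.* R) ℕ.≤ B ℕ.* B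
    szV M B e = ℕP.*-cancelʳ-≤ (q° ℕ.* (R ℕ.* (M ℕ.* M)) ℕ.* (2 ℕ.* R)) (B ℕ.* B) (c° ℕ.* c°) {{ℕ.>-nonZero (ℕP.*-mono-≤ 1≤c° 1≤c°)}}
      (ℕP.≤-trans (ℕP.≤-reflexive (l q° R M c°)) (ℕP.≤-trans (ℕP.*-monoʳ-≤ (M ℕ.* M) (ℕP.≤-trans (ℕP.≤-reflexive (sym (ℕP.*-identityʳ G))) (ℕP.*-monoʳ-≤ G 1≤G)))
        (ℕP.≤-reflexive (trans (l3 M G) (trans (cong₂ ℕ._*_ e e) (l2 c° B))))))
      where
      l : ∀ q r m c → q ℕ.* (r ℕ.* (m ℕ.* m)) ℕ.* (2 ℕ.* r) ℕ.* (c ℕ.* c) ≡ m ℕ.* m ℕ.* (q ℕ.* (2 ℕ.* r ℕ.* r ℕ.* c ℕ.* c))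
      l = ℕS.solve-∀
      l2 : ∀ c b → c ℕ.* b ℕ.* (c ℕ.* b) ≡ b ℕ.* b ℕ.* (c ℕ.* c)
      l2 = ℕS.solve-∀
      l3 : ∀ m g → m ℕ.* m ℕ.* (g ℕ.* g) ≡ m ℕ.* g ℕ.* (m ℕ.* g)
      l3 = ℕS.solve-∀

    module Increment (n' : ℕ) (W∣n : W ∣ suc n') where
      open Square n'

      CV : ∀ i j → i ℕ.+ j ≡ R → CE m² _⬆_ (aV i) (bV j)
      CV i j p = vert (cell n' (aV i) (bV j) (∣-trans (dV i j p) W∣n))

      CH : ∀ i j → i ℕ.+ j ≡ R → CE m² _⮕_ (qℓ i) (bH j)
      CH i j p = hori (cell n' (qℓ i) (bH j) (∣-trans (dH i j p) W∣n))

      module _ (f : Pt → ℚ) (f0 : ∀ ω → 0ℚ ≤ f ω) (f1 : ∀ ω → f ω ≤ 1ℚ) where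
        e : ∀ i j → i ℕ.+ j ≡ R → ℚ
        e i j p = CondExp.energy (CV i j p) f + CondExp.energy (CH i j p) f

        e≥0 : ∀ i j p → 0ℚ ≤ e i j p
        e≥0 i j p = nn+ (CondExp.energy≥0 (CV i j p) f) (CondExp.energy≥0 (CH i j p) f)

        e≤2 : ∀ i j p → e i j p ≤ 2ℚ
        e≤2 i j p = CondExp.energy≤1 (CV i j p) f (λ ω → bd-nn (f0 ω) (f1 ω)) +≤ CondExp.energy≤1 (CH i j p) f (λ ω → bd-nn (f0 ω) (f1 ω))

        Stable : ℕ → ℕ → Set
        Stable i j = Σ (i ℕ.+ suc j ≡ R) λ p → Σ (suc i ℕ.+ j ≡ R) λ p' → e (suc i) j p' - e i (suc j) p ≤ ι 3 * rec r

        search : ∀ j i p → (Σ ℕ λ i → Σ ℕ λ j → Stable i j) ⊎ (e i j p + ι j * (ι 3 * rec r) ≤ 2ℚ)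
        search zero i p = inj₂ (≡≤ (trans (cong (e i zero p +_) (ℚP.*-zeroˡ (ι 3 * rec r))) (ℚP.+-identityʳ (e i zero p))) ≤⟨⟩ e≤2 i zero p)
        search (suc j) i p = go (e (suc i) j p' - e i (suc j) p ℚP.≤? ι 3 * rec r) (search j (suc i) p')
          where
          p' : suc i ℕ.+ j ≡ R
          p' = trans (sym (ℕP.+-suc i j)) p
          go : Dec (e (suc i) j p' - e i (suc j) p ≤ ι 3 * rec r) → (Σ ℕ λ i → Σ ℕ λ j → Stable i j) ⊎ (e (suc i) j p' + ι j * (ι 3 * rec r) ≤ 2ℚ) → (Σ ℕ λ i → Σ ℕ λ j → Stable i j) ⊎ (e i (suc j) p + ι (suc j) * (ι 3 * rec r) ≤ 2ℚ)
          go (yes h) _ = inj₁ (i , j , p , p' , h)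
          go (no _) (inj₁ s) = inj₁ s
          go (no ¬h) (inj₂ h) = inj₂ (by (diff (ℚP.<⇒≤ (ℚP.≰⇒> ¬h))) (l (e i (suc j) p) (e (suc i) j p') (ι j) (ι 3 * rec r)) ≤⟨⟩ h)
            where l : ∀ x y k c → y + k * c ≡ x + (1ℚ + k) * c + (y - x - c)
                  l = solve-∀ ℚR

        -- Otherwise each of R steps would raise the energy by more than 3/R, up to at least 3,
        -- while the sum of two energies is at most 2.
        stable : Σ ℕ λ i → Σ ℕ λ j → Stable i j
        stable = go (search R zero refl)
          where
          go : _ ⊎ (e zero R refl + ι R * (ι 3 * rec r) ≤ 2ℚ) → Σ ℕ λ i → Σ ℕ λ j → Stable i j
          go (inj₁ s) = s
          go (inj₂ h) = contradiction (≡≤ (sym (trans (l (ι R) (rec r)) (trans (cong (ι 3 *_) (rec-inv r)) (ℚP.*-identityʳ (ι 3))))) ≤⟨⟩ by (e≥0 zero R refl) (ℚP.+-comm (e zero R refl) (ι R * (ι 3 * rec r))) ≤⟨⟩ h) (ℚP.≤⇒≤ᵇ {ι 3} {2ℚ})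
            where l : ∀ a b → a * (ι 3 * b) ≡ ι 3 * (b * a)
                  l = solve-∀ ℚR

        private
          vn : ∀ i j p p' → Nested (CV i (suc j) p) (CV (suc i) j p')
          vn i j p p' = vert-nested (cell n' (aV i) (bV (suc j)) (∣-trans (dV i (suc j) p) W∣n)) (cell n' (aV (suc i)) (bV j) (∣-trans (dV (suc i) j p') W∣n))
            (cell-nested n' (aV i) (bV (suc j)) (aV (suc i)) (bV j) _ _ (G₁ ℕ.* G₁) (divides (q° ℕ.* q°) (l (qℓ i) q°)) (wV≡ i j))
            where l : ∀ x q → (x ℕ.* q) ℕ.* (x ℕ.* q) ≡ (q ℕ.* q) ℕ.* (x ℕ.* x)
                  l = ℕS.solve-∀
          hn : ∀ i j p p' → Nested (CH i (suc j) p) (CH (suc i) j p')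
          hn i j p p' = hori-nested (cell n' (qℓ i) (bH (suc j)) (∣-trans (dH i (suc j) p) W∣n)) (cell n' (qℓ (suc i)) (bH j) (∣-trans (dH (suc i) j p') W∣n))
            (cell-nested n' (qℓ i) (bH (suc j)) (qℓ (suc i)) (bH j) _ _ G₁ (divides q° (ℕP.*-comm (qℓ i) q°)) (wH≡ i j))

        popular : ∀ t → ι (suc k2D) * (ι 9 * rec r) * pw 36 (ι (suc t)) ≤ 1ℚ →
          Σ ℕ λ d → (1 ℕ.≤ d) × (d ℕ.≤ W) × (d ℕ.* d ℕ.≤ W) ×
            (E m² f * E m² f * E m² f - (2ℚ * rec t + ι 7 * rec r) ≤ E m² (λ ω → f ω * f (ω ⮕ (ℤ.+ d)) * f (ω ⬆ (ℤ.+ (d ℕ.* d)))))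
        popular t hκ = go stable
          where
          c : ℚ
          c = E m² f * E m² f * E m² f - (2ℚ * rec t + ι 7 * rec r)
          Goal : Set
          Goal = Σ ℕ λ d → (1 ℕ.≤ d) × (d ℕ.≤ W) × (d ℕ.* d ℕ.≤ W) × (c ≤ E m² (λ ω → f ω * f (ω ⮕ (ℤ.+ d)) * f (ω ⬆ (ℤ.+ (d ℕ.* d)))))
          ≤W : ∀ {x} → x ∣ W → x ℕ.≤ W
          ≤W = ℕD.∣⇒≤ {{ℕ.>-nonZero 1≤W}}
          l : ∀ r q m → r ℕ.* (q ℕ.* m) ≡ r ℕ.* m ℕ.* q
          l = ℕS.solve-∀
          l2 : ∀ r q m → r ℕ.* (q ℕ.* m ℕ.* (q ℕ.* m)) ≡ r ℕ.* (m ℕ.* m) ℕ.* (q ℕ.* q)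
          l2 = ℕS.solve-∀
          l3 : ∀ q m → q ℕ.* q ℕ.* (m ℕ.* m) ≡ q ℕ.* m ℕ.* (q ℕ.* m)
          l3 = ℕS.solve-∀
          l4 : ∀ T m e → T ≡ m - e + (T + e - m)
          l4 = solve-∀ ℚR
          F : ℕ → ℤ → ℚ
          F q d = E m² (λ ω → f ω * f (ω ⮕ (ℤ.+ q ℤ.* d)) * f (ω ⬆ (ℤ.+ (q ℕ.* q) ℤ.* (d ℤ.* d))))
          F≡ : ∀ q k → F q (ℤ.+ k) ≡ E m² (λ ω → f ω * f (ω ⮕ (ℤ.+ (q ℕ.* k))) * f (ω ⬆ (ℤ.+ (q ℕ.* k ℕ.* (q ℕ.* k)))))
          F≡ q k = E-cong m² (λ ω → cong₂ (λ a b → f ω * f (ω ⮕ a) * f (ω ⬆ b)) (sym (ℤP.pos-* q k))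
              (trans (cong (λ z → ℤ.+ (q ℕ.* q) ℤ.* z) (sym (ℤP.pos-* k k))) (trans (sym (ℤP.pos-* (q ℕ.* q) (k ℕ.* k))) (cong ℤ.+_ (l3 q k)))))
          avg : ∀ i j → Stable i j → c ≤ E (Iv (mℓ (suc j))) (F (qℓ i))
          avg i j (p , p' , h) = by (diff (L.level t hκ h)) (l4 L.T (E m² f * E m² f * E m² f) (2ℚ * rec t + ι 7 * rec r))
            where
            module L = Level r (mℓ (suc j)) (scales (suc j)) S² (qℓ i) q° (suc (mℓ j)) refl (CV i (suc j) p) (CH i (suc j) p) (CV (suc i) j p') (CH (suc i) j p')
              (vn i j p p') (hn i j p p') (szV (suc (mℓ j)) (suc (Scales.b° (scales (suc j)))) (trans (sym (mℓ-suc j)) (Scales.e° (scales (suc j))))) (szH j) f f0 f1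
          fin : ∀ q m k → 1 ℕ.≤ q → k ℕ.≤ m → R ℕ.* suc m ℕ.* q ∣ W → R ℕ.* (suc m ℕ.* suc m) ℕ.* (q ℕ.* q) ∣ W → c ≤ F q (ℤ.+ suc k) → Goal
          fin q m k 1q k≤m hH hV hk = q ℕ.* suc k , ℕP.*-mono-≤ 1q (ℕ.s≤s ℕ.z≤n) ,
            ℕP.≤-trans (ℕP.*-monoʳ-≤ q (ℕ.s≤s k≤m)) (ℕP.≤-trans (ℕP.≤-trans (ℕP.m≤n*m (q ℕ.* suc m) R) (ℕP.≤-reflexive (l R q (suc m)))) (≤W hH)) ,
            ℕP.≤-trans (ℕP.*-mono-≤ (ℕP.*-monoʳ-≤ q (ℕ.s≤s k≤m)) (ℕP.*-monoʳ-≤ q (ℕ.s≤s k≤m))) (ℕP.≤-trans (ℕP.≤-trans (ℕP.m≤n*m (q ℕ.* suc m ℕ.* (q ℕ.* suc m)) R) (ℕP.≤-reflexive (l2 R q (suc m)))) (≤W hV)) ,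
            (hk ≤⟨⟩ ≡≤ (F≡ q (suc k)))
          go : (Σ ℕ λ i → Σ ℕ λ j → Stable i j) → Goal
          go (i , j , s@(p , _)) = let (k , k≤m , hk) = Iv-max (mℓ (suc j)) (F (qℓ i)) c (avg i j s) in
            fin (qℓ i) (mℓ (suc j)) k (1≤qℓ i) k≤m (dH i (suc j) p) (dV i (suc j) p) hk
open EnergyIncrement

-- Translating grid counts into means on the torus.

module GridCounting where
  ℕtoℚ≡ι : ∀ n → ℕtoℚ n ≡ ι n
  ℕtoℚ≡ι zero = refl
  ℕtoℚ≡ι (suc n) = trans (ℚP.toℚᵘ-injective (begin
      ℚ.toℚᵘ (ℕtoℚ (suc n)) ≈⟨ ℚP.toℚᵘ-fromℚᵘ (ℚᵘ.mkℚᵘ (ℤ.+ suc n) 0) ⟩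
      ℚᵘ.mkℚᵘ (ℤ.+ suc n) 0 ≈⟨ ℚᵘ.*≡* (l (ℤ.+ n)) ⟩
      ℚᵘ.mkℚᵘ (ℤ.+ 1) 0 ℚᵘ.+ ℚᵘ.mkℚᵘ (ℤ.+ n) 0 ≈⟨ ℚᵘP.+-congʳ (ℚᵘ.mkℚᵘ (ℤ.+ 1) 0) (ℚᵘP.≃-sym (ℚP.toℚᵘ-fromℚᵘ (ℚᵘ.mkℚᵘ (ℤ.+ n) 0))) ⟩
      ℚ.toℚᵘ 1ℚ ℚᵘ.+ ℚ.toℚᵘ (ℕtoℚ n) ≈⟨ ℚᵘP.≃-sym (ℚP.toℚᵘ-homo-+ 1ℚ (ℕtoℚ n)) ⟩
      ℚ.toℚᵘ (1ℚ + ℕtoℚ n) ∎)) (cong (1ℚ +_) (ℕtoℚ≡ι n))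
    where
    open import Relation.Binary.Reasoning.Setoid ℚᵘP.≃-setoid
    l : ∀ n → (ℤ.+ 1 ℤ.+ n) ℤ.* ℤ.+ 1 ≡ (ℤ.+ 1 ℤ.* ℤ.+ 1 ℤ.+ n ℤ.* ℤ.+ 1) ℤ.* ℤ.+ 1
    l = ℤS.solve-∀

  sumL : {A : Set} → List A → (A → ℚ) → ℚ
  sumL [] g = 0ℚ
  sumL (x ∷ xs) g = g x + sumL xs g

  sumL-++ : {A : Set} (xs ys : List A) (g : A → ℚ) → sumL (xs ++ ys) g ≡ sumL xs g + sumL ys g
  sumL-++ [] ys g = sym (ℚP.+-identityˡ (sumL ys g))
  sumL-++ (x ∷ xs) ys g = trans (cong (g x +_) (sumL-++ xs ys g)) (sym (ℚP.+-assoc (g x) (sumL xs g) (sumL ys g)))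

  sumL-map : {A B : Set} (h : A → B) (xs : List A) (g : B → ℚ) → sumL (map h xs) g ≡ sumL xs (g ∘ h)
  sumL-map h [] g = refl
  sumL-map h (x ∷ xs) g = cong (g (h x) +_) (sumL-map h xs g)

  sumL-concatMap : {A B : Set} (h : A → List B) (xs : List A) (g : B → ℚ) → sumL (concatMap h xs) g ≡ sumL xs (λ x → sumL (h x) g)
  sumL-concatMap h [] g = refl
  sumL-concatMap h (x ∷ xs) g = trans (sumL-++ (h x) (concatMap h xs) g) (cong (sumL (h x) g +_) (sumL-concatMap h xs g))

  sumL-applyUpTo : {A : Set} (h : ℕ → A) (n : ℕ) (g : A → ℚ) → sumL (applyUpTo h n) g ≡ sumℕ n (g ∘ h)
  sumL-applyUpTo h zero g = refl
  sumL-applyUpTo h (suc n) g = cong (g (h 0) +_) (sumL-applyUpTo (h ∘ suc) n g)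

  sumL-cong : {A : Set} (xs : List A) {g h : A → ℚ} → (∀ x → g x ≡ h x) → sumL xs g ≡ sumL xs h
  sumL-cong [] e = refl
  sumL-cong (x ∷ xs) e = cong₂ _+_ (e x) (sumL-cong xs e)

  length-filter : {A : Set} {Q : A → Set} (Q? : Decidable Q) (g : A → ℚ) → (∀ a → Q a → g a ≡ 1ℚ) → (∀ a → ¬ Q a → g a ≡ 0ℚ) →
    ∀ xs → ι (length (filter Q? xs)) ≡ sumL xs g
  length-filter Q? g h h' [] = refl
  length-filter Q? g h h' (x ∷ xs) with Q? x
  ... | yes q = cong₂ _+_ (sym (h x q)) (length-filter Q? g h h' xs)
  ... | no ¬q = trans (length-filter Q? g h h' xs) (trans (sym (ℚP.+-identityˡ (sumL xs g))) (cong (_+ sumL xs g) (sym (h' x ¬q))))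

  𝟙 : Bool → ℚ
  𝟙 true = 1ℚ
  𝟙 false = 0ℚ

  𝟙-true : ∀ {b} → b ≡ true → 𝟙 b ≡ 1ℚ
  𝟙-true refl = refl

  𝟙-false : ∀ b → ¬ b ≡ true → 𝟙 b ≡ 0ℚ
  𝟙-false true h = contradiction refl h
  𝟙-false false h = refl

  0≤𝟙 : ∀ b → 0ℚ ≤ 𝟙 b
  0≤𝟙 true = 0≤1
  0≤𝟙 false = ℚP.≤-refl

  𝟙≤1 : ∀ b → 𝟙 b ≤ 1ℚ
  𝟙≤1 true = ℚP.≤-refl
  𝟙≤1 false = 0≤1

  countGrid-Σ : ∀ N (P : ℤ → ℤ → Bool) → ι (countGrid N P) ≡ sumℕ N (λ i → sumℕ N (λ j → 𝟙 (P (ℤ.+ suc i) (ℤ.+ suc j))))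
  countGrid-Σ N P = trans (length-filter _ g (λ p q → 𝟙-true q) (λ p ¬q → 𝟙-false (P (proj₁ p) (proj₂ p)) ¬q) (grid N))
    (trans (sumL-concatMap {B = ℤ × ℤ} (λ x → map (x ,_) (range N)) (range N) g) (trans (sumL-applyUpTo (λ i → ℤ.+ suc i) N (λ x → sumL (map (x ,_) (range N)) g))
      (Σs-cong N (λ i → trans (sumL-map {B = ℤ × ℤ} (ℤ.+ suc (toℕ i) ,_) (range N) g) (sumL-applyUpTo (λ j → ℤ.+ suc j) N (λ y → g (ℤ.+ suc (toℕ i) , y)))))))
    where
    g : ℤ × ℤ → ℚ
    g p = 𝟙 (P (proj₁ p) (proj₂ p))

  sumℕ-0 : ∀ n (g : ℕ → ℚ) → (∀ k → g k ≡ 0ℚ) → sumℕ n g ≡ 0ℚ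
  sumℕ-0 n g h = trans (Σs-cong n (λ i → h (toℕ i))) (trans (Σs-const n 0ℚ) (ℚP.*-zeroʳ (ι n)))

  -- Residues run over 0, ..., n - 1 and the grid over 1, ..., N: the residue 0 and those above N
  -- must contribute nothing.
  sumℕ-window : ∀ N n (g : ℕ → ℚ) → N ℕ.< n → g 0 ≡ 0ℚ → (∀ k → N ℕ.< k → g k ≡ 0ℚ) → sumℕ n g ≡ sumℕ N (g ∘ suc)
  sumℕ-window N n g p h0 h with ℕP.m≤n⇒∃[o]m+o≡n p
  ... | o , refl = trans (cong₂ _+_ h0 (trans (sumℕ-+ N o (g ∘ suc)) (trans (cong (sumℕ N (g ∘ suc) +_) (sumℕ-0 o _ (λ k → h (suc N ℕ.+ k) (ℕP.m≤m+n (suc N) k)))) (ℚP.+-identityʳ (sumℕ N (g ∘ suc))))))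
    (ℚP.+-identityˡ (sumℕ N (g ∘ suc)))

  module Count (N n' W : ℕ) (A : ℤ → ℤ → Bool) (inA : InGrid N A) (N<n : N ℕ.+ W ℕ.< suc n') where
    open Zn n'
    open Square n'

    f : Pt → ℚ
    f (x , y) = 𝟙 (A (ℤ.+ toℕ x) (ℤ.+ toℕ y))

    f≥0 : ∀ ω → 0ℚ ≤ f ω
    f≥0 (x , y) = 0≤𝟙 (A (ℤ.+ toℕ x) (ℤ.+ toℕ y))

    f≤1 : ∀ ω → f ω ≤ 1ℚ
    f≤1 (x , y) = 𝟙≤1 (A (ℤ.+ toℕ x) (ℤ.+ toℕ y))

    private
      N<n' : N ℕ.< n
      N<n' = ℕP.≤-<-trans (ℕP.m≤m+n N W) N<n

      outside : ∀ {P : ℤ → ℤ → Bool} → InGrid N P → ∀ a b → (a ≡ 0) ⊎ (N ℕ.< a) ⊎ (b ≡ 0) ⊎ (N ℕ.< b) → 𝟙 (P (ℤ.+ a) (ℤ.+ b)) ≡ 0ℚ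
      outside {P} h a b o = 𝟙-false _ (λ e → bad (h _ _ e) o)
        where
        bad : (ℤ.+ 1 ℤ.≤ ℤ.+ a) × (ℤ.+ a ℤ.≤ ℤ.+ N) × (ℤ.+ 1 ℤ.≤ ℤ.+ b) × (ℤ.+ b ℤ.≤ ℤ.+ N) → (a ≡ 0) ⊎ (N ℕ.< a) ⊎ (b ≡ 0) ⊎ (N ℕ.< b) → ⊥
        bad (ℤ.+≤+ p , _) (inj₁ refl) = contradiction p λ ()
        bad (_ , ℤ.+≤+ p , _) (inj₂ (inj₁ q)) = ℕP.<⇒≱ q p
        bad (_ , _ , ℤ.+≤+ p , _) (inj₂ (inj₂ (inj₁ refl))) = contradiction p λ ()
        bad (_ , _ , _ , ℤ.+≤+ p) (inj₂ (inj₂ (inj₂ q))) = ℕP.<⇒≱ q p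

    E-count : ∀ (P : ℤ → ℤ → Bool) → InGrid N P → E m² (λ ω → 𝟙 (P (ℤ.+ toℕ (proj₁ ω)) (ℤ.+ toℕ (proj₂ ω)))) ≡ rec n' * (rec n' * ι (countGrid N P))
    E-count P h = cong (rec n' *_) (trans (Σs-* n (rec n') (λ i → sumℕ n (λ b → g (toℕ i) b))) (cong (rec n' *_)
       (trans (sumℕ-window N n (λ a → sumℕ n (g a)) N<n' (sumℕ-0 n (g 0) (λ b → outside h 0 b (inj₁ refl))) (λ a p → sumℕ-0 n (g a) (λ b → outside h a b (inj₂ (inj₁ p)))))
         (trans (Σs-cong N (λ i → sumℕ-window N n (g (suc (toℕ i))) N<n' (outside h (suc (toℕ i)) 0 (inj₂ (inj₂ (inj₁ refl)))) (λ b p → outside h (suc (toℕ i)) b (inj₂ (inj₂ (inj₂ p))))))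
           (sym (countGrid-Σ N P))))))
      where
      g : ℕ → ℕ → ℚ
      g a b = 𝟙 (P (ℤ.+ a) (ℤ.+ b))

    E-card : E m² f ≡ rec n' * (rec n' * ι (card N A))
    E-card = E-count A inA

    private
      -- If (x, y) lies in A, its coordinates are at most N and the shifts at most W, so N + W < n
      -- excludes wrapping around. If not, both sides vanish.
      corner-pt : ∀ x y d d² → d ℕ.≤ W → d² ℕ.≤ W → f (x , y) * f ((x , y) ⮕ (ℤ.+ d)) * f ((x , y) ⬆ (ℤ.+ d²)) ≡
        𝟙 (A (ℤ.+ toℕ x) (ℤ.+ toℕ y) ∧ A (ℤ.+ toℕ x ℤ.+ ℤ.+ d) (ℤ.+ toℕ y) ∧ A (ℤ.+ toℕ x) (ℤ.+ toℕ y ℤ.+ ℤ.+ d²))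
      corner-pt x y d d² p p' = go (A (ℤ.+ toℕ x) (ℤ.+ toℕ y)) refl
        where
        nowrap : ∀ (z : Fin n) e → e ℕ.≤ W → ℤ.+ toℕ z ℤ.≤ ℤ.+ N → ℤ.+ toℕ (z ⊹ (ℤ.+ e)) ≡ ℤ.+ toℕ z ℤ.+ ℤ.+ e
        nowrap z e q (ℤ.+≤+ r) = cong ℤ.+_ (toℕ-π< (toℕ z ℕ.+ e) (ℕP.≤-<-trans (ℕP.+-mono-≤ r q) N<n))
        ∧3 : ∀ b c → 1ℚ * 𝟙 b * 𝟙 c ≡ 𝟙 (true ∧ b ∧ c)
        ∧3 true true = refl
        ∧3 true false = refl
        ∧3 false true = refl
        ∧3 false false = refl
        go : ∀ b → A (ℤ.+ toℕ x) (ℤ.+ toℕ y) ≡ b → f (x , y) * f ((x , y) ⮕ (ℤ.+ d)) * f ((x , y) ⬆ (ℤ.+ d²)) ≡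
          𝟙 (A (ℤ.+ toℕ x) (ℤ.+ toℕ y) ∧ A (ℤ.+ toℕ x ℤ.+ ℤ.+ d) (ℤ.+ toℕ y) ∧ A (ℤ.+ toℕ x) (ℤ.+ toℕ y ℤ.+ ℤ.+ d²))
        go false e = trans (cong (λ b → 𝟙 b * f ((x , y) ⮕ (ℤ.+ d)) * f ((x , y) ⬆ (ℤ.+ d²))) e)
          (trans (l (f ((x , y) ⮕ (ℤ.+ d))) (f ((x , y) ⬆ (ℤ.+ d²)))) (sym (cong (λ b → 𝟙 (b ∧ A (ℤ.+ toℕ x ℤ.+ ℤ.+ d) (ℤ.+ toℕ y) ∧ A (ℤ.+ toℕ x) (ℤ.+ toℕ y ℤ.+ ℤ.+ d²))) e)))
          where l : ∀ a b → 0ℚ * a * b ≡ 0ℚ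
                l = solve-∀ ℚR
        go true e = let (_ , x≤ , _ , y≤) = inA _ _ e in
          trans (cong (λ b → 𝟙 b * f ((x , y) ⮕ (ℤ.+ d)) * f ((x , y) ⬆ (ℤ.+ d²))) e)
          (trans (cong₂ (λ a b → 1ℚ * 𝟙 (A a (ℤ.+ toℕ y)) * 𝟙 (A (ℤ.+ toℕ x) b)) (nowrap x d p x≤) (nowrap y d² p' y≤))
            (trans (∧3 (A (ℤ.+ toℕ x ℤ.+ ℤ.+ d) (ℤ.+ toℕ y)) (A (ℤ.+ toℕ x) (ℤ.+ toℕ y ℤ.+ ℤ.+ d²))) (sym (cong (λ b → 𝟙 (b ∧ A (ℤ.+ toℕ x ℤ.+ ℤ.+ d) (ℤ.+ toℕ y) ∧ A (ℤ.+ toℕ x) (ℤ.+ toℕ y ℤ.+ ℤ.+ d²))) e))))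

    E-corner : ∀ d → d ℕ.≤ W → d ℕ.* d ℕ.≤ W → E m² (λ ω → f ω * f (ω ⮕ (ℤ.+ d)) * f (ω ⬆ (ℤ.+ (d ℕ.* d)))) ≡ rec n' * (rec n' * ι (cornerCount N A (ℤ.+ d)))
    E-corner d p p' = trans (E-cong m² (λ { (x , y) → trans (corner-pt x y d (d ℕ.* d) p p')
         (cong (λ z → 𝟙 (A (ℤ.+ toℕ x) (ℤ.+ toℕ y) ∧ A (ℤ.+ toℕ x ℤ.+ ℤ.+ d) (ℤ.+ toℕ y) ∧ A (ℤ.+ toℕ x) (ℤ.+ toℕ y ℤ.+ z))) (ℤP.pos-* d d)) }))
      (E-count (λ x y → A x y ∧ A (x ℤ.+ ℤ.+ d) y ∧ A x (y ℤ.+ ℤ.+ d ℤ.* ℤ.+ d)) (λ x y e → inA x y (∧-true e)))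
      where
      ∧-true : ∀ {b c} → b ∧ c ≡ true → b ≡ true
      ∧-true {true} e = refl
open GridCounting

-- All scales are at most exponential in a power of 1/ε.

module Growth where
  -- With T ≥ 2 a constant k satisfies k ≤ 2^k ≤ T^k, so a bare power of T bounds every polynomial
  -- quantity.
  record PolyB (f : ℕ → ℕ) : Set where
    constructor _,ₚ_
    field
      degree : ℕ
      poly-bound : ∀ T → 2 ℕ.≤ T → f T ℕ.≤ T ℕ.^ degree

  1≤pow : ∀ x k → 1 ℕ.≤ x → 1 ℕ.≤ x ℕ.^ k
  1≤pow x k h = ℕP.≤-trans (ℕP.≤-reflexive (sym (ℕP.^-zeroˡ k))) (ℕP.^-monoˡ-≤ k h)

  k≤2^k : ∀ k → k ℕ.≤ 2 ℕ.^ k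
  k≤2^k zero = ℕ.z≤n
  k≤2^k (suc k) = ℕP.≤-trans (ℕP.+-mono-≤ (1≤pow 2 k (ℕ.s≤s ℕ.z≤n)) (k≤2^k k)) (ℕP.≤-reflexive (cong (2 ℕ.^ k ℕ.+_) (sym (ℕP.+-identityʳ (2 ℕ.^ k)))))

  poly-≤ : ∀ {f g} → (∀ T → 2 ℕ.≤ T → f T ℕ.≤ g T) → PolyB g → PolyB f
  poly-≤ h (C ,ₚ p) = C ,ₚ λ T t → ℕP.≤-trans (h T t) (p T t)

  poly-const : ∀ k → PolyB (λ _ → k)
  poly-const k = k ,ₚ λ T t → ℕP.≤-trans (k≤2^k k) (ℕP.^-monoˡ-≤ k t)

  poly-id : PolyB id
  poly-id = 1 ,ₚ λ T t → ℕP.≤-reflexive (sym (ℕP.^-identityʳ T))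

  poly-* : ∀ {f g} → PolyB f → PolyB g → PolyB (λ T → f T ℕ.* g T)
  poly-* (a ,ₚ p) (b ,ₚ q) = (a ℕ.+ b) ,ₚ λ T t → ℕP.≤-trans (ℕP.*-mono-≤ (p T t) (q T t)) (ℕP.≤-reflexive (sym (ℕP.^-distribˡ-+-* T a b)))

  poly-+ : ∀ {f g} → PolyB f → PolyB g → PolyB (λ T → f T ℕ.+ g T)
  poly-+ (a ,ₚ p) (b ,ₚ q) = (suc (a ℕ.+ b)) ,ₚ λ T t → ℕP.≤-trans (ℕP.+-mono-≤ (p T t) (q T t)) (ℕP.≤-trans
     (x+y≤2xy (T ℕ.^ a) (T ℕ.^ b) (1≤pow T a (ℕP.≤-trans (ℕ.s≤s ℕ.z≤n) t)) (1≤pow T b (ℕP.≤-trans (ℕ.s≤s ℕ.z≤n) t)))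
     (ℕP.*-mono-≤ t (ℕP.≤-reflexive (sym (ℕP.^-distribˡ-+-* T a b)))))
    where
    x+y≤2xy : ∀ x y → 1 ℕ.≤ x → 1 ℕ.≤ y → x ℕ.+ y ℕ.≤ 2 ℕ.* (x ℕ.* y)
    x+y≤2xy x y p q = ℕP.≤-trans (ℕP.+-mono-≤ (ℕP.≤-trans (ℕP.≤-reflexive (sym (ℕP.*-identityʳ x))) (ℕP.*-monoʳ-≤ x q)) (ℕP.≤-trans (ℕP.≤-reflexive (sym (ℕP.*-identityˡ y))) (ℕP.*-monoˡ-≤ y p))) (ℕP.≤-reflexive (l (x ℕ.* y)))
      where l : ∀ z → z ℕ.+ z ≡ 2 ℕ.* z
            l = ℕS.solve-∀

  poly-pwℕ : ∀ n {f} → PolyB f → PolyB (λ T → pwℕ n (f T))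
  poly-pwℕ zero {f} p = poly-≤ (λ T _ → ℕP.≤-reflexive (pwℕ-0 (f T))) p
  poly-pwℕ (suc n) {f} p = poly-≤ (λ T _ → ℕP.≤-reflexive (pwℕ-suc n (f T))) (poly-pwℕ n (poly-* p p))

  -- Closed under sums, products, polynomial powers and factorials of polynomial quantities, the
  -- operations from which W is built.
  record ExpB (f : ℕ → ℕ) : Set where
    constructor expB
    field
      exponent : ℕ → ℕ
      exponent-poly : PolyB exponent
      exp-bound : ∀ T → 2 ℕ.≤ T → f T ℕ.≤ 2 ℕ.^ exponent T

  exp-≤ : ∀ {f g} → (∀ T → 2 ℕ.≤ T → f T ℕ.≤ g T) → ExpB g → ExpB f
  exp-≤ h (expB g p q) = expB g p (λ T t → ℕP.≤-trans (h T t) (q T t))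

  exp-≡ : ∀ {f g} → (∀ T → f T ≡ g T) → ExpB g → ExpB f
  exp-≡ h = exp-≤ (λ T _ → ℕP.≤-reflexive (h T))

  exp-poly : ∀ {f} → PolyB f → ExpB f
  exp-poly {f} p = expB f p (λ T _ → k≤2^k (f T))

  exp-* : ∀ {f g} → ExpB f → ExpB g → ExpB (λ T → f T ℕ.* g T)
  exp-* (expB a p p') (expB b q q') = expB (λ T → a T ℕ.+ b T) (poly-+ p q) (λ T t → ℕP.≤-trans (ℕP.*-mono-≤ (p' T t) (q' T t)) (ℕP.≤-reflexive (sym (ℕP.^-distribˡ-+-* 2 (a T) (b T)))))

  exp-+ : ∀ {f g} → ExpB f → ExpB g → ExpB (λ T → f T ℕ.+ g T)
  exp-+ {f} {g} p q = exp-≤ (λ T _ → le (f T) (g T)) (exp-* (suc1 p) (suc1 q))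
    where
    suc1 : ∀ {f} → ExpB f → ExpB (λ T → 1 ℕ.+ f T)
    suc1 (expB a p p') = expB (λ T → 1 ℕ.+ a T) (poly-+ (poly-const 1) p) (λ T t → ℕP.≤-trans (ℕP.+-mono-≤ (1≤pow 2 (a T) (ℕ.s≤s ℕ.z≤n)) (p' T t)) (ℕP.≤-reflexive (cong (2 ℕ.^ a T ℕ.+_) (sym (ℕP.+-identityʳ (2 ℕ.^ a T))))))
    le : ∀ x y → x ℕ.+ y ℕ.≤ (1 ℕ.+ x) ℕ.* (1 ℕ.+ y)
    le x y = ℕP.≤-trans (ℕP.m≤m+n (x ℕ.+ y) (1 ℕ.+ x ℕ.* y)) (ℕP.≤-reflexive (l x y))
      where l : ∀ x y → x ℕ.+ y ℕ.+ (1 ℕ.+ x ℕ.* y) ≡ (1 ℕ.+ x) ℕ.* (1 ℕ.+ y)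
            l = ℕS.solve-∀

  exp-! : ∀ {f} → PolyB f → ExpB (λ T → (f T) !)
  exp-! {f} p = expB (λ T → f T ℕ.* f T) (poly-* p p) (λ T _ → n!≤ (f T))
    where
    n!≤ : ∀ n → n ! ℕ.≤ 2 ℕ.^ (n ℕ.* n)
    n!≤ zero = ℕP.≤-refl
    n!≤ (suc n) = ℕP.≤-trans (ℕP.*-mono-≤ (k≤2^k (suc n)) (n!≤ n)) (ℕP.≤-trans (ℕP.≤-reflexive (sym (ℕP.^-distribˡ-+-* 2 (suc n) (n ℕ.* n))))
      (ℕP.^-monoʳ-≤ 2 (ℕP.+-monoʳ-≤ (suc n) (ℕP.*-monoʳ-≤ n (ℕP.n≤1+n n)))))

  exp-^ : ∀ {f k} → ExpB f → PolyB k → ExpB (λ T → f T ℕ.^ k T)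
  exp-^ {f} {k} (expB a p p') q = expB (λ T → a T ℕ.* k T) (poly-* p q) (λ T t → ℕP.≤-trans (ℕP.^-monoˡ-≤ (k T) (p' T t)) (ℕP.≤-reflexive (ℕP.^-*-assoc 2 (a T) (k T))))

  abstract
    -- All absorption errors are 1/(suc (rT T)); the power 2³⁶ undoes the exponent lost in twoD.
    rT : ℕ → ℕ
    rT T = ℕ.pred (suc k2D ℕ.* 9 ℕ.* pwℕ 36 (10 ℕ.* T))

    pwℕ-≥ : ∀ n x → 1 ℕ.≤ x → x ℕ.≤ pwℕ n x
    pwℕ-≥ zero x h = ℕP.≤-reflexive (sym (pwℕ-0 x))
    pwℕ-≥ (suc n) x h = ℕP.≤-trans (ℕP.≤-trans (ℕP.≤-trans (ℕP.≤-reflexive (sym (ℕP.*-identityʳ x))) (ℕP.*-monoʳ-≤ x h)) (pwℕ-≥ n (x ℕ.* x) (ℕP.*-mono-≤ h h))) (ℕP.≤-reflexive (sym (pwℕ-suc n x)))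

    rT-suc : ∀ T → 1 ℕ.≤ T → suc (rT T) ≡ suc k2D ℕ.* 9 ℕ.* pwℕ 36 (10 ℕ.* T)
    rT-suc T h = ℕP.suc-pred (suc k2D ℕ.* 9 ℕ.* pwℕ 36 (10 ℕ.* T)) {{ℕ.>-nonZero (ℕP.*-mono-≤ {1} {suc k2D ℕ.* 9} (ℕP.*-mono-≤ {1} {suc k2D} (ℕ.s≤s ℕ.z≤n) (ℕ.s≤s ℕ.z≤n)) (ℕP.≤-trans (ℕP.*-mono-≤ {1} {10} (ℕ.s≤s ℕ.z≤n) h) (pwℕ-≥ 36 (10 ℕ.* T) (ℕP.*-mono-≤ {1} {10} (ℕ.s≤s ℕ.z≤n) h))))}}

    rT-poly : PolyB (λ T → suc (rT T))
    rT-poly = poly-≤ (λ T t → ℕP.≤-reflexive (rT-suc T (ℕP.≤-trans (ℕ.s≤s ℕ.z≤n) t))) (poly-* (poly-const (suc k2D ℕ.* 9)) (poly-pwℕ 36 (poly-* (poly-const 10) poly-id)))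

  -- `Qr` is a factorial of a polynomial quantity, and the number of stages is fixed. The only
  -- growing exponent is R in `G ^ R`, which is itself polynomial in T.
  growth : Σ ℕ λ C → ∀ T → 2 ℕ.≤ T → 80 ℕ.* T ℕ.* Scale.W (rT T) ℕ.≤ 2 ℕ.^ (T ℕ.^ C)
  growth = let (expB g (C ,ₚ p) q) = exp-* (exp-poly (poly-* (poly-const 80) poly-id)) gW in C , λ T t → ℕP.≤-trans (q T t) (ℕP.^-monoʳ-≤ 2 (p T t))
    where
    R : PolyB (λ T → suc (rT T))
    R = rT-poly
    eR : ExpB (λ T → suc (rT T))
    eR = exp-poly R
    gk : ∀ k → ExpB (λ _ → k)
    gk k = exp-poly (poly-const k)
    gC4 : PolyB (λ T → C4 (rT T))
    gC4 = poly-+ (poly-+ R R) (poly-+ R R)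
    gDr : PolyB (λ T → Dr (rT T))
    gDr = poly-≤ (λ T _ → ℕP.≤-reflexive (Dr-def (rT T))) (poly-+ (poly-* gC4 gC4) (poly-* gC4 gC4))
    gQr : ExpB (λ T → Qr (rT T))
    gQr = exp-≡ (λ T → Qr-def (rT T)) (exp-! gDr)
    gEc : ExpB (λ T → Par.Ec (rT T))
    gEc = exp-≡ (λ T → Par.Ec-def (rT T)) (exp-* (exp-* gQr (exp-poly gDr)) (exp-* (gk 4) eR))
    gc5 : ExpB (λ T → Par.c5 (rT T))
    gc5 = exp-≡ (λ T → Par.c5-def (rT T)) (exp-* (exp-* (gk 2) eR) gEc)
    ESt : (ℕ → St) → Set
    ESt s = ExpB (λ T → ℤ.∣ qs (s T) ∣) × ExpB (λ T → As (s T))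
    gcS : ∀ s → ESt s → ExpB (λ T → Par.cS (rT T) (s T))
    gcS s (a , b) = exp-≡ (λ T → Par.cS-def (rT T) (s T)) (exp-* (exp-+ (exp-* (exp-* (gk 4) eR) a) (exp-* (gk 6) b)) gEc)
    st5 st4 st3 st2 st1 : ℕ → St
    st5 T = Par.s5 (rT T)
    st4 T = Par.next (rT T) (st5 T)
    st3 T = Par.next (rT T) (st4 T)
    st2 T = Par.next (rT T) (st3 T)
    st1 T = Par.next (rT T) (st2 T)
    gnext : ∀ s → ESt s → ESt (λ T → Par.next (rT T) (s T))
    gnext s e@(a , b) = exp-≡ (λ T → Par.abs-next (rT T) (s T)) (exp-* (exp-* (exp-* (gk 2) a) a) gQr) ,
      exp-≡ (λ T → Par.As-next (rT T) (s T)) (exp-* (exp-* (exp-* (gk 2) eR) (exp-* (gcS s e) (gcS s e))) (exp-* (exp-* (exp-* (gk 2) a) gQr) b))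
    g5 : ESt st5
    g5 = exp-≡ (λ T → trans (cong ℤ.∣_∣ (Par.qs-s5 (rT T))) (ℤP.abs-* (ℤ.+ 2) (ℤ.+ Qr (rT T)))) (exp-* (gk 2) gQr) ,
      exp-≡ (λ T → Par.As-s5 (rT T)) (exp-* (exp-* (gk 2) eR) (exp-* gc5 gc5))
    g4 : ESt st4
    g4 = gnext st5 g5
    g3 : ESt st3
    g3 = gnext st4 g4
    g2 : ESt st2
    g2 = gnext st3 g3
    g1 : ESt st1
    g1 = gnext st2 g2
    gc° : ExpB (λ T → Par2.c° (rT T))
    gc° = exp-≡ (λ T → Par2.c°≡ (rT T)) (exp-* (exp-+ (exp-* (exp-* (gk 2) eR) (proj₁ g1)) (exp-* (exp-* (gk 6) eR) (proj₂ g1))) gEc)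
    gM₀ : ExpB (λ T → Scale.M₀ (rT T))
    gM₀ = exp-* (exp-* gc5 (exp-* (exp-* (exp-* (gcS st5 g5) (gcS st4 g4)) (gcS st3 g3)) (gcS st2 g2))) gc°
    gq° : ExpB (λ T → Scale.q° (rT T))
    gq° = exp-≡ (λ T → trans (ℤP.abs-* (ℤ.+ 2 ℤ.* qs (st1 T)) (ℤ.+ Qr (rT T))) (cong (ℕ._* Qr (rT T)) (ℤP.abs-* (ℤ.+ 2) (qs (st1 T))))) (exp-* (exp-* (gk 2) (proj₁ g1)) gQr)
    gG : ExpB (λ T → Scale.G (rT T))
    gG = exp-* gq° (exp-* (exp-* (exp-* (exp-* (gk 2) eR) eR) gc°) gc°)
    gM : ExpB (λ T → suc (Scale.mℓ (rT T) (suc (rT T))))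
    gM = exp-≡ (λ T → Scale.mℓ≡ (rT T) (suc (rT T))) (exp-* gM₀ (exp-^ gG R))
    gW : ExpB (λ T → Scale.W (rT T))
    gW = exp-* (exp-* eR (exp-* gM gM)) (exp-* eR gM)
open Growth

-- From the torus back to the grid, and the choice of constants.

cube-mono : ∀ {a b} → 0ℚ ≤ a → a ≤ b → a * a * a ≤ b * b * b
cube-mono {a} {b} a0 p = *mono (a * a) (nn* a0 a0) p ≤⟨⟩ *mono' b (a0 ≤⟨⟩ p) (*mono a a0 p ≤⟨⟩ *mono' b (a0 ≤⟨⟩ p) p)

-- z = N/n is the cost of enlarging the grid from N to n.
rescale : ∀ {δ ε z ρ m X err} → 0ℚ ≤ δ → δ ≤ 1ℚ → 0ℚ ≤ z → z ≤ 1ℚ → 0ℚ ≤ ρ → ρ ≤ 1ℚ → ι 4 * (1ℚ - z) ≤ ρ → ι 10 * ρ ≤ ε → err ≤ ι 3 * ρ →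
  δ * (z * z) ≤ m → m * m * m - err ≤ X → (δ * δ * δ - ε) * (z * z) ≤ X
rescale {δ} {ε} {z} {ρ} {m} {X} {err} δ0 δ1 z0 z1 ρ0 ρ1 hz hε herr hm hX =
  by (nn+ (nn+ (nn+ (diff hX) (diff (cube-mono (nn* δ0 y0) hm))) (diff herr))
       (nn+ (nn+ (nn* (diff hε) y0) (nn* y0 (nn+ b (nn* 0≤1-D c)))) (nn+ (nn* (nn* (0≤ι 9) ρ0) (diff y½)) (nn* (nn* (0≤ι 3) 0≤½) ρ0))))
    (l3 X ε z ρ m err δ)
  where
  y = z * z
  y0 : 0ℚ ≤ y
  y0 = nn* z0 z0
  a : 0ℚ ≤ ½ * ρ - (1ℚ - y)
  a = nn+ (nn* 0≤½ (diff hz)) (nn-sq (1ℚ - z)) ≤⟨⟩ ≡≤ (l z ρ)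
    where l : ∀ z ρ → ½ * (ρ - ι 4 * (1ℚ - z)) + (1ℚ - z) * (1ℚ - z) ≡ ½ * ρ - (1ℚ - z * z)
          l = solve-∀ ℚR
  b : 0ℚ ≤ ρ - (1ℚ - y * y)
  b = nn+ (nn* 0≤2 a) (nn-sq (1ℚ - y)) ≤⟨⟩ ≡≤ (l y ρ)
    where l : ∀ y ρ → 2ℚ * (½ * ρ - (1ℚ - y)) + (1ℚ - y) * (1ℚ - y) ≡ ρ - (1ℚ - y * y)
          l = solve-∀ ℚR
  c : 0ℚ ≤ 1ℚ - y * y
  c = nn* (nn* (diff z1) (nn+ 0≤1 z0)) (nn+ 0≤1 y0) ≤⟨⟩ ≡≤ (l z)
    where l : ∀ z → (1ℚ - z) * (1ℚ + z) * (1ℚ + z * z) ≡ 1ℚ - z * z * (z * z)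
          l = solve-∀ ℚR
  y½ : ½ ≤ y
  y½ = by (nn+ a (nn* 0≤½ (diff ρ1))) (l y ρ)
    where l : ∀ y ρ → y ≡ ½ + (½ * ρ - (1ℚ - y) + ½ * (1ℚ - ρ))
          l = solve-∀ ℚR
  0≤1-D : 0ℚ ≤ 1ℚ - δ * δ * δ
  0≤1-D = diff (cube-mono δ0 δ1)
  l3 : ∀ X ε z ρ m err δ → X ≡ (δ * δ * δ - ε) * (z * z) + (X - (m * m * m - err) + (m * m * m - δ * (z * z) * (δ * (z * z)) * (δ * (z * z))) + (ι 3 * ρ - err)
     + ((ε - ι 10 * ρ) * (z * z) + z * z * (ρ - (1ℚ - z * z * (z * z)) + (1ℚ - δ * δ * δ) * (1ℚ - z * z * (z * z))) + (ι 9 * ρ * (z * z - ½) + ι 3 * ½ * ρ)))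
  l3 = solve-∀ ℚR

-- The modulus n = W(⌊N/W⌋ + 2) is a multiple of W with N + W < n ≤ N + 2W: large enough to prevent
-- wrapping around, and, as N ≥ 80TW, so close to N that the density barely drops.
many-corners : ∀ T → 2 ℕ.≤ T → ∀ N → 80 ℕ.* T ℕ.* Scale.W (rT T) ℕ.≤ N → ∀ δ → 0ℚ ≤ δ → δ ≤ 1ℚ → ∀ A → InGrid N A →
  δ * (ι N * ι N) ≤ ι (card N A) → ∀ ε → 1ℚ ≤ ε * ι T →
  Σ ℕ λ d → (1 ℕ.≤ d) × ((δ * δ * δ - ε) * (ι N * ι N) ≤ ι (cornerCount N A (ℤ.+ d)))
many-corners T 2≤T N N≥ δ δ0 δ1 A inA hA ε hε = fin (S.Increment.popular n' (divides (N ℕDM./ W ℕ.+ 2) (trans n≡ (ℕP.*-comm W (N ℕDM./ W ℕ.+ 2)))) C.f C.f≥0 C.f≤1 t hκ)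
  where
  r = rT T
  module S = Scale r
  W = S.W
  instance
    nzW : ℕ.NonZero W
    nzW = ℕ.>-nonZero S.1≤W
  1≤T : 1 ℕ.≤ T
  1≤T = ℕP.≤-trans (ℕ.s≤s ℕ.z≤n) 2≤T
  t n' : ℕ
  t = ℕ.pred (10 ℕ.* T)
  n' = ℕ.pred (W ℕ.* (N ℕDM./ W ℕ.+ 2))
  t≡ : suc t ≡ 10 ℕ.* T
  t≡ = ℕP.suc-pred (10 ℕ.* T) {{ℕ.>-nonZero (ℕP.*-mono-≤ {1} {10} (ℕ.s≤s ℕ.z≤n) 1≤T)}}
  n≡ : suc n' ≡ W ℕ.* (N ℕDM./ W ℕ.+ 2)
  n≡ = ℕP.suc-pred (W ℕ.* (N ℕDM./ W ℕ.+ 2)) {{ℕ.>-nonZero (ℕP.*-mono-≤ {1} S.1≤W (ℕP.≤-trans (ℕ.s≤s ℕ.z≤n) (ℕP.m≤n+m 2 (N ℕDM./ W))))}}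
  n≡' : suc n' ≡ N ℕDM./ W ℕ.* W ℕ.+ (W ℕ.+ W)
  n≡' = trans n≡ (l W (N ℕDM./ W))
    where l : ∀ w k → w ℕ.* (k ℕ.+ 2) ≡ k ℕ.* w ℕ.+ (w ℕ.+ w)
          l = ℕS.solve-∀
  N<n : N ℕ.+ W ℕ.< suc n'
  N<n = ℕP.<-≤-trans (ℕP.+-monoˡ-< W (ℕP.<-≤-trans (ℕP.≤-<-trans (ℕP.≤-reflexive (ℕDM.m≡m%n+[m/n]*n N W)) (ℕP.+-monoˡ-< (N ℕDM./ W ℕ.* W) (ℕDM.m%n<n N W))) ℕP.≤-refl))
    (ℕP.≤-reflexive (trans (l W (N ℕDM./ W ℕ.* W)) (sym n≡')))
    where l : ∀ w k → w ℕ.+ k ℕ.+ w ≡ k ℕ.+ (w ℕ.+ w)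
          l = ℕS.solve-∀
  n≤ : suc n' ℕ.≤ N ℕ.+ (W ℕ.+ W)
  n≤ = ℕP.≤-trans (ℕP.≤-reflexive n≡') (ℕP.+-monoˡ-≤ (W ℕ.+ W) (ℕDM.m/n*n≤m N W))
  module C = Count N n' W A inA N<n
  v iN iₙ ρ κ z : ℚ
  v = rec n'
  iN = ι N
  iₙ = ι (suc n')
  ρ = rec t
  κ = rec r
  z = v * iN
  v0 = 0≤rec n'
  viₙ : v * iₙ ≡ 1ℚ
  viₙ = rec-inv n'
  N≤n : iN ≤ iₙ
  N≤n = ι-mono (ℕP.≤-trans (ℕP.m≤m+n N W) (ℕP.<⇒≤ N<n))
  hκ : ι (suc k2D) * (ι 9 * κ) * pw 36 (ι (suc t)) ≤ 1ℚ
  hκ = ≡≤ (trans (cong (ι (suc k2D) * (ι 9 * κ) *_) (trans (pw-ι 36 (suc t)) (cong (λ k → ι (pwℕ 36 k)) t≡)))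
    (trans (l (ι (suc k2D)) (ι 9) κ (ι (pwℕ 36 (10 ℕ.* T)))) (trans (cong (κ *_) (trans (cong (_* ι (pwℕ 36 (10 ℕ.* T))) (sym (ι-* (suc k2D) 9))) (trans (sym (ι-* (suc k2D ℕ.* 9) (pwℕ 36 (10 ℕ.* T)))) (cong ι (sym (rT-suc T 1≤T)))))) (rec-inv r))))
    where l : ∀ a b k p → a * (b * k) * p ≡ k * (a * b * p)
          l = solve-∀ ℚR
  7κ≤ρ : ι 7 * κ ≤ ρ
  7κ≤ρ = ≤rec t (≡≤ (l (ι 7) κ (ι (suc t))) ≤⟨⟩ rec≤ r (≡≤ (sym (ι-* 7 (suc t))) ≤⟨⟩ ι-mono le ≤⟨⟩ ≡≤ (sym (ℚP.*-identityˡ (ι (suc r)))))) ≤⟨⟩ ≡≤ (ℚP.*-identityʳ ρ)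
    where
    l : ∀ a k t → a * k * t ≡ k * (a * t)
    l = solve-∀ ℚR
    le : 7 ℕ.* suc t ℕ.≤ suc r
    le = ℕP.≤-trans (ℕP.*-mono-≤ {7} {suc k2D ℕ.* 9} (ℕP.≤-trans (ℕP.m≤m+n 7 2) (ℕP.m≤n*m 9 (suc k2D))) (ℕP.≤-trans (ℕP.≤-reflexive t≡) (pwℕ-≥ 36 (10 ℕ.* T) (ℕP.≤-trans (ℕ.s≤s ℕ.z≤n) (ℕP.≤-reflexive t≡)))))
      (ℕP.≤-reflexive (sym (rT-suc T 1≤T)))
  herr : 2ℚ * ρ + ι 7 * κ ≤ ι 3 * ρ
  herr = +l (2ℚ * ρ) 7κ≤ρ ≤⟨⟩ ≡≤ (l ρ)
    where l : ∀ ρ → 2ℚ * ρ + ρ ≡ ι 3 * ρ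
          l = solve-∀ ℚR
  hρε : ι 10 * ρ ≤ ε
  hρε = ≡≤ (ℚP.*-comm (ι 10) ρ) ≤⟨⟩ rec≤ t (≡≤ (sym (ℚP.*-identityʳ (ι 10))) ≤⟨⟩ *mono (ι 10) (0≤ι 10) hε ≤⟨⟩
      ≡≤ (trans (l (ι 10) ε (ι T)) (cong (ε *_) (trans (sym (ι-* 10 T)) (cong ι (sym t≡))))))
    where l : ∀ a e t → a * (e * t) ≡ e * (a * t)
          l = solve-∀ ℚR
  -- 80 = 4·10·2: the loss 1 - z is at most 2W/n, and it has to stay below a quarter of ρ = 1/(10T).
  hz : ι 4 * (1ℚ - z) ≤ ρ
  hz = ≤rec t (≡≤ (trans (cong (λ w → ι 4 * (w - z) * ι (suc t)) (sym viₙ)) (l (ι 4) v iₙ iN (ι (suc t)))) ≤⟨⟩ rec≤ n' (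
      *mono (ι 4 * ι (suc t)) (nn* (0≤ι 4) (0≤ι (suc t))) (+r (- iN) (ι-mono n≤ ≤⟨⟩ ≡≤ (ι-+ N (W ℕ.+ W))) ≤⟨⟩ ≡≤ (l2 iN (ι (W ℕ.+ W)))) ≤⟨⟩
      ≡≤ (trans (cong (_* ι (W ℕ.+ W)) (trans (sym (ι-* 4 (suc t))) (cong (λ k → ι (4 ℕ.* k)) t≡))) (trans (sym (ι-* (4 ℕ.* (10 ℕ.* T)) (W ℕ.+ W))) (cong ι (l3 T W)))) ≤⟨⟩
      ι-mono N≥ ≤⟨⟩ N≤n ≤⟨⟩ ≡≤ (sym (ℚP.*-identityˡ iₙ)))) ≤⟨⟩ ≡≤ (ℚP.*-identityʳ ρ)
    where
    l : ∀ a v n N t → a * (v * n - v * N) * t ≡ v * (a * t * (n - N))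
    l = solve-∀ ℚR
    l2 : ∀ N w → N + w - N ≡ w
    l2 = solve-∀ ℚR
    l3 : ∀ t w → 4 ℕ.* (10 ℕ.* t) ℕ.* (w ℕ.+ w) ≡ 80 ℕ.* t ℕ.* w
    l3 = ℕS.solve-∀
  z0 : 0ℚ ≤ z
  z0 = nn* v0 (0≤ι N)
  z1 : z ≤ 1ℚ
  z1 = *mono v v0 N≤n ≤⟨⟩ ≡≤ viₙ
  m : ℚ
  m = E (Square.m² n') C.f
  hm : δ * (z * z) ≤ m
  hm = ≡≤ (l δ v iN) ≤⟨⟩ *mono v v0 (*mono v v0 hA) ≤⟨⟩ ≡≤ (sym C.E-card)
    where l : ∀ d v n → d * (v * n * (v * n)) ≡ v * (v * (d * (n * n)))
          l = solve-∀ ℚR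
  unscale : ∀ x c → x * (z * z) ≤ v * (v * c) → x * (iN * iN) ≤ c
  unscale x c h = ≡≤ (sym (trans (l iₙ x v iN) (trans (cong (λ w → w * w * (x * (iN * iN))) viₙ) (l2 (x * (iN * iN)))))) ≤⟨⟩ *mono iₙ (0≤ι (suc n')) (*mono iₙ (0≤ι (suc n')) h) ≤⟨⟩
      ≡≤ (trans (l3 iₙ v c) (trans (cong (λ w → w * w * c) viₙ) (l2 c)))
    where
    l : ∀ i x v n → i * (i * (x * (v * n * (v * n)))) ≡ v * i * (v * i) * (x * (n * n))
    l = solve-∀ ℚR
    l2 : ∀ x → 1ℚ * 1ℚ * x ≡ x
    l2 = solve-∀ ℚR
    l3 : ∀ i v c → i * (i * (v * (v * c))) ≡ v * i * (v * i) * c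
    l3 = solve-∀ ℚR
  fin : _ → Σ ℕ λ d → (1 ℕ.≤ d) × ((δ * δ * δ - ε) * (iN * iN) ≤ ι (cornerCount N A (ℤ.+ d)))
  fin (d , 1≤d , d≤W , d²≤W , h) = d , 1≤d , unscale (δ * δ * δ - ε) (ι (cornerCount N A (ℤ.+ d)))
    (rescale δ0 δ1 z0 z1 (0≤rec t) (rec≤1 t) hz hρε herr hm (h ≤⟨⟩ ≡≤ (C.E-corner d d≤W d²≤W)))

pow-* : ∀ x y k → (x ℕ.* y) ℕ.^ k ≡ x ℕ.^ k ℕ.* y ℕ.^ k
pow-* x y zero = refl
pow-* x y (suc k) = trans (cong (x ℕ.* y ℕ.*_) (pow-* x y k)) (l x y (x ℕ.^ k) (y ℕ.^ k))
  where l : ∀ x y a b → x ℕ.* y ℕ.* (a ℕ.* b) ≡ x ℕ.* a ℕ.* (y ℕ.* b)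
        l = ℕS.solve-∀

-- T^c·p^C = (Tp)^c·p^(C - c) ≤ (2q)^c·q^(C - c) = 2^c·q^C. The choice C = 2^c exceeds c and also
-- pays for the factor 2^c.
below : ∀ c T p q N → T ℕ.* p ℕ.≤ 2 ℕ.* q → p ℕ.≤ q → N ℕ.≤ 2 ℕ.^ (T ℕ.^ c) → N ℕ.^ (p ℕ.^ (2 ℕ.^ c)) ℕ.≤ 2 ℕ.^ (2 ℕ.^ c ℕ.* q ℕ.^ (2 ℕ.^ c))
below c T p q N Tp pq h = ℕP.≤-trans (ℕP.^-monoˡ-≤ (p ℕ.^ C) h) (ℕP.≤-trans (ℕP.≤-reflexive (ℕP.^-*-assoc 2 (T ℕ.^ c) (p ℕ.^ C))) (ℕP.^-monoʳ-≤ 2 le))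
  where
  C = 2 ℕ.^ c
  e = C ℕ.∸ c
  C≡ : c ℕ.+ e ≡ C
  C≡ = ℕP.m+[n∸m]≡n (k≤2^k c)
  le : T ℕ.^ c ℕ.* p ℕ.^ C ℕ.≤ C ℕ.* q ℕ.^ C
  le = ℕP.≤-trans (ℕP.≤-reflexive (trans (cong (T ℕ.^ c ℕ.*_) (trans (cong (p ℕ.^_) (sym C≡)) (ℕP.^-distribˡ-+-* p c e))) (trans (sym (ℕP.*-assoc (T ℕ.^ c) (p ℕ.^ c) (p ℕ.^ e))) (cong (ℕ._* p ℕ.^ e) (sym (pow-* T p c))))))
    (ℕP.≤-trans (ℕP.*-mono-≤ (ℕP.^-monoˡ-≤ c Tp) (ℕP.^-monoˡ-≤ e pq))
      (ℕP.≤-reflexive (trans (cong (ℕ._* q ℕ.^ e) (pow-* 2 q c)) (trans (ℕP.*-assoc C (q ℕ.^ c) (q ℕ.^ e)) (cong (C ℕ.*_) (trans (sym (ℕP.^-distribˡ-+-* q c e)) (cong (q ℕ.^_) C≡)))))))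

fraction : ∀ ε → 0ℚ ℚ.< ε → ε ≤ ½ → Σ ℕ λ p → (ℤ.∣ ℚ.↥ ε ∣ ≡ suc p) × (suc p ℕ.* 2 ℕ.≤ ℚ.↧ₙ ε) × (ε * ι (ℚ.↧ₙ ε) ≡ ι (suc p))
fraction (ℚ.mkℚ (ℤ.+ zero) d c) (ℚ.*<* (ℤ.+<+ ())) h
fraction (ℚ.mkℚ (ℤ.-[1+ n ]) d c) (ℚ.*<* ()) h
fraction ε@(ℚ.mkℚ (ℤ.+ suc p) d c) pos (ℚ.*≤* h) = p , refl , ℕP.≤-trans (ℤP.drop‿+≤+ (subst₂ ℤ._≤_ (sym (ℤP.pos-* (suc p) 2)) (ℤP.*-identityˡ (ℤ.+ suc d)) h)) ℕP.≤-refl ,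
  trans (cong (ε *_) (sym (ℕtoℚ≡ι (suc d)))) (trans (ℚP.toℚᵘ-injective (begin
    ℚ.toℚᵘ (ε * ℕtoℚ (suc d)) ≈⟨ ℚP.toℚᵘ-homo-* ε (ℕtoℚ (suc d)) ⟩
    ℚ.toℚᵘ ε ℚᵘ.* ℚ.toℚᵘ (ℕtoℚ (suc d)) ≈⟨ ℚᵘP.*-congˡ {ℚ.toℚᵘ ε} (ℚP.toℚᵘ-fromℚᵘ (ℚᵘ.mkℚᵘ (ℤ.+ suc d) 0)) ⟩
    ℚᵘ.mkℚᵘ (ℤ.+ suc p) d ℚᵘ.* ℚᵘ.mkℚᵘ (ℤ.+ suc d) 0 ≈⟨ ℚᵘ.*≡* (l (ℤ.+ suc p) (ℤ.+ suc d)) ⟩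
    ℚᵘ.mkℚᵘ (ℤ.+ suc p) 0 ≈⟨ ℚᵘP.≃-sym (ℚP.toℚᵘ-fromℚᵘ (ℚᵘ.mkℚᵘ (ℤ.+ suc p) 0)) ⟩
    ℚ.toℚᵘ (ℕtoℚ (suc p)) ∎)) (ℕtoℚ≡ι (suc p)))
  where
  open import Relation.Binary.Reasoning.Setoid ℚᵘP.≃-setoid
  l : ∀ p d → p ℤ.* d ℤ.* ℤ.+ 1 ≡ p ℤ.* (d ℤ.* ℤ.+ 1)
  l = ℤS.solve-∀

dichotomy : ∀ c → (∀ T → 2 ℕ.≤ T → 80 ℕ.* T ℕ.* Scale.W (rT T) ℕ.≤ 2 ℕ.^ (T ℕ.^ c)) →
  ∀ N δ → 0ℚ ℚ.< δ → δ ≤ 1ℚ → ∀ A → InGrid N A → δ * (ℕtoℚ N * ℕtoℚ N) ≤ ℕtoℚ (card N A) → ∀ ε → 0ℚ ℚ.< ε → ε ≤ ½ →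
  BelowExpBound (2 ℕ.^ c) ε N ⊎ ∃ λ (d : ℤ) → (d ≢ ℤ.0ℤ) × ((δ * δ * δ - ε) * (ℕtoℚ N * ℕtoℚ N) ≤ ℕtoℚ (cornerCount N A d))
dichotomy c gr N δ δ0 δ1 A inA hA ε ε0 ε½ = go (ℕP.≤-total (80 ℕ.* T ℕ.* Scale.W (rT T)) N)
  where
  fr = fraction ε ε0 ε½
  p q T : ℕ
  p = suc (proj₁ fr)
  q = ℚ.↧ₙ ε
  2p≤q : p ℕ.* 2 ℕ.≤ q
  2p≤q = proj₁ (proj₂ (proj₂ fr))
  εq : ε * ι q ≡ ι p
  εq = proj₂ (proj₂ (proj₂ fr))
  -- An integer between 1/ε and 2/ε: the lower bound feeds `many-corners`, the upper one `below`.
  T = suc (q ℕDM./ p)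
  2≤T : 2 ℕ.≤ T
  2≤T = ℕ.s≤s (ℕP.≤-trans (ℕP.≤-reflexive (sym (ℕDM.n/n≡1 p))) (ℕDM./-monoˡ-≤ p (ℕP.≤-trans (ℕP.m≤m*n p 2) 2p≤q)))
  p≤q : p ℕ.≤ q
  p≤q = ℕP.≤-trans (ℕP.m≤m*n p 2) 2p≤q
  Tp : T ℕ.* p ℕ.≤ 2 ℕ.* q
  Tp = ℕP.≤-trans (ℕP.+-mono-≤ p≤q (ℕDM.m/n*n≤m q p)) (ℕP.≤-reflexive (cong (q ℕ.+_) (sym (ℕP.+-identityʳ q))))
  qT : q ℕ.≤ T ℕ.* p
  qT = ℕP.≤-trans (ℕP.≤-reflexive (ℕDM.m≡m%n+[m/n]*n q p)) (ℕP.+-monoˡ-≤ (q ℕDM./ p ℕ.* p) (ℕP.<⇒≤ (ℕDM.m%n<n q p)))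
  εT : 1ℚ ≤ ε * ι T
  εT = ≤rec' (ι-mono qT ≤⟨⟩ ≡≤ (trans (ι-* T p) (trans (cong (ι T *_) (sym εq)) (l (ι T) ε (ι q)))))
    where
    d = ℚ.denominator-1 ε
    l : ∀ t e q → t * (e * q) ≡ e * t * q
    l = solve-∀ ℚR
    ≤rec' : ι q ≤ ε * ι T * ι q → 1ℚ ≤ ε * ι T
    ≤rec' h = ≡≤ (sym (rec-inv d)) ≤⟨⟩ rec≤ d h
  go : (80 ℕ.* T ℕ.* Scale.W (rT T) ℕ.≤ N) ⊎ (N ℕ.≤ 80 ℕ.* T ℕ.* Scale.W (rT T)) → _
  go (inj₂ h) = inj₁ (subst (λ x → N ℕ.^ (x ℕ.^ (2 ℕ.^ c)) ℕ.≤ 2 ℕ.^ (2 ℕ.^ c ℕ.* q ℕ.^ (2 ℕ.^ c))) (sym (proj₁ (proj₂ fr))) (below c T p q N Tp p≤q (ℕP.≤-trans h (gr T 2≤T))))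
  go (inj₁ h) = let (d , 1≤d , hd) = many-corners T 2≤T N h δ (ℚP.<⇒≤ δ0) δ1 A inA hA' ε εT in
    inj₂ (ℤ.+ d , (λ e → ℕP.<⇒≢ 1≤d (sym (ℤP.+-injective e))) ,
      (≡≤ (cong (λ x → (δ * δ * δ - ε) * (x * x)) (ℕtoℚ≡ι N)) ≤⟨⟩ hd ≤⟨⟩ ≡≤ (sym (ℕtoℚ≡ι (cornerCount N A (ℤ.+ d))))))
    where
    hA' : δ * (ι N * ι N) ≤ ι (card N A)
    hA' = ≡≤ (cong (λ x → δ * (x * x)) (sym (ℕtoℚ≡ι N))) ≤⟨⟩ hA ≤⟨⟩ ≡≤ (ℕtoℚ≡ι (card N A))

theorem1p2 : Σ ℕ λ C → (1 ℕ.≤ C) ×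
    ((N : ℕ) → 1 ℕ.≤ N →
    (δ : ℚ) → 0ℚ ℚ.< δ → δ ℚ.≤ 1ℚ →
    (A : ℤ → ℤ → Bool) → InGrid N A →
    δ * (ℕtoℚ N * ℕtoℚ N) ℚ.≤ ℕtoℚ (card N A) →
    (ε : ℚ) → 0ℚ ℚ.< ε → ε ℚ.≤ ½ →
    BelowExpBound C ε N
    ⊎ ∃ λ (d : ℤ) → (d ≢ ℤ.0ℤ) ×
    ((δ * δ * δ - ε) * (ℕtoℚ N * ℕtoℚ N) ℚ.≤ ℕtoℚ (cornerCount N A d)))
theorem1p2 = 2 ℕ.^ proj₁ growth , 1≤pow 2 (proj₁ growth) (ℕ.s≤s ℕ.z≤n) , λ N _ → dichotomy (proj₁ growth) (proj₂ growth) N
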